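{- For every positive integer $t$, $$\varrho_3(3t+2)=\frac{5t-4}{5t+1}\qquad\text{and}\qquad \varrho_4(4t+2)=\frac{7t-6}{7t+1}.$$
   Context: For a graph $G$, $\alpha_p(G)$ is the maximum size of a vertex set $U$ such that $G[U]$ contains no $K_p$. $\mathsf{RT}_p(n,K_q,m)$ is the maximum number of edges in an $n$-vertex $K_q$-free graph $G$ with $\alpha_p(G)\le m$, and $\varrho_p(q):=\lim_{\varepsilon\to0}\lim_{n\to\infty}\mathsf{RT}_p(n,K_q,\varepsilon n)/\binom n2$ (the limits exist). -}

module Defs where

open import Data.Nat as ℕ using (ℕ; zero; suc; _<ᵇ_)
open import Data.Nat.Combinatorics using (_C_)
open import Data.Integer using (+_)
open import Data.Rational using (ℚ; _/_; _≤_; _<_; _+_; _-_; _*_; 0ℚ)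
open import Data.Fin using (Fin; toℕ)
open import Data.Fin.Subset using (Subset; _∈_; ∣_∣)
open import Data.Bool using (Bool; true; false; _∧_; if_then_else_)
open import Data.List using (List; map; allFin)
open import Data.Nat.ListAction using (sum)
open import Data.Product using (Σ; ∃; ∃-syntax; _×_)
open import Relation.Binary.PropositionalEquality using (_≡_; _≢_)
open import Relation.Nullary using (¬_)

ℕ→ℚ : ℕ → ℚ
ℕ→ℚ k = (+ k) / 1

record Graph (n : ℕ) : Set where
  field
    adj    : Fin n → Fin n → Bool
    sym    : ∀ i j → adj i j ≡ adj j i
    irrefl : ∀ i → adj i i ≡ false
open Graph public

edges : ∀ {n} → Graph n → ℕ
edges {n} G = sum (map (λ i → sum (map (λ j →
  if (adj G i j ∧ (toℕ i <ᵇ toℕ j)) then 1 else 0) (allFin n))) (allFin n))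

HasCliqueIn : ∀ {n} → Graph n → ℕ → Subset n → Set
HasCliqueIn {n} G p U = Σ (Fin p → Fin n) λ f →
  (∀ i → f i ∈ U) × (∀ i j → i ≢ j → adj G (f i) (f j) ≡ true)

HasClique : ∀ {n} → Graph n → ℕ → Set
HasClique {n} G q = Σ (Fin q → Fin n) λ f →
  ∀ i j → i ≢ j → adj G (f i) (f j) ≡ true

KFree : ∀ {n} → Graph n → ℕ → Set
KFree G q = ¬ HasClique G q

αLe : ∀ {n} → Graph n → ℕ → ℚ → Set
αLe {n} G p m = ∀ (U : Subset n) → ¬ HasCliqueIn G p U → ℕ→ℚ ∣ U ∣ ≤ m

-- ϱ_p(q) = r, written out as the double limit
-- lim_{ε→0} lim_{n→∞} RT_p(n,K_q,εn) / C(n,2) = r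
RhoIs : ℕ → ℕ → ℚ → Set
RhoIs p q r =
  ∀ (δ : ℚ) → 0ℚ < δ →
  Σ ℚ λ ε₀ → (0ℚ < ε₀ ×
    (∀ (ε : ℚ) → 0ℚ < ε → ε < ε₀ →
      Σ ℕ λ N → (∀ (n : ℕ) → N ℕ.≤ n →
        ((∀ (G : Graph n) → KFree G q → αLe G p (ε * ℕ→ℚ n) →
            ℕ→ℚ (edges G) ≤ (r + δ) * ℕ→ℚ (n C 2))
        × (Σ (Graph n) λ G → (KFree G q × αLe G p (ε * ℕ→ℚ n) ×
            (r - δ) * ℕ→ℚ (n C 2) ≤ ℕ→ℚ (edges G)))))))

{-# OPTIONS --safe #-}
module Submission where

-- Upper bound. Start from the uniform weight on the vertices and repeatedly move to a weight of noticeably larger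
-- density with controlled maximum; the process stops at a near-optimal weight, and near-optimality replaces the
-- regularity lemma: it forces the densities between suitable sparse clusters to be almost constant on large
-- subsets. Rounding these densities to multiples of 1/p gives a weighted Turán problem whose optimum is the
-- claimed value, and a weighted clique of value pt+2 embeds a genuine one.
-- Lower bound. Replace the high-dimensional sphere of the Bollobás–Erdős graph by Ω = (Pᴹ)ᵖ for a long path P, on
-- which the cyclic group of order p acts by rotating coordinates. Two points of one part are joined if one is near
-- a nontrivial rotate of the other; a Poincaré inequality makes K_p-free sets small. Two special classes X, Y are
-- joined when y correlates with x more than with any nontrivial rotate of x, an event of density about 1/p by a
-- Littlewood–Offord estimate; all other pairs of classes are joined completely. Summing correlations over orbits
-- shows that X ∪ Y contains no K_{p+2}.

-- The value comes from one extremal pattern. Take t - 1 clusters of weight 2p - 1 and two clusters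
-- of weight p, with density 1/p between these two and density 1 elsewhere. All clusters then see
-- the same average density, a greedy clique collects p(t - 1) + p + 1 = pt + 1 vertices, and the
-- density is 1 - (2p - 1)/((2p - 1)t + 1). The bound p ≤ 4 is used on both sides. Above, it makes
-- the deletion of a light cluster from an optimal weighting profitable. Below, it leaves few ways
-- to distribute p + 2 vertices over the two special classes. All estimates are carried out with
-- integers: weights are scaled up until rounding errors are negligible, densities are fractions
-- over a fixed denominator `R`, and minima are replaced by descent. In a power of a path the
-- Poincaré constant does not grow with the number of factors. Sets of positive density therefore
-- fill the space at a squared distance of order n², whereas a point and its rotates typically
-- differ by much more once `M` is large. This room separates "near a rotate" from "generic".

module Proof where
 import Defs as D
 open import Data.Nat.Base as ℕ using (ℕ; zero; suc)
 import Data.Nat.Properties as N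
 open import Data.Integer.Base using (ℤ; +_; -[1+_]; _+_; _*_; _-_; -_; _≤_; _<_; 0ℤ; 1ℤ; +≤+; -≤+; -≤-; _⊔_; _⊓_; ∣_∣)
 import Data.Integer.Properties as Z
 open import Data.Integer.Solver using (module +-*-Solver)
 open +-*-Solver using (solve; Polynomial; con; _:=_; _:+_; _:*_; _:-_; :-_)
 open import Data.List.Base as L using (List; []; _∷_; _++_; length; map; filter; lookup; allFin)
 import Data.List.Properties as Lₚ
 open import Data.List.Membership.Propositional using (_∈_; _∉_)
 import Data.List.Membership.Propositional.Properties as ∈ₚ
 open import Data.List.Relation.Unary.Any as Any using (Any; here; there)
 open import Data.List.Relation.Unary.All as All using (All; []; _∷_)
 import Data.List.Relation.Unary.All.Properties as Allₚ
 open import Data.List.Relation.Unary.AllPairs as AllPairs using (AllPairs; []; _∷_)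
 import Data.List.Relation.Unary.AllPairs.Properties as APₚ
 open import Data.Fin.Base as F using (Fin; toℕ; punchIn)
 import Data.Fin.Properties as Fₚ
 open import Data.Bool.Base as B using (Bool; true; false; if_then_else_; _∧_; _∨_; not)
 open import Data.Product.Base using (Σ; ∃; _×_; _,_; proj₁; proj₂)
 open import Data.Sum.Base using (_⊎_; inj₁; inj₂; [_,_]′)
 open import Data.Empty using (⊥; ⊥-elim)
 open import Function.Base using (_∘_; id; _$_; case_of_)
 open import Relation.Nullary using (¬_; Dec; yes; no; does; ¬?)
 open import Relation.Binary.PropositionalEquality using (_≡_; _≢_; refl; sym; trans; cong; cong₂; subst; subst₂; module ≡-Reasoning)
 open import Data.List.Relation.Binary.Sublist.Propositional as Sub using (_⊆_; _∷ʳ_; _∷_)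
 import Data.List.Relation.Binary.Sublist.Propositional.Properties as Subₚ
 open import Relation.Nullary.Decidable using (True; toWitness; _⊎-dec_; _→-dec_; _×-dec_)
 open import Relation.Binary.Definitions using (DecidableEquality)
 import Data.Bool.Properties as Bₚ
 import Data.Fin.Subset as Subset
 import Data.Integer.Base as ℤ
 open import Data.Maybe.Base as Maybe using (Maybe; just; nothing; maybe′)
 import Data.Nat.Combinatorics as Comb
 import Data.Nat.Coprimality as Coprime
 open import Data.Nat.DivMod using (_%_; _/_; m<n⇒m%n≡m; [m+n]%n≡m%n; m≡m%n+[m/n]*n; m%n<n)
 open import Data.Nat.ListAction using (sum)
 import Data.Product.Properties as ×ₚ
 import Data.Rational.Base as ℚ
 open ℚ using (ℚ; mkℚ; *≤*; *<*; 0ℚ)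
 import Data.Rational.Properties as Q
 import Data.Rational.Solver as ℚSolver
 open ℚSolver.+-*-Solver using () renaming (solve to solveℚ; _:+_ to _⊹_; _:*_ to _⊛_; _:=_ to _≐_; _:-_ to _⊖_; :-_ to ⊝_)
 import Data.Rational.Unnormalised.Base as ℚᵘ
 import Data.Rational.Unnormalised.Properties as ℚᵘₚ
 open import Data.Unit.Base using (⊤; tt)
 open import Data.Unit.Properties using () renaming (_≟_ to _≟⊤_)
 import Data.Vec.Base as V
 import Data.Vec.Properties as Vₚ

 -- Integer inequalities and finite sums

 :0 :1 :2 :4 : ∀ {n} -> Polynomial n
 :0 = con 0ℤ
 :1 = con 1ℤ
 :2 = con (+ 2)
 :4 = con (+ 4)

 by : ∀ {a b e} -> 0ℤ ≤ e -> b ≡ a + e -> a ≤ b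
 by {a} h refl = Z.≤-trans (Z.≤-reflexive (sym (Z.+-identityʳ a))) (Z.+-monoʳ-≤ a h)

 ≤r : ∀ {a b} -> a ≡ b -> a ≤ b
 ≤r = Z.≤-reflexive

 infixr 5 _⟫_
 _⟫_ : ∀ {a b c} -> a ≤ b -> b ≤ c -> a ≤ c
 _⟫_ = Z.≤-trans

 0≤ℕ : ∀ {n} -> 0ℤ ≤ + n
 0≤ℕ = +≤+ ℕ.z≤n

 0≤-+ : ∀ {a b} -> 0ℤ ≤ a -> 0ℤ ≤ b -> 0ℤ ≤ a + b
 0≤-+ = Z.+-mono-≤

 0≤-* : ∀ {a b} -> 0ℤ ≤ a -> 0ℤ ≤ b -> 0ℤ ≤ a * b
 0≤-* {+ m} {+ n} _ _ = 0≤ℕ ⟫ ≤r (Z.pos-* m n)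

 0≤-sq : ∀ a -> 0ℤ ≤ a * a
 0≤-sq (+ n) = 0≤-* {+ n} {+ n} 0≤ℕ 0≤ℕ
 0≤-sq (-[1+ n ]) = 0≤ℕ

 0≤-- : ∀ {a b} -> a ≤ b -> 0ℤ ≤ b - a
 0≤-- = Z.i≤j⇒0≤j-i

 ≤-*ˡ : ∀ {a b} c -> 0ℤ ≤ c -> a ≤ b -> c * a ≤ c * b
 ≤-*ˡ {a} {b} c h k = by (0≤-* h (0≤-- k)) (eq a b c)
   where
   eq : ∀ a b c -> c * b ≡ c * a + c * (b - a)
   eq = solve 3 (λ a b c -> c :* b := c :* a :+ c :* (b :- a)) refl

 ≤-*ʳ : ∀ {a b} c -> 0ℤ ≤ c -> a ≤ b -> a * c ≤ b * c
 ≤-*ʳ {a} {b} c h k = subst₂ _≤_ (Z.*-comm c a) (Z.*-comm c b) (≤-*ˡ c h k)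

 ≤-*² : ∀ {a b c d} -> 0ℤ ≤ a -> 0ℤ ≤ d -> a ≤ b -> c ≤ d -> a * c ≤ b * d
 ≤-*² {a} {b} {c} {d} ha hd h k = ≤-*ˡ a ha k ⟫ ≤-*ʳ d hd h

 ≤-cancelˡ : ∀ {a b} c -> 1ℤ ≤ c -> c * a ≤ c * b -> a ≤ b
 ≤-cancelˡ {a} {b} (+ suc n) _ h = Z.*-cancelˡ-≤-pos a b (+ suc n) h
 ≤-cancelˡ (+ zero) (+≤+ ()) h

 1≰0 : ¬ (1ℤ ≤ 0ℤ)
 1≰0 (+≤+ ())

 -- 0 ≤ e and e < 0, where e < 0 is witnessed by e + k ≡ -1.
 absurd : ∀ e k -> 0ℤ ≤ e -> 0ℤ ≤ k -> e + k ≡ -[1+ 0 ] -> ⊥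
 absurd e k h h′ eq with subst (0ℤ ≤_) eq (0≤-+ h h′)
 ... | ()

 ≰⇒≥1 : ∀ {a b} -> ¬ (a ≤ b) -> b + 1ℤ ≤ a
 ≰⇒≥1 {a} {b} h = ≤r (Z.+-comm b 1ℤ) ⟫ Z.i<j⇒suc[i]≤j (Z.≰⇒> h)

 ≥1⇒≰ : ∀ {a b} -> b + 1ℤ ≤ a -> ¬ (a ≤ b)
 ≥1⇒≰ {a} {b} h k = absurd (b - (b + 1ℤ)) 0ℤ (0≤-- (h ⟫ k)) 0≤ℕ (eq b)
   where
   eq : ∀ b -> b - (b + 1ℤ) + 0ℤ ≡ -[1+ 0 ]
   eq = solve 1 (λ b -> b :- (b :+ :1) :+ :0 := con -[1+ 0 ]) refl

 1≤⇒0≤ : ∀ {a} -> 1ℤ ≤ a -> 0ℤ ≤ a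
 1≤⇒0≤ h = 0≤ℕ ⟫ h

 1≤-* : ∀ {a b} -> 1ℤ ≤ a -> 1ℤ ≤ b -> 1ℤ ≤ a * b
 1≤-* {a} {b} h k = by (0≤-+ (0≤-* (1≤⇒0≤ h) (0≤-- k)) (0≤-- h)) (eq a b)
   where
   eq : ∀ a b -> a * b ≡ 1ℤ + (a * (b - 1ℤ) + (a - 1ℤ))
   eq = solve 2 (λ a b -> a :* b := :1 :+ (a :* (b :- :1) :+ (a :- :1))) refl

 1≤⊎≤0 : ∀ a -> 1ℤ ≤ a ⊎ a ≤ 0ℤ
 1≤⊎≤0 (+ suc n) = inj₁ (+≤+ (ℕ.s≤s ℕ.z≤n))
 1≤⊎≤0 (+ zero) = inj₂ (+≤+ ℕ.z≤n)
 1≤⊎≤0 (-[1+ n ]) = inj₂ -≤+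

 +ˡ : ∀ a {b c} -> b ≡ c -> a + b ≡ a + c
 +ˡ a = cong (λ z -> a + z)

 ∑ : ∀ {A : Set} -> List A -> (A -> ℤ) -> ℤ
 ∑ [] f = 0ℤ
 ∑ (x ∷ xs) f = f x + ∑ xs f

 module _ {A : Set} where

   ∑-cong∈ : ∀ (xs : List A) {f g : A -> ℤ} -> (∀ x -> x ∈ xs -> f x ≡ g x) -> ∑ xs f ≡ ∑ xs g
   ∑-cong∈ [] h = refl
   ∑-cong∈ (x ∷ xs) h = cong₂ _+_ (h x (here refl)) (∑-cong∈ xs (λ y m -> h y (there m)))

   ∑-cong : ∀ (xs : List A) {f g : A -> ℤ} -> (∀ x -> f x ≡ g x) -> ∑ xs f ≡ ∑ xs g
   ∑-cong xs h = ∑-cong∈ xs (λ x _ -> h x)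

   ∑-+ : ∀ (xs : List A) (f g : A -> ℤ) -> ∑ xs (λ x -> f x + g x) ≡ ∑ xs f + ∑ xs g
   ∑-+ [] f g = refl
   ∑-+ (x ∷ xs) f g = trans (+ˡ (f x + g x) (∑-+ xs f g)) (eq (f x) (g x) _ _)
     where
     eq : ∀ a b c d -> a + b + (c + d) ≡ a + c + (b + d)
     eq = solve 4 (λ a b c d -> a :+ b :+ (c :+ d) := a :+ c :+ (b :+ d)) refl

   ∑-*ˡ : ∀ (xs : List A) c (f : A -> ℤ) -> ∑ xs (λ x -> c * f x) ≡ c * ∑ xs f
   ∑-*ˡ [] c f = sym (Z.*-zeroʳ c)
   ∑-*ˡ (x ∷ xs) c f = trans (+ˡ (c * f x) (∑-*ˡ xs c f)) (sym (Z.*-distribˡ-+ c _ _))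

   ∑-*ʳ : ∀ (xs : List A) c (f : A -> ℤ) -> ∑ xs (λ x -> f x * c) ≡ ∑ xs f * c
   ∑-*ʳ xs c f = trans (∑-cong xs (λ x -> Z.*-comm (f x) c)) (trans (∑-*ˡ xs c f) (Z.*-comm c _))

   ∑-- : ∀ (xs : List A) (f g : A -> ℤ) -> ∑ xs (λ x -> f x - g x) ≡ ∑ xs f - ∑ xs g
   ∑-- [] f g = refl
   ∑-- (x ∷ xs) f g = trans (+ˡ (f x - g x) (∑-- xs f g)) (eq (f x) (g x) _ _)
     where
     eq : ∀ a b c d -> a - b + (c - d) ≡ a + c - (b + d)
     eq = solve 4 (λ a b c d -> a :- b :+ (c :- d) := a :+ c :- (b :+ d)) refl

   ∑-mono∈ : ∀ (xs : List A) {f g : A -> ℤ} -> (∀ x -> x ∈ xs -> f x ≤ g x) -> ∑ xs f ≤ ∑ xs g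
   ∑-mono∈ [] h = +≤+ ℕ.z≤n
   ∑-mono∈ (x ∷ xs) h = Z.+-mono-≤ (h x (here refl)) (∑-mono∈ xs (λ y m -> h y (there m)))

   ∑-mono : ∀ (xs : List A) {f g : A -> ℤ} -> (∀ x -> f x ≤ g x) -> ∑ xs f ≤ ∑ xs g
   ∑-mono xs h = ∑-mono∈ xs (λ x _ -> h x)

   ∑-const : ∀ (xs : List A) c -> ∑ xs (λ _ -> c) ≡ + length xs * c
   ∑-const [] c = sym (Z.*-zeroˡ c)
   ∑-const (x ∷ xs) c = trans (+ˡ (c) (∑-const xs c)) (trans (eq c (+ length xs)) (cong (_* c) (Z.+-comm (+ length xs) 1ℤ)))
     where
     eq : ∀ c l -> c + l * c ≡ (l + 1ℤ) * c
     eq = solve 2 (λ c l -> c :+ l :* c := (l :+ :1) :* c) refl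

   ∑-zero : ∀ (xs : List A) -> ∑ xs (λ _ -> 0ℤ) ≡ 0ℤ
   ∑-zero xs = trans (∑-const xs 0ℤ) (Z.*-zeroʳ (+ length xs))

   ∑-nonneg∈ : ∀ (xs : List A) {f : A -> ℤ} -> (∀ x -> x ∈ xs -> 0ℤ ≤ f x) -> 0ℤ ≤ ∑ xs f
   ∑-nonneg∈ xs h = ≤r (sym (∑-zero xs)) ⟫ ∑-mono∈ xs h

   ∑-nonneg : ∀ (xs : List A) {f : A -> ℤ} -> (∀ x -> 0ℤ ≤ f x) -> 0ℤ ≤ ∑ xs f
   ∑-nonneg xs h = ∑-nonneg∈ xs (λ x _ -> h x)

   ∑-++ : ∀ (xs ys : List A) f -> ∑ (xs ++ ys) f ≡ ∑ xs f + ∑ ys f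
   ∑-++ [] ys f = sym (Z.+-identityˡ _)
   ∑-++ (x ∷ xs) ys f = trans (+ˡ (f x) (∑-++ xs ys f)) (sym (Z.+-assoc (f x) _ _))

   ∑-∈≤ : ∀ (xs : List A) {f : A -> ℤ} -> (∀ x -> 0ℤ ≤ f x) -> ∀ {x} -> x ∈ xs -> f x ≤ ∑ xs f
   ∑-∈≤ (y ∷ xs) h (here refl) = by (∑-nonneg xs h) refl
   ∑-∈≤ (y ∷ xs) {f} h {x} (there m) = ∑-∈≤ xs h m ⟫ by (h y) (Z.+-comm (f y) _)

   ∑-pick : ∀ (xs : List A) {f g : A -> ℤ} -> ∑ xs f + 1ℤ ≤ ∑ xs g -> ∃ λ x -> x ∈ xs × f x + 1ℤ ≤ g x
   ∑-pick [] h = ⊥-elim (1≰0 h)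
   ∑-pick (x ∷ xs) {f} {g} h with g x Z.≤? f x
   ... | no q = x , here refl , ≰⇒≥1 q
   ... | yes q with ∑-pick xs {f} {g} (by (0≤-+ (0≤-- h) (0≤-- q)) (eq (f x) (g x) (∑ xs f) (∑ xs g)))
     where
     eq : ∀ a b c d -> d ≡ c + 1ℤ + (((b + d) - (a + c + 1ℤ)) + (a - b))
     eq = solve 4 (λ a b c d -> d := c :+ :1 :+ (((b :+ d) :- (a :+ c :+ :1)) :+ (a :- b))) refl
   ... | y , m , r = y , there m , r

 ∑-swap : ∀ {A B : Set} (xs : List A) (ys : List B) (f : A -> B -> ℤ) ->
   ∑ xs (λ x -> ∑ ys (f x)) ≡ ∑ ys (λ y -> ∑ xs (λ x -> f x y))
 ∑-swap [] ys f = sym (∑-zero ys)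
 ∑-swap (x ∷ xs) ys f = trans (+ˡ (∑ ys (f x)) (∑-swap xs ys f)) (sym (∑-+ ys (f x) _))

 ∑-map : ∀ {A B : Set} (h : A -> B) (xs : List A) f -> ∑ (map h xs) f ≡ ∑ xs (f ∘ h)
 ∑-map h [] f = refl
 ∑-map h (x ∷ xs) f = +ˡ (f (h x)) (∑-map h xs f)

 ∑-** : ∀ {A B : Set} (xs : List A) (ys : List B) (f : A -> ℤ) (g : B -> ℤ) ->
   ∑ xs (λ x -> ∑ ys (λ y -> f x * g y)) ≡ ∑ xs f * ∑ ys g
 ∑-** xs ys f g = trans (∑-cong xs (λ x -> ∑-*ˡ ys (f x) g)) (∑-*ʳ xs (∑ ys g) f)

 allFin-suc : ∀ n -> allFin (suc n) ≡ F.zero ∷ map F.suc (allFin n)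
 allFin-suc n = cong (F.zero ∷_) (sym (Lₚ.map-tabulate (λ i -> i) F.suc))

 ∑-allFin-suc : ∀ n (f : Fin (suc n) -> ℤ) -> ∑ (allFin (suc n)) f ≡ f F.zero + ∑ (allFin n) (f ∘ F.suc)
 ∑-allFin-suc n f = trans (cong (λ l -> ∑ l f) (allFin-suc n)) (+ˡ (f F.zero) (∑-map F.suc (allFin n) f))

 ∑-punchIn : ∀ n (v : Fin (suc n)) (f : Fin (suc n) -> ℤ) -> ∑ (allFin (suc n)) f ≡ f v + ∑ (allFin n) (f ∘ punchIn v)
 ∑-punchIn n F.zero f = ∑-allFin-suc n f
 ∑-punchIn (suc n) (F.suc v) f = begin
   ∑ (allFin (suc (suc n))) f ≡⟨ ∑-allFin-suc (suc n) f ⟩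
   f F.zero + ∑ (allFin (suc n)) (f ∘ F.suc) ≡⟨ +ˡ (f F.zero) (∑-punchIn n v (f ∘ F.suc)) ⟩
   f F.zero + (f (F.suc v) + ∑ (allFin n) (λ i -> f (F.suc (punchIn v i)))) ≡⟨ eq (f F.zero) (f (F.suc v)) _ ⟩
   f (F.suc v) + (f F.zero + ∑ (allFin n) (λ i -> f (F.suc (punchIn v i)))) ≡⟨ +ˡ (f (F.suc v)) (sym (∑-allFin-suc n (f ∘ punchIn (F.suc v)))) ⟩
   f (F.suc v) + ∑ (allFin (suc n)) (f ∘ punchIn (F.suc v)) ∎
   where
   open ≡-Reasoning
   eq : ∀ a b c -> a + (b + c) ≡ b + (a + c)
   eq = solve 3 (λ a b c -> a :+ (b :+ c) := b :+ (a :+ c)) refl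

 -- Cauchy–Schwarz against the constant function 1.
 ∑-cauchy : ∀ {A : Set} (xs : List A) (f : A -> ℤ) -> ∑ xs f * ∑ xs f ≤ + length xs * ∑ xs (λ x -> f x * f x)
 ∑-cauchy [] f = +≤+ ℕ.z≤n
 ∑-cauchy (x ∷ xs) f = by (0≤-+ (0≤-- (∑-cauchy xs f)) (∑-nonneg xs (λ y -> 0≤-sq (f x - f y))))
     (trans (eq (f x) S Q (+ length xs)) (+ˡ ((f x + S) * (f x + S)) (+ˡ (+ length xs * Q - S * S) (sym ex))))
   where
   S Q : ℤ
   S = ∑ xs f
   Q = ∑ xs (λ y -> f y * f y)
   sqe : ∀ a b -> (a - b) * (a - b) ≡ a * a - (+ 2 * a) * b + b * b
   sqe = solve 2 (λ a b -> (a :- b) :* (a :- b) := a :* a :- (:2 :* a) :* b :+ b :* b) refl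
   ex : ∑ xs (λ y -> (f x - f y) * (f x - f y)) ≡ + length xs * (f x * f x) - (+ 2 * f x) * S + Q
   ex = trans (∑-cong xs (λ y -> sqe (f x) (f y))) (trans (∑-+ xs (λ y -> f x * f x - (+ 2 * f x) * f y) (λ y -> f y * f y)) (cong (_+ Q)
         (trans (∑-- xs (λ _ -> f x * f x) (λ y -> (+ 2 * f x) * f y)) (cong₂ _-_ (∑-const xs (f x * f x)) (∑-*ˡ xs (+ 2 * f x) f)))))
   eq : ∀ a s q l -> (1ℤ + l) * (a * a + q) ≡ (a + s) * (a + s) + ((l * q - s * s) + (l * (a * a) - (+ 2 * a) * s + q))
   eq = solve 4 (λ a s q l -> (:1 :+ l) :* (a :* a :+ q) := (a :+ s) :* (a :+ s) :+ ((l :* q :- s :* s) :+ (l :* (a :* a) :- (:2 :* a) :* s :+ q))) refl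

 -- Polynomial inequalities for the weighted Turán problem

 -- Deletion of a vertex of weight `x`. Normalise to `M` = 1 and ignore errors: stationarity gives r
 -- = q, hence q' = q - 2xq + px². The bound for q' and the failed bound for q then force (p - q)(q²
 -- - p³x²) + q(q - px)² < 0, which the lightness 2px ≤ q excludes for p ≤ 4. The remaining work
 -- keeps track of the errors of relative order 1/M, against which the gap `C * M` is set.
 drop-arith : ∀ p M q x r q' K c1 C n ->
   0ℤ ≤ c1 -> 1ℤ ≤ p -> p ≤ + 4 -> + 4 ≤ M -> 0ℤ ≤ q -> 0ℤ ≤ q' -> 0ℤ ≤ x -> x ≤ M -> 0ℤ ≤ n ->
   p * p * c1 * ((M - x) * (M - x)) ≤ q' * (K - c1) ->
   q' ≡ q - + 2 * x * r + p * x * x ->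
   + 2 * p * M * x ≤ q + + 2 * p * M ->
   q ≤ M * r + p * M ->
   q ≤ p * (M * M) ->
   q * K + C * M ≤ p * p * c1 * (M * M) ->
   p * ((M - x) * (M - x)) ≤ n * q' ->
   C ≡ + 16 * n * c1 * (+ 8 * p + + 2 * p * p) + 1ℤ -> ⊥
 drop-arith p M q x r q' K c1 C n 0≤c1 1≤p p≤4 4≤M 0≤q 0≤q' 0≤x x≤M 0≤n h1 eq' h2 h3 h4 h5 h6 refl =
   absurd _ (p * p * M⁵ - 1ℤ)
     (0≤-+ (0≤-* (0≤-* {+ 16} 0≤ℕ 0≤n) step6) (0≤-* {(C * p) * M³} (0≤-* (0≤-* 0≤C 0≤p) 0≤M³) step7))
     (0≤-- (1≤-* (1≤-* 1≤p 1≤p) 1≤M⁵))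
     (eq8 p M q' c1 n)
   where
   M³ M⁵ U Y : ℤ
   M³ = M * M * M
   M⁵ = M * M * M * M * M
   U = p * p * (M * M) - q
   Y = M * q - + 2 * x * q + p * M * x * x + + 2 * p * x * M
   1≤M : 1ℤ ≤ M
   1≤M = +≤+ (ℕ.s≤s ℕ.z≤n) ⟫ 4≤M
   0≤M = 1≤⇒0≤ 1≤M
   0≤p = 1≤⇒0≤ 1≤p
   1≤M⁵ : 1ℤ ≤ M⁵
   1≤M⁵ = 1≤-* (1≤-* (1≤-* (1≤-* 1≤M 1≤M) 1≤M) 1≤M) 1≤M
   0≤M³ : 0ℤ ≤ M³
   0≤M³ = 0≤-* (0≤-* 0≤M 0≤M) 0≤M
   0≤C : 0ℤ ≤ C
   0≤C = 0≤-+ (0≤-* (0≤-* (0≤-* {+ 16} 0≤ℕ 0≤n) 0≤c1) (0≤-+ (0≤-* {+ 8} 0≤ℕ 0≤p) (0≤-* (0≤-* {+ 2} 0≤ℕ 0≤p) 0≤p))) (0≤ℕ {1})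
   0≤U : 0ℤ ≤ U
   0≤U = subst (0ℤ ≤_) (eq p M q) (0≤-+ (0≤-- h4) (0≤-* (0≤-* (0≤-- 1≤p) 0≤p) (0≤-* 0≤M 0≤M)))
     where
     eq : ∀ p M q -> p * (M * M) - q + (p - 1ℤ) * p * (M * M) ≡ p * p * (M * M) - q
     eq = solve 3 (λ p M q -> p :* (M :* M) :- q :+ (p :- :1) :* p :* (M :* M) := p :* p :* (M :* M) :- q) refl
   step1 : 0ℤ ≤ c1 * (q' * U - q * (p * p) * ((M - x) * (M - x))) - C * M * q'
   step1 = subst (0ℤ ≤_) (eq p M q x q' K c1 C) (0≤-+ (0≤-* 0≤q (0≤-- h1)) (0≤-* 0≤q' (0≤-- h5)))
     where
     eq : ∀ p M q x q' K c1 C -> q * (q' * (K - c1) - p * p * c1 * ((M - x) * (M - x))) + q' * (p * p * c1 * (M * M) - (q * K + C * M))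
       ≡ c1 * (q' * (p * p * (M * M) - q) - q * (p * p) * ((M - x) * (M - x))) - C * M * q'
     eq = solve 8 (λ p M q x q' K c1 C -> q :* (q' :* (K :- c1) :- p :* p :* c1 :* ((M :- x) :* (M :- x))) :+ q' :* (p :* p :* c1 :* (M :* M) :- (q :* K :+ C :* M)) := c1 :* (q' :* (p :* p :* (M :* M) :- q) :- q :* (p :* p) :* ((M :- x) :* (M :- x))) :- C :* M :* q') refl
   step2 : 0ℤ ≤ Y - M * q'
   step2 = subst (0ℤ ≤_) (trans (eq p M q x r) (cong (λ z -> Y - M * z) (sym eq'))) (0≤-* (0≤-* {+ 2} 0≤ℕ 0≤x) (0≤-- h3))
     where
     eq : ∀ p M q x r -> + 2 * x * (M * r + p * M - q)
       ≡ (M * q - + 2 * x * q + p * M * x * x + + 2 * p * x * M) - M * (q - + 2 * x * r + p * x * x)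
     eq = solve 5 (λ p M q x r -> :2 :* x :* (M :* r :+ p :* M :- q) := (M :* q :- :2 :* x :* q :+ p :* M :* x :* x :+ :2 :* p :* x :* M) :- M :* (q :- :2 :* x :* r :+ p :* x :* x)) refl
   step3 : 0ℤ ≤ c1 * (Y * U - q * (p * p) * M * ((M - x) * (M - x))) - C * M * M * q'
   step3 = subst (0ℤ ≤_) (eq p M q x q' c1 C U Y) (0≤-+ (0≤-* 0≤M step1) (0≤-* 0≤c1 (0≤-* 0≤U step2)))
     where
     eq : ∀ p M q x q' c1 C U Y -> M * (c1 * (q' * U - q * (p * p) * ((M - x) * (M - x))) - C * M * q') + c1 * (U * (Y - M * q'))
       ≡ c1 * (Y * U - q * (p * p) * M * ((M - x) * (M - x))) - C * M * M * q'
     eq = solve 9 (λ p M q x q' c1 C U Y -> M :* (c1 :* (q' :* U :- q :* (p :* p) :* ((M :- x) :* (M :- x))) :- C :* M :* q') :+ c1 :* (U :* (Y :- M :* q')) := c1 :* (Y :* U :- q :* (p :* p) :* M :* ((M :- x) :* (M :- x))) :- C :* M :* M :* q') refl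
   sq≤ : 0ℤ ≤ (q + + 2 * p * M) * (q + + 2 * p * M) - (+ 2 * p * M * x) * (+ 2 * p * M * x)
   sq≤ = 0≤-- (≤-*² 0≤2pMx (0≤2pMx ⟫ h2) h2 h2)
     where 0≤2pMx = 0≤-* (0≤-* (0≤-* {+ 2} 0≤ℕ 0≤p) 0≤M) 0≤x
   -- Here p ≤ 4 enters: lightness gives 4p²x² ≤ q² up to errors, so p³x² ≤ pq²/4 ≤ q².
   step4 : 0ℤ ≤ + 8 * p * p * M³ + q * q - p * p * p * (M * M) * (x * x)
   step4 = subst (0ℤ ≤_) (eq p M q x)
     (0≤-+ (0≤-+ (0≤-+ sq≤ (0≤-* (0≤-- p≤4) (0≤-* (0≤-* 0≤p 0≤p) (0≤-* (0≤-* 0≤M 0≤M) (0≤-* 0≤x 0≤x)))))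
       (0≤-* (0≤-* (0≤-* {+ 4} 0≤ℕ 0≤p) 0≤M) (0≤-- h4)))
       (0≤-* (0≤-* (0≤-* {+ 4} 0≤ℕ 0≤p) 0≤p) (0≤-* (0≤-* 0≤M 0≤M) (0≤-- 1≤M))))
     where
     eq : ∀ p M q x -> (q + + 2 * p * M) * (q + + 2 * p * M) - (+ 2 * p * M * x) * (+ 2 * p * M * x) + (+ 4 - p) * (p * p * (M * M * (x * x)))
        + + 4 * p * M * (p * (M * M) - q) + + 4 * p * p * (M * M * (M - 1ℤ))
        ≡ + 8 * p * p * (M * M * M) + q * q - p * p * p * (M * M) * (x * x)
     eq = solve 4 (λ p M q x -> (q :+ :2 :* p :* M) :* (q :+ :2 :* p :* M) :- (:2 :* p :* M :* x) :* (:2 :* p :* M :* x) :+ (:4 :- p) :* (p :* p :* (M :* M :* (x :* x))) :+ :4 :* p :* M :* (p :* (M :* M) :- q) :+ :4 :* p :* p :* (M :* M :* (M :- :1)) := con (+ 8) :* p :* p :* (M :* M :* M) :+ q :* q :- p :* p :* p :* (M :* M) :* (x :* x)) refl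
   step5 : 0ℤ ≤ c1 * (+ 8 * p * p * p + + 2 * p * p * p * p) * M⁵ - C * p * M³ * q'
   step5 = subst (0ℤ ≤_) (eq p M q x q' c1 C)
     (0≤-+ (0≤-* (0≤-* 0≤p 0≤M) step3)
       (0≤-* 0≤c1 (0≤-+ (0≤-+ (0≤-+
          (0≤-* (0≤-- h4) step4)
          (0≤-* 0≤q (0≤-sq (q - p * M * x))))
          (0≤-* (0≤-* (0≤-* (0≤-* {+ 2} 0≤ℕ 0≤p) 0≤p) (0≤-* 0≤M 0≤M)) (0≤-+ (0≤-* (0≤-- x≤M) (0≤-* (0≤-* 0≤p 0≤p) (0≤-* 0≤M 0≤M))) (0≤-* 0≤x 0≤q))))
          (0≤-* 0≤q (0≤-* (0≤-* (0≤-* {+ 8} 0≤ℕ 0≤p) 0≤p) 0≤M³)))))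
     where
     eq : ∀ p M q x q' c1 C -> p * M * (c1 * ((M * q - + 2 * x * q + p * M * x * x + + 2 * p * x * M) * (p * p * (M * M) - q) - q * (p * p) * M * ((M - x) * (M - x))) - C * M * M * q')
       + c1 * ((p * (M * M) - q) * (+ 8 * p * p * (M * M * M) + q * q - p * p * p * (M * M) * (x * x))
           + q * ((q - p * M * x) * (q - p * M * x))
           + + 2 * p * p * (M * M) * ((M - x) * (p * p * (M * M)) + x * q)
           + q * (+ 8 * p * p * (M * M * M)))
       ≡ c1 * (+ 8 * p * p * p + + 2 * p * p * p * p) * (M * M * M * M * M) - C * p * (M * M * M) * q'
     eq = solve 7 (λ p M q x q' c1 C -> p :* M :* (c1 :* ((M :* q :- :2 :* x :* q :+ p :* M :* x :* x :+ :2 :* p :* x :* M) :* (p :* p :* (M :* M) :- q) :- q :* (p :* p) :* M :* ((M :- x) :* (M :- x))) :- C :* M :* M :* q') :+ c1 :* ((p :* (M :* M) :- q) :* (con (+ 8) :* p :* p :* (M :* M :* M) :+ q :* q :- p :* p :* p :* (M :* M) :* (x :* x)) :+ q :* ((q :- p :* M :* x) :* (q :- p :* M :* x)) :+ :2 :* p :* p :* (M :* M) :* ((M :- x) :* (p :* p :* (M :* M)) :+ x :* q) :+ q :* (con (+ 8) :* p :* p :* (M :* M :* M))) := c1 :* (con (+ 8) :* p :* p :* p :+ :2 :* p :* p :* p :* p) :* (M :* M :* M :* M :* M) :- C :* p :* (M :* M :* M) :* q') refl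
   step6 : 0ℤ ≤ c1 * (+ 8 * p * p * p + + 2 * p * p * p * p) * M⁵ - C * p * M³ * q'
   step6 = step5
   -- A light vertex carries at most three quarters of the total, so by `h6` the form q' keeps a
   -- fixed proportion of M². The gap, multiplied by q', then outweighs the collected errors; this
   -- dictates the size of `C`.
   M≤4M-x : M ≤ + 4 * (M - x)
   M≤4M-x = ≤-cancelˡ p 1≤p (≤-cancelˡ M 1≤M
     (by (0≤-+ (0≤-+ (0≤-* {+ 2} 0≤ℕ (0≤-- h2)) (0≤-* {+ 2} 0≤ℕ (0≤-- h4))) (0≤-* (0≤-* 0≤p 0≤M) (0≤-- 4≤M))) (eq p M q x)))
     where
     eq : ∀ p M q x -> M * (p * (+ 4 * (M - x))) ≡ M * (p * M) + (+ 2 * (q + + 2 * p * M - + 2 * p * M * x) + + 2 * (p * (M * M) - q) + p * M * (M - + 4))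
     eq = solve 4 (λ p M q x -> M :* (p :* (:4 :* (M :- x))) := M :* (p :* M) :+ (:2 :* (q :+ :2 :* p :* M :- :2 :* p :* M :* x) :+ :2 :* (p :* (M :* M) :- q) :+ p :* M :* (M :- :4))) refl
   step7 : 0ℤ ≤ + 16 * n * q' - p * (M * M)
   step7 = subst (0ℤ ≤_) (eq p M q' x n)
     (0≤-+ (0≤-* {+ 16} 0≤ℕ (0≤-- h6)) (0≤-* 0≤p (0≤-- (≤-*² 0≤M (0≤M ⟫ M≤4M-x) M≤4M-x M≤4M-x))))
     where
     eq : ∀ p M q' x n -> + 16 * (n * q' - p * ((M - x) * (M - x))) + p * (+ 4 * (M - x) * (+ 4 * (M - x)) - M * M) ≡ + 16 * n * q' - p * (M * M)
     eq = solve 5 (λ p M q' x n -> con (+ 16) :* (n :* q' :- p :* ((M :- x) :* (M :- x))) :+ p :* (:4 :* (M :- x) :* (:4 :* (M :- x)) :- M :* M) := con (+ 16) :* n :* q' :- p :* (M :* M)) refl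
   eq8 : ∀ p M q' c1 n -> + 16 * n * (c1 * (+ 8 * p * p * p + + 2 * p * p * p * p) * (M * M * M * M * M) - (+ 16 * n * c1 * (+ 8 * p + + 2 * p * p) + 1ℤ) * p * (M * M * M) * q')
      + (+ 16 * n * c1 * (+ 8 * p + + 2 * p * p) + 1ℤ) * p * (M * M * M) * (+ 16 * n * q' - p * (M * M))
      + (p * p * (M * M * M * M * M) - 1ℤ) ≡ -[1+ 0 ]
   eq8 = solve 5 (λ p M q' c1 n -> con (+ 16) :* n :* (c1 :* (con (+ 8) :* p :* p :* p :+ :2 :* p :* p :* p :* p) :* (M :* M :* M :* M :* M) :- (con (+ 16) :* n :* c1 :* (con (+ 8) :* p :+ :2 :* p :* p) :+ :1) :* p :* (M :* M :* M) :* q') :+ (con (+ 16) :* n :* c1 :* (con (+ 8) :* p :+ :2 :* p :* p) :+ :1) :* p :* (M :* M :* M) :* (con (+ 16) :* n :* q' :- p :* (M :* M)) :+ (p :* p :* (M :* M :* M :* M :* M) :- :1) := con -[1+ 0 ]) refl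

 -- The case where all `s` clusters other than v are pairwise fully joined, so that the clique of
 -- the deleted weighting has no cluster left to be extended by. Here `E` is the total deficit of v
 -- and `g` its share of the value. `h3` comes from averaging the row bounds over the other clusters
 -- and replaces the induction.
 special-arith : ∀ p M q x E g s K c1 C ->
   0ℤ ≤ q -> 0ℤ ≤ x -> 1ℤ ≤ M -> 1ℤ ≤ g -> 0ℤ ≤ s -> 1ℤ ≤ p -> 0ℤ ≤ c1 ->
   p - E ≤ g ->
   + 2 * p * M * x ≤ q + + 2 * p * M ->
   p * M * M ≤ s * (q + p * M) + (p - E) * x * M ->
   q * K + C * M ≤ p * p * c1 * (M * M) ->
   c1 ≡ + 2 * p - 1ℤ ->
   c1 * (p * s + g) - (p - 1ℤ) ≤ K ->
   p * p * c1 * (s + g) + 1ℤ ≤ C -> ⊥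
 special-arith p M q x E g s K c1 C 0≤q 0≤x 1≤M 1≤g 0≤s 1≤p 0≤c1 h1 h2 h3 h4 refl h5 h6 =
   absurd _ (+ 2 * M - 1ℤ + (+ 2 * c1 * p * (p - 1ℤ) * g * M))
     (0≤-+ (0≤-+ (0≤-+ (0≤-+ (0≤-+ (0≤-+
       (0≤-* (0≤-* {+ 2} 0≤ℕ (0≤-* 0≤c1 0≤p)) (0≤-- h3))
       (0≤-* (0≤-* {+ 2} 0≤ℕ (0≤-* 0≤c1 0≤p)) (0≤-* (0≤-* (0≤-- h1) 0≤x) 0≤M)))
       (0≤-* (0≤-* 0≤c1 (1≤⇒0≤ 1≤g)) (0≤-- h2)))
       (0≤-* {+ 2} 0≤ℕ (0≤-- h4)))
       (0≤-* (0≤-* {+ 2} 0≤ℕ 0≤q) (0≤-- h5)))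
       (0≤-* (0≤-* {+ 2} 0≤ℕ 0≤M) (0≤-- h6)))
       (0≤-* 0≤q (0≤-+ (0≤-* 0≤c1 (0≤-- 1≤g)) (0≤ℕ {1}))))
     (0≤-+ (0≤-- (1≤-* {+ 2} (+≤+ (ℕ.s≤s ℕ.z≤n)) 1≤M)) (0≤-* (0≤-* (0≤-* (0≤-* (0≤-* {+ 2} 0≤ℕ 0≤c1) 0≤p) (0≤-- 1≤p)) (1≤⇒0≤ 1≤g)) 0≤M))
     (eq p M q x E g s K C)
   where
   0≤p = 1≤⇒0≤ 1≤p
   0≤M = 1≤⇒0≤ 1≤M
   eq : ∀ p M q x E g s K C -> + 2 * ((+ 2 * p - 1ℤ) * p) * (s * (q + p * M) + (p - E) * x * M - p * M * M)
      + + 2 * ((+ 2 * p - 1ℤ) * p) * ((g - (p - E)) * x * M)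
      + (+ 2 * p - 1ℤ) * g * (q + + 2 * p * M - + 2 * p * M * x)
      + + 2 * (p * p * (+ 2 * p - 1ℤ) * (M * M) - (q * K + C * M))
      + + 2 * q * (K - ((+ 2 * p - 1ℤ) * (p * s + g) - (p - 1ℤ)))
      + + 2 * M * (C - (p * p * (+ 2 * p - 1ℤ) * (s + g) + 1ℤ))
      + q * ((+ 2 * p - 1ℤ) * (g - 1ℤ) + 1ℤ)
      + (+ 2 * M - 1ℤ + + 2 * (+ 2 * p - 1ℤ) * p * (p - 1ℤ) * g * M)
      ≡ -[1+ 0 ]
   eq = solve 9 (λ p M q x E g s K C -> :2 :* ((:2 :* p :- :1) :* p) :* (s :* (q :+ p :* M) :+ (p :- E) :* x :* M :- p :* M :* M) :+ :2 :* ((:2 :* p :- :1) :* p) :* ((g :- (p :- E)) :* x :* M) :+ (:2 :* p :- :1) :* g :* (q :+ :2 :* p :* M :- :2 :* p :* M :* x) :+ :2 :* (p :* p :* (:2 :* p :- :1) :* (M :* M) :- (q :* K :+ C :* M)) :+ :2 :* q :* (K :- ((:2 :* p :- :1) :* (p :* s :+ g) :- (p :- :1))) :+ :2 :* M :* (C :- (p :* p :* (:2 :* p :- :1) :* (s :+ g) :+ :1)) :+ q :* ((:2 :* p :- :1) :* (g :- :1) :+ :1) :+ (:2 :* M :- :1 :+ :2 :* (:2 :* p :- :1) :* p :* (p :- :1) :* g :* M) := con -[1+ 0 ]) refl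

 -- With every vertex heavy, p n − E already exceeds the bound; v is a lightest vertex carrying a deficit.
 heavy-arith : ∀ p M q x r a S b n F K c1 C ->
   0ℤ ≤ q -> 1ℤ ≤ M -> + 2 ≤ p -> 0ℤ ≤ c1 -> 0ℤ ≤ n ->
   1ℤ ≤ a ->
   q + + 2 * p * M + 1ℤ ≤ + 2 * p * M * x ->
   q ≤ M * r + p * M ->
   M * r ≤ q + p * M ->
   p * x + a * x ≤ r ->
   + 2 * p * M * r - + 2 * (p - a) * (p * M * x) - + 2 * a * q ≤ S ->
   + 2 * (p * n) - b ≤ + 2 * F ->
   S + + 2 * p * p * (M * M) - + 2 * n * p * p * M ≤ + 2 * p * n * q - b * q ->
   q * K + C * M ≤ p * p * c1 * (M * M) ->
   c1 ≡ + 2 * p - 1ℤ ->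
   K ≡ c1 * F - (p - 1ℤ) ->
   p * p * c1 * (n + + 4) + 1ℤ ≤ C -> ⊥
 heavy-arith p M q x r a S b n F K c1 C 0≤q 1≤M 2≤p 0≤c1 0≤n 1≤a h0 h1 h2 h3 h4 h5 h6 h7 refl refl h8 = final
   where
   1≤p : 1ℤ ≤ p
   1≤p = +≤+ (ℕ.s≤s ℕ.z≤n) ⟫ 2≤p
   0≤p = 1≤⇒0≤ 1≤p
   0≤a = 1≤⇒0≤ 1≤a
   0≤M = 1≤⇒0≤ 1≤M
   -- If a ≥ p, then r ≥ 2px, and heaviness pushes Mr above q + 2pM, against `h2`.
   a<p : a + 1ℤ ≤ p
   a<p with p Z.≤? a
   ... | no h = ≰⇒≥1 h
   ... | yes p≤a = ⊥-elim (absurd _ (+ 2 * (p * p) * M - 1ℤ + + 2 * p)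
       (0≤-+ (0≤-+ (0≤-+ (0≤-* (0≤-+ 0≤p 0≤a) (0≤-- h0)) (0≤-* (0≤-* {+ 2} 0≤ℕ 0≤p) (0≤-* 0≤M (0≤-- h3)))) (0≤-* (0≤-* {+ 2} 0≤ℕ 0≤p) (0≤-- h2)))
             (0≤-* (0≤-- p≤a) (0≤-+ (0≤-+ 0≤q (0≤-* (0≤-* {+ 2} 0≤ℕ 0≤p) 0≤M)) (0≤ℕ {1}))))
       (0≤-+ (0≤-- (1≤-* (1≤-* {+ 2} (+≤+ (ℕ.s≤s ℕ.z≤n)) (1≤-* 1≤p 1≤p)) 1≤M)) (0≤-* {+ 2} 0≤ℕ 0≤p)) (eq p M q x r a))
     where
     eq : ∀ p M q x r a -> (p + a) * (+ 2 * p * M * x - (q + + 2 * p * M + 1ℤ)) + + 2 * p * (M * (r - (p * x + a * x))) + + 2 * p * (q + p * M - M * r)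
        + (a - p) * (q + + 2 * p * M + 1ℤ) + (+ 2 * (p * p) * M - 1ℤ + + 2 * p) ≡ -[1+ 0 ]
     eq = solve 6 (λ p M q x r a -> (p :+ a) :* (:2 :* p :* M :* x :- (q :+ :2 :* p :* M :+ :1)) :+ :2 :* p :* (M :* (r :- (p :* x :+ a :* x))) :+ :2 :* p :* (q :+ p :* M :- M :* r) :+ (a :- p) :* (q :+ :2 :* p :* M :+ :1) :+ (:2 :* (p :* p) :* M :- :1 :+ :2 :* p) := con -[1+ 0 ]) refl
   -- c1 (p - a) a ≥ (p - 1)(p + a) for 1 ≤ a ≤ p - 1, by writing p = u + w + 2 and a = u + 1.
   conv : 0ℤ ≤ (+ 2 * p - 1ℤ) * (p - a) * a - (p - 1ℤ) * (p + a)
   conv = subst (0ℤ ≤_) (eq p a) (0≤-+ (0≤-+ (0≤-+ (0≤-* hw hw) (0≤-* (0≤-* {+ 4} 0≤ℕ hu) hw)) hw) (0≤-+ (0≤-* (0≤-* (0≤-* {+ 2} 0≤ℕ hu) hu) hw) (0≤-* (0≤-* (0≤-* {+ 2} 0≤ℕ hu) hw) hw)))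
     where
     hu : 0ℤ ≤ a - 1ℤ
     hu = 0≤-- 1≤a
     hw : 0ℤ ≤ p - (a + 1ℤ)
     hw = 0≤-- a<p
     eq : ∀ p a -> (p - (a + 1ℤ)) * (p - (a + 1ℤ)) + + 4 * (a - 1ℤ) * (p - (a + 1ℤ)) + (p - (a + 1ℤ))
        + (+ 2 * (a - 1ℤ) * (a - 1ℤ) * (p - (a + 1ℤ)) + + 2 * (a - 1ℤ) * (p - (a + 1ℤ)) * (p - (a + 1ℤ)))
        ≡ (+ 2 * p - 1ℤ) * (p - a) * a - (p - 1ℤ) * (p + a)
     eq = solve 2 (λ p a -> (p :- (a :+ :1)) :* (p :- (a :+ :1)) :+ :4 :* (a :- :1) :* (p :- (a :+ :1)) :+ (p :- (a :+ :1)) :+ (:2 :* (a :- :1) :* (a :- :1) :* (p :- (a :+ :1)) :+ :2 :* (a :- :1) :* (p :- (a :+ :1)) :* (p :- (a :+ :1))) := (:2 :* p :- :1) :* (p :- a) :* a :- (p :- :1) :* (p :+ a)) refl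
   0≤p-a : 0ℤ ≤ p - a
   0≤p-a = subst (0ℤ ≤_) (eq p a) (0≤-+ (0≤-- a<p) (0≤ℕ {1}))
     where
     eq : ∀ p a -> p - (a + 1ℤ) + 1ℤ ≡ p - a
     eq = solve 2 (λ p a -> p :- (a :+ :1) :+ :1 := p :- a) refl
   -- Divided by c1(p + a) this reads S ≥ 2(p - 1)q/c1 - O(M). It is exactly the slack (p - 1)/c1 by
   -- which the bound differs from F.
   step1 : 0ℤ ≤ (+ 2 * p - 1ℤ) * (p + a) * S - + 2 * (p - 1ℤ) * (p + a) * q + (+ 2 * p - 1ℤ) * (+ 4 * p * p * p) * M
   step1 = subst (0ℤ ≤_) (eq p M q x r a S)
     (0≤-+ (0≤-+ (0≤-+ (0≤-+ (0≤-* (0≤-* 0≤c1 (0≤-+ 0≤p 0≤a)) (0≤-- h4))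
       (0≤-* (0≤-* 0≤c1 (0≤-+ 0≤p 0≤a)) (0≤-* (0≤-* {+ 2} 0≤ℕ 0≤p) (0≤-- h1))))
       (0≤-* (0≤-* (0≤-* 0≤c1 (0≤-* {+ 2} 0≤ℕ 0≤p)) 0≤p-a) (0≤-* 0≤M (0≤-- h3))))
       (0≤-* (0≤-* (0≤-* 0≤c1 (0≤-* {+ 2} 0≤ℕ 0≤p)) 0≤p-a) (0≤-- h2)))
       (0≤-* (0≤-* {+ 2} 0≤ℕ 0≤q) conv))
     where
     eq : ∀ p M q x r a S -> (+ 2 * p - 1ℤ) * (p + a) * (S - (+ 2 * p * M * r - + 2 * (p - a) * (p * M * x) - + 2 * a * q))
       + (+ 2 * p - 1ℤ) * (p + a) * (+ 2 * p * (M * r + p * M - q))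
       + (+ 2 * p - 1ℤ) * (+ 2 * p) * (p - a) * (M * (r - (p * x + a * x)))
       + (+ 2 * p - 1ℤ) * (+ 2 * p) * (p - a) * (q + p * M - M * r)
       + + 2 * q * ((+ 2 * p - 1ℤ) * (p - a) * a - (p - 1ℤ) * (p + a))
       ≡ (+ 2 * p - 1ℤ) * (p + a) * S - + 2 * (p - 1ℤ) * (p + a) * q + (+ 2 * p - 1ℤ) * (+ 4 * p * p * p) * M
     eq = solve 7 (λ p M q x r a S -> (:2 :* p :- :1) :* (p :+ a) :* (S :- (:2 :* p :* M :* r :- :2 :* (p :- a) :* (p :* M :* x) :- :2 :* a :* q)) :+ (:2 :* p :- :1) :* (p :+ a) :* (:2 :* p :* (M :* r :+ p :* M :- q)) :+ (:2 :* p :- :1) :* (:2 :* p) :* (p :- a) :* (M :* (r :- (p :* x :+ a :* x))) :+ (:2 :* p :- :1) :* (:2 :* p) :* (p :- a) :* (q :+ p :* M :- M :* r) :+ :2 :* q :* ((:2 :* p :- :1) :* (p :- a) :* a :- (p :- :1) :* (p :+ a)) := (:2 :* p :- :1) :* (p :+ a) :* S :- :2 :* (p :- :1) :* (p :+ a) :* q :+ (:2 :* p :- :1) :* (:4 :* p :* p :* p) :* M) refl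
   final : ⊥
   final = absurd _ ((p + a) * (+ 2 * M) - 1ℤ + (+ 2 * p - 1ℤ) * (+ 4 * p * p) * (p + (a + a)) * M)
     (0≤-+ (0≤-+ (0≤-+ (0≤-+ step1
       (0≤-* (0≤-* 0≤c1 (0≤-+ 0≤p 0≤a)) (0≤-- h6)))
       (0≤-* (0≤-* (0≤-* 0≤c1 (0≤-+ 0≤p 0≤a)) 0≤q) (0≤-- h5)))
       (0≤-* (0≤-* {+ 2} 0≤ℕ (0≤-+ 0≤p 0≤a)) (0≤-- h7)))
       (0≤-* (0≤-* (0≤-* {+ 2} 0≤ℕ (0≤-+ 0≤p 0≤a)) 0≤M) (0≤-- h8)))
     (0≤-+ (0≤-- (1≤-* (1≤p ⟫ by 0≤a refl) (1≤-* {+ 2} (+≤+ (ℕ.s≤s ℕ.z≤n)) 1≤M))) (0≤-* (0≤-* (0≤-* 0≤c1 (0≤-* (0≤-* {+ 4} 0≤ℕ 0≤p) 0≤p)) (0≤-+ 0≤p (0≤-+ 0≤a 0≤a))) 0≤M))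
     (eq p M q a S b n F C)
     where
     eq : ∀ p M q a S b n F C -> (+ 2 * p - 1ℤ) * (p + a) * S - + 2 * (p - 1ℤ) * (p + a) * q + (+ 2 * p - 1ℤ) * (+ 4 * p * p * p) * M
       + (+ 2 * p - 1ℤ) * (p + a) * (+ 2 * p * n * q - b * q - (S + + 2 * p * p * (M * M) - + 2 * n * p * p * M))
       + (+ 2 * p - 1ℤ) * (p + a) * q * (+ 2 * F - (+ 2 * (p * n) - b))
       + + 2 * (p + a) * (p * p * (+ 2 * p - 1ℤ) * (M * M) - (q * ((+ 2 * p - 1ℤ) * F - (p - 1ℤ)) + C * M))
       + + 2 * (p + a) * M * (C - (p * p * (+ 2 * p - 1ℤ) * (n + + 4) + 1ℤ))
       + ((p + a) * (+ 2 * M) - 1ℤ + (+ 2 * p - 1ℤ) * (+ 4 * p * p) * (p + (a + a)) * M) ≡ -[1+ 0 ]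
     eq = solve 9 (λ p M q a S b n F C -> (:2 :* p :- :1) :* (p :+ a) :* S :- :2 :* (p :- :1) :* (p :+ a) :* q :+ (:2 :* p :- :1) :* (:4 :* p :* p :* p) :* M :+ (:2 :* p :- :1) :* (p :+ a) :* (:2 :* p :* n :* q :- b :* q :- (S :+ :2 :* p :* p :* (M :* M) :- :2 :* n :* p :* p :* M)) :+ (:2 :* p :- :1) :* (p :+ a) :* q :* (:2 :* F :- (:2 :* (p :* n) :- b)) :+ :2 :* (p :+ a) :* (p :* p :* (:2 :* p :- :1) :* (M :* M) :- (q :* ((:2 :* p :- :1) :* F :- (p :- :1)) :+ C :* M)) :+ :2 :* (p :+ a) :* M :* (C :- (p :* p :* (:2 :* p :- :1) :* (n :+ :4) :+ :1)) :+ ((p :+ a) :* (:2 :* M) :- :1 :+ (:2 :* p :- :1) :* (:4 :* p :* p) :* (p :+ (a :+ a)) :* M) := con -[1+ 0 ]) refl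

 -- Quadratic forms and the weighted Turán problem

 δ : ∀ {n} -> Fin n -> Fin n -> ℤ
 δ w i = if does (w Fₚ.≟ i) then 1ℤ else 0ℤ

 δ-self : ∀ {n} (w : Fin n) -> δ w w ≡ 1ℤ
 δ-self w with w Fₚ.≟ w
 ... | yes _ = refl
 ... | no q = ⊥-elim (q refl)

 δ-other : ∀ {n} {w i : Fin n} -> w ≢ i -> δ w i ≡ 0ℤ
 δ-other {_} {w} {i} h with w Fₚ.≟ i
 ... | yes q = ⊥-elim (h q)
 ... | no _ = refl

 0≤δ : ∀ {n} (w i : Fin n) -> 0ℤ ≤ δ w i
 0≤δ w i with w Fₚ.≟ i
 ... | yes _ = 0≤ℕ
 ... | no _ = 0≤ℕ

 ∑-δ : ∀ {n} (f : Fin n -> ℤ) w -> ∑ (allFin n) (λ j -> f j * δ w j) ≡ f w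
 ∑-δ {suc n} f w = begin
   ∑ (allFin (suc n)) (λ j -> f j * δ w j) ≡⟨ ∑-punchIn n w (λ j -> f j * δ w j) ⟩
   f w * δ w w + ∑ (allFin n) (λ j -> f (punchIn w j) * δ w (punchIn w j))
     ≡⟨ cong₂ _+_ (trans (cong (f w *_) (δ-self w)) (Z.*-identityʳ (f w)))
          (trans (∑-cong (allFin n) (λ j -> trans (cong (f (punchIn w j) *_) (δ-other (λ q -> Fₚ.punchInᵢ≢i w j (sym q)))) (Z.*-zeroʳ (f (punchIn w j))))) (∑-zero (allFin n))) ⟩
   f w + 0ℤ ≡⟨ Z.+-identityʳ (f w) ⟩
   f w ∎
   where open ≡-Reasoning

 tot : ∀ {n} -> (Fin n -> ℤ) -> ℤ
 tot {n} x = ∑ (allFin n) x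

 row : ∀ {n} -> (Fin n -> Fin n -> ℤ) -> (Fin n -> ℤ) -> Fin n -> ℤ
 row {n} e x i = ∑ (allFin n) (λ j -> e i j * x j)

 quad : ∀ {n} -> (Fin n -> Fin n -> ℤ) -> (Fin n -> ℤ) -> ℤ
 quad {n} e x = ∑ (allFin n) (λ i -> x i * row e x i)

 minor : ∀ {n} -> Fin (suc n) -> (Fin (suc n) -> Fin (suc n) -> ℤ) -> Fin n -> Fin n -> ℤ
 minor v e i j = e (punchIn v i) (punchIn v j)

 -- Descent on the natural number `x i` takes the place of choosing a minimum, since only a
 -- contradiction is wanted.
 lightest : ∀ {n} (x : Fin n -> ℤ) -> (∀ i -> 0ℤ ≤ x i) -> (P : Fin n -> Set) ->
   (∀ v -> P v -> (∀ j -> P j -> x v ≤ x j) -> ⊥) -> ∀ i -> P i -> ⊥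
 lightest {n} x 0≤x P k i pi = go ∣ x i ∣ i pi (≤r (sym (Z.0≤i⇒+∣i∣≡i (0≤x i))))
   where
   go : ∀ b i -> P i -> x i ≤ + b -> ⊥
   below : ∀ b i -> x i ≤ + b -> ∀ j -> P j -> x j + 1ℤ ≤ x i -> ⊥
   below zero i h j pj q = absurd (x j + (0ℤ - (x j + 1ℤ))) 0ℤ (0≤-+ (0≤x j) (0≤-- (q ⟫ h))) 0≤ℕ (eq (x j))
     where
     eq : ∀ a -> a + (0ℤ - (a + 1ℤ)) + 0ℤ ≡ -[1+ 0 ]
     eq = solve 1 (λ a -> a :+ (:0 :- (a :+ :1)) :+ :0 := con -[1+ 0 ]) refl
   below (suc b) i h j pj q = go b j pj (by (0≤-- (q ⟫ h)) (eq (x j) (+ b)))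
     where
     eq : ∀ a c -> c ≡ a + (1ℤ + c - (a + 1ℤ))
     eq = solve 2 (λ a c -> c := a :+ (:1 :+ c :- (a :+ :1))) refl
   go b i pi h = k i pi min
     where
     min : ∀ j -> P j -> x i ≤ x j
     min j pj with x i Z.≤? x j
     ... | yes q = q
     ... | no q = ⊥-elim (below b i h j pj (≰⇒≥1 q))

 module Turan (p : ℤ) (2≤p : + 2 ≤ p) (p≤4 : p ≤ + 4) where

   1≤p : 1ℤ ≤ p
   1≤p = +≤+ (ℕ.s≤s ℕ.z≤n) ⟫ 2≤p

   0≤p : 0ℤ ≤ p
   0≤p = 1≤⇒0≤ 1≤p

   c0 c1 : ℤ
   c0 = p - 1ℤ
   c1 = + 2 * p - 1ℤ

   1≤c1 : 1ℤ ≤ c1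
   1≤c1 = by (0≤-+ (0≤-- 1≤p) (0≤-- 1≤p)) (eq p)
     where
     eq : ∀ p -> + 2 * p - 1ℤ ≡ 1ℤ + (p - 1ℤ + (p - 1ℤ))
     eq = solve 1 (λ p -> :2 :* p :- :1 := :1 :+ (p :- :1 :+ (p :- :1))) refl

   0≤c1 : 0ℤ ≤ c1
   0≤c1 = 1≤⇒0≤ 1≤c1

   -- The size of a clique that can be built greedily along the list: cluster `i` offers a K_p, each
   -- later cluster `j` may cost `e i j` of its vertices, and one vertex always survives.
   value : ∀ {I : Set} -> (I -> I -> ℤ) -> List I -> ℤ
   value e [] = 0ℤ
   value e (i ∷ l) = (1ℤ ⊔ (p - ∑ l (e i))) + value e l

   Valid Zero : ∀ {I : Set} -> (I -> I -> ℤ) -> List I -> Set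
   Valid e = AllPairs (λ i j -> e i j + 1ℤ ≤ p)
   Zero e = AllPairs (λ i j -> e i j ≡ 0ℤ)

   -- The density between clusters i and j is 1 - `e i j` / p. The diagonal value p says that
   -- clusters are sparse inside, and `quad` measures the missing density, so it is to be minimised.
   record IsDeficit {n} (e : Fin n -> Fin n -> ℤ) : Set where
     field
       e-sym  : ∀ i j -> e i j ≡ e j i
       e-diag : ∀ i -> e i i ≡ p
       e≥0    : ∀ i j -> 0ℤ ≤ e i j
       e≤p    : ∀ i j -> e i j ≤ p

   Bounded : ∀ {n} -> (Fin n -> Fin n -> ℤ) -> ℤ -> Set
   Bounded e F = ∀ l -> Valid e l -> value e l ≤ F

   -- Good says that the weighted density is at most that of the bound F, up to the slack (p - 1) / (2p - 1),
   -- or at most that of a clique of fully joined clusters.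
   Good : ∀ {n} -> (Fin n -> Fin n -> ℤ) -> ℤ -> ℤ -> ℤ -> Set
   Good e F X q = (p * p * c1 * (X * X) ≤ q * (c1 * F - c0)) ⊎ (∃ λ l -> Zero e l × p * (X * X) ≤ + length l * q)

   value-map : ∀ {I J : Set} (π : I -> J) e (l : List I) -> value e (map π l) ≡ value (λ i j -> e (π i) (π j)) l
   value-map π e [] = refl
   value-map π e (i ∷ l) = cong₂ (λ a b -> (1ℤ ⊔ (p - a)) + b) (∑-map π l (e (π i))) (value-map π e l)

   zero-value : ∀ {I : Set} e (l : List I) -> Zero e l -> p * + length l ≤ value e l
   zero-value e [] _ = ≤r (Z.*-zeroʳ p)
   zero-value e (i ∷ l) (h ∷ hs) = ≤r (eq p (+ length l)) ⟫ Z.+-mono-≤ (≤r p≡ ⟫ Z.i≤j⊔i 1ℤ (p - ∑ l (e i))) (zero-value e l hs)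
     where
     eq : ∀ p a -> p * (1ℤ + a) ≡ p + p * a
     eq = solve 2 (λ p a -> p :* (:1 :+ a) := p :+ p :* a) refl
     s≡0 : ∑ l (e i) ≡ 0ℤ
     s≡0 = trans (∑-cong∈ l (λ x m -> All.lookup h m)) (∑-zero l)
     p≡ : p ≡ p - ∑ l (e i)
     p≡ = trans (sym (Z.+-identityʳ p)) (cong (λ z -> p - z) (sym s≡0))

   -- Each maximum with 1 is bounded below by its second argument. By symmetry the pairs in list
   -- order make up half of the off-diagonal sum, which explains the doubling.
   value-lower : ∀ {I : Set} (e : I -> I -> ℤ) -> (∀ i j -> e i j ≡ e j i) -> (∀ i -> e i i ≡ p) -> (l : List I) ->
     + 2 * (p * + length l) - (∑ l (λ i -> ∑ l (e i)) - + length l * p) ≤ + 2 * value e l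
   value-lower e e-sym e-diag [] = ≤r (eq p)
     where
     eq : ∀ p -> + 2 * (p * 0ℤ) - (0ℤ - 0ℤ * p) ≡ 0ℤ
     eq = solve 1 (λ p -> :2 :* (p :* :0) :- (:0 :- :0 :* p) := :0) refl
   value-lower e e-sym e-diag (i ∷ l) = by (0≤-+ (0≤-- (value-lower e e-sym e-diag l)) (0≤-* {+ 2} 0≤ℕ (0≤-- (Z.i≤j⊔i 1ℤ (p - ∑ l (e i))))))
      (trans (eq p (+ length l) (∑ l (e i)) (∑ l (λ i -> ∑ l (e i))) (value e l) (1ℤ ⊔ (p - ∑ l (e i))))
        (cong (λ z -> + 2 * (p * (1ℤ + + length l)) - (z - (1ℤ + + length l) * p) + rest) (sym ex)))
     where
     rest : ℤ
     rest = + 2 * value e l - (+ 2 * (p * + length l) - (∑ l (λ i -> ∑ l (e i)) - + length l * p)) + + 2 * ((1ℤ ⊔ (p - ∑ l (e i))) - (p - ∑ l (e i)))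
     ex : ∑ (i ∷ l) (λ k -> ∑ (i ∷ l) (e k)) ≡ p + ∑ l (e i) + (∑ l (e i) + ∑ l (λ i -> ∑ l (e i)))
     ex = cong₂ _+_ (cong (_+ ∑ l (e i)) (e-diag i)) (trans (∑-+ l (λ k -> e k i) (λ k -> ∑ l (e k))) (cong (_+ ∑ l (λ i -> ∑ l (e i))) (∑-cong l (λ k -> e-sym k i))))
     eq : ∀ p n a T w z -> + 2 * (z + w) ≡ + 2 * (p * (1ℤ + n)) - (p + a + (a + T) - (1ℤ + n) * p)
         + (+ 2 * w - (+ 2 * (p * n) - (T - n * p)) + + 2 * (z - (p - a)))
     eq = solve 6 (λ p n a T w z -> :2 :* (z :+ w) := :2 :* (p :* (:1 :+ n)) :- (p :+ a :+ (a :+ T) :- (:1 :+ n) :* p) :+ (:2 :* w :- (:2 :* (p :* n) :- (T :- n :* p)) :+ :2 :* (z :- (p :- a)))) refl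

   module Quad {n} (e : Fin n -> Fin n -> ℤ) (def : IsDeficit e) where
     open IsDeficit def

     quad-perturb : ∀ x s w -> quad e (λ i -> x i + s * δ w i) ≡ quad e x + + 2 * s * row e x w + s * s * p
     quad-perturb x s w = begin
       quad e (λ i -> x i + s * δ w i)
         ≡⟨ ∑-cong (allFin n) (λ i -> trans (cong ((x i + s * δ w i) *_) (row′ i)) (expand (x i) (row e x i) s (δ w i) (e i w))) ⟩
       ∑ (allFin n) (λ i -> x i * row e x i + s * (e i w * x i) + (s * row e x i + s * s * e i w) * δ w i)
         ≡⟨ ∑-+ (allFin n) _ _ ⟩
       ∑ (allFin n) (λ i -> x i * row e x i + s * (e i w * x i)) + ∑ (allFin n) (λ i -> (s * row e x i + s * s * e i w) * δ w i)
         ≡⟨ cong₂ _+_ (trans (∑-+ (allFin n) _ _) (cong (λ z -> quad e x + z) (trans (∑-*ˡ (allFin n) s _) (cong (s *_) (∑-cong (allFin n) (λ i -> cong (_* x i) (e-sym i w))))))) (∑-δ (λ i -> s * row e x i + s * s * e i w) w) ⟩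
       quad e x + s * row e x w + (s * row e x w + s * s * e w w) ≡⟨ cong (λ z -> quad e x + s * row e x w + (s * row e x w + s * s * z)) (e-diag w) ⟩
       quad e x + s * row e x w + (s * row e x w + s * s * p) ≡⟨ fin (quad e x) s (row e x w) p ⟩
       quad e x + + 2 * s * row e x w + s * s * p ∎
       where
       open ≡-Reasoning
       row′ : ∀ i -> row e (λ j -> x j + s * δ w j) i ≡ row e x i + s * e i w
       row′ i = trans (∑-cong (allFin n) (λ j -> dist (e i j) (x j) s (δ w j)))
          (trans (∑-+ (allFin n) _ _) (cong (λ z -> row e x i + z) (∑-δ (λ j -> s * e i j) w)))
         where
         dist : ∀ a b s d -> a * (b + s * d) ≡ a * b + s * a * d
         dist = solve 4 (λ a b s d -> a :* (b :+ s :* d) := a :* b :+ s :* a :* d) refl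
       expand : ∀ x r s d e -> (x + s * d) * (r + s * e) ≡ x * r + s * (e * x) + (s * r + s * s * e) * d
       expand = solve 5 (λ x r s d e -> (x :+ s :* d) :* (r :+ s :* e) := x :* r :+ s :* (e :* x) :+ (s :* r :+ s :* s :* e) :* d) refl
       fin : ∀ q s r p -> q + s * r + (s * r + s * s * p) ≡ q + + 2 * s * r + s * s * p
       fin = solve 4 (λ q s r p -> q :+ s :* r :+ (s :* r :+ s :* s :* p) := q :+ :2 :* s :* r :+ s :* s :* p) refl

     row-perturb : ∀ x s w i -> row e (λ j -> x j + s * δ w j) i ≡ row e x i + s * e i w
     row-perturb x s w i = trans (∑-cong (allFin n) (λ j -> dist (e i j) (x j) s (δ w j)))
        (trans (∑-+ (allFin n) _ _) (cong (λ z -> row e x i + z) (∑-δ (λ j -> s * e i j) w)))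
       where
       dist : ∀ a b s d -> a * (b + s * d) ≡ a * b + s * a * d
       dist = solve 4 (λ a b s d -> a :* (b :+ s :* d) := a :* b :+ s :* a :* d) refl

     0≤row : ∀ x -> (∀ i -> 0ℤ ≤ x i) -> ∀ i -> 0ℤ ≤ row e x i
     0≤row x 0≤x i = ∑-nonneg (allFin n) (λ j -> 0≤-* (e≥0 i j) (0≤x j))

     0≤quad : ∀ x -> (∀ i -> 0ℤ ≤ x i) -> 0ℤ ≤ quad e x
     0≤quad x 0≤x = ∑-nonneg (allFin n) (λ i -> 0≤-* (0≤x i) (0≤row x 0≤x i))

     quad-upper : ∀ x -> (∀ i -> 0ℤ ≤ x i) -> quad e x ≤ p * (tot x * tot x)
     quad-upper x 0≤x = ∑-mono (allFin n) (λ i -> ≤-*ˡ (x i) (0≤x i)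
          (∑-mono (allFin n) (λ j -> ≤-*ʳ (x j) (0≤x j) (e≤p i j)) ⟫ ≤r (∑-*ˡ (allFin n) p x)))
        ⟫ ≤r (trans (∑-*ʳ (allFin n) (p * tot x) x) (eq (tot x) p))
       where
       eq : ∀ a p -> a * (p * a) ≡ p * (a * a)
       eq = solve 2 (λ a p -> a :* (p :* a) := p :* (a :* a)) refl

     -- Only the diagonal terms of the form are kept; the rest is Cauchy-Schwarz.
     quad-lower : ∀ x -> (∀ i -> 0ℤ ≤ x i) -> p * (tot x * tot x) ≤ + n * quad e x
     quad-lower x 0≤x = ≤-*ˡ p 0≤p (∑-cauchy (allFin n) x) ⟫ ≤r (eq p (+ length (allFin n)) (∑ (allFin n) (λ i -> x i * x i)))
        ⟫ ≤-*ˡ (+ length (allFin n)) 0≤ℕ (≤r (sym (∑-*ˡ (allFin n) p _)) ⟫ ∑-mono (allFin n) term)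
        ⟫ ≤r (cong (λ k -> + k * quad e x) (Lₚ.length-tabulate (λ (i : Fin n) -> i)))
       where
       eq : ∀ p l s -> p * (l * s) ≡ l * (p * s)
       eq = solve 3 (λ p l s -> p :* (l :* s) := l :* (p :* s)) refl
       eq′ : ∀ p a -> p * (a * a) ≡ a * (p * a)
       eq′ = solve 2 (λ p a -> p :* (a :* a) := a :* (p :* a)) refl
       term : ∀ i -> p * (x i * x i) ≤ x i * row e x i
       term i = ≤r (eq′ p (x i)) ⟫ ≤-*ˡ (x i) (0≤x i) (≤r (cong (_* x i) (sym (e-diag i)))
         ⟫ ∑-∈≤ (allFin n) (λ j -> 0≤-* (e≥0 i j) (0≤x j)) (∈ₚ.∈-allFin i))

   module Minor {n} (e : Fin (suc n) -> Fin (suc n) -> ℤ) (def : IsDeficit e) (v : Fin (suc n)) where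
     open IsDeficit def

     π : Fin n -> Fin (suc n)
     π = punchIn v

     minor-deficit : IsDeficit (minor v e)
     minor-deficit = record { e-sym = λ i j -> e-sym (π i) (π j) ; e-diag = λ i -> e-diag (π i)
                            ; e≥0 = λ i j -> e≥0 (π i) (π j) ; e≤p = λ i j -> e≤p (π i) (π j) }

     row-self : ∀ x -> row e x v ≡ p * x v + ∑ (allFin n) (λ j -> e v (π j) * x (π j))
     row-self x = trans (∑-punchIn n v (λ j -> e v j * x j)) (cong (λ z -> z * x v + ∑ (allFin n) (λ j -> e v (π j) * x (π j))) (e-diag v))

     row-other : ∀ x i -> row e x (π i) ≡ e v (π i) * x v + row (minor v e) (x ∘ π) i
     row-other x i = trans (∑-punchIn n v (λ j -> e (π i) j * x j)) (cong (λ z -> z * x v + row (minor v e) (x ∘ π) i) (e-sym (π i) v))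

     tot-minor : ∀ x -> tot (x ∘ π) ≡ tot x - x v
     tot-minor x = trans (eq (x v) (tot (x ∘ π))) (cong (_- x v) (sym (∑-punchIn n v x)))
       where
       eq : ∀ a b -> b ≡ a + b - a
       eq = solve 2 (λ a b -> b := a :+ b :- a) refl

     quad-minor : ∀ x -> quad (minor v e) (x ∘ π) ≡ quad e x - + 2 * x v * row e x v + p * x v * x v
     quad-minor x = begin
       q′ ≡⟨ eq (x v) s q′ p ⟩
       (x v * (p * x v + s) + (x v * s + q′)) - + 2 * x v * (p * x v + s) + p * x v * x v
         ≡⟨ cong₂ (λ a b -> a - + 2 * x v * b + p * x v * x v) (sym ex) (sym (row-self x)) ⟩
       quad e x - + 2 * x v * row e x v + p * x v * x v ∎
       where
       open ≡-Reasoning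
       s q′ : ℤ
       s = ∑ (allFin n) (λ j -> e v (π j) * x (π j))
       q′ = quad (minor v e) (x ∘ π)
       eq : ∀ a s q p -> q ≡ (a * (p * a + s) + (a * s + q)) - + 2 * a * (p * a + s) + p * a * a
       eq = solve 4 (λ a s q p -> q := (a :* (p :* a :+ s) :+ (a :* s :+ q)) :- :2 :* a :* (p :* a :+ s) :+ p :* a :* a) refl
       dist : ∀ y e a r -> y * (e * a + r) ≡ a * (e * y) + y * r
       dist = solve 4 (λ y e a r -> y :* (e :* a :+ r) := a :* (e :* y) :+ y :* r) refl
       ex : quad e x ≡ x v * (p * x v + s) + (x v * s + q′)
       ex = trans (∑-punchIn n v (λ i -> x i * row e x i)) (cong₂ _+_ (cong (x v *_) (row-self x))
         (trans (∑-cong (allFin n) (λ i -> trans (cong (x (π i) *_) (row-other x i)) (dist (x (π i)) (e v (π i)) (x v) (row (minor v e) (x ∘ π) i))))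
           (trans (∑-+ (allFin n) _ _) (cong (_+ q′) (∑-*ˡ (allFin n) (x v) _)))))

     valid-map : ∀ l -> Valid (minor v e) l -> Valid e (map π l)
     valid-map l = APₚ.map⁺

     bounded-minor : ∀ {F} -> Bounded e F -> Bounded (minor v e) F
     bounded-minor h l vl = ≤r (sym (value-map π e l)) ⟫ h (map π l) (valid-map l vl)

     -- The vertex `v` can be put in front of every valid list of the others, and there it counts
     -- for at least 1.
     bounded-drop : ∀ {F} -> (∀ j -> e v (π j) + 1ℤ ≤ p) -> Bounded e F -> Bounded (minor v e) (F - 1ℤ)
     bounded-drop {F} hv h l vl = by (0≤-+ (0≤-- (h (v ∷ map π l) (Allₚ.map⁺ (All.universal hv l) ∷ valid-map l vl)))
         (0≤-- (Z.i≤i⊔j 1ℤ (p - ∑ (map π l) (e v))))) (trans (eq F (value (minor v e) l) (1ℤ ⊔ (p - ∑ (map π l) (e v))))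
           (cong (λ z -> value (minor v e) l + (F - ((1ℤ ⊔ (p - ∑ (map π l) (e v))) + z) + ((1ℤ ⊔ (p - ∑ (map π l) (e v))) - 1ℤ))) (sym (value-map π e l))))
       where
       eq : ∀ F a b -> F - 1ℤ ≡ a + (F - (b + a) + (b - 1ℤ))
       eq = solve 3 (λ F a b -> F :- :1 := a :+ (F :- (b :+ a) :+ (b :- :1))) refl

     zero-map : ∀ {X q F} -> Good (minor v e) F X q -> Good e F X q
     zero-map (inj₁ h) = inj₁ h
     zero-map {X} {q} (inj₂ (l , z , h)) = inj₂ (map π l , APₚ.map⁺ z , (h ⟫ ≤r (cong (λ k -> + k * q) (sym (Lₚ.length-map π l)))))

 -- The weighted Turán bound by descent and deletion of clusters

 module TuranMain (p : ℤ) (2≤p : + 2 ≤ p) (p≤4 : p ≤ + 4) where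
   open Turan p 2≤p p≤4

   -- A counterexample to both alternatives of `Good`, with a margin of `C` times the total to
   -- absorb rounding. `stationary` is the discrete first-order condition: moving one unit of weight
   -- from i to j changes the form by twice row j - row i + p - e i j.
   record Minimal {n} (e : Fin n -> Fin n -> ℤ) (F C : ℤ) (x : Fin n -> ℤ) : Set where
     field
       x≥0   : ∀ i -> 0ℤ ≤ x i
       M≥4   : + 4 ≤ tot x
       gap₁  : quad e x * (c1 * F - c0) + C * tot x ≤ p * p * c1 * (tot x * tot x)
       gap₂  : ∀ l -> Zero e l -> + length l * quad e x + C * tot x ≤ p * (tot x * tot x)
       stationary : ∀ i j -> 1ℤ ≤ x i -> row e x i ≤ row e x j + p

   -- The second alternative of `Good` asserts the existence of a clique, which the descent does not
   -- produce; hence the double negation. It is harmless, because the final inequality is decidable.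
   NearTuran : ℕ -> Set
   NearTuran n = ∀ (e : Fin n -> Fin n -> ℤ) -> IsDeficit e -> ∀ F -> Bounded e F ->
     ∀ x -> (∀ i -> 0ℤ ≤ x i) -> ¬ ¬ Good e F (tot x) (quad e x)

   module Step {n} (ih : NearTuran n) (e : Fin (suc n) -> Fin (suc n) -> ℤ) (def : IsDeficit e)
               (F : ℤ) (bd : Bounded e F) where
     open IsDeficit def
     open Quad e def

     N C K : ℤ
     N = + (5 ℕ.+ n)
     C = + 16 * N * c1 * (+ 8 * p + + 2 * p * p) + 1ℤ
     K = c1 * F - c0

     0≤C-1 : 0ℤ ≤ + 16 * N * c1 * (+ 8 * p + + 2 * p * p)
     0≤C-1 = 0≤-* (0≤-* (0≤-* {+ 16} {N} 0≤ℕ 0≤ℕ) 0≤c1) (0≤-+ (0≤-* {+ 8} 0≤ℕ 0≤p) (0≤-* (0≤-* {+ 2} 0≤ℕ 0≤p) 0≤p))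

     1≤C : 1ℤ ≤ C
     1≤C = by 0≤C-1 (Z.+-comm (+ 16 * N * c1 * (+ 8 * p + + 2 * p * p)) 1ℤ)

     C-large : p * p * c1 * N + 1ℤ ≤ C
     C-large = by (0≤-* (0≤-* {N} 0≤ℕ 0≤c1) (0≤-+ (0≤-* {+ 128} 0≤ℕ 0≤p) (0≤-* (0≤-* {+ 31} 0≤ℕ 0≤p) 0≤p))) (eq p N c1)
       where
       eq : ∀ p N c1 -> + 16 * N * c1 * (+ 8 * p + + 2 * p * p) + 1ℤ ≡ p * p * c1 * N + 1ℤ + N * c1 * (+ 128 * p + + 31 * p * p)
       eq = solve 3 (λ p N c1 -> con (+ 16) :* N :* c1 :* (con (+ 8) :* p :+ :2 :* p :* p) :+ :1 := p :* p :* c1 :* N :+ :1 :+ N :* c1 :* (con (+ 128) :* p :+ con (+ 31) :* p :* p)) refl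

     p≤F : p ≤ F
     p≤F = ≤r (sym (Z.+-identityʳ p)) ⟫ Z.i≤j⊔i 1ℤ (p - 0ℤ) ⟫ ≤r (sym (Z.+-identityʳ _)) ⟫ bd (F.zero ∷ []) ([] ∷ [])

     0≤K : 0ℤ ≤ K
     0≤K = subst (0ℤ ≤_) (eq p F) (0≤-+ (0≤-* 0≤c1 (0≤-- p≤F)) (0≤-+ (0≤-* (0≤-* {+ 2} 0≤ℕ 0≤p) (0≤-- 1≤p)) (0≤ℕ {1})))
       where
       eq : ∀ p F -> (+ 2 * p - 1ℤ) * (F - p) + (+ 2 * p * (p - 1ℤ) + 1ℤ) ≡ (+ 2 * p - 1ℤ) * F - (p - 1ℤ)
       eq = solve 2 (λ p F -> (:2 :* p :- :1) :* (F :- p) :+ (:2 :* p :* (p :- :1) :+ :1) := (:2 :* p :- :1) :* F :- (p :- :1)) refl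

     crit : ∀ x -> Minimal e F C x -> ⊥
     crit x mn = main
       where
       open Minimal mn
       M q : ℤ
       M = tot x
       q = quad e x
       1≤M : 1ℤ ≤ M
       1≤M = +≤+ (ℕ.s≤s ℕ.z≤n) ⟫ M≥4
       0≤M = 1≤⇒0≤ 1≤M
       0≤q : 0ℤ ≤ q
       0≤q = 0≤quad x x≥0

       -- A configuration that is no heavier than x cannot satisfy the conclusion, because of the gap.
       kill : ∀ {X q′} -> X ≡ M -> q′ ≤ q -> ¬ Good e F X q′
       kill refl h (inj₁ g) = ≥1⇒≰ (by (0≤-- (1≤-* 1≤C 1≤M)) (eq (q * K) (C * M))) (gap₁ ⟫ g ⟫ ≤-*ʳ K 0≤K h)
         where
         eq : ∀ a b -> a + b ≡ a + 1ℤ + (b - 1ℤ)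
         eq = solve 2 (λ a b -> a :+ b := a :+ :1 :+ (b :- :1)) refl
       kill refl h (inj₂ (l , z , g)) = ≥1⇒≰ (by (0≤-- (1≤-* 1≤C 1≤M)) (eq (+ length l * q) (C * M))) (gap₂ l z ⟫ g ⟫ ≤-*ˡ (+ length l) 0≤ℕ h)
         where
         eq : ∀ a b -> a + b ≡ a + 1ℤ + (b - 1ℤ)
         eq = solve 2 (λ a b -> a :+ b := a :+ :1 :+ (b :- :1)) refl

       vanish : ∀ v -> x v ≤ 0ℤ -> ⊥
       vanish v h = ih (minor v e) minor-deficit F (bounded-minor bd) (x ∘ π) (λ i -> x≥0 (π i))
           (λ g -> kill {tot (x ∘ π)} {quad (minor v e) (x ∘ π)} tot≡ (≤r quad≡) (zero-map {tot (x ∘ π)} {quad (minor v e) (x ∘ π)} {F} g))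
         where
         open Minor e def v
         x≡0 : x v ≡ 0ℤ
         x≡0 = Z.≤-antisym h (x≥0 v)
         tot≡ : tot (x ∘ π) ≡ M
         tot≡ = trans (tot-minor x) (trans (cong (λ z -> M - z) x≡0) (Z.+-identityʳ M))
         eq : ∀ q r p -> q - + 2 * 0ℤ * r + p * 0ℤ * 0ℤ ≡ q
         eq = solve 3 (λ q r p -> q :- :2 :* :0 :* r :+ p :* :0 :* :0 := q) refl
         quad≡ : quad (minor v e) (x ∘ π) ≡ q
         quad≡ = trans (quad-minor x) (trans (cong (λ z -> q - + 2 * z * row e x v + p * z * z) x≡0) (eq q (row e x v) p))

       -- Zykov symmetrisation: between the two clusters there is no density, so handing the whole
       -- weight of one to the one with the smaller row does not raise the form, and a cluster
       -- disappears.
       merge : ∀ v w -> p ≤ e v (punchIn v w) -> row e x (punchIn v w) ≤ row e x v -> ⊥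
       merge v w pe h = ih (minor v e) minor-deficit F (bounded-minor bd) y
           (λ i -> 0≤-+ (x≥0 (π i)) (0≤-* (x≥0 v) (0≤δ w i)))
           (λ g -> kill {tot y} {quad (minor v e) y} tot≡ quad≤ (zero-map {tot y} {quad (minor v e) y} {F} g))
         where
         open Minor e def v
         y : Fin n -> ℤ
         y i = x (π i) + x v * δ w i
         tot≡ : tot y ≡ M
         tot≡ = trans (∑-+ (allFin n) _ _) (trans (cong₂ _+_ (tot-minor x) (∑-δ (λ _ -> x v) w)) (eq M (x v)))
           where
           eq : ∀ a b -> a - b + b ≡ a
           eq = solve 2 (λ a b -> a :- b :+ b := a) refl
         e≡p : e v (π w) ≡ p
         e≡p = Z.≤-antisym (e≤p v (π w)) pe
         r-eq : row (minor v e) (x ∘ π) w ≡ row e x (π w) - p * x v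
         r-eq = trans (eq (p * x v) _) (cong (_- p * x v) (sym (trans (row-other x w) (cong (λ z -> z * x v + row (minor v e) (x ∘ π) w) e≡p))))
           where
           eq : ∀ a b -> b ≡ a + b - a
           eq = solve 2 (λ a b -> b := a :+ b :- a) refl
         quad≤ : quad (minor v e) y ≤ q
         quad≤ = by (0≤-* (0≤-* {+ 2} 0≤ℕ (x≥0 v)) (0≤-- h))
           (trans (eq q (x v) (row e x v) (row e x (π w)) p) (cong (_+ + 2 * x v * (row e x v - row e x (π w)))
             (sym (trans (Quad.quad-perturb (minor v e) minor-deficit (x ∘ π) (x v) w)
               (cong₂ (λ a b -> a + + 2 * x v * b + x v * x v * p) (quad-minor x) r-eq)))))
           where
           eq : ∀ q a rv rj p -> q ≡ (q - + 2 * a * rv + p * a * a) + + 2 * a * (rj - p * a) + a * a * p + + 2 * a * (rv - rj)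
           eq = solve 5 (λ q a rv rj p -> q := (q :- :2 :* a :* rv :+ p :* a :* a) :+ :2 :* a :* (rj :- p :* a) :+ a :* a :* p :+ :2 :* a :* (rv :- rj)) refl

       module Regular (x≥1 : ∀ i -> 1ℤ ≤ x i) (e<p : ∀ v j -> e v (punchIn v j) + 1ℤ ≤ p) where

         -- The stationarity condition, averaged over w with the weights `x w`; all rows agree with
         -- q/M up to p.
         row-upper : ∀ v -> M * row e x v ≤ q + p * M
         row-upper v = ≤r (sym (∑-*ʳ (allFin (suc n)) (row e x v) x))
           ⟫ ∑-mono (allFin (suc n)) (λ w -> ≤-*ˡ (x w) (x≥0 w) (stationary v w (x≥1 v)) ⟫ ≤r (Z.*-distribˡ-+ (x w) (row e x w) p))
           ⟫ ≤r (trans (∑-+ (allFin (suc n)) (λ w -> x w * row e x w) (λ w -> x w * p)) (cong (λ z -> q + z) (trans (∑-*ʳ (allFin (suc n)) p x) (Z.*-comm M p))))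

         row-lower : ∀ v -> q ≤ M * row e x v + p * M
         row-lower v = ∑-mono (allFin (suc n)) (λ w -> ≤-*ˡ (x w) (x≥0 w) (stationary w v (x≥1 w)) ⟫ ≤r (Z.*-distribˡ-+ (x w) (row e x v) p))
           ⟫ ≤r (trans (∑-+ (allFin (suc n)) (λ w -> x w * row e x v) (λ w -> x w * p)) (cong₂ _+_ (∑-*ʳ (allFin (suc n)) (row e x v) x) (trans (∑-*ʳ (allFin (suc n)) p x) (Z.*-comm M p))))

         light : ∀ v -> + 2 * p * M * x v ≤ q + + 2 * p * M -> ⊥
         light v h2 = ih (minor v e) minor-deficit (F - 1ℤ) (bounded-drop {F} (e<p v) bd) (x ∘ π) (λ i -> x≥0 (π i)) go
           where
           open Minor e def v
           q′ : ℤ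
           q′ = quad (minor v e) (x ∘ π)
           0≤q′ : 0ℤ ≤ q′
           0≤q′ = Quad.0≤quad (minor v e) minor-deficit (x ∘ π) (λ i -> x≥0 (π i))
           h6 : p * ((M - x v) * (M - x v)) ≤ N * q′
           h6 = ≤r (cong (λ z -> p * (z * z)) (sym (tot-minor x))) ⟫ Quad.quad-lower (minor v e) minor-deficit (x ∘ π) (λ i -> x≥0 (π i))
              ⟫ ≤-*ʳ q′ 0≤q′ (+≤+ (N.m≤n+m n 5))
           shrink : p * p * c1 * ((M - x v) * (M - x v)) ≤ q′ * (K - c1) -> ⊥
           shrink h1 = drop-arith p M q (x v) (row e x v) q′ K c1 C N 0≤c1 1≤p p≤4 M≥4 0≤q 0≤q′ (x≥0 v)
              (∑-∈≤ (allFin (suc n)) x≥0 (∈ₚ.∈-allFin v)) 0≤ℕ h1 (quad-minor x) h2 (row-lower v) (quad-upper x x≥0) gap₁ h6 refl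
           go : Good (minor v e) (F - 1ℤ) (tot (x ∘ π)) q′ -> ⊥
           go (inj₁ g) = shrink (≤r (cong (λ z -> p * p * c1 * (z * z)) (sym (tot-minor x))) ⟫ g ⟫ ≤r (cong (q′ *_) (eq c1 F c0)))
             where
             eq : ∀ c F d -> c * (F - 1ℤ) - d ≡ c * F - d - c
             eq = solve 3 (λ c F d -> c :* (F :- :1) :- d := c :* F :- d :- c) refl
           go (inj₂ (l , z , gd)) with Fₚ.any? (λ w -> ¬? (Any.any? (w Fₚ.≟_) l))
           -- The clique `l` misses w, so v, w and `l` together have value at least p|l| + 2. Since
           -- p - 1 ≤ c1, the clique alternative is then no stronger than the main alternative for F
           -- - 1.
           ... | yes (w , w∉l) = shrink (≤r (cong (λ z -> p * p * c1 * (z * z)) (sym (tot-minor x))) ⟫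
                   ≤r (eq₁ p c1 (tot (x ∘ π) * tot (x ∘ π))) ⟫ ≤-*ˡ (p * c1) (0≤-* 0≤p 0≤c1) gd ⟫ ≤r (eq₂ p c1 (+ length l) q′) ⟫ ≤-*ˡ q′ 0≤q′ bound)
             where
             eq₁ : ∀ p c a -> p * p * c * a ≡ p * c * (p * a)
             eq₁ = solve 3 (λ p c a -> p :* p :* c :* a := p :* c :* (p :* a)) refl
             eq₂ : ∀ p c l q -> p * c * (l * q) ≡ q * (c * (p * l))
             eq₂ = solve 4 (λ p c l q -> p :* c :* (l :* q) := q :* (c :* (p :* l))) refl
             L₀ : List (Fin (suc n))
             L₀ = v ∷ π w ∷ map π l
             valid-l : Valid (minor v e) l
             valid-l = AllPairs.map (λ {i} {j} h -> ≤r (cong (_+ 1ℤ) h) ⟫ 1≤p) z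
             allw : All (λ j -> e (π w) (π j) + 1ℤ ≤ p) l
             allw = All.tabulate (λ {j} j∈l -> offdiag w j (λ q -> w∉l (subst (_∈ l) (sym q) j∈l)))
               where
               offdiag : ∀ i j -> i ≢ j -> e (π i) (π j) + 1ℤ ≤ p
               offdiag i j i≢j = subst (λ k -> e (π i) k + 1ℤ ≤ p) (Fₚ.punchIn-punchOut ne) (e<p (π i) (F.punchOut ne))
                 where ne = λ q -> i≢j (Fₚ.punchIn-injective v i j q)
             valid₀ : Valid e L₀
             valid₀ = (e<p v w ∷ Allₚ.map⁺ (All.universal (e<p v) l)) ∷ (Allₚ.map⁺ allw ∷ valid-map l valid-l)
             F≥ : p * + length l + + 2 ≤ F
             F≥ = by (0≤-+ (0≤-+ (0≤-+ (0≤-- (bd L₀ valid₀)) (0≤-- (zero-value (minor v e) l z)))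
                   (0≤-- (Z.i≤i⊔j 1ℤ (p - ∑ (π w ∷ map π l) (e v))))) (0≤-- (Z.i≤i⊔j 1ℤ (p - ∑ (map π l) (e (π w))))))
                   (trans (eq F (p * + length l) (value (minor v e) l) (1ℤ ⊔ (p - ∑ (π w ∷ map π l) (e v))) (1ℤ ⊔ (p - ∑ (map π l) (e (π w)))))
                      (cong (λ y -> p * + length l + + 2 + (F - (A + (B′ + y)) + (value (minor v e) l - p * + length l) + (A - 1ℤ) + (B′ - 1ℤ))) (sym (value-map π e l))))
               where
               A B′ : ℤ
               A = 1ℤ ⊔ (p - ∑ (π w ∷ map π l) (e v))
               B′ = 1ℤ ⊔ (p - ∑ (map π l) (e (π w)))
               eq : ∀ F a b c d -> F ≡ a + + 2 + (F - (c + (d + b)) + (b - a) + (c - 1ℤ) + (d - 1ℤ))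
               eq = solve 5 (λ F a b c d -> F := a :+ :2 :+ (F :- (c :+ (d :+ b)) :+ (b :- a) :+ (c :- :1) :+ (d :- :1))) refl
             bound : c1 * (p * + length l) ≤ K - c1
             bound = by (0≤-+ (0≤-* 0≤c1 (0≤-- F≥)) 0≤p) (eq p (p * + length l) F)
               where
               eq : ∀ p a F -> (+ 2 * p - 1ℤ) * F - (p - 1ℤ) - (+ 2 * p - 1ℤ) ≡ (+ 2 * p - 1ℤ) * a + ((+ 2 * p - 1ℤ) * (F - (a + + 2)) + p)
               eq = solve 3 (λ p a F -> (:2 :* p :- :1) :* F :- (p :- :1) :- (:2 :* p :- :1) := (:2 :* p :- :1) :* a :+ ((:2 :* p :- :1) :* (F :- (a :+ :2)) :+ p)) refl
           ... | no none = special-arith p M q (x v) E g (+ n) K c1 C 0≤q (x≥0 v) 1≤M (Z.i≤i⊔j 1ℤ (p - E)) 0≤ℕ 1≤p 0≤c1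
                   (Z.i≤j⊔i 1ℤ (p - E)) h2 h3 gap₁ refl bound C-ok
             where
             E g : ℤ
             E = ∑ (allFin n) (e v ∘ π)
             g = 1ℤ ⊔ (p - E)
             pair-zero : ∀ i j -> i ≢ j -> minor v e i j ≡ 0ℤ
             pair-zero i j i≢j = go-l l z (member i) (member j)
               where
               member : ∀ w -> w ∈ l
               member w with Any.any? (w Fₚ.≟_) l
               ... | yes m = m
               ... | no m = ⊥-elim (none (w , m))
               go-l : ∀ l -> Zero (minor v e) l -> i ∈ l -> j ∈ l -> minor v e i j ≡ 0ℤ
               go-l (k ∷ l) (h ∷ hs) (here refl) (here refl) = ⊥-elim (i≢j refl)
               go-l (k ∷ l) (h ∷ hs) (here refl) (there mj) = All.lookup h mj
               go-l (k ∷ l) (h ∷ hs) (there mi) (here refl) = trans (e-sym (π i) (π j)) (All.lookup h mi)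
               go-l (k ∷ l) (h ∷ hs) (there mi) (there mj) = go-l l hs mi mj
             zero-all : Zero (minor v e) (allFin n)
             zero-all = APₚ.tabulate⁺ (λ {i} {j} -> pair-zero i j)
             row-flat : ∀ i -> row (minor v e) (x ∘ π) i ≡ p * x (π i)
             row-flat i = trans (∑-cong (allFin n) step) (∑-δ (λ j -> p * x (π j)) i)
               where
               step : ∀ j -> minor v e i j * x (π j) ≡ p * x (π j) * δ i j
               step j with i Fₚ.≟ j
               ... | yes refl = trans (cong (_* x (π i)) (e-diag (π i))) (sym (Z.*-identityʳ (p * x (π i))))
               ... | no i≢j = trans (cong (_* x (π j)) (pair-zero i j i≢j)) (trans (Z.*-zeroˡ (x (π j))) (sym (Z.*-zeroʳ (p * x (π j)))))
             rows : ∑ (allFin n) (λ i -> row e x (π i)) ≡ E * x v + p * (M - x v)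
             rows = trans (∑-cong (allFin n) (λ i -> trans (row-other x i) (cong (λ y -> e v (π i) * x v + y) (row-flat i))))
                (trans (∑-+ (allFin n) _ _) (cong₂ _+_ (∑-*ʳ (allFin n) (x v) (e v ∘ π)) (trans (∑-*ˡ (allFin n) p (x ∘ π)) (cong (p *_) (tot-minor x)))))
             h3 : p * M * M ≤ + n * (q + p * M) + (p - E) * x v * M
             h3 = by (0≤-- (≤r (sym (∑-*ˡ (allFin n) M (λ i -> row e x (π i)))) ⟫ ∑-mono (allFin n) (λ i -> row-upper (π i))
                     ⟫ ≤r (trans (∑-const (allFin n) (q + p * M)) (cong (λ k -> + k * (q + p * M)) (Lₚ.length-tabulate (λ (i : Fin n) -> i))))))
                   (trans (eq p M (x v) E (+ n * (q + p * M))) (cong (λ y -> p * M * M + (+ n * (q + p * M) - M * y)) (sym rows)))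
               where
               eq : ∀ p M x E a -> a + (p - E) * x * M ≡ p * M * M + (a - M * (E * x + p * (M - x)))
               eq = solve 5 (λ p M x E a -> a :+ (p :- E) :* x :* M := p :* M :* M :+ (a :- M :* (E :* x :+ p :* (M :- x)))) refl
             bound : c1 * (p * + n + g) - c0 ≤ K
             bound = by (0≤-+ (0≤-* 0≤c1 (0≤-- (bd (v ∷ map π (allFin n)) (Allₚ.map⁺ (All.universal (e<p v) (allFin n)) ∷ valid-map (allFin n) (AllPairs.map (λ h -> ≤r (cong (_+ 1ℤ) h) ⟫ 1≤p) zero-all)))))
                        (0≤-* 0≤c1 (0≤-- (zero-value (minor v e) (allFin n) zero-all))))
                     (trans (eq c1 c0 F g (p * + n) (value (minor v e) (allFin n)))
                       (cong₂ (λ y k -> c1 * (p * + n + g) - c0 + (c1 * (F - y) + c1 * (value (minor v e) (allFin n) - p * + k)))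
                         (sym (cong₂ (λ a b -> (1ℤ ⊔ (p - a)) + b) (∑-map π (allFin n) (e v)) (value-map π e (allFin n)))) (sym (Lₚ.length-tabulate (λ (i : Fin n) -> i)))))
               where
               eq : ∀ c d F g a b -> c * F - d ≡ c * (a + g) - d + (c * (F - (g + b)) + c * (b - a))
               eq = solve 6 (λ c d F g a b -> c :* F :- d := c :* (a :+ g) :- d :+ (c :* (F :- (g :+ b)) :+ c :* (b :- a))) refl
             C-ok : p * p * c1 * (+ n + g) + 1ℤ ≤ C
             C-ok = Z.+-monoˡ-≤ 1ℤ (≤-*ˡ (p * p * c1) (0≤-* (0≤-* 0≤p 0≤p) 0≤c1) (Z.+-monoʳ-≤ (+ n) g≤5 ⟫ ≤r (cong +_ (N.+-comm n 5)))) ⟫ C-large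
               where
               g≤5 : g ≤ + 5
               g≤5 = Z.⊔-lub (+≤+ (ℕ.s≤s ℕ.z≤n)) (by (0≤-+ (0≤-+ (0≤-- p≤4) (∑-nonneg (allFin n) (λ j -> e≥0 v (π j)))) (0≤ℕ {1})) (eq p E))
                 where
                 eq : ∀ p E -> + 5 ≡ p - E + (+ 4 - p + E + 1ℤ)
                 eq = solve 2 (λ p E -> con (+ 5) := p :- E :+ (:4 :- p :+ E :+ :1)) refl

         ε : Fin (suc n) -> ℤ
         ε i = ∑ (allFin (suc n)) (e i) - p

         ε-minor : ∀ v -> ε v ≡ ∑ (allFin n) (λ j -> e v (punchIn v j))
         ε-minor v = trans (cong (_- p) (trans (∑-punchIn n v (e v)) (cong (_+ ∑ (allFin n) (λ j -> e v (punchIn v j))) (e-diag v)))) (eq p _)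
           where
           eq : ∀ a b -> a + b - a ≡ b
           eq = solve 2 (λ a b -> a :+ b :- a := b) refl

         e≤ε : ∀ v j -> e v (punchIn v j) ≤ ε v
         e≤ε v j = ∑-∈≤ (allFin n) (λ k -> e≥0 v (punchIn v k)) (∈ₚ.∈-allFin j) ⟫ ≤r (sym (ε-minor v))

         e≤ε′ : ∀ v j -> e v (punchIn v j) ≤ ε (punchIn v j)
         e≤ε′ v j = ≤r (trans (e-sym v (punchIn v j)) (cong (e (punchIn v j)) (sym (Fₚ.punchIn-punchOut ne))))
             ⟫ e≤ε (punchIn v j) (F.punchOut ne)
           where
           ne : punchIn v j ≢ v
           ne = Fₚ.punchInᵢ≢i v j

         0≤ε : ∀ i -> 0ℤ ≤ ε i
         0≤ε i = ∑-nonneg (allFin n) (λ k -> e≥0 i (punchIn i k)) ⟫ ≤r (sym (ε-minor i))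

         heavy : (∀ v -> q + + 2 * p * M + 1ℤ ≤ + 2 * p * M * x v) -> ∀ v -> 1ℤ ≤ ε v -> (∀ j -> 1ℤ ≤ ε j -> x v ≤ x j) -> ⊥
         heavy hx v 1≤a xmin = heavy-arith p M q (x v) (row e x v) (ε v) S b (+ suc n) F K c1 C 0≤q 1≤M 2≤p 0≤c1 0≤ℕ 1≤a
             (hx v) (row-lower v) (row-upper v) h3 h4 h5 h6 gap₁ refl refl C-ok
           where
           open Minor e def v using (π; row-self)
           w : Fin (suc n) -> ℤ
           w i = + 2 * p * M * x i - q
           S b : ℤ
           S = ∑ (allFin (suc n)) (λ i -> ε i * w i)
           b = ∑ (allFin (suc n)) ε
           0≤w : ∀ i -> 0ℤ ≤ w i
           0≤w i = subst (0ℤ ≤_) (eq q (+ 2 * p * M) (+ 2 * p * M * x i)) (0≤-+ (0≤-- (hx i)) (0≤-+ (0≤-* (0≤-* {+ 2} 0≤ℕ 0≤p) 0≤M) (0≤ℕ {1})))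
             where
             eq : ∀ q a b -> b - (q + a + 1ℤ) + (a + 1ℤ) ≡ b - q
             eq = solve 3 (λ q a b -> b :- (q :+ a :+ :1) :+ (a :+ :1) := b :- q) refl
           h3 : p * x v + ε v * x v ≤ row e x v
           h3 = Z.+-monoʳ-≤ (p * x v) (≤r (trans (cong (_* x v) (ε-minor v)) (sym (∑-*ʳ (allFin n) (x v) (λ j -> e v (π j)))))
                  ⟫ ∑-mono (allFin n) term) ⟫ ≤r (sym (row-self x))
             where
             -- Only clusters with a positive deficit towards v contribute. These carry a deficit
             -- themselves, so the minimality of `x v` applies to them.
             term : ∀ j -> e v (π j) * x v ≤ e v (π j) * x (π j)
             term j with 1≤⊎≤0 (e v (π j))
             ... | inj₁ h = ≤-*ˡ (e v (π j)) (e≥0 v (π j)) (xmin (π j) (h ⟫ e≤ε′ v j))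
             ... | inj₂ h = ≤r (trans (cong (_* x v) z) (trans (Z.*-zeroˡ (x v)) (sym (trans (cong (_* x (π j)) z) (Z.*-zeroˡ (x (π j)))))))
               where z = Z.≤-antisym h (e≥0 v (π j))
           h4 : + 2 * p * M * row e x v - + 2 * (p - ε v) * (p * M * x v) - + 2 * ε v * q ≤ S
           h4 = ≤r (trans (cong (λ r -> + 2 * p * M * r - + 2 * (p - ε v) * (p * M * x v) - + 2 * ε v * q) (row-self x))
                  (trans (eq p M (x v) (ε v) q s) (cong (λ y -> ε v * w v + y) (sym sum≡))))
                ⟫ Z.+-monoʳ-≤ (ε v * w v) (∑-mono (allFin n) (λ j -> ≤-*ʳ (w (π j)) (0≤w (π j)) (e≤ε′ v j))) ⟫ ≤r (sym (∑-punchIn n v (λ i -> ε i * w i)))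
             where
             s : ℤ
             s = ∑ (allFin n) (λ j -> e v (π j) * x (π j))
             dist : ∀ e a x q -> e * (a * x - q) ≡ a * (e * x) - e * q
             dist = solve 4 (λ e a x q -> e :* (a :* x :- q) := a :* (e :* x) :- e :* q) refl
             sum≡ : ∑ (allFin n) (λ j -> e v (π j) * w (π j)) ≡ + 2 * p * M * s - ε v * q
             sum≡ = trans (∑-cong (allFin n) (λ j -> dist (e v (π j)) (+ 2 * p * M) (x (π j)) q))
               (trans (∑-- (allFin n) _ _) (cong₂ _-_ (∑-*ˡ (allFin n) (+ 2 * p * M) _) (trans (∑-*ʳ (allFin n) q _) (cong (_* q) (sym (ε-minor v))))))
             eq : ∀ p M x a q s -> + 2 * p * M * (p * x + s) - + 2 * (p - a) * (p * M * x) - + 2 * a * q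
                 ≡ a * (+ 2 * p * M * x - q) + (+ 2 * p * M * s - a * q)
             eq = solve 6 (λ p M x a q s -> :2 :* p :* M :* (p :* x :+ s) :- :2 :* (p :- a) :* (p :* M :* x) :- :2 :* a :* q := a :* (:2 :* p :* M :* x :- q) :+ (:2 :* p :* M :* s :- a :* q)) refl
           b≡ : b ≡ ∑ (allFin (suc n)) (λ i -> ∑ (allFin (suc n)) (e i)) - + suc n * p
           b≡ = trans (∑-- (allFin (suc n)) (λ i -> ∑ (allFin (suc n)) (e i)) (λ _ -> p)) (cong (λ y -> ∑ (allFin (suc n)) (λ i -> ∑ (allFin (suc n)) (e i)) - y)
               (trans (∑-const (allFin (suc n)) p) (cong (λ k -> + k * p) (Lₚ.length-tabulate (λ (i : Fin (suc n)) -> i)))))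
           valid-all : Valid e (allFin (suc n))
           valid-all = APₚ.tabulate⁺ (λ {i} {j} i≢j -> subst (λ k -> e i k + 1ℤ ≤ p) (Fₚ.punchIn-punchOut i≢j) (e<p i (F.punchOut i≢j)))
           h5 : + 2 * (p * + suc n) - b ≤ + 2 * F
           h5 = ≤r (trans (cong (λ y -> + 2 * (p * + suc n) - y) b≡) (cong (λ k -> + 2 * (p * + k) - (∑ (allFin (suc n)) (λ i -> ∑ (allFin (suc n)) (e i)) - + k * p)) (sym (Lₚ.length-tabulate (λ (i : Fin (suc n)) -> i)))))
              ⟫ value-lower e e-sym e-diag (allFin (suc n)) ⟫ ≤-*ˡ (+ 2) 0≤ℕ (bd (allFin (suc n)) valid-all)
           h6 : S + + 2 * p * p * (M * M) - + 2 * + suc n * p * p * M ≤ + 2 * p * + suc n * q - b * q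
           h6 = by (0≤-* (0≤-* {+ 2} 0≤ℕ 0≤p) (0≤-- rows))
               (trans (eq p M (+ suc n) q b Σεx) (cong₂ (λ y z -> y + + 2 * p * p * (M * M) - + 2 * + suc n * p * p * M + + 2 * p * (+ suc n * (q + p * M) - z)) (sym S≡) refl))
             where
             Σεx : ℤ
             Σεx = ∑ (allFin (suc n)) (λ i -> ε i * x i)
             rows : M * (p * M + Σεx) ≤ + suc n * (q + p * M)
             rows = ≤r (cong (M *_) (sym rsum)) ⟫ ≤r (sym (∑-*ˡ (allFin (suc n)) M (row e x))) ⟫ ∑-mono (allFin (suc n)) row-upper
                ⟫ ≤r (trans (∑-const (allFin (suc n)) (q + p * M)) (cong (λ k -> + k * (q + p * M)) (Lₚ.length-tabulate (λ (i : Fin (suc n)) -> i))))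
               where
               dist : ∀ s x p -> s * x ≡ p * x + (s - p) * x
               dist = solve 3 (λ s x p -> s :* x := p :* x :+ (s :- p) :* x) refl
               rsum : ∑ (allFin (suc n)) (row e x) ≡ p * M + Σεx
               rsum = trans (∑-swap (allFin (suc n)) (allFin (suc n)) (λ i j -> e i j * x j))
                 (trans (∑-cong (allFin (suc n)) (λ j -> trans (∑-*ʳ (allFin (suc n)) (x j) (λ i -> e i j))
                      (trans (cong (_* x j) (∑-cong (allFin (suc n)) (λ i -> e-sym i j))) (dist (∑ (allFin (suc n)) (e j)) (x j) p))))
                   (trans (∑-+ (allFin (suc n)) (λ j -> p * x j) (λ j -> ε j * x j)) (cong (_+ Σεx) (∑-*ˡ (allFin (suc n)) p x))))
             dist : ∀ e a x q -> e * (a * x - q) ≡ a * (e * x) - e * q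
             dist = solve 4 (λ e a x q -> e :* (a :* x :- q) := a :* (e :* x) :- e :* q) refl
             S≡ : S ≡ + 2 * p * M * Σεx - b * q
             S≡ = trans (∑-cong (allFin (suc n)) (λ i -> dist (ε i) (+ 2 * p * M) (x i) q))
               (trans (∑-- (allFin (suc n)) (λ i -> + 2 * p * M * (ε i * x i)) (λ i -> ε i * q)) (cong₂ _-_ (∑-*ˡ (allFin (suc n)) (+ 2 * p * M) (λ i -> ε i * x i)) (∑-*ʳ (allFin (suc n)) q ε)))
             eq : ∀ p M n q b s -> + 2 * p * n * q - b * q ≡ (+ 2 * p * M * s - b * q) + + 2 * p * p * (M * M) - + 2 * n * p * p * M
                 + + 2 * p * (n * (q + p * M) - M * (p * M + s))
             eq = solve 6 (λ p M n q b s -> :2 :* p :* n :* q :- b :* q := (:2 :* p :* M :* s :- b :* q) :+ :2 :* p :* p :* (M :* M) :- :2 :* n :* p :* p :* M :+ :2 :* p :* (n :* (q :+ p :* M) :- M :* (p :* M :+ s))) refl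
           C-ok : p * p * c1 * (+ suc n + + 4) + 1ℤ ≤ C
           C-ok = ≤r (cong (λ k -> p * p * c1 * + k + 1ℤ) (N.+-comm (suc n) 4)) ⟫ C-large

         regular : ⊥
         regular with Fₚ.any? (λ v -> (+ 2 * p * M * x v) Z.≤? (q + + 2 * p * M))
         ... | yes (v , h) = light v h
         ... | no none with Fₚ.any? (λ v -> 1ℤ Z.≤? ε v)
         ...   | yes (v , h) = lightest x x≥0 (λ v -> 1ℤ ≤ ε v) (heavy (λ v -> ≰⇒≥1 (λ h -> none (v , h)))) v h
         ...   | no flat = kill {M} {q} refl Z.≤-refl (inj₂ (allFin (suc n) , zero-all , quad-lower x x≥0 ⟫ ≤r (cong (λ k -> + k * q) (sym (Lₚ.length-tabulate (λ (i : Fin (suc n)) -> i))))))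
           where
           pair-zero : ∀ i j -> i ≢ j -> e i j ≡ 0ℤ
           pair-zero i j i≢j = Z.≤-antisym (≤r (cong (e i) (sym (Fₚ.punchIn-punchOut i≢j))) ⟫ e≤ε i (F.punchOut i≢j) ⟫ ε≤0) (e≥0 i j)
             where
             ε≤0 : ε i ≤ 0ℤ
             ε≤0 with 1≤⊎≤0 (ε i)
             ... | inj₁ h = ⊥-elim (flat (i , h))
             ... | inj₂ h = h
           zero-all : Zero e (allFin (suc n))
           zero-all = APₚ.tabulate⁺ (λ {i} {j} -> pair-zero i j)

       main : ⊥
       main with Fₚ.any? (λ i -> x i Z.≤? 0ℤ)
       ... | yes (v , h) = vanish v h
       ... | no pos with Fₚ.any? (λ v -> Fₚ.any? (λ w -> p Z.≤? e v (punchIn v w)))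
       ...   | no reg = Regular.regular (λ i -> ≰⇒≥1 (λ h -> pos (i , h))) (λ v j -> ≰⇒≥1 (λ h -> reg (v , j , h)))
       ...   | yes (v , w , h) with row e x (punchIn v w) Z.≤? row e x v
       ...     | yes r≤ = merge v w h r≤
       ...     | no r> = merge v′ (F.punchOut ne)
                 (h ⟫ ≤r (trans (e-sym v v′) (cong (e v′) (sym (Fₚ.punchIn-punchOut ne)))))
                 (subst (λ k -> row e x k ≤ row e x v′) (sym (Fₚ.punchIn-punchOut ne)) (Z.<⇒≤ (Z.≰⇒> r>)))
         where
         v′ : Fin (suc n)
         v′ = punchIn v w
         ne : v′ ≢ v
         ne = Fₚ.punchInᵢ≢i v w

     -- As long as moving one unit of weight lowers the form, it is moved; `b` bounds the value of
     -- the form and hence the number of moves. The total is unchanged and the form decreases, so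
     -- both gaps survive.
     descend : ∀ b x -> (∀ i -> 0ℤ ≤ x i) -> + 4 ≤ tot x ->
       quad e x * K + C * tot x ≤ p * p * c1 * (tot x * tot x) ->
       (∀ l -> Zero e l -> + length l * quad e x + C * tot x ≤ p * (tot x * tot x)) ->
       quad e x ≤ + b -> ⊥
     descend b x x≥0 M≥4 g₁ g₂ qb = crit x (record { x≥0 = x≥0 ; M≥4 = M≥4 ; gap₁ = g₁ ; gap₂ = g₂ ; stationary = stat })
       where
       stat : ∀ i j -> 1ℤ ≤ x i -> row e x i ≤ row e x j + p
       stat i j 1≤xi = by (0≤-+ (e≥0 i j) (half {quad e x} {row e x j - row e x i + (p - e i j)} (subst (λ z -> 0ℤ ≤ z - quad e x) quad-y (0≤-- q≤qy)))) (eq₂ (row e x i) (row e x j) (e i j) p)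
         where
         y z : Fin (suc n) -> ℤ
         z k = x k + (- 1ℤ) * δ i k
         y k = z k + 1ℤ * δ j k
         eq₂ : ∀ ri rj e p -> rj + p ≡ ri + (e + (rj - ri + (p - e)))
         eq₂ = solve 4 (λ ri rj e p -> rj :+ p := ri :+ (e :+ (rj :- ri :+ (p :- e)))) refl
         0≤y : ∀ k -> 0ℤ ≤ y k
         0≤y k = 0≤-+ 0≤z (0≤-* {1ℤ} 0≤ℕ (0≤δ j k))
           where
           0≤z : 0ℤ ≤ z k
           0≤z with i Fₚ.≟ k
           ... | yes refl = 0≤-- 1≤xi
           ... | no _ = 0≤-+ (x≥0 k) (0≤ℕ {0})
         tot-y : tot y ≡ tot x
         tot-y = trans (∑-+ (allFin (suc n)) z (λ k -> 1ℤ * δ j k)) (trans (cong₂ _+_ (trans (∑-+ (allFin (suc n)) x (λ k -> (- 1ℤ) * δ i k)) (cong (λ t -> tot x + t) (∑-δ (λ _ -> - 1ℤ) i))) (∑-δ (λ _ -> 1ℤ) j)) (eq (tot x)))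
           where
           eq : ∀ a -> a + (- 1ℤ) + 1ℤ ≡ a
           eq = solve 1 (λ a -> a :+ (:- :1) :+ :1 := a) refl
         quad-y : quad e y ≡ quad e x + + 2 * (row e x j - row e x i + (p - e i j))
         quad-y = trans (quad-perturb z 1ℤ j) (trans (cong₂ (λ a r -> a + + 2 * 1ℤ * r + 1ℤ * 1ℤ * p) (quad-perturb x (- 1ℤ) i)
             (trans (row-perturb x (- 1ℤ) i j) (cong (λ t -> row e x j + (- 1ℤ) * t) (e-sym j i)))) (eq (quad e x) (row e x i) (row e x j) (e i j) p))
           where
           eq : ∀ q ri rj e p -> q + + 2 * (- 1ℤ) * ri + (- 1ℤ) * (- 1ℤ) * p + + 2 * 1ℤ * (rj + (- 1ℤ) * e) + 1ℤ * 1ℤ * p ≡ q + + 2 * (rj - ri + (p - e))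
           eq = solve 5 (λ q ri rj e p -> q :+ :2 :* (:- :1) :* ri :+ (:- :1) :* (:- :1) :* p :+ :2 :* :1 :* (rj :+ (:- :1) :* e) :+ :1 :* :1 :* p := q :+ :2 :* (rj :- ri :+ (p :- e))) refl
         half : ∀ {a b} -> 0ℤ ≤ a + + 2 * b - a -> 0ℤ ≤ b
         half {a} {b} h = ≤-cancelˡ (+ 2) (+≤+ (ℕ.s≤s ℕ.z≤n)) (≤r (Z.*-zeroʳ (+ 2)) ⟫ h ⟫ ≤r (eq a b))
           where
           eq : ∀ a b -> a + + 2 * b - a ≡ + 2 * b
           eq = solve 2 (λ a b -> a :+ :2 :* b :- a := :2 :* b) refl
         0≤qy : 0ℤ ≤ quad e y
         0≤qy = 0≤quad y 0≤y
         below : ∀ b -> quad e x ≤ + b -> quad e y + 1ℤ ≤ quad e x -> ⊥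
         below zero h k = ≥1⇒≰ (Z.+-monoˡ-≤ 1ℤ 0≤qy ⟫ k) h
         below (suc b) h k = descend b y 0≤y (M≥4 ⟫ ≤r (sym tot-y))
             (subst (λ t -> quad e y * K + C * t ≤ p * p * c1 * (t * t)) (sym tot-y) (Z.+-monoˡ-≤ (C * tot x) (≤-*ʳ K 0≤K qy≤qx) ⟫ g₁))
             (λ l zl -> subst (λ t -> + length l * quad e y + C * t ≤ p * (t * t)) (sym tot-y) (Z.+-monoˡ-≤ (C * tot x) (≤-*ˡ (+ length l) 0≤ℕ qy≤qx) ⟫ g₂ l zl))
             (by (0≤-- (k ⟫ h)) (eq (quad e y) (+ b)))
           where
           qy≤qx : quad e y ≤ quad e x
           qy≤qx = by 0≤ℕ refl ⟫ k
           eq : ∀ a c -> c ≡ a + (1ℤ + c - (a + 1ℤ))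
           eq = solve 2 (λ a c -> c := a :+ (:1 :+ c :- (a :+ :1))) refl
         q≤qy : quad e x ≤ quad e y
         q≤qy with quad e x Z.≤? quad e y
         ... | yes h = h
         ... | no h = ⊥-elim (below b qb (≰⇒≥1 h))

     step : ∀ x -> (∀ i -> 0ℤ ≤ x i) -> ¬ ¬ Good e F (tot x) (quad e x)
     step x x≥0 bad with 1≤⊎≤0 (tot x)
     ... | inj₂ h = bad (inj₂ ([] , [] , ≤r (trans (cong (λ z -> p * (z * z)) (Z.≤-antisym h (∑-nonneg (allFin (suc n)) x≥0))) (trans (Z.*-zeroʳ p) (sym (Z.*-zeroˡ (quad e x)))))))
     ... | inj₁ 1≤X = descend ∣ quad e y ∣ y (λ i -> 0≤-* 0≤m (x≥0 i)) M≥4 g₁ g₂ (≤r (sym (Z.0≤i⇒+∣i∣≡i (0≤quad y (λ i -> 0≤-* 0≤m (x≥0 i))))))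
       where
       X q m : ℤ
       X = tot x
       q = quad e x
       -- An integer inequality that fails does so by at least 1. Scaling the weights by m turns
       -- this into m², which equals `C` times the new total m X: exactly the gap required.
       m = C * X
       1≤m : 1ℤ ≤ m
       1≤m = 1≤-* 1≤C 1≤X
       0≤m = 1≤⇒0≤ 1≤m
       y : Fin (suc n) -> ℤ
       y i = m * x i
       tot-y : tot y ≡ m * X
       tot-y = ∑-*ˡ (allFin (suc n)) m x
       quad-y : quad e y ≡ m * m * q
       quad-y = trans (∑-cong (allFin (suc n)) (λ i -> trans (cong (m * x i *_) (trans (∑-cong (allFin (suc n)) (λ j -> eq₁ (e i j) m (x j))) (∑-*ˡ (allFin (suc n)) m _))) (eq₂ m (x i) (row e x i))))
            (∑-*ˡ (allFin (suc n)) (m * m) _)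
         where
         eq₁ : ∀ e m x -> e * (m * x) ≡ m * (e * x)
         eq₁ = solve 3 (λ e m x -> e :* (m :* x) := m :* (e :* x)) refl
         eq₂ : ∀ m x r -> m * x * (m * r) ≡ m * m * (x * r)
         eq₂ = solve 3 (λ m x r -> m :* x :* (m :* r) := m :* m :* (x :* r)) refl
       M≥4 : + 4 ≤ tot y
       M≥4 = 4≤C ⟫ by (0≤-+ (0≤-* 0≤C (0≤-- 1≤X)) (0≤-* (0≤-- 1≤X) 0≤m)) (trans tot-y (eq C X))
         where
         0≤C = 1≤⇒0≤ 1≤C
         eq : ∀ C X -> C * X * X ≡ C + (C * (X - 1ℤ) + (X - 1ℤ) * (C * X))
         eq = solve 2 (λ C X -> C :* X :* X := C :+ (C :* (X :- :1) :+ (X :- :1) :* (C :* X))) refl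
         4≤C : + 4 ≤ C
         4≤C = by (0≤-+ (0≤-* {N - + 4} (0≤ℕ {suc n}) (0≤-* (0≤-* 0≤p 0≤p) 0≤c1)) (0≤-+ (0≤-* {+ 4} 0≤ℕ (0≤-- (1≤-* (1≤-* 1≤p 1≤p) 1≤c1))) (0≤ℕ {1}))) (eq₄ N (p * p * c1)) ⟫ C-large
           where
           eq₄ : ∀ N a -> a * N + 1ℤ ≡ + 4 + ((N - + 4) * a + (+ 4 * (a - 1ℤ) + 1ℤ))
           eq₄ = solve 2 (λ N a -> a :* N :+ :1 := :4 :+ ((N :- :4) :* a :+ (:4 :* (a :- :1) :+ :1))) refl
       scale : ∀ a b A -> ¬ (b ≤ a * q) -> A ≡ m * m * b -> m * m * q * a + C * (m * X) ≤ A
       scale a b A h refl = by (0≤-* (0≤-* 0≤m 0≤m) (0≤-- (≰⇒≥1 h))) (eq C X a b q)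
         where
         eq : ∀ C X a b q -> C * X * (C * X) * b ≡ C * X * (C * X) * q * a + C * (C * X * X) + C * X * (C * X) * (b - (a * q + 1ℤ))
         eq = solve 5 (λ C X a b q -> C :* X :* (C :* X) :* b := C :* X :* (C :* X) :* q :* a :+ C :* (C :* X :* X) :+ C :* X :* (C :* X) :* (b :- (a :* q :+ :1))) refl
       g₁ : quad e y * K + C * tot y ≤ p * p * c1 * (tot y * tot y)
       g₁ = subst₂ (λ t s -> s * K + C * t ≤ p * p * c1 * (t * t)) (sym tot-y) (sym quad-y)
          (scale K (p * p * c1 * (X * X)) _ (λ h -> bad (inj₁ (h ⟫ ≤r (Z.*-comm K q)))) (eq p c1 m X))
         where
         eq : ∀ p c m X -> p * p * c * (m * X * (m * X)) ≡ m * m * (p * p * c * (X * X))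
         eq = solve 4 (λ p c m X -> p :* p :* c :* (m :* X :* (m :* X)) := m :* m :* (p :* p :* c :* (X :* X))) refl
       g₂ : ∀ l -> Zero e l -> + length l * quad e y + C * tot y ≤ p * (tot y * tot y)
       g₂ l zl = subst₂ (λ t s -> + length l * s + C * t ≤ p * (t * t)) (sym tot-y) (sym quad-y)
          (≤r (cong (_+ C * (m * X)) (Z.*-comm (+ length l) (m * m * q))) ⟫ scale (+ length l) (p * (X * X)) _ (λ h -> bad (inj₂ (l , zl , h))) (eq p m X))
         where
         eq : ∀ p m X -> p * (m * X * (m * X)) ≡ m * m * (p * (X * X))
         eq = solve 3 (λ p m X -> p :* (m :* X :* (m :* X)) := m :* m :* (p :* (X :* X))) refl

   near-turan : ∀ n -> NearTuran n
   near-turan zero e def F bd x x≥0 bad = bad (inj₂ ([] , [] , ≤r (Z.*-zeroʳ p)))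
   near-turan (suc n) e def F bd = Step.step (near-turan n) e def F bd

   -- The bound for F = p t + 1; slackness rules out the exceptional alternative of near-turan.
   weighted-turan : ∀ {n} (e : Fin n -> Fin n -> ℤ) -> IsDeficit e -> ∀ t -> 1ℤ ≤ t -> Bounded e (p * t + 1ℤ) ->
     ∀ x -> (∀ i -> 0ℤ ≤ x i) -> p * c1 * (tot x * tot x) ≤ quad e x * (c1 * t + 1ℤ)
   weighted-turan {n} e def t 1≤t bd x x≥0 with (p * c1 * (tot x * tot x)) Z.≤? (quad e x * (c1 * t + 1ℤ))
   ... | yes h = h
   ... | no bad = ⊥-elim (near-turan n e def (p * t + 1ℤ) bd x x≥0 go)
     where
     X q : ℤ
     X = tot x
     q = quad e x
     0≤q : 0ℤ ≤ q
     0≤q = Quad.0≤quad e def x x≥0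
     go : ¬ Good e (p * t + 1ℤ) X q
     go (inj₁ h) = bad (≤-cancelˡ p 1≤p (≤r (eq₁ p c1 (X * X)) ⟫ h ⟫ ≤r (eq₂ p q t)))
       where
       eq₁ : ∀ p c a -> p * (p * c * a) ≡ p * p * c * a
       eq₁ = solve 3 (λ p c a -> p :* (p :* c :* a) := p :* p :* c :* a) refl
       eq₂ : ∀ p q t -> q * ((+ 2 * p - 1ℤ) * (p * t + 1ℤ) - (p - 1ℤ)) ≡ p * (q * ((+ 2 * p - 1ℤ) * t + 1ℤ))
       eq₂ = solve 3 (λ p q t -> q :* ((:2 :* p :- :1) :* (p :* t :+ :1) :- (p :- :1)) := p :* (q :* ((:2 :* p :- :1) :* t :+ :1))) refl
     go (inj₂ (l , z , h)) = bad (≤r (eq₁ p c1 (X * X)) ⟫ ≤-*ˡ c1 0≤c1 h ⟫ ≤r (eq₂ c1 (+ length l) q) ⟫ ≤-*ˡ q 0≤q (≤-*ˡ c1 0≤c1 l≤t ⟫ by (0≤ℕ {1}) refl))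
       where
       eq₁ : ∀ p c a -> p * c * a ≡ c * (p * a)
       eq₁ = solve 3 (λ p c a -> p :* c :* a := c :* (p :* a)) refl
       eq₂ : ∀ c l q -> c * (l * q) ≡ q * (c * l)
       eq₂ = solve 3 (λ c l q -> c :* (l :* q) := q :* (c :* l)) refl
       pl≤ : p * + length l ≤ p * t + 1ℤ
       pl≤ = zero-value e l z ⟫ bd l (AllPairs.map (λ h -> ≤r (cong (_+ 1ℤ) h) ⟫ 1≤p) z)
       l≤t : + length l ≤ t
       l≤t with + length l Z.≤? t
       ... | yes h = h
       ... | no h = ⊥-elim (absurd _ (p - + 2) (0≤-+ (0≤-- pl≤) (0≤-* 0≤p (0≤-- (≰⇒≥1 h)))) (0≤-- 2≤p) (eq p (+ length l) t))
         where
         eq : ∀ p l t -> p * t + 1ℤ - p * l + p * (l - (t + 1ℤ)) + (p - + 2) ≡ -[1+ 0 ]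
         eq = solve 3 (λ p l t -> p :* t :+ :1 :- p :* l :+ p :* (l :- (t :+ :1)) :+ (p :- :2) := con -[1+ 0 ]) refl

 -- Density increments and critical weightings

 ind : Bool -> ℤ
 ind b = if b then 1ℤ else 0ℤ

 0≤ind : ∀ b -> 0ℤ ≤ ind b
 0≤ind true = 0≤ℕ
 0≤ind false = 0≤ℕ

 ind≤1 : ∀ b -> ind b ≤ 1ℤ
 ind≤1 true = Z.≤-refl
 ind≤1 false = 0≤ℕ

 ind-∧ : ∀ a b -> ind (a ∧ b) ≡ ind a * ind b
 ind-∧ true true = refl
 ind-∧ true false = refl
 ind-∧ false true = refl
 ind-∧ false false = refl

 ind-split : ∀ a b -> ind a ≡ ind (a ∧ b) + ind (a ∧ not b)
 ind-split true true = refl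
 ind-split true false = refl
 ind-split false _ = refl

 ∧-trueˡ : ∀ {a b} -> a ∧ b ≡ true -> a ≡ true
 ∧-trueˡ {true} _ = refl

 ∧-trueʳ : ∀ {a b} -> a ∧ b ≡ true -> b ≡ true
 ∧-trueʳ {true} h = h

 ∧-true : ∀ {a b} -> a ≡ true -> b ≡ true -> a ∧ b ≡ true
 ∧-true refl h = h

 module Dense {n : ℕ} (adj : Fin n -> Fin n -> Bool) (adj-sym : ∀ i j -> adj i j ≡ adj j i) where

   V : List (Fin n)
   V = allFin n

   Subset Weight : Set
   Subset = Fin n -> Bool
   Weight = Fin n -> ℤ

   ⟪_,_⟫ : Weight -> Weight -> ℤ
   ⟪ f , g ⟫ = ∑ V (λ u -> f u * ∑ V (λ v -> ind (adj u v) * g v))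

   ⟪⟫-cong : ∀ {f f′ g g′} -> (∀ u -> f u ≡ f′ u) -> (∀ u -> g u ≡ g′ u) -> ⟪ f , g ⟫ ≡ ⟪ f′ , g′ ⟫
   ⟪⟫-cong h k = ∑-cong V (λ u -> cong₂ _*_ (h u) (∑-cong V (λ v -> cong (ind (adj u v) *_) (k v))))

   ⟪⟫-sym : ∀ f g -> ⟪ f , g ⟫ ≡ ⟪ g , f ⟫
   ⟪⟫-sym f g = trans (∑-cong V (λ u -> sym (∑-*ˡ V (f u) (λ v -> ind (adj u v) * g v))))
     (trans (∑-swap V V (λ u v -> f u * (ind (adj u v) * g v)))
       (∑-cong V (λ v -> trans (∑-cong V (λ u -> trans (cong (λ b -> f u * (ind b * g v)) (adj-sym u v)) (eq (f u) (ind (adj v u)) (g v)))) (∑-*ˡ V (g v) (λ u -> ind (adj v u) * f u)))))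
     where
     eq : ∀ a b c -> a * (b * c) ≡ c * (b * a)
     eq = solve 3 (λ a b c -> a :* (b :* c) := c :* (b :* a)) refl

   ⟪⟫-linˡ : ∀ a b f g h -> ⟪ (λ u -> a * f u + b * g u) , h ⟫ ≡ a * ⟪ f , h ⟫ + b * ⟪ g , h ⟫
   ⟪⟫-linˡ a b f g h = trans (∑-cong V (λ u -> eq a b (f u) (g u) (∑ V (λ v -> ind (adj u v) * h v))))
     (trans (∑-+ V _ _) (cong₂ _+_ (∑-*ˡ V a _) (∑-*ˡ V b _)))
     where
     eq : ∀ a b f g r -> (a * f + b * g) * r ≡ a * (f * r) + b * (g * r)
     eq = solve 5 (λ a b f g r -> (a :* f :+ b :* g) :* r := a :* (f :* r) :+ b :* (g :* r)) refl

   ⟪⟫-linʳ : ∀ a b f g h -> ⟪ h , (λ u -> a * f u + b * g u) ⟫ ≡ a * ⟪ h , f ⟫ + b * ⟪ h , g ⟫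
   ⟪⟫-linʳ a b f g h = trans (⟪⟫-sym h _) (trans (⟪⟫-linˡ a b f g h) (cong₂ (λ x y -> a * x + b * y) (⟪⟫-sym f h) (⟪⟫-sym g h)))

   ⟪⟫-sq : ∀ a b f g -> ⟪ (λ u -> a * f u + b * g u) , (λ u -> a * f u + b * g u) ⟫
     ≡ a * a * ⟪ f , f ⟫ + + 2 * a * b * ⟪ f , g ⟫ + b * b * ⟪ g , g ⟫
   ⟪⟫-sq a b f g = trans (⟪⟫-linˡ a b f g _) (trans (cong₂ (λ x y -> a * x + b * y) (⟪⟫-linʳ a b f g f)
       (trans (⟪⟫-linʳ a b f g g) (cong (λ z -> a * z + b * ⟪ g , g ⟫) (⟪⟫-sym g f)))) (eq a b ⟪ f , f ⟫ ⟪ f , g ⟫ ⟪ g , g ⟫))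
     where
     eq : ∀ a b x y z -> a * (a * x + b * y) + b * (a * y + b * z) ≡ a * a * x + + 2 * a * b * y + b * b * z
     eq = solve 5 (λ a b x y z -> a :* (a :* x :+ b :* y) :+ b :* (a :* y :+ b :* z) := a :* a :* x :+ :2 :* a :* b :* y :+ b :* b :* z) refl

   ⟪⟫-mono : ∀ {f f′ g g′} -> (∀ u -> 0ℤ ≤ f u) -> (∀ u -> 0ℤ ≤ g′ u) -> (∀ u -> f u ≤ f′ u) -> (∀ u -> g u ≤ g′ u) -> ⟪ f , g ⟫ ≤ ⟪ f′ , g′ ⟫
   ⟪⟫-mono hf hg h k = ∑-mono V (λ u -> ≤-*² (hf u) (∑-nonneg V (λ v -> 0≤-* (0≤ind (adj u v)) (hg v))) (h u)
      (∑-mono V (λ v -> ≤-*ˡ (ind (adj u v)) (0≤ind (adj u v)) (k v))))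

   0≤⟪⟫ : ∀ f g -> (∀ u -> 0ℤ ≤ f u) -> (∀ u -> 0ℤ ≤ g u) -> 0ℤ ≤ ⟪ f , g ⟫
   0≤⟪⟫ f g hf hg = ∑-nonneg V (λ u -> 0≤-* (hf u) (∑-nonneg V (λ v -> 0≤-* (0≤ind (adj u v)) (hg v))))

   ⟪⟫≤ : ∀ f g -> (∀ u -> 0ℤ ≤ f u) -> (∀ u -> 0ℤ ≤ g u) -> ⟪ f , g ⟫ ≤ ∑ V f * ∑ V g
   ⟪⟫≤ f g hf hg = ∑-mono V (λ u -> ≤-*ˡ (f u) (hf u) (∑-mono V (λ v -> ≤-*ʳ (g v) (hg v) (ind≤1 (adj u v)) ⟫ ≤r (Z.*-identityˡ (g v)))))
      ⟫ ≤r (∑-*ʳ V (∑ V g) f)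

   -- y is a vertex weighting with density at least ρ / R whose maximum is at most B times its average.
   record Level (R B ρ : ℤ) (y : Weight) : Set where
     field
       y≥0    : ∀ u -> 0ℤ ≤ y u
       mass   : 1ℤ ≤ ∑ V y
       spread : ∀ u -> + n * y u ≤ B * ∑ V y
       dense  : ρ * (∑ V y * ∑ V y) ≤ R * ⟪ y , y ⟫

   -- A second-order optimality condition: on perturbations of total 0 the adjacency form is
   -- negative up to 4K²(Σy)²/R. It is the substitute for regularity.
   Critical : ℤ -> Weight -> Set
   Critical R y = ∀ K g -> 1ℤ ≤ K -> (∀ u -> - (K * y u) ≤ g u) -> (∀ u -> g u ≤ K * y u) ->
     R * ⟪ g , g ⟫ ≤ + 4 * (K * K) * (∑ V y * ∑ V y) + (R + 1ℤ) * (∑ V g * ∑ V g)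

   -- Both 2Ky + g and 2Ky - g lie between Ky and 3Ky, so their maxima are within the budget 3B and
   -- neither can reach density (ρ + 1)/R. Adding the two inequalities cancels the cross terms of y
   -- and g, and the density of y itself cancels the terms in y.
   critical : ∀ {R B ρ y} -> 0ℤ ≤ R -> 0ℤ ≤ B -> (∀ z -> ¬ Level R (+ 3 * B) (ρ + 1ℤ) z) -> Level R B ρ y -> Critical R y
   critical {R} {B} {ρ} {y} 0≤R 0≤B none lv K g 1≤K h₁ h₂ =
     ≤-cancelˡ (+ 2) (+≤+ (ℕ.s≤s ℕ.z≤n)) (by (0≤-+ (0≤-+ (0≤-+ (0≤-- (sparser 1ℤ (λ u -> low₊ u) (λ u -> high₊ u)))
          (0≤-- (sparser (- 1ℤ) (λ u -> low₋ u) (λ u -> high₋ u)))) (0≤-* (0≤-* {+ 8} 0≤ℕ (0≤-* 0≤K 0≤K)) (0≤-- dense))) (0≤-* (0≤-* {+ 2} 0≤ℕ (0≤-sq S)) (0≤-- ρ≤R)))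
       (trans (eq R K ρ s S yy gg yg) (cong₂ (λ a b -> + 2 * (R * gg) + (((ρ + 1ℤ) * (+ 2 * K * s + 1ℤ * S) * (+ 2 * K * s + 1ℤ * S) - R * a)
           + ((ρ + 1ℤ) * (+ 2 * K * s + (- 1ℤ) * S) * (+ 2 * K * s + (- 1ℤ) * S) - R * b) + + 8 * (K * K) * (R * yy - ρ * (s * s)) + + 2 * (S * S) * (R - ρ)))
           (sym (⟪⟫-sq (+ 2 * K) 1ℤ y g)) (sym (⟪⟫-sq (+ 2 * K) (- 1ℤ) y g)))))
     where
     open Level lv
     s S yy gg yg : ℤ
     s = ∑ V y
     S = ∑ V g
     yy = ⟪ y , y ⟫
     gg = ⟪ g , g ⟫
     yg = ⟪ y , g ⟫
     0≤K = 1≤⇒0≤ 1≤K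
     ρ≤R : ρ ≤ R
     ρ≤R = ≤-cancelˡ (s * s) (1≤-* mass mass) (≤r (Z.*-comm (s * s) ρ) ⟫ dense ⟫ ≤-*ˡ R 0≤R (⟪⟫≤ y y y≥0 y≥0) ⟫ ≤r (Z.*-comm R (s * s)))
     low₊ : ∀ u -> K * y u ≤ + 2 * K * y u + 1ℤ * g u
     low₊ u = by (0≤-- (h₁ u)) (e K (y u) (g u))
       where
       e : ∀ K y g -> + 2 * K * y + 1ℤ * g ≡ K * y + (g - - (K * y))
       e = solve 3 (λ K y g -> :2 :* K :* y :+ :1 :* g := K :* y :+ (g :- :- (K :* y))) refl
     high₊ : ∀ u -> + 2 * K * y u + 1ℤ * g u ≤ + 3 * (K * y u)
     high₊ u = by (0≤-- (h₂ u)) (e K (y u) (g u))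
       where
       e : ∀ K y g -> + 3 * (K * y) ≡ + 2 * K * y + 1ℤ * g + (K * y - g)
       e = solve 3 (λ K y g -> con (+ 3) :* (K :* y) := :2 :* K :* y :+ :1 :* g :+ (K :* y :- g)) refl
     low₋ : ∀ u -> K * y u ≤ + 2 * K * y u + (- 1ℤ) * g u
     low₋ u = by (0≤-- (h₂ u)) (e K (y u) (g u))
       where
       e : ∀ K y g -> + 2 * K * y + (- 1ℤ) * g ≡ K * y + (K * y - g)
       e = solve 3 (λ K y g -> :2 :* K :* y :+ (:- :1) :* g := K :* y :+ (K :* y :- g)) refl
     high₋ : ∀ u -> + 2 * K * y u + (- 1ℤ) * g u ≤ + 3 * (K * y u)
     high₋ u = by (0≤-- (h₁ u)) (e K (y u) (g u))
       where
       e : ∀ K y g -> + 3 * (K * y) ≡ + 2 * K * y + (- 1ℤ) * g + (g - - (K * y))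
       e = solve 3 (λ K y g -> con (+ 3) :* (K :* y) := :2 :* K :* y :+ (:- :1) :* g :+ (g :- :- (K :* y))) refl
     sparser : ∀ σ -> (∀ u -> K * y u ≤ + 2 * K * y u + σ * g u) -> (∀ u -> + 2 * K * y u + σ * g u ≤ + 3 * (K * y u)) ->
       R * ⟪ (λ u -> + 2 * K * y u + σ * g u) , (λ u -> + 2 * K * y u + σ * g u) ⟫ ≤ (ρ + 1ℤ) * (+ 2 * K * s + σ * S) * (+ 2 * K * s + σ * S)
     sparser σ lo hi with R * ⟪ (λ u -> + 2 * K * y u + σ * g u) , (λ u -> + 2 * K * y u + σ * g u) ⟫ Z.≤? (ρ + 1ℤ) * (+ 2 * K * s + σ * S) * (+ 2 * K * s + σ * S)
     ... | yes h = h
     ... | no h = ⊥-elim (none y′ (record { y≥0 = λ u -> 0≤-* 0≤K (y≥0 u) ⟫ lo u ; mass = 1≤-* 1≤K mass ⟫ Ks≤ ; spread = spr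
               ; dense = ≤r (trans (cong (λ z -> (ρ + 1ℤ) * (z * z)) tot′) (sym (Z.*-assoc (ρ + 1ℤ) _ _))) ⟫ Z.<⇒≤ (Z.≰⇒> h) }))
       where
       y′ : Weight
       y′ u = + 2 * K * y u + σ * g u
       tot′ : ∑ V y′ ≡ + 2 * K * s + σ * S
       tot′ = trans (∑-+ V _ _) (cong₂ _+_ (∑-*ˡ V (+ 2 * K) y) (∑-*ˡ V σ g))
       Ks≤ : K * s ≤ ∑ V y′
       Ks≤ = ≤r (sym (∑-*ˡ V K y)) ⟫ ∑-mono V lo
       spr : ∀ u -> + n * y′ u ≤ + 3 * B * ∑ V y′
       spr u = ≤-*ˡ (+ n) 0≤ℕ (hi u) ⟫ ≤r (e₁ (+ n) K (y u)) ⟫ ≤-*ˡ (+ 3 * K) (0≤-* {+ 3} 0≤ℕ 0≤K) (spread u) ⟫ ≤r (e₂ K B s) ⟫ ≤-*ˡ (+ 3 * B) (0≤-* {+ 3} 0≤ℕ 0≤B) Ks≤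
         where
         e₁ : ∀ n K y -> n * (+ 3 * (K * y)) ≡ + 3 * K * (n * y)
         e₁ = solve 3 (λ n K y -> n :* (con (+ 3) :* (K :* y)) := con (+ 3) :* K :* (n :* y)) refl
         e₂ : ∀ K B s -> + 3 * K * (B * s) ≡ + 3 * B * (K * s)
         e₂ = solve 3 (λ K B s -> con (+ 3) :* K :* (B :* s) := con (+ 3) :* B :* (K :* s)) refl
     eq : ∀ R K ρ s S yy gg yg -> + 2 * (+ 4 * (K * K) * (s * s) + (R + 1ℤ) * (S * S)) ≡ + 2 * (R * gg) + (((ρ + 1ℤ) * (+ 2 * K * s + 1ℤ * S) * (+ 2 * K * s + 1ℤ * S) - R * (+ 2 * K * (+ 2 * K) * yy + + 2 * (+ 2 * K) * 1ℤ * yg + 1ℤ * 1ℤ * gg))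
           + ((ρ + 1ℤ) * (+ 2 * K * s + (- 1ℤ) * S) * (+ 2 * K * s + (- 1ℤ) * S) - R * (+ 2 * K * (+ 2 * K) * yy + + 2 * (+ 2 * K) * (- 1ℤ) * yg + (- 1ℤ) * (- 1ℤ) * gg)) + + 8 * (K * K) * (R * yy - ρ * (s * s)) + + 2 * (S * S) * (R - ρ))
     eq = solve 8 (λ R K ρ s S yy gg yg -> :2 :* (:4 :* (K :* K) :* (s :* s) :+ (R :+ :1) :* (S :* S)) := :2 :* (R :* gg) :+ (((ρ :+ :1) :* (:2 :* K :* s :+ :1 :* S) :* (:2 :* K :* s :+ :1 :* S) :- R :* (:2 :* K :* (:2 :* K) :* yy :+ :2 :* (:2 :* K) :* :1 :* yg :+ :1 :* :1 :* gg)) :+ ((ρ :+ :1) :* (:2 :* K :* s :+ (:- :1) :* S) :* (:2 :* K :* s :+ (:- :1) :* S) :- R :* (:2 :* K :* (:2 :* K) :* yy :+ :2 :* (:2 :* K) :* (:- :1) :* yg :+ (:- :1) :* (:- :1) :* gg)) :+ con (+ 8) :* (K :* K) :* (R :* yy :- ρ :* (s :* s)) :+ :2 :* (S :* S) :* (R :- ρ))) refl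

   -- Density increments ρ ↦ ρ + 1 at the price of tripling B can happen at most R times.
   no-level : ∀ R Bmax ρ₀ -> 0ℤ ≤ R -> (∀ B ρ y -> 0ℤ ≤ B -> B ≤ Bmax -> ρ₀ ≤ ρ -> Level R B ρ y -> Critical R y -> ⊥) ->
     ∀ k B ρ y -> 0ℤ ≤ B -> B * + (3 ℕ.^ k) ≤ Bmax -> ρ₀ ≤ ρ -> R + 1ℤ ≤ ρ + + k -> Level R B ρ y -> ⊥
   no-level R Bmax ρ₀ 0≤R core zero B ρ y 0≤B hB hρ hk lv =
     ≥1⇒≰ (Z.+-monoˡ-≤ 1ℤ (≤-*ˡ R 0≤R (⟪⟫≤ y y y≥0 y≥0)) ⟫ by (0≤-+ (0≤-- (1≤-* mass mass)) (0≤-* (0≤-sq s) (0≤-- hk))) (eq R ρ s) ⟫ dense) Z.≤-refl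
     where
     open Level lv
     s : ℤ
     s = ∑ V y
     eq : ∀ R ρ s -> ρ * (s * s) ≡ R * (s * s) + 1ℤ + (s * s - 1ℤ + s * s * (ρ + 0ℤ - (R + 1ℤ)))
     eq = solve 3 (λ R ρ s -> ρ :* (s :* s) := R :* (s :* s) :+ :1 :+ (s :* s :- :1 :+ s :* s :* (ρ :+ :0 :- (R :+ :1)))) refl
   no-level R Bmax ρ₀ 0≤R core (suc k) B ρ y 0≤B hB hρ hk lv = core B ρ y 0≤B B≤ hρ lv
     (critical 0≤R 0≤B (λ z lz -> no-level R Bmax ρ₀ 0≤R core k (+ 3 * B) (ρ + 1ℤ) z (0≤-* {+ 3} 0≤ℕ 0≤B)
        (≤r (trans (eq B (+ (3 ℕ.^ k))) (cong (B *_) (sym (Z.pos-* 3 (3 ℕ.^ k))))) ⟫ hB) (hρ ⟫ by (0≤ℕ {1}) refl) (hk ⟫ ≤r (eq′ ρ (+ k))) lz) lv)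
     where
     eq : ∀ B a -> + 3 * B * a ≡ B * (+ 3 * a)
     eq = solve 2 (λ B a -> con (+ 3) :* B :* a := B :* (con (+ 3) :* a)) refl
     eq′ : ∀ r k -> r + (1ℤ + k) ≡ r + 1ℤ + k
     eq′ = solve 2 (λ r k -> r :+ (:1 :+ k) := r :+ :1 :+ k) refl
     B≤ : B ≤ Bmax
     B≤ = ≤r (sym (Z.*-identityʳ B)) ⟫ ≤-*ˡ B 0≤B (+≤+ (N.m^n>0 3 (suc k))) ⟫ hB

 pow-suc : ∀ a k -> + (a ℕ.^ suc k) ≡ + a * + (a ℕ.^ k)
 pow-suc a k = Z.pos-* a (a ℕ.^ k)

 -- Partition into sparse clusters

 module Sets {n : ℕ} (adj : Fin n -> Fin n -> Bool) (adj-sym : ∀ i j -> adj i j ≡ adj j i)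
             (y : Fin n -> ℤ) (y≥0 : ∀ u -> 0ℤ ≤ y u) where
   open Dense adj adj-sym

   on : Subset -> Weight
   on S u = ind (S u) * y u

   μ : Subset -> ℤ
   μ S = ∑ V (on S)

   Σy : ℤ
   Σy = ∑ V y

   on≥0 : ∀ S u -> 0ℤ ≤ on S u
   on≥0 S u = 0≤-* (0≤ind (S u)) (y≥0 u)

   0≤μ : ∀ S -> 0ℤ ≤ μ S
   0≤μ S = ∑-nonneg V (on≥0 S)

   on≤y : ∀ S u -> on S u ≤ y u
   on≤y S u = ≤-*ʳ (y u) (y≥0 u) (ind≤1 (S u)) ⟫ ≤r (Z.*-identityˡ (y u))

   μ≤Σy : ∀ S -> μ S ≤ Σy
   μ≤Σy S = ∑-mono V (on≤y S)

   _⊑_ : Subset -> Subset -> Set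
   S ⊑ T = ∀ u -> S u ≡ true -> T u ≡ true

   on-mono : ∀ {S T} -> S ⊑ T -> ∀ u -> on S u ≤ on T u
   on-mono {S} {T} h u with S u in eq
   ... | true = ≤r (cong (λ b -> ind b * y u) (sym (h u eq)))
   ... | false = on≥0 T u

   μ-mono : ∀ {S T} -> S ⊑ T -> μ S ≤ μ T
   μ-mono h = ∑-mono V (on-mono h)

   _∩_ _∖_ : Subset -> Subset -> Subset
   (S ∩ T) u = S u ∧ T u
   (S ∖ T) u = S u ∧ not (T u)

   μ-split : ∀ S T -> μ S ≡ μ (S ∩ T) + μ (S ∖ T)
   μ-split S T = trans (∑-cong V (λ u -> trans (cong (_* y u) (ind-split (S u) (T u))) (Z.*-distribʳ-+ (y u) (ind (S u ∧ T u)) (ind (S u ∧ not (T u)))))) (∑-+ V _ _)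

   degree : Subset -> Fin n -> ℤ
   degree S u = ∑ V (λ v -> ind (adj u v) * on S v)

   degree-∩ : ∀ S u -> degree S u ≡ μ (S ∩ adj u)
   degree-∩ S u = ∑-cong V (λ v -> trans (eq (ind (adj u v)) (ind (S v)) (y v)) (cong (_* y v) (sym (ind-∧ (S v) (adj u v)))))
     where
     eq : ∀ a b c -> a * (b * c) ≡ b * a * c
     eq = solve 3 (λ a b c -> a :* (b :* c) := b :* a :* c) refl

   Clique : List (Fin n) -> Set
   Clique = AllPairs (λ u v -> adj u v ≡ true)

   Inside : Subset -> List (Fin n) -> Set
   Inside S = All (λ u -> S u ≡ true)

   Z-pick : ∀ Z S -> μ S * μ S + 1ℤ ≤ Z * ⟪ on S , on S ⟫ -> ∃ λ u -> S u ≡ true × μ S ≤ Z * degree S u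
   Z-pick Z S h with ∑-pick V {λ u -> on S u * μ S} {λ u -> Z * (on S u * degree S u)} (≤r (cong (_+ 1ℤ) (∑-*ʳ V (μ S) (on S))) ⟫ h ⟫ ≤r (sym (∑-*ˡ V Z _)))
   ... | u , _ , k with S u in eq
   ...   | true = u , eq , cancel
     where
     cancel : μ S ≤ Z * degree S u
     cancel with μ S Z.≤? Z * degree S u
     ... | yes q = q
     ... | no q = ⊥-elim (absurd _ 0ℤ (0≤-+ (0≤-- k) (0≤-* (0≤-* {1ℤ} 0≤ℕ (y≥0 u)) (0≤-- (Z.<⇒≤ (Z.≰⇒> q))))) 0≤ℕ (e (1ℤ * y u) (μ S) Z (degree S u)))
       where
       e : ∀ a m Z d -> Z * (a * d) - (a * m + 1ℤ) + a * (m - Z * d) + 0ℤ ≡ -[1+ 0 ]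
       e = solve 4 (λ a m Z d -> Z :* (a :* d) :- (a :* m :+ :1) :+ a :* (m :- Z :* d) :+ :0 := con -[1+ 0 ]) refl
   ...   | false = ⊥-elim (≥1⇒≰ (≤r (e (μ S) (y u)) ⟫ k ⟫ ≤r (e′ Z (y u) (degree S u))) Z.≤-refl)
     where
     e : ∀ m y -> 0ℤ + 1ℤ ≡ 0ℤ * y * m + 1ℤ
     e = solve 2 (λ m y -> :0 :+ :1 := :0 :* y :* m :+ :1) refl
     e′ : ∀ Z y d -> Z * (0ℤ * y * d) ≡ 0ℤ
     e′ = solve 3 (λ Z y d -> Z :* (:0 :* y :* d) := :0) refl

   -- While the density of the set exceeds 1/Z, some vertex has degree at least μ/Z in it, and one
   -- passes to its neighbourhood. This costs a factor Z and lowers the admissible clique size by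
   -- one, so it stops within k passages.
   sparse-subset : ∀ (Z : ℕ) k U -> 1 ℕ.≤ Z -> (∀ l -> Clique l -> Inside U l -> length l ≡ k -> ⊥) ->
     ∃ λ S -> S ⊑ U × + Z * ⟪ on S , on S ⟫ ≤ μ S * μ S × μ U ≤ + (Z ℕ.^ k) * μ S
   sparse-subset Z zero U 1≤Z free = ⊥-elim (free [] [] [] refl)
   sparse-subset Z (suc k) U 1≤Z free with + Z * ⟪ on U , on U ⟫ Z.≤? μ U * μ U
   ... | yes h = U , (λ _ q -> q) , h , ≤r (sym (Z.*-identityˡ (μ U))) ⟫ ≤-*ʳ (μ U) (0≤μ U) (+≤+ (N.m^n>0 Z {{ℕ.>-nonZero 1≤Z}} (suc k)))
   ... | no h with Z-pick (+ Z) U (≰⇒≥1 h)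
   ...   | u , Uu , d with sparse-subset Z k (U ∩ adj u) 1≤Z
              (λ l cl al eq -> free (u ∷ l) (All.map (λ {v} q -> ∧-trueʳ {U v} q) al ∷ cl) (Uu ∷ All.map (λ q -> ∧-trueˡ q) al) (cong suc eq))
   ...     | S , sub , sp , big = S , (λ v q -> ∧-trueˡ (sub v q)) , sp ,
             (d ⟫ ≤r (cong (+ Z *_) (degree-∩ U u)) ⟫ ≤-*ˡ (+ Z) 0≤ℕ big ⟫ ≤r (trans (sym (Z.*-assoc (+ Z) _ _)) (cong (_* μ S) (sym (pow-suc Z k)))))

   -- A partition of most of the mass of U into sparse parts of mass at least Σy / Β.
   record Partition (Z Β Θ : ℕ) (U : Subset) : Set where
     field
       {m}    : ℕ
       part   : Fin m -> Subset
       rest   : Subset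
       split  : ∀ u -> ind (U u) ≡ ∑ (allFin m) (λ i -> ind (part i u)) + ind (rest u)
       sparse : ∀ i -> + Z * ⟪ on (part i) , on (part i) ⟫ ≤ μ (part i) * μ (part i)
       large  : ∀ i -> Σy ≤ + Β * μ (part i)
       small  : + Θ * μ rest ≤ Σy

   -- Sparse subsets are split off greedily until the remainder has mass at most Σy/Θ. Each of them
   -- has mass at least Σy/(Θ Z^k), so every extraction can be paid for with one unit of `fuel`.
   partition : ∀ (Z Θ : ℕ) k -> 1 ℕ.≤ Z -> (∀ l -> Clique l -> length l ≡ k -> ⊥) ->
     ∀ fuel U -> + (Θ ℕ.* Z ℕ.^ k) * μ U ≤ + fuel * Σy -> Partition Z (Θ ℕ.* Z ℕ.^ k) Θ U
   partition Z Θ k 1≤Z free fuel U hf with + Θ * μ U Z.≤? Σy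
   ... | yes h = record { m = 0 ; part = λ () ; rest = U ; split = λ u -> sym (Z.+-identityˡ _) ; sparse = λ () ; large = λ () ; small = h }
   ... | no h with sparse-subset Z k U 1≤Z (λ l cl _ -> free l cl)
   ...   | S , sub , sp , big = go fuel hf
     where
     Β : ℕ
     Β = Θ ℕ.* Z ℕ.^ k
     Σy≤ : Σy ≤ + Β * μ S
     Σy≤ = Z.<⇒≤ (Z.≰⇒> h) ⟫ ≤-*ˡ (+ Θ) 0≤ℕ big ⟫ ≤r (trans (sym (Z.*-assoc (+ Θ) _ _)) (cong (_* μ S) (sym (Z.pos-* Θ (Z ℕ.^ k)))))
     0≤Σy : 0ℤ ≤ Σy
     0≤Σy = ∑-nonneg V y≥0
     meet : ∀ u -> U u ∧ S u ≡ S u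
     meet u with S u in eq
     ... | true = ∧-true (sub u eq) refl
     ... | false = go′ (U u)
       where
       go′ : ∀ b -> b ∧ false ≡ false
       go′ true = refl
       go′ false = refl
     go : ∀ fuel -> + Β * μ U ≤ + fuel * Σy -> Partition Z Β Θ U
     go zero hf = ⊥-elim (h (≤-*ˡ (+ Θ) 0≤ℕ μU≤0 ⟫ ≤r (Z.*-zeroʳ (+ Θ)) ⟫ 0≤Σy))
       where
       μU≤0 : μ U ≤ 0ℤ
       μU≤0 with 1≤⊎≤0 (μ U)
       ... | inj₂ q = q
       ... | inj₁ q = ⊥-elim (h (≤-*ˡ (+ Θ) 0≤ℕ (≤r (sym (Z.*-identityˡ (μ U))) ⟫ ≤-*ʳ (μ U) (0≤μ U) (+≤+ (N.m^n>0 Z {{ℕ.>-nonZero 1≤Z}} k)))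
              ⟫ ≤r (trans (sym (Z.*-assoc (+ Θ) _ _)) (cong (_* μ U) (sym (Z.pos-* Θ (Z ℕ.^ k))))) ⟫ hf ⟫ 0≤Σy))
     go (suc fuel) hf = record { m = suc m ; part = part′ ; rest = rest ; split = split′ ; sparse = sparse′ ; large = large′ ; small = small }
       where
       hf′ : + Β * μ (U ∖ S) ≤ + fuel * Σy
       hf′ = by (0≤-+ (0≤-- hf) (0≤-- Σy≤)) (trans (e (+ fuel) Σy (+ Β) (μ (U ∖ S)) (μ S)) (cong (λ z -> + Β * μ (U ∖ S) + (((1ℤ + + fuel) * Σy - + Β * z) + (+ Β * μ S - Σy)))
          (sym (trans (μ-split U S) (cong (_+ μ (U ∖ S)) (∑-cong V (λ u -> cong (λ b -> ind b * y u) (meet u))))))))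
         where
         e : ∀ f s b r a -> f * s ≡ b * r + (((1ℤ + f) * s - b * (a + r)) + (b * a - s))
         e = solve 5 (λ f s b r a -> f :* s := b :* r :+ (((:1 :+ f) :* s :- b :* (a :+ r)) :+ (b :* a :- s))) refl
       open Partition (partition Z Θ k 1≤Z free fuel (U ∖ S) hf′)
       part′ : Fin (suc m) -> Subset
       part′ F.zero = S
       part′ (F.suc i) = part i
       split′ : ∀ u -> ind (U u) ≡ ∑ (allFin (suc m)) (λ i -> ind (part′ i u)) + ind (rest u)
       split′ u = trans (ind-split (U u) (S u)) (trans (cong₂ _+_ (cong ind (meet u)) (split u))
          (trans (sym (Z.+-assoc (ind (S u)) _ _)) (cong (_+ ind (rest u)) (sym (∑-allFin-suc m (λ i -> ind (part′ i u)))))))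
       sparse′ : ∀ i -> + Z * ⟪ on (part′ i) , on (part′ i) ⟫ ≤ μ (part′ i) * μ (part′ i)
       sparse′ F.zero = sp
       sparse′ (F.suc i) = sparse i
       large′ : ∀ i -> Σy ≤ + Β * μ (part′ i)
       large′ F.zero = Σy≤
       large′ (F.suc i) = large i

 -- Near-constant densities between sparse clusters

 -- Solved for X, the critical inequality bounds it by three terms, each at most αbγ/(3H): the
 -- squared mass of the test function through D = 3HT, the edges inside A through Z ≥ 3HD, and the
 -- error 4K²s²/R through the lower bound on R, which uses that α, b and γ are not too small
 -- compared with s.
 clone-arith : ∀ α b γ s R H T D Z Β X gg CC AA ->
   1ℤ ≤ α -> 1ℤ ≤ b -> 1ℤ ≤ γ -> 1ℤ ≤ R -> 1ℤ ≤ H -> 1ℤ ≤ T -> 1ℤ ≤ D -> 1ℤ ≤ Z -> 1ℤ ≤ Β -> α ≤ s -> γ ≤ s ->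
   α ≤ T * b -> s ≤ Β * α -> s ≤ Β * γ ->
   D ≡ + 3 * H * T -> + 3 * H * D ≤ Z -> + 6 * H * ((D + 1ℤ) * (D + 1ℤ)) * (T * (Β * Β * Β * Β)) ≤ R ->
   R * (D * γ * (D * γ) * gg + + 2 * (D * γ) * (α * α) * X + α * α * (α * α) * CC)
     ≤ + 4 * ((D * γ * α + α * α) * (D * γ * α + α * α)) * (s * s) + (R + 1ℤ) * (α * α * γ * (α * α * γ)) ->
   - (+ 2 * α * b * AA) ≤ gg -> 0ℤ ≤ CC -> Z * AA ≤ α * α ->
   H * X ≤ α * b * γ
 clone-arith α b γ s R H T D Z Β X gg CC AA 1≤α 1≤b 1≤γ 1≤R 1≤H 1≤T 1≤D 1≤Z 1≤Β α≤s γ≤s αTb sα sγ D≡ hZ hR crit hgg 0≤CC hAA =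
   ≤-cancelˡ (+ 6 * Z * R * (D * γ) * (α * α)) (1≤-* (1≤-* (1≤-* (1≤-* {+ 6} (+≤+ (ℕ.s≤s ℕ.z≤n)) 1≤Z) 1≤R) (1≤-* 1≤D 1≤γ)) (1≤-* 1≤α 1≤α))
     (by (0≤-+ (0≤-+ (0≤-+ (0≤-+ (0≤-* (0≤-* {+ 3} 0≤ℕ (0≤-* 0≤H 0≤Z)) (0≤-- crit))
           (0≤-* (0≤-* {+ 3} 0≤ℕ (0≤-* 0≤H 0≤Z)) (0≤-* 0≤R (0≤-+ (0≤-* (0≤-* 0≤Dγ 0≤Dγ) (0≤-- hgg)) (0≤-* (0≤-* 0≤αα 0≤αα) 0≤CC)))))
           (0≤-* (0≤-* (0≤-* (0≤-* {+ 6} 0≤ℕ 0≤H) 0≤R) (0≤-* 0≤Dγ 0≤Dγ)) (0≤-* (0≤-* 0≤α 0≤b) (0≤-- hAA))))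
           (0≤-+ (0≤-* (0≤-* {+ 2} 0≤ℕ (0≤-* 0≤Z 0≤αα)) step1)
                 (0≤-* (0≤-* 0≤Z (0≤-* (0≤-* 0≤αα 0≤α) (0≤-* 0≤γ 0≤γ))) step2)))
           (0≤-* (0≤-* (0≤-* {+ 2} 0≤ℕ 0≤R) (0≤-* (0≤-* 0≤Dγ 0≤γ) (0≤-* (0≤-* 0≤αα 0≤α) 0≤b))) (0≤-- hZ)))
       (eq α b γ s R H D Z X gg CC AA))
   where
   0≤α = 1≤⇒0≤ 1≤α
   0≤b = 1≤⇒0≤ 1≤b
   0≤γ = 1≤⇒0≤ 1≤γ
   0≤R = 1≤⇒0≤ 1≤R
   0≤H = 1≤⇒0≤ 1≤H
   0≤T = 1≤⇒0≤ 1≤T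
   0≤D = 1≤⇒0≤ 1≤D
   0≤Z = 1≤⇒0≤ 1≤Z
   0≤Β = 1≤⇒0≤ 1≤Β
   0≤s = 0≤α ⟫ α≤s
   0≤Dγ = 0≤-* 0≤D 0≤γ
   0≤αα = 0≤-* 0≤α 0≤α
   0≤Βα = 0≤-* 0≤Β 0≤α
   0≤Βγ = 0≤-* 0≤Β 0≤γ
   s⁴≤ : s * s * (s * s) ≤ T * (Β * Β * Β * Β) * (α * b * (γ * γ))
   s⁴≤ = ≤-*² (0≤-* 0≤s 0≤s) (0≤-* 0≤Βγ 0≤Βγ) (≤-*² 0≤s (0≤-* 0≤Β (0≤-* 0≤T 0≤b)) sα (sα ⟫ ≤-*ˡ Β 0≤Β αTb)) (≤-*² 0≤s 0≤Βγ sγ sγ) ⟫ ≤r (e Β α T b γ)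
     where
     e : ∀ Β α T b γ -> Β * α * (Β * (T * b)) * (Β * γ * (Β * γ)) ≡ T * (Β * Β * Β * Β) * (α * b * (γ * γ))
     e = solve 5 (λ Β α T b γ -> Β :* α :* (Β :* (T :* b)) :* (Β :* γ :* (Β :* γ)) := T :* (Β :* Β :* Β :* Β) :* (α :* b :* (γ :* γ))) refl
   k≤ : D * γ + α ≤ (D + 1ℤ) * s
   k≤ = Z.+-mono-≤ (≤-*ˡ D 0≤D γ≤s) α≤s ⟫ ≤r (e D s)
     where
     e : ∀ D s -> D * s + s ≡ (D + 1ℤ) * s
     e = solve 2 (λ D s -> D :* s :+ s := (D :+ :1) :* s) refl
   0≤k = 0≤-+ 0≤Dγ 0≤α
   step1 : 0ℤ ≤ R * D * (α * b * (γ * γ)) - + 6 * H * ((D * γ + α) * (D * γ + α) * (s * s))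
   step1 = subst (0ℤ ≤_) (e H D s R (T * (Β * Β * Β * Β)) (α * b * (γ * γ)) (D * γ + α))
      (0≤-+ (0≤-+ (0≤-+ (0≤-* (0≤-* {+ 6} 0≤ℕ 0≤H) (0≤-* (0≤-- (≤-*² 0≤k (0≤k ⟫ k≤) k≤ k≤)) (0≤-sq s)))
         (0≤-* (0≤-* (0≤-* {+ 6} 0≤ℕ 0≤H) (0≤-sq (D + 1ℤ))) (0≤-- s⁴≤)))
         (0≤-* (0≤-* (0≤-* 0≤α 0≤b) (0≤-* 0≤γ 0≤γ)) (0≤-- hR)))
         (0≤-* 0≤R (0≤-* (0≤-* (0≤-* 0≤α 0≤b) (0≤-* 0≤γ 0≤γ)) (0≤-- 1≤D))))
     where
     e : ∀ H D s R t m k -> + 6 * H * (((D + 1ℤ) * s * ((D + 1ℤ) * s) - k * k) * (s * s)) + + 6 * H * ((D + 1ℤ) * (D + 1ℤ)) * (t * m - s * s * (s * s))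
          + m * (R - + 6 * H * ((D + 1ℤ) * (D + 1ℤ)) * t) + R * (m * (D - 1ℤ)) ≡ R * D * m - + 6 * H * (k * k * (s * s))
     e = solve 7 (λ H D s R t m k -> con (+ 6) :* H :* (((D :+ :1) :* s :* ((D :+ :1) :* s) :- k :* k) :* (s :* s)) :+ con (+ 6) :* H :* ((D :+ :1) :* (D :+ :1)) :* (t :* m :- s :* s :* (s :* s)) :+ m :* (R :- con (+ 6) :* H :* ((D :+ :1) :* (D :+ :1)) :* t) :+ R :* (m :* (D :- :1)) := R :* D :* m :- con (+ 6) :* H :* (k :* k :* (s :* s))) refl
   step2 : 0ℤ ≤ + 2 * R * D * b - + 3 * H * (R + 1ℤ) * α
   step2 = subst (0ℤ ≤_) (trans (e R H T b α) (cong (λ z -> + 2 * R * z * b - + 3 * H * (R + 1ℤ) * α) (sym D≡)))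
      (0≤-+ (0≤-* (0≤-* (0≤-* {+ 6} 0≤ℕ 0≤R) 0≤H) (0≤-- αTb)) (0≤-* (0≤-* {+ 3} 0≤ℕ 0≤H) (0≤-* 0≤α (0≤-- 1≤R))))
     where
     e : ∀ R H T b α -> + 6 * R * H * (T * b - α) + + 3 * H * (α * (R - 1ℤ)) ≡ + 2 * R * (+ 3 * H * T) * b - + 3 * H * (R + 1ℤ) * α
     e = solve 5 (λ R H T b α -> con (+ 6) :* R :* H :* (T :* b :- α) :+ con (+ 3) :* H :* (α :* (R :- :1)) := :2 :* R :* (con (+ 3) :* H :* T) :* b :- con (+ 3) :* H :* (R :+ :1) :* α) refl
   eq : ∀ α b γ s R H D Z X gg CC AA -> + 6 * Z * R * (D * γ) * (α * α) * (α * b * γ) ≡ + 6 * Z * R * (D * γ) * (α * α) * (H * X)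
      + (+ 3 * (H * Z) * (+ 4 * ((D * γ * α + α * α) * (D * γ * α + α * α)) * (s * s) + (R + 1ℤ) * (α * α * γ * (α * α * γ)) - R * (D * γ * (D * γ) * gg + + 2 * (D * γ) * (α * α) * X + α * α * (α * α) * CC))
         + + 3 * (H * Z) * (R * (D * γ * (D * γ) * (gg - - (+ 2 * α * b * AA)) + α * α * (α * α) * CC))
         + + 6 * H * R * (D * γ * (D * γ)) * (α * b * (α * α - Z * AA))
         + (+ 2 * (Z * (α * α)) * (R * D * (α * b * (γ * γ)) - + 6 * H * ((D * γ + α) * (D * γ + α) * (s * s)))
           + Z * (α * α * α * (γ * γ)) * (+ 2 * R * D * b - + 3 * H * (R + 1ℤ) * α))
         + + 2 * R * (D * γ * γ * (α * α * α * b)) * (Z - + 3 * H * D))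
   eq = solve 12 (λ α b γ s R H D Z X gg CC AA -> con (+ 6) :* Z :* R :* (D :* γ) :* (α :* α) :* (α :* b :* γ) := con (+ 6) :* Z :* R :* (D :* γ) :* (α :* α) :* (H :* X) :+ (con (+ 3) :* (H :* Z) :* (:4 :* ((D :* γ :* α :+ α :* α) :* (D :* γ :* α :+ α :* α)) :* (s :* s) :+ (R :+ :1) :* (α :* α :* γ :* (α :* α :* γ)) :- R :* (D :* γ :* (D :* γ) :* gg :+ :2 :* (D :* γ) :* (α :* α) :* X :+ α :* α :* (α :* α) :* CC)) :+ con (+ 3) :* (H :* Z) :* (R :* (D :* γ :* (D :* γ) :* (gg :- :- (:2 :* α :* b :* AA)) :+ α :* α :* (α :* α) :* CC)) :+ con (+ 6) :* H :* R :* (D :* γ :* (D :* γ)) :* (α :* b :* (α :* α :- Z :* AA)) :+ (:2 :* (Z :* (α :* α)) :* (R :* D :* (α :* b :* (γ :* γ)) :- con (+ 6) :* H :* ((D :* γ :+ α) :* (D :* γ :+ α) :* (s :* s))) :+ Z :* (α :* α :* α :* (γ :* γ)) :* (:2 :* R :* D :* b :- con (+ 3) :* H :* (R :+ :1) :* α)) :+ :2 :* R :* (D :* γ :* γ :* (α :* α :* α :* b)) :* (Z :- con (+ 3) :* H :* D))) refl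

 module Clones {n : ℕ} (adj : Fin n -> Fin n -> Bool) (adj-sym : ∀ i j -> adj i j ≡ adj j i)
               (y : Fin n -> ℤ) (y≥0 : ∀ u -> 0ℤ ≤ y u) where
   open Dense adj adj-sym
   open Sets adj adj-sym y y≥0

   record Constants (R H T D Z Β : ℤ) : Set where
     field
       1≤R : 1ℤ ≤ R
       1≤H : 1ℤ ≤ H
       1≤T : 1ℤ ≤ T
       1≤Z : 1ℤ ≤ Z
       1≤Β : 1ℤ ≤ Β
       D≡  : D ≡ + 3 * H * T
       Z≥  : + 3 * H * D ≤ Z
       R≥  : + 6 * H * ((D + 1ℤ) * (D + 1ℤ)) * (T * (Β * Β * Β * Β)) ≤ R

   module _ {R H T D Z Β : ℤ} (cst : Constants R H T D Z Β) (1≤Σy : 1ℤ ≤ Σy) (crit : Critical R y) where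
     open Constants cst

     private
       1≤D : 1ℤ ≤ D
       1≤D = subst (1ℤ ≤_) (sym D≡) (1≤-* (1≤-* {+ 3} (+≤+ (ℕ.s≤s ℕ.z≤n)) 1≤H) 1≤T)

       pos : ∀ {a b} -> 0ℤ ≤ b -> 1ℤ ≤ a -> a ≤ Β * b -> 1ℤ ≤ b
       pos {a} {b} 0≤b h k with 1≤⊎≤0 b
       ... | inj₁ q = q
       ... | inj₂ q = ⊥-elim (1≰0 (h ⟫ k ⟫ ≤-*ˡ Β (1≤⇒0≤ 1≤Β) q ⟫ ≤r (Z.*-zeroʳ Β)))

       pos′ : ∀ {a b} -> 0ℤ ≤ b -> 1ℤ ≤ a -> a ≤ T * b -> 1ℤ ≤ b
       pos′ {a} {b} 0≤b h k with 1≤⊎≤0 b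
       ... | inj₁ q = q
       ... | inj₂ q = ⊥-elim (1≰0 (h ⟫ k ⟫ ≤-*ˡ T (1≤⇒0≤ 1≤T) q ⟫ ≤r (Z.*-zeroʳ T)))

     -- A large subset B of a sparse set A sees every large set C with the density with which A sees it:
     -- otherwise shifting weight between B, A and C would increase the density of y.
     clone : ∀ A B C -> B ⊑ A -> Z * ⟪ on A , on A ⟫ ≤ μ A * μ A ->
       μ A ≤ T * μ B -> Σy ≤ Β * μ A -> Σy ≤ Β * μ C ->
       H * (μ B * ⟪ on A , on C ⟫ - μ A * ⟪ on B , on C ⟫) ≤ μ A * μ B * μ C
     clone A B C B⊑A sp αTb sα sγ = clone-arith α b γ Σy R H T D Z Β X gg CC AA 1≤α 1≤b 1≤γ 1≤R 1≤H 1≤T 1≤D 1≤Z 1≤Β (μ≤Σy A) (μ≤Σy C)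
         αTb sα sγ D≡ Z≥ R≥ main gg≥ (0≤⟪⟫ (on C) (on C) (on≥0 C) (on≥0 C)) sp
       where
       α b γ X gg CC AA k l : ℤ
       α = μ A
       b = μ B
       γ = μ C
       g G : Weight
       g u = α * on B u + (- b) * on A u
       X = b * ⟪ on A , on C ⟫ - α * ⟪ on B , on C ⟫
       gg = ⟪ g , g ⟫
       CC = ⟪ on C , on C ⟫
       AA = ⟪ on A , on A ⟫
       k = D * γ
       l = α * α
       -- `g` has total 0 and pairs with C to -X. Subtracting a multiple of C makes the cross term
       -- 2klX positive, and the factor D in k keeps the squared mass of `G` small in comparison.
       G u = k * g u + (- l) * on C u
       1≤α : 1ℤ ≤ α
       1≤α = pos (0≤μ A) 1≤Σy sα
       1≤γ : 1ℤ ≤ γ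
       1≤γ = pos (0≤μ C) 1≤Σy sγ
       1≤b : 1ℤ ≤ b
       1≤b = pos′ (0≤μ B) 1≤α αTb
       0≤α = 0≤μ A
       0≤b = 0≤μ B
       0≤k = 0≤-* (1≤⇒0≤ 1≤D) (0≤μ C)
       0≤l = 0≤-* 0≤α 0≤α
       b≤α : b ≤ α
       b≤α = μ-mono B⊑A
       K : ℤ
       K = k * α + l
       gC : ⟪ g , on C ⟫ ≡ α * ⟪ on B , on C ⟫ - b * ⟪ on A , on C ⟫
       gC = trans (⟪⟫-linˡ α (- b) (on B) (on A) (on C)) (e α b ⟪ on B , on C ⟫ ⟪ on A , on C ⟫)
         where
         e : ∀ α b x y -> α * x + (- b) * y ≡ α * x - b * y
         e = solve 4 (λ α b x y -> α :* x :+ (:- b) :* y := α :* x :- b :* y) refl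
       gg≥ : - (+ 2 * α * b * AA) ≤ gg
       gg≥ = by (0≤-+ (0≤-+ (0≤-* (0≤-* 0≤α 0≤α) (0≤⟪⟫ (on B) (on B) (on≥0 B) (on≥0 B))) (0≤-* (0≤-* 0≤b 0≤b) (0≤⟪⟫ (on A) (on A) (on≥0 A) (on≥0 A))))
              (0≤-* (0≤-* (0≤-* {+ 2} 0≤ℕ 0≤α) 0≤b) (0≤-- (⟪⟫-mono (on≥0 B) (on≥0 A) (on-mono B⊑A) (λ u -> Z.≤-refl {on A u})))))
            (trans (⟪⟫-sq α (- b) (on B) (on A)) (e α b ⟪ on B , on B ⟫ ⟪ on B , on A ⟫ AA))
         where
         e : ∀ α b x y z -> α * α * x + + 2 * α * (- b) * y + (- b) * (- b) * z ≡ - (+ 2 * α * b * z) + (α * α * x + b * b * z + + 2 * α * b * (z - y))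
         e = solve 5 (λ α b x y z -> α :* α :* x :+ :2 :* α :* (:- b) :* y :+ (:- b) :* (:- b) :* z := :- (:2 :* α :* b :* z) :+ (α :* α :* x :+ b :* b :* z :+ :2 :* α :* b :* (z :- y))) refl
       totG : ∑ V G ≡ (- l) * γ
       totG = trans (∑-+ V _ _) (trans (cong₂ _+_ (trans (∑-*ˡ V k g) (cong (k *_) (trans (∑-+ V _ _) (cong₂ _+_ (∑-*ˡ V α (on B)) (∑-*ˡ V (- b) (on A)))))) (∑-*ˡ V (- l) (on C))) (e k α b ((- l) * γ)))
         where
         e : ∀ k α b r -> k * (α * b + (- b) * α) + r ≡ r
         e = solve 4 (λ k α b r -> k :* (α :* b :+ (:- b) :* α) :+ r := r) refl
       main : R * (D * γ * (D * γ) * gg + + 2 * (D * γ) * (α * α) * X + α * α * (α * α) * CC)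
         ≤ + 4 * ((D * γ * α + α * α) * (D * γ * α + α * α)) * (Σy * Σy) + (R + 1ℤ) * (α * α * γ * (α * α * γ))
       main = ≤r (cong (R *_) (sym GG)) ⟫ crit K G 1≤K lo hi ⟫ ≤r (cong (λ z -> + 4 * (K * K) * (Σy * Σy) + (R + 1ℤ) * z) sq)
         where
         GG : ⟪ G , G ⟫ ≡ k * k * gg + + 2 * k * l * X + l * l * CC
         GG = trans (⟪⟫-sq k (- l) g (on C)) (trans (cong (λ z -> k * k * gg + + 2 * k * (- l) * z + (- l) * (- l) * CC) gC)
               (e k l gg α b ⟪ on B , on C ⟫ ⟪ on A , on C ⟫ CC))
           where
           e : ∀ k l gg α b x z CC -> k * k * gg + + 2 * k * (- l) * (α * x - b * z) + (- l) * (- l) * CC ≡ k * k * gg + + 2 * k * l * (b * z - α * x) + l * l * CC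
           e = solve 8 (λ k l gg α b x z CC -> k :* k :* gg :+ :2 :* k :* (:- l) :* (α :* x :- b :* z) :+ (:- l) :* (:- l) :* CC := k :* k :* gg :+ :2 :* k :* l :* (b :* z :- α :* x) :+ l :* l :* CC) refl
         sq : ∑ V G * ∑ V G ≡ l * γ * (l * γ)
         sq = trans (cong (λ z -> z * z) totG) (e l γ)
           where
           e : ∀ l γ -> (- l) * γ * ((- l) * γ) ≡ l * γ * (l * γ)
           e = solve 2 (λ l γ -> (:- l) :* γ :* ((:- l) :* γ) := l :* γ :* (l :* γ)) refl
         1≤K : 1ℤ ≤ K
         1≤K = 1≤-* 1≤α 1≤α ⟫ by (0≤-* 0≤k 0≤α) (Z.+-comm (k * α) l)
         g≤ : ∀ u -> g u ≤ α * y u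
         g≤ u = by (0≤-+ (0≤-* 0≤α (0≤-- (on≤y B u))) (0≤-* 0≤b (on≥0 A u))) (e α b (y u) (on B u) (on A u))
           where
           e : ∀ α b y x z -> α * y ≡ α * x + (- b) * z + (α * (y - x) + b * z)
           e = solve 5 (λ α b y x z -> α :* y := α :* x :+ (:- b) :* z :+ (α :* (y :- x) :+ b :* z)) refl
         g≥ : ∀ u -> - (α * y u) ≤ g u
         g≥ u = by (0≤-+ (0≤-+ (0≤-* 0≤α (on≥0 B u)) (0≤-* 0≤α (0≤-- (on≤y A u)))) (0≤-* (0≤-- b≤α) (on≥0 A u))) (e α b (y u) (on B u) (on A u))
           where
           e : ∀ α b y x z -> α * x + (- b) * z ≡ - (α * y) + (α * x + α * (y - z) + (α - b) * z)
           e = solve 5 (λ α b y x z -> α :* x :+ (:- b) :* z := :- (α :* y) :+ (α :* x :+ α :* (y :- z) :+ (α :- b) :* z)) refl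
         lo : ∀ u -> - (K * y u) ≤ G u
         lo u = by (0≤-+ (0≤-* 0≤k (0≤-- (g≥ u))) (0≤-* 0≤l (0≤-- (on≤y C u)))) (e k α l (y u) (g u) (on C u))
           where
           e : ∀ k α l y g c -> k * g + (- l) * c ≡ - ((k * α + l) * y) + (k * (g - - (α * y)) + l * (y - c))
           e = solve 6 (λ k α l y g c -> k :* g :+ (:- l) :* c := :- ((k :* α :+ l) :* y) :+ (k :* (g :- :- (α :* y)) :+ l :* (y :- c))) refl
         hi : ∀ u -> G u ≤ K * y u
         hi u = by (0≤-+ (0≤-+ (0≤-* 0≤k (0≤-- (g≤ u))) (0≤-* 0≤l (y≥0 u))) (0≤-* 0≤l (on≥0 C u))) (e k α l (y u) (g u) (on C u))
           where
           e : ∀ k α l y g c -> (k * α + l) * y ≡ k * g + (- l) * c + (k * (α * y - g) + l * y + l * c)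
           e = solve 6 (λ k α l y g c -> (k :* α :+ l) :* y := k :* g :+ (:- l) :* c :+ (k :* (α :* y :- g) :+ l :* y :+ l :* c)) refl

     -- Two applications of `clone`: first B is replaced by A₁ as seen from C, then C by A₂ as seen
     -- from A₁. Each loses 1/H in density. Only this lower bound on the density of the subsets is
     -- wanted for embedding.
     regular-pair : ∀ A₁ A₂ B C -> B ⊑ A₁ -> C ⊑ A₂ ->
       Z * ⟪ on A₁ , on A₁ ⟫ ≤ μ A₁ * μ A₁ -> Z * ⟪ on A₂ , on A₂ ⟫ ≤ μ A₂ * μ A₂ ->
       μ A₁ ≤ T * μ B -> μ A₂ ≤ T * μ C -> Σy ≤ Β * μ A₁ -> Σy ≤ Β * μ A₂ -> Σy ≤ Β * μ C ->
       (H * ⟪ on A₁ , on A₂ ⟫ - + 2 * (μ A₁ * μ A₂)) * (μ B * μ C) ≤ H * (μ A₁ * μ A₂) * ⟪ on B , on C ⟫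
     regular-pair A₁ A₂ B C B⊑ C⊑ sp₁ sp₂ hB hC s₁ s₂ sC =
       by (0≤-+ (0≤-* (0≤μ A₂) (0≤-- (clone A₁ B C B⊑ sp₁ hB s₁ sC)))
                (0≤-* (0≤μ B) (0≤-- (clone A₂ C A₁ C⊑ sp₂ hC s₂ s₁))))
         (trans (e H (μ A₁) (μ A₂) (μ B) (μ C) ⟪ on B , on C ⟫ ⟪ on A₁ , on C ⟫ ⟪ on A₁ , on A₂ ⟫)
           (cong₂ (λ p q -> (H * ⟪ on A₁ , on A₂ ⟫ - + 2 * (μ A₁ * μ A₂)) * (μ B * μ C)
              + (μ A₂ * (μ A₁ * μ B * μ C - H * (μ B * ⟪ on A₁ , on C ⟫ - μ A₁ * ⟪ on B , on C ⟫)) + μ B * (μ A₂ * μ C * μ A₁ - H * (μ C * q - μ A₂ * p))))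
             (⟪⟫-sym (on A₁) (on C)) (⟪⟫-sym (on A₁) (on A₂))))
       where
       e : ∀ H α β b c bc ac w -> H * (α * β) * bc ≡ (H * w - + 2 * (α * β)) * (b * c)
          + (β * (α * b * c - H * (b * ac - α * bc)) + b * (β * c * α - H * (c * w - β * ac)))
       e = solve 8 (λ H α β b c bc ac w -> H :* (α :* β) :* bc := (H :* w :- :2 :* (α :* β)) :* (b :* c) :+ (β :* (α :* b :* c :- H :* (b :* ac :- α :* bc)) :+ b :* (β :* c :* α :- H :* (c :* w :- β :* ac)))) refl

 -- Embedding a clique along a weighted clique

 AllPairs-⊆ : ∀ {A : Set} {R : A -> A -> Set} {xs ys : List A} -> xs ⊆ ys -> AllPairs R ys -> AllPairs R xs
 AllPairs-⊆ Sub.[] [] = []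
 AllPairs-⊆ (y ∷ʳ τ) (_ ∷ r) = AllPairs-⊆ τ r
 AllPairs-⊆ (refl ∷ τ) (h ∷ r) = Subₚ.All-resp-⊆ τ h ∷ AllPairs-⊆ τ r

 module Embed {n : ℕ} (adj : Fin n -> Fin n -> Bool) (adj-sym : ∀ i j -> adj i j ≡ adj j i)
              (y : Fin n -> ℤ) (y≥0 : ∀ u -> 0ℤ ≤ y u)
              (pn : ℕ) (2≤p : + 2 ≤ + pn) (p≤4 : + pn ≤ + 4) (k : ℕ) (p≤4k : + pn ≤ + 4 * + k) where
   open Dense adj adj-sym
   open Sets adj adj-sym y y≥0
   open Turan (+ pn) 2≤p p≤4

   p : ℤ
   p = + pn

   -- The loss in passing to a common neighbourhood: 4k for averaging over the target cluster, 2^p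
   -- for fixing which members of a p-clique are adjacent.
   Φ : ℤ
   Φ = + (4 ℕ.* k ℕ.* 2 ℕ.^ pn)

   1≤k : 1ℤ ≤ + k
   1≤k with 1≤⊎≤0 (+ k)
   ... | inj₁ h = h
   ... | inj₂ h = ⊥-elim (1≰0 (1≤p ⟫ p≤4k ⟫ ≤-*ˡ (+ 4) 0≤ℕ h))

   2^p≥1 : 1ℤ ≤ + (2 ℕ.^ pn)
   2^p≥1 = +≤+ (N.m^n>0 2 pn)

   Φ≡ : Φ ≡ + 4 * + k * + (2 ℕ.^ pn)
   Φ≡ = trans (Z.pos-* (4 ℕ.* k) (2 ℕ.^ pn)) (cong (_* + (2 ℕ.^ pn)) (Z.pos-* 4 k))

   4k≤Φ : + 4 * + k ≤ Φ
   4k≤Φ = ≤r (sym (Z.*-identityʳ (+ 4 * + k))) ⟫ ≤-*ˡ (+ 4 * + k) (0≤-* {+ 4} {+ k} 0≤ℕ 0≤ℕ) 2^p≥1 ⟫ ≤r (sym Φ≡)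

   1≤Φ : 1ℤ ≤ Φ
   1≤Φ = 1≤-* {+ 4} (+≤+ (ℕ.s≤s ℕ.z≤n)) 1≤k ⟫ 4k≤Φ

   common : Subset -> List (Fin n) -> Subset
   common S [] = S
   common S (x ∷ xs) = common S xs ∩ adj x

   common⊑ : ∀ S xs -> common S xs ⊑ S
   common⊑ S [] u h = h
   common⊑ S (x ∷ xs) u h = common⊑ S xs u (∧-trueˡ h)

   common-adj : ∀ S xs u -> common S xs u ≡ true -> All (λ x -> adj x u ≡ true) xs
   common-adj S [] u h = []
   common-adj S (x ∷ xs) u h = ∧-trueʳ {common S xs u} h ∷ common-adj S xs u (∧-trueˡ h)

   common-mono : ∀ {S T} xs -> S ⊑ T -> common S xs ⊑ common T xs
   common-mono [] h = h
   common-mono (x ∷ xs) h u q = ∧-true (common-mono xs h u (∧-trueˡ q)) (∧-trueʳ q)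

   common-⊆ : ∀ S {xs ys} -> xs ⊆ ys -> common S ys ⊑ common S xs
   common-⊆ S Sub.[] u h = h
   common-⊆ S (y ∷ʳ τ) u h = common-⊆ S τ u (∧-trueˡ h)
   common-⊆ S (refl ∷ τ) u h = ∧-true (common-⊆ S τ u (∧-trueˡ h)) (∧-trueʳ h)

   hits : List (Fin n) -> Fin n -> ℤ
   hits xs u = ∑ xs (λ x -> ind (adj x u))

   -- Splitting by adjacency to each x in turn and keeping the heavier half.
   trace : ∀ xs S -> ∃ λ ys -> ys ⊆ xs × ∃ λ S′ -> S′ ⊑ common S ys × (∀ u -> S′ u ≡ true -> hits xs u ≡ + length ys)
     × μ S ≤ + (2 ℕ.^ length xs) * μ S′
   trace [] S = [] , Sub.[] , S , (λ u h -> h) , (λ u h -> refl) , ≤r (sym (Z.*-identityˡ (μ S)))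
   trace (x ∷ xs) S with μ (S ∖ adj x) Z.≤? μ (S ∩ adj x)
   ... | yes h with trace xs (S ∩ adj x)
   ...   | ys , τ , S′ , sub , hit , big = x ∷ ys , refl ∷ τ , S′
       , (λ u q -> ∧-true (common-mono ys (λ v r -> ∧-trueˡ r) u (sub u q)) (∧-trueʳ {S u} (common⊑ (S ∩ adj x) ys u (sub u q))))
       , (λ u q -> cong₂ (λ b r -> ind b + r) (∧-trueʳ {S u} (common⊑ (S ∩ adj x) ys u (sub u q))) (hit u q))
       , (≤r (μ-split S (adj x)) ⟫ by (0≤-+ (0≤-- h) (0≤-* {+ 2} 0≤ℕ (0≤-- big))) (trans (cong (_* μ S′) (pow-suc 2 (length xs))) (e (μ (S ∩ adj x)) (μ (S ∖ adj x)) (+ (2 ℕ.^ length xs)) (μ S′))))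
     where
     e : ∀ a b t s -> + 2 * t * s ≡ a + b + (a - b + + 2 * (t * s - a))
     e = solve 4 (λ a b t s -> :2 :* t :* s := a :+ b :+ (a :- b :+ :2 :* (t :* s :- a))) refl
   trace (x ∷ xs) S | no h with trace xs (S ∖ adj x)
   ...   | ys , τ , S′ , sub , hit , big = ys , x ∷ʳ τ , S′
       , (λ u q -> common-mono ys (λ v r -> ∧-trueˡ r) u (sub u q))
       , (λ u q -> cong₂ (λ b r -> ind b + r) (not-true (∧-trueʳ {S u} (common⊑ (S ∖ adj x) ys u (sub u q)))) (hit u q) ⟨≡⟩ Z.+-identityˡ _)
       , (≤r (μ-split S (adj x)) ⟫ by (0≤-+ (0≤-- (Z.<⇒≤ (Z.≰⇒> h))) (0≤-* {+ 2} 0≤ℕ (0≤-- big))) (trans (cong (_* μ S′) (pow-suc 2 (length xs))) (e (μ (S ∩ adj x)) (μ (S ∖ adj x)) (+ (2 ℕ.^ length xs)) (μ S′))))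
     where
     e : ∀ a b t s -> + 2 * t * s ≡ a + b + (b - a + + 2 * (t * s - b))
     e = solve 4 (λ a b t s -> :2 :* t :* s := a :+ b :+ (b :- a :+ :2 :* (t :* s :- b))) refl
     not-true : ∀ {b} -> not b ≡ true -> b ≡ false
     not-true {false} _ = refl
     _⟨≡⟩_ : ∀ {a b c : ℤ} -> a ≡ b -> b ≡ c -> a ≡ c
     _⟨≡⟩_ = trans

   member : ∀ S -> 1ℤ ≤ μ S -> ∃ λ u -> S u ≡ true
   member S h with ∑-pick V {λ _ -> 0ℤ} {on S} (≤r (cong (_+ 1ℤ) (∑-zero V)) ⟫ h)
   ... | u , _ , q with S u in eq
   ...   | true = u , eq
   ...   | false = ⊥-elim (1≰0 (q ⟫ ≤r (Z.*-zeroˡ (y u))))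

   Rich : ℤ -> Subset -> Fin n -> Set
   Rich e B x = (+ 4 * + k * (p - e - 1ℤ) + p) * μ B ≤ + 4 * + k * p * degree B x

   -- If every x in xs sees B with density more than (p - e - 1) / p, then at least |xs| - e of the x
   -- have a common neighbourhood of positive density in B.
   pick : ∀ e B xs -> 0ℤ ≤ e -> e + 1ℤ ≤ p -> 1 ℕ.≤ length xs -> + length xs ≤ p -> 1ℤ ≤ μ B -> All (Rich e B) xs ->
     ∃ λ ys -> ys ⊆ xs × (1ℤ ⊔ (+ length xs - e)) ≤ + length ys × μ B ≤ Φ * μ (common B ys)
   pick e B (x ∷ xs) 0≤e e<p _ len 1≤B (rx ∷ rs) with + length (x ∷ xs) Z.≤? e
   -- With at most `e` vertices left only the guaranteed single vertex is kept. Because e < p,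
   -- richness still gives it a neighbourhood of positive density.
   ... | yes h = x ∷ [] , refl ∷ Sub.minimum xs , Z.⊔-lub Z.≤-refl (by (0≤-+ (0≤-- h) (0≤ℕ {1})) (e₁ (+ length (x ∷ xs)) e)) ,
        (≤-cancelˡ p 1≤p (by (0≤-+ (0≤-+ (0≤-- rx) (0≤-* (0≤-* (0≤-* {+ 4} {+ k} 0≤ℕ 0≤ℕ) (0≤-- e<p)) (1≤⇒0≤ 1≤B))) (0≤-* (0≤-- 4k≤Φ) (0≤-* 0≤p (0≤μ (common B (x ∷ []))))))
            (trans (e₂ p e (+ k) (μ B) (μ (B ∩ adj x)) Φ) (cong (λ z -> p * μ B + (+ 4 * + k * p * z - (+ 4 * + k * (p - e - 1ℤ) + p) * μ B + + 4 * + k * (p - (e + 1ℤ)) * μ B + (Φ - + 4 * + k) * (p * μ (B ∩ adj x)))) (sym (degree-∩ B x))))))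
     where
     e₁ : ∀ l e -> 1ℤ ≡ l - e + (e - l + 1ℤ)
     e₁ = solve 2 (λ l e -> :1 := l :- e :+ (e :- l :+ :1)) refl
     e₂ : ∀ p e k b d Φ -> p * (Φ * d) ≡ p * b + (+ 4 * k * p * d - (+ 4 * k * (p - e - 1ℤ) + p) * b + + 4 * k * (p - (e + 1ℤ)) * b + (Φ - + 4 * k) * (p * d))
     e₂ = solve 6 (λ p e k b d Φ -> p :* (Φ :* d) := p :* b :+ (:4 :* k :* p :* d :- (:4 :* k :* (p :- e :- :1) :+ p) :* b :+ :4 :* k :* (p :- (e :+ :1)) :* b :+ (Φ :- :4 :* k) :* (p :* d))) refl
   ... | no h = go (trace l S)
     where
     l : List (Fin n)
     l = x ∷ xs
     N : ℤ
     N = + length l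
     -- Selects the vertices that miss at most `e` members of the clique. Counting non-adjacencies
     -- in two ways shows below that they carry at least 1/(4k) of the mass of `B`.
     test : Fin n -> Bool
     test u = does ((N - hits l u) Z.≤? e)
     S : Subset
     S = B ∩ test
     test-true : ∀ u -> test u ≡ true -> N - hits l u ≤ e
     test-true u q with (N - hits l u) Z.≤? e
     ... | yes r = r
     hits≤ : ∀ l u -> hits l u ≤ + length l
     hits≤ l u = ∑-mono l (λ x -> ind≤1 (adj x u)) ⟫ ≤r (trans (∑-const l 1ℤ) (Z.*-identityʳ (+ length l)))
     pointwise : ∀ u -> (e + 1ℤ) * (on B u - on S u) ≤ on B u * (N - hits l u)
     pointwise u with B u | (N - hits l u) Z.≤? e
     ... | true | yes q = ≤r (e₁ (e + 1ℤ) (y u)) ⟫ 0≤-* (0≤-* {1ℤ} 0≤ℕ (y≥0 u)) (0≤-- (hits≤ l u))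
       where
       e₁ : ∀ a y -> a * (1ℤ * y - 1ℤ * y) ≡ 0ℤ
       e₁ = solve 2 (λ a y -> a :* (:1 :* y :- :1 :* y) := :0) refl
     ... | true | no q = by (0≤-* (y≥0 u) (0≤-- (≰⇒≥1 q))) (e₁ e (y u) (N - hits l u))
       where
       e₁ : ∀ e y m -> 1ℤ * y * m ≡ (e + 1ℤ) * (1ℤ * y - 0ℤ * y) + y * (m - (e + 1ℤ))
       e₁ = solve 3 (λ e y m -> :1 :* y :* m := (e :+ :1) :* (:1 :* y :- :0 :* y) :+ y :* (m :- (e :+ :1))) refl
     ... | false | _ = ≤r (e₁ (e + 1ℤ) (y u) (N - hits l u))
       where
       e₁ : ∀ a y m -> a * (0ℤ * y - 0ℤ * y) ≡ 0ℤ * y * m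
       e₁ = solve 3 (λ a y m -> a :* (:0 :* y :- :0 :* y) := :0 :* y :* m) refl
     degs : ℤ
     degs = ∑ l (degree B)
     double : ∑ V (λ u -> on B u * (N - hits l u)) ≡ N * μ B - degs
     double = trans (∑-cong V (λ u -> e₁ (on B u) N (hits l u))) (trans (∑-- V (λ u -> N * on B u) (λ u -> on B u * hits l u)) (cong₂ _-_ (∑-*ˡ V N (on B))
        (trans (∑-cong V (λ u -> trans (sym (∑-*ˡ l (on B u) (λ x -> ind (adj x u)))) (∑-cong l (λ x -> Z.*-comm (on B u) (ind (adj x u)))))) (∑-swap V l (λ u x -> ind (adj x u) * on B u)))))
       where
       e₁ : ∀ b N h -> b * (N - h) ≡ N * b - b * h
       e₁ = solve 3 (λ b N h -> b :* (N :- h) := N :* b :- b :* h) refl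
     mass : (e + 1ℤ) * (μ B - μ S) ≤ N * μ B - degs
     mass = ≤r (trans (cong ((e + 1ℤ) *_) (sym (∑-- V (on B) (on S)))) (sym (∑-*ˡ V (e + 1ℤ) _))) ⟫ ∑-mono V pointwise ⟫ ≤r double
     degs≥ : N * ((+ 4 * + k * (p - e - 1ℤ) + p) * μ B) ≤ + 4 * + k * p * degs
     degs≥ = ≤r (sym (∑-const l _)) ⟫ ∑-mono∈ l (λ z m -> All.lookup (rx ∷ rs) m) ⟫ ≤r (∑-*ˡ l (+ 4 * + k * p) (degree B))
     μB≤ : μ B ≤ + 4 * + k * μ S
     μB≤ = ≤-cancelˡ p 1≤p (≤-cancelˡ p 1≤p (by (0≤-+ (0≤-+ (0≤-+ (0≤-* (0≤-* (0≤-* {+ 4} {+ k} 0≤ℕ 0≤ℕ) 0≤p) (0≤-- mass)) (0≤-- degs≥))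
           (0≤-* (0≤-* (0≤-- len) (1≤⇒0≤ 1≤B)) (0≤-+ (0≤-- p≤4k) (0≤-* (0≤-* {+ 4} {+ k} 0≤ℕ 0≤ℕ) 0≤e))))
           (0≤-* (0≤-* (0≤-* (0≤-* {+ 4} {+ k} 0≤ℕ 0≤ℕ) 0≤p) (0≤-- e<p)) (0≤μ S)))
         (e₁ p (+ k) e N (μ B) (μ S) degs)))
       where
       e₁ : ∀ p k e N b s d -> p * (p * (+ 4 * k * s)) ≡ p * (p * b) +
          (+ 4 * k * p * (N * b - d - (e + 1ℤ) * (b - s)) + (+ 4 * k * p * d - N * ((+ 4 * k * (p - e - 1ℤ) + p) * b))
            + (p - N) * b * (+ 4 * k - p + + 4 * k * e) + + 4 * k * p * (p - (e + 1ℤ)) * s)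
       e₁ = solve 7 (λ p k e N b s d -> p :* (p :* (:4 :* k :* s)) := p :* (p :* b) :+ (:4 :* k :* p :* (N :* b :- d :- (e :+ :1) :* (b :- s)) :+ (:4 :* k :* p :* d :- N :* ((:4 :* k :* (p :- e :- :1) :+ p) :* b)) :+ (p :- N) :* b :* (:4 :* k :- p :+ :4 :* k :* e) :+ :4 :* k :* p :* (p :- (e :+ :1)) :* s)) refl
     go : (∃ λ ys -> ys ⊆ l × ∃ λ S′ -> S′ ⊑ common S ys × (∀ u -> S′ u ≡ true -> hits l u ≡ + length ys) × μ S ≤ + (2 ℕ.^ length l) * μ S′) ->
        ∃ λ ys -> ys ⊆ l × (1ℤ ⊔ (+ length l - e)) ≤ + length ys × μ B ≤ Φ * μ (common B ys)
     go (ys , τ , S′ , sub , hit , big) = ys , τ , Z.⊔-lub (by (0≤-+ (0≤-- (≰⇒≥1 h)) (0≤-- many)) (e₁ N e (+ length ys))) many , final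
       where
       big′ : μ S ≤ + (2 ℕ.^ pn) * μ S′
       big′ = big ⟫ ≤-*ʳ (μ S′) (0≤μ S′) (+≤+ (N.^-monoʳ-≤ 2 (Z.drop‿+≤+ len)))
       chain : μ B ≤ Φ * μ S′
       chain = μB≤ ⟫ ≤-*ˡ (+ 4 * + k) (0≤-* {+ 4} {+ k} 0≤ℕ 0≤ℕ) big′ ⟫ ≤r (trans (sym (Z.*-assoc (+ 4 * + k) _ _)) (cong (_* μ S′) (sym Φ≡)))
       1≤S′ : 1ℤ ≤ μ S′
       1≤S′ with 1≤⊎≤0 (μ S′)
       ... | inj₁ q = q
       ... | inj₂ q = ⊥-elim (1≰0 (1≤B ⟫ chain ⟫ ≤-*ˡ Φ 0≤ℕ q ⟫ ≤r (Z.*-zeroʳ Φ)))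
       u : Fin n
       u = proj₁ (member S′ 1≤S′)
       S′u : S′ u ≡ true
       S′u = proj₂ (member S′ 1≤S′)
       many : N - e ≤ + length ys
       many = by (0≤-- (test-true u (∧-trueʳ {B u} (common⊑ S ys u (sub u S′u))))) (trans (sym (hit u S′u)) (e₂ N (hits l u) e))
         where
         e₂ : ∀ N h e -> h ≡ N - e + (e - (N - h))
         e₂ = solve 3 (λ N h e -> h := N :- e :+ (e :- (N :- h))) refl
       e₁ : ∀ N e y -> y ≡ 1ℤ + (N - (e + 1ℤ) + (y - (N - e)))
       e₁ = solve 3 (λ N e y -> y := :1 :+ (N :- (e :+ :1) :+ (y :- (N :- e)))) refl
       final : μ B ≤ Φ * μ (common B ys)
       final = chain ⟫ ≤-*ˡ Φ 0≤ℕ (μ-mono (λ v q -> common-mono ys (λ w r -> ∧-trueˡ r) v (sub v q)))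

   -- `pick` is applied to one cluster after another, the survivors of each round being the clique
   -- of the next, so the losses `e j` add up. Common neighbourhoods found earlier only grow when
   -- the clique is thinned further.
   process : ∀ {I : Set} (e : I -> ℤ) (B : I -> Subset) (js : List I) xs -> All (λ j -> 0ℤ ≤ e j × e j + 1ℤ ≤ p × 1ℤ ≤ μ (B j)) js ->
     1 ℕ.≤ length xs -> + length xs ≤ p -> All (λ j -> All (Rich (e j) (B j)) xs) js ->
     ∃ λ zs -> zs ⊆ xs × (1ℤ ⊔ (+ length xs - ∑ js e)) ≤ + length zs × All (λ j -> μ (B j) ≤ Φ * μ (common (B j) zs)) js
   process e B [] xs [] 1≤l len [] = xs , Sub.⊆-refl , Z.⊔-lub (+≤+ 1≤l) (≤r (Z.+-identityʳ _)) , []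
   process e B (j ∷ js) xs ((0≤e , e<p , 1≤B) ∷ hs) 1≤l len (r ∷ rs) with pick (e j) (B j) xs 0≤e e<p 1≤l len 1≤B r
   ... | ys , τ , many , big with process e B js ys hs (Z.drop‿+≤+ (Z.i≤i⊔j 1ℤ _ ⟫ many)) (+≤+ (Subₚ.length-mono-≤ τ) ⟫ len) (All.map (Subₚ.All-resp-⊆ τ) rs)
   ...   | zs , τ′ , many′ , bigs = zs , Sub.⊆-trans τ′ τ , Z.⊔-lub (Z.i≤i⊔j 1ℤ _ ⟫ many′)
           (by (0≤-+ (0≤-- (Z.i≤j⊔i 1ℤ (+ length xs - e j) ⟫ many)) (0≤-- (Z.i≤j⊔i 1ℤ (+ length ys - ∑ js e) ⟫ many′))) (e₁ (+ length xs) (+ length ys) (+ length zs) (e j) (∑ js e)))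
           , (big ⟫ ≤-*ˡ Φ 0≤ℕ (μ-mono (common-⊆ (B j) τ′))) ∷ bigs
     where
     e₁ : ∀ x y z e s -> z ≡ x - (e + s) + (y - (x - e) + (z - (y - s)))
     e₁ = solve 5 (λ x y z e s -> z := x :- (e :+ s) :+ (y :- (x :- e) :+ (z :- (y :- s)))) refl

   module Clusters {m : ℕ} (A : Fin m -> Subset) (e : Fin m -> Fin m -> ℤ) (e≥0 : ∀ i j -> 0ℤ ≤ e i j)
     (T : ℤ) (Q : ℕ) (A≥1 : ∀ i -> 1ℤ ≤ μ (A i))
     (pair : ∀ i j -> e i j + 1ℤ ≤ p -> ∀ B C -> B ⊑ A i -> C ⊑ A j -> μ (A i) ≤ T * μ B -> μ (A j) ≤ T * μ C ->
        (+ 2 * + k * (p - e i j - 1ℤ) + p) * (μ B * μ C) ≤ + 2 * + k * p * ⟪ on B , on C ⟫)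
     (cliques : ∀ i S -> S ⊑ A i -> μ (A i) ≤ T * μ S -> (∀ l -> Clique l -> Inside S l -> length l ≡ pn -> ⊥) -> ⊥) where

     private
       pos : ∀ {c a b} -> 0ℤ ≤ c -> 1ℤ ≤ a -> a ≤ c * b -> 1ℤ ≤ b
       pos {c} {a} {b} 0≤c h k with 1≤⊎≤0 b
       ... | inj₁ q = q
       ... | inj₂ q = ⊥-elim (1≰0 (h ⟫ k ⟫ ≤-*ˡ c 0≤c q ⟫ ≤r (Z.*-zeroʳ c)))

     module Good (0≤T : 0ℤ ≤ T) (i : Fin m) (B : Fin m -> Subset) (Bi⊑ : B i ⊑ A i) where

       -- The threshold lies 1/(4k) above (p - e - 1)/p, half of the slack 1/(2k) granted by `pair`;
       -- the other half makes bad vertices rare.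
       dens : Fin m -> Subset
       dens j x = does ((+ 4 * + k * (p - e i j - 1ℤ) + p) * μ (B j) Z.≤? + 4 * + k * p * degree (B j) x)

       good : List (Fin m) -> Subset
       good [] = B i
       good (j ∷ js) = good js ∩ dens j

       good⊑ : ∀ js -> good js ⊑ B i
       good⊑ [] u h = h
       good⊑ (j ∷ js) u h = good⊑ js u (∧-trueˡ h)

       good-rich : ∀ js x -> good js x ≡ true -> All (λ j -> Rich (e i j) (B j) x) js
       good-rich [] x h = []
       good-rich (j ∷ js) x h = rich (∧-trueʳ {good js x} h) ∷ good-rich js x (∧-trueˡ h)
         where
         rich : dens j x ≡ true -> Rich (e i j) (B j) x
         rich q with (+ 4 * + k * (p - e i j - 1ℤ) + p) * μ (B j) Z.≤? + 4 * + k * p * degree (B j) x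
         ... | yes r = r

       -- If the vertices of low degree into `B j` were numerous, they would themselves be an
       -- admissible subset of `A i`, and their density to `B j` would contradict `pair`.
       few-bad : ∀ S j -> S ⊑ A i -> B j ⊑ A j -> e i j + 1ℤ ≤ p -> μ (A j) ≤ T * μ (B j) -> T * μ (S ∖ dens j) ≤ μ (A i)
       few-bad S j S⊑ Bj⊑ e<p hj with T * μ (S ∖ dens j) Z.≤? μ (A i)
       ... | yes h = h
       ... | no h = ⊥-elim (absurd _ (p * (b * β) - 1ℤ)
              (0≤-+ (0≤-* {+ 2} 0≤ℕ (0≤-- (pair i j e<p bad (B j) bad⊑ Bj⊑ Ai≤ hj))) (0≤-- upper))
              (0≤-- (1≤-* 1≤p (1≤-* (pos 0≤T (A≥1 i) Ai≤) (pos 0≤T (A≥1 j) hj)))) (e₁ (+ k) p (e i j) b β ⟪ on bad , on (B j) ⟫))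
         where
         bad : Subset
         bad = S ∖ dens j
         bad⊑ : bad ⊑ A i
         bad⊑ u q = S⊑ u (∧-trueˡ q)
         Ai≤ : μ (A i) ≤ T * μ bad
         Ai≤ = Z.<⇒≤ (Z.≰⇒> h)
         b β : ℤ
         b = μ bad
         β = μ (B j)
         e₁ : ∀ k p e b β w -> + 2 * (+ 2 * k * p * w - (+ 2 * k * (p - e - 1ℤ) + p) * (b * β)) + (b * ((+ 4 * k * (p - e - 1ℤ) + p) * β) - + 4 * k * p * w) + (p * (b * β) - 1ℤ) ≡ -[1+ 0 ]
         e₁ = solve 6 (λ k p e b β w -> :2 :* (:2 :* k :* p :* w :- (:2 :* k :* (p :- e :- :1) :+ p) :* (b :* β)) :+ (b :* ((:4 :* k :* (p :- e :- :1) :+ p) :* β) :- :4 :* k :* p :* w) :+ (p :* (b :* β) :- :1) := con -[1+ 0 ]) refl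
         upper : + 4 * + k * p * ⟪ on bad , on (B j) ⟫ ≤ b * ((+ 4 * + k * (p - e i j - 1ℤ) + p) * β)
         upper = ≤r (sym (∑-*ˡ V (+ 4 * + k * p) _)) ⟫ ∑-mono V pt ⟫ ≤r (∑-*ʳ V _ (on bad))
           where
           e₂ : ∀ a w d -> a * (w * d) ≡ w * (a * d)
           e₂ = solve 3 (λ a w d -> a :* (w :* d) := w :* (a :* d)) refl
           pt : ∀ u -> + 4 * + k * p * (on bad u * degree (B j) u) ≤ on bad u * ((+ 4 * + k * (p - e i j - 1ℤ) + p) * β)
           pt u = ≤r (e₂ (+ 4 * + k * p) (on bad u) (degree (B j) u)) ⟫ inner
             where
             inner : on bad u * (+ 4 * + k * p * degree (B j) u) ≤ on bad u * ((+ 4 * + k * (p - e i j - 1ℤ) + p) * β)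
             inner with S u | (+ 4 * + k * (p - e i j - 1ℤ) + p) * μ (B j) Z.≤? + 4 * + k * p * degree (B j) u
             ... | true | yes _ = ≤r (trans (cong (_* (+ 4 * + k * p * degree (B j) u)) (Z.*-zeroˡ (y u))) (sym (trans (cong (_* ((+ 4 * + k * (p - e i j - 1ℤ) + p) * β)) (Z.*-zeroˡ (y u))) refl)))
             ... | true | no q = ≤-*ˡ (1ℤ * y u) (0≤-* {1ℤ} 0≤ℕ (y≥0 u)) (Z.<⇒≤ (Z.≰⇒> q))
             ... | false | _ = ≤r (trans (cong (_* (+ 4 * + k * p * degree (B j) u)) (Z.*-zeroˡ (y u))) (sym (trans (cong (_* ((+ 4 * + k * (p - e i j - 1ℤ) + p) * β)) (Z.*-zeroˡ (y u))) refl)))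

       good-large : ∀ js -> All (λ j -> B j ⊑ A j × e i j + 1ℤ ≤ p × μ (A j) ≤ T * μ (B j)) js ->
         T * μ (B i) ≤ T * μ (good js) + + length js * μ (A i)
       good-large [] [] = ≤r (sym (trans (cong (λ z -> T * μ (B i) + z) (Z.*-zeroˡ (μ (A i)))) (Z.+-identityʳ _)))
       good-large (j ∷ js) ((Bj⊑ , e<p , hj) ∷ hs) = by (0≤-+ (0≤-- (good-large js hs)) (0≤-- (few-bad (good js) j (λ u q -> Bi⊑ u (good⊑ js u q)) Bj⊑ e<p hj)))
          (trans (e₁ T (μ (B i)) (μ (good js ∩ dens j)) (μ (good js ∖ dens j)) (+ length js) (μ (A i))) (cong (λ z -> T * μ (B i) + (T * z + + length js * μ (A i) - T * μ (B i) + (μ (A i) - T * μ (good js ∖ dens j)))) (sym (μ-split (good js) (dens j)))))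
         where
         e₁ : ∀ T b g h l a -> T * g + (1ℤ + l) * a ≡ T * b + (T * (g + h) + l * a - T * b + (a - T * h))
         e₁ = solve 6 (λ T b g h l a -> T :* g :+ (:1 :+ l) :* a := T :* b :+ (T :* (g :+ h) :+ l :* a :- T :* b :+ (a :- T :* h))) refl

     -- Induction along the list: a K_p is found among the vertices of the first cluster that are
     -- rich for all later ones, thinned by `process`, and the rest of the clique is built inside
     -- the common neighbourhoods `B′`. `Tc` records how far the sets `B i` have shrunk; each round
     -- multiplies it by Φ, and `T` is chosen to withstand all rounds.
     embed : ∀ L -> Valid e L -> ∀ (B : Fin m -> Subset) Tc -> 1ℤ ≤ Tc -> All (λ i -> B i ⊑ A i × μ (A i) ≤ Tc * μ (B i)) L ->
       + length L ≤ + Q -> (+ Q + 1ℤ) * (+ (∣ Φ ∣ ℕ.^ length L) * Tc) ≤ T ->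
       (∀ l -> Clique l -> All (λ u -> Any (λ i -> B i u ≡ true) L) l -> value e L ≤ + length l -> ⊥) -> ⊥
     embed [] _ B Tc 1≤Tc [] len hT out = out [] [] [] Z.≤-refl
     embed (i ∷ js) (vi ∷ vs) B Tc 1≤Tc ((Bi⊑ , hi) ∷ hs) len hT out = cliques i X (λ u q -> Bi⊑ u (good⊑ js u q)) X-large found
       where
       pw : ℤ
       pw = + (∣ Φ ∣ ℕ.^ length js)
       1≤pw : 1ℤ ≤ pw
       1≤pw = +≤+ (N.m^n>0 ∣ Φ ∣ {{ℕ.>-nonZero (Z.drop‿+≤+ 1≤Φ)}} (length js))
       0≤Tc = 1≤⇒0≤ 1≤Tc
       pw-suc : + (∣ Φ ∣ ℕ.^ suc (length js)) ≡ Φ * pw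
       pw-suc = pow-suc ∣ Φ ∣ (length js)
       0≤Q+1 : 0ℤ ≤ + Q + 1ℤ
       0≤Q+1 = 0≤-+ (0≤ℕ {Q}) (0≤ℕ {1})
       QTc≤T : (+ Q + 1ℤ) * Tc ≤ T
       QTc≤T = ≤-*ˡ (+ Q + 1ℤ) 0≤Q+1 (≤r (sym (Z.*-identityˡ Tc)) ⟫ ≤-*ʳ Tc 0≤Tc (1≤-* 1≤Φ 1≤pw ⟫ ≤r (sym pw-suc))) ⟫ hT
       Tc≤T : Tc ≤ T
       Tc≤T = by (0≤-* (0≤ℕ {Q}) 0≤Tc) (e₁ (+ Q) Tc) ⟫ QTc≤T
         where
         e₁ : ∀ Q t -> (Q + 1ℤ) * t ≡ t + Q * t
         e₁ = solve 2 (λ Q t -> (Q :+ :1) :* t := t :+ Q :* t) refl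
       0≤T : 0ℤ ≤ T
       0≤T = 0≤Tc ⟫ Tc≤T
       open Good 0≤T i B Bi⊑
       X : Subset
       X = good js
       info : All (λ j -> B j ⊑ A j × e i j + 1ℤ ≤ p × μ (A j) ≤ T * μ (B j)) js
       info = All.zipWith (λ { {j} (v , (s , h)) -> s , v , (h ⟫ ≤-*ʳ (μ (B j)) (0≤μ (B j)) Tc≤T) }) (vi , hs)
       X-large : μ (A i) ≤ T * μ X
       X-large = by (0≤-+ (0≤-+ (0≤-+ (0≤-- (good-large js info)) (0≤-* (0≤-- QTc≤T) (0≤μ (B i)))) (0≤-* 0≤Q+1 (0≤-- hi))) (0≤-* (0≤-- len′) (0≤μ (A i))))
           (e₁ T (μ X) (μ (A i)) (μ (B i)) (+ Q) Tc (+ length js))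
         where
         len′ : + length js ≤ + Q
         len′ = by (0≤ℕ {1}) (Z.+-comm 1ℤ (+ length js)) ⟫ len
         e₁ : ∀ T x a b Q t l -> T * x ≡ a + (T * x + l * a - T * b + (T - (Q + 1ℤ) * t) * b + (Q + 1ℤ) * (t * b - a) + (Q - l) * a)
         e₁ = solve 7 (λ T x a b Q t l -> T :* x := a :+ (T :* x :+ l :* a :- T :* b :+ (T :- (Q :+ :1) :* t) :* b :+ (Q :+ :1) :* (t :* b :- a) :+ (Q :- l) :* a)) refl
       found : ∀ xs -> Clique xs -> Inside X xs -> length xs ≡ pn -> ⊥
       found xs cl ins lxs = go (process (e i) B js xs hyp (Z.drop‿+≤+ (1≤p ⟫ ≤r (cong +_ (sym lxs)))) (≤r (cong +_ lxs)) rich)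
         where
         hyp : All (λ j -> 0ℤ ≤ e i j × e i j + 1ℤ ≤ p × 1ℤ ≤ μ (B j)) js
         hyp = All.map (λ {j} (s , v , h) -> e≥0 i j , v , pos 0≤T (A≥1 j) h) info
         transpose : ∀ {I J : Set} {R : I -> J -> Set} {is : List I} {js : List J} -> All (λ i -> All (R i) js) is -> All (λ j -> All (λ i -> R i j) is) js
         transpose {js = []} _ = []
         transpose {js = j ∷ js} h = All.map (λ { (a ∷ _) -> a }) h ∷ transpose (All.map (λ { (_ ∷ a) -> a }) h)
         rich : All (λ j -> All (Rich (e i j) (B j)) xs) js
         rich = transpose (All.map (λ {x} q -> good-rich js x q) ins)
         go : (∃ λ zs -> zs ⊆ xs × (1ℤ ⊔ (+ length xs - ∑ js (e i))) ≤ + length zs × All (λ j -> μ (B j) ≤ Φ * μ (common (B j) zs)) js) -> ⊥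
         go (zs , τ , many , bigs) = embed js vs B′ (Φ * Tc) (1≤-* 1≤Φ 1≤Tc) info′ (by (0≤ℕ {1}) (Z.+-comm 1ℤ (+ length js)) ⟫ len)
             (≤r (cong ((+ Q + 1ℤ) *_) (trans (e₁ pw Φ Tc) (cong (_* Tc) (sym pw-suc)))) ⟫ hT) out′
           where
           B′ : Fin m -> Subset
           B′ j = common (B j) zs
           e₁ : ∀ a b c -> a * (b * c) ≡ b * a * c
           e₁ = solve 3 (λ a b c -> a :* (b :* c) := b :* a :* c) refl
           info′ : All (λ j -> B′ j ⊑ A j × μ (A j) ≤ Φ * Tc * μ (B′ j)) js
           info′ = All.zipWith (λ { {j} ((s , h) , big) -> (λ u q -> s u (common⊑ (B j) zs u q)) , (h ⟫ ≤-*ˡ Tc 0≤Tc big ⟫ ≤r (e₂ Tc Φ (μ (B′ j)))) }) (hs , bigs)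
             where
             e₂ : ∀ t f b -> t * (f * b) ≡ f * t * b
             e₂ = solve 3 (λ t f b -> t :* (f :* b) := f :* t :* b) refl
           out′ : ∀ l -> Clique l -> All (λ u -> Any (λ j -> B′ j u ≡ true) js) l -> value e js ≤ + length l -> ⊥
           out′ l cl′ al val = out (zs ++ l) (APₚ.++⁺ (AllPairs-⊆ τ cl) cl′ cross)
               (Allₚ.++⁺ (All.map (λ {u} q -> here (good⊑ js u q)) (Subₚ.All-resp-⊆ τ ins)) (All.map (λ {u} a -> there (Any.map (λ {j} q -> common⊑ (B j) zs u q) a)) al))
               (Z.+-mono-≤ (≤r (cong (λ k -> 1ℤ ⊔ (+ k - ∑ js (e i))) (sym lxs)) ⟫ many) val ⟫ ≤r (cong +_ (sym (Lₚ.length-++ zs))))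
             where
             anyadj : ∀ u -> Any (λ j -> B′ j u ≡ true) js -> All (λ x -> adj x u ≡ true) zs
             anyadj u a = let (j , q) = Any.satisfied a in common-adj (B j) zs u q
             cross : All (λ x -> All (λ u -> adj x u ≡ true) l) zs
             cross = transpose (All.map (λ {u} a -> anyadj u a) al)

 -- Rounded densities and the upper bound for graphs

 -- With h = c1 t + 1 the weighted bound allows density 1 - c1/h. Rounding the densities costs 1/k
 -- and the discarded remainder another 1/k, which together stay below ρ/R.
 core-arith : ∀ p k h c1 R ρ yy ww r s X q ->
   1ℤ ≤ p -> 1ℤ ≤ k -> c1 ≤ h -> 0ℤ ≤ c1 -> 0ℤ ≤ R -> 1ℤ ≤ s -> 0ℤ ≤ X -> X ≤ s ->
   yy ≤ ww + + 2 * (r * s) -> k * p * ww ≤ k * (p * (X * X) - q) + p * (X * X) ->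
   p * c1 * (X * X) ≤ q * h -> + 2 * k * r ≤ s -> ρ * (s * s) ≤ R * yy ->
   R * (k * (h - c1) + + 2 * h) + 1ℤ ≤ ρ * (h * k) -> ⊥
 core-arith p k h c1 R ρ yy ww r s X q 1≤p 1≤k c≤h 0≤c 0≤R 1≤s 0≤X X≤s h₁ h₂ h₃ h₄ h₅ h₆ =
   absurd _ (p * (s * s) - 1ℤ)
     (0≤-+ (0≤-+ (0≤-* 0≤phk (0≤-- h₅)) (0≤-* (0≤-* 0≤p (0≤-sq s)) (0≤-- h₆)))
       (0≤-* 0≤R (0≤-+ (0≤-+ (0≤-+ (0≤-+ (0≤-* 0≤phk (0≤-- h₁)) (0≤-* 0≤h (0≤-- h₂))) (0≤-* 0≤k (0≤-- h₃)))
         (0≤-* (0≤-* (0≤-* 0≤p 0≤h) 0≤s) (0≤-- h₄))) (0≤-* (0≤-* 0≤p (0≤-+ (0≤-* 0≤k (0≤-- c≤h)) 0≤h)) (0≤-- (≤-*² 0≤X 0≤s X≤s X≤s))))))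
     (0≤-- (1≤-* 1≤p (1≤-* 1≤s 1≤s))) (e p k h c1 R ρ yy ww r s X q)
   where
   0≤p = 1≤⇒0≤ 1≤p
   0≤k = 1≤⇒0≤ 1≤k
   0≤s = 1≤⇒0≤ 1≤s
   0≤h = 0≤c ⟫ c≤h
   0≤phk = 0≤-* 0≤p (0≤-* 0≤h 0≤k)
   e : ∀ p k h c1 R ρ yy ww r s X q -> p * (h * k) * (R * yy - ρ * (s * s)) + p * (s * s) * (ρ * (h * k) - (R * (k * (h - c1) + + 2 * h) + 1ℤ))
     + R * (p * (h * k) * (ww + + 2 * (r * s) - yy) + h * (k * (p * (X * X) - q) + p * (X * X) - k * p * ww) + k * (q * h - p * c1 * (X * X))
        + p * h * s * (s - + 2 * k * r) + p * (k * (h - c1) + h) * (s * s - X * X)) + (p * (s * s) - 1ℤ) ≡ -[1+ 0 ]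
   e = solve 12 (λ p k h c1 R ρ yy ww r s X q -> p :* (h :* k) :* (R :* yy :- ρ :* (s :* s)) :+ p :* (s :* s) :* (ρ :* (h :* k) :- (R :* (k :* (h :- c1) :+ :2 :* h) :+ :1)) :+ R :* (p :* (h :* k) :* (ww :+ :2 :* (r :* s) :- yy) :+ h :* (k :* (p :* (X :* X) :- q) :+ p :* (X :* X) :- k :* p :* ww) :+ k :* (q :* h :- p :* c1 :* (X :* X)) :+ p :* h :* s :* (s :- :2 :* k :* r) :+ p :* (k :* (h :- c1) :+ h) :* (s :* s :- X :* X)) :+ (p :* (s :* s) :- :1) := con -[1+ 0 ]) refl

 -- Minimality of the rounded value puts the density more than 1/k above c/p. The regularity loss
 -- 2/H with H = 4k takes half of this and leaves 1/(2k).
 pair-arith : ∀ p k c a b γ w x ->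
   1ℤ ≤ a -> 0ℤ ≤ b -> 0ℤ ≤ γ -> 0ℤ ≤ p ->
   (k * c + p) * a + 1ℤ ≤ k * p * w -> (+ 4 * k * w - + 2 * a) * (b * γ) ≤ + 4 * k * a * x ->
   (+ 2 * k * c + p) * (b * γ) ≤ + 2 * k * p * x
 pair-arith p k c a b γ w x 1≤a 0≤b 0≤γ 0≤p h₁ h₂ = ≤-cancelˡ (+ 2 * a) (1≤-* {+ 2} (+≤+ (ℕ.s≤s ℕ.z≤n)) 1≤a)
   (by (0≤-+ (0≤-+ (0≤-* 0≤p (0≤-- h₂)) (0≤-* (0≤-* {+ 4} 0≤ℕ (0≤-* 0≤b 0≤γ)) (0≤-- h₁))) (0≤-* {+ 4} 0≤ℕ (0≤-* 0≤b 0≤γ))) (e p k c a b γ w x))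
   where
   e : ∀ p k c a b γ w x -> + 2 * a * (+ 2 * k * p * x) ≡ + 2 * a * ((+ 2 * k * c + p) * (b * γ))
      + (p * (+ 4 * k * a * x - (+ 4 * k * w - + 2 * a) * (b * γ)) + + 4 * (b * γ) * (k * p * w - ((k * c + p) * a + 1ℤ)) + + 4 * (b * γ))
   e = solve 8 (λ p k c a b γ w x -> :2 :* a :* (:2 :* k :* p :* x) := :2 :* a :* ((:2 :* k :* c :+ p) :* (b :* γ)) :+ (p :* (:4 :* k :* a :* x :- (:4 :* k :* w :- :2 :* a) :* (b :* γ)) :+ :4 :* (b :* γ) :* (k :* p :* w :- ((k :* c :+ p) :* a :+ :1)) :+ :4 :* (b :* γ))) refl

 search : {P : ℕ -> Set} -> (∀ c -> Dec (P c)) -> ℕ -> ℕ -> ℕ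
 search P? zero c = c
 search P? (suc f) c = if does (P? c) then c else search P? f (suc c)

 search-sound : {P : ℕ -> Set} (P? : ∀ c -> Dec (P c)) -> ∀ f c -> P (c ℕ.+ f) -> P (search P? f c)
 search-sound {P} P? zero c h = subst P (N.+-identityʳ c) h
 search-sound {P} P? (suc f) c h with P? c
 ... | yes q = q
 ... | no _ = search-sound P? f (suc c) (subst P (N.+-suc c f) h)

 search-≤ : {P : ℕ -> Set} (P? : ∀ c -> Dec (P c)) -> ∀ f c -> search P? f c ℕ.≤ c ℕ.+ f
 search-≤ P? zero c = N.m≤m+n c 0
 search-≤ P? (suc f) c with P? c
 ... | yes q = N.m≤m+n c (suc f)
 ... | no _ = N.≤-trans (search-≤ P? f (suc c)) (N.≤-reflexive (sym (N.+-suc c f)))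

 search-minimal : {P : ℕ -> Set} (P? : ∀ c -> Dec (P c)) -> ∀ f c s -> c ℕ.≤ s -> s ℕ.< search P? f c -> ¬ P s
 search-minimal P? zero c s h k = ⊥-elim (N.<-irrefl refl (N.≤-<-trans h k))
 search-minimal P? (suc f) c s h k with P? c
 ... | yes q = ⊥-elim (N.<-irrefl refl (N.≤-<-trans h k))
 ... | no q with N.m≤n⇒m<n∨m≡n h
 ...   | inj₁ c<s = search-minimal P? f (suc c) s c<s k
 ...   | inj₂ refl = q

 module Shorten (p : ℤ) (2≤p : + 2 ≤ p) (p≤4 : p ≤ + 4) {I : Set} (e : I -> I -> ℤ) where
   open Turan p 2≤p p≤4

   value≥length : ∀ l -> + length l ≤ value e l
   value≥length [] = Z.≤-refl
   value≥length (i ∷ l) = Z.+-mono-≤ (Z.i≤i⊔j 1ℤ (p - ∑ l (e i))) (value≥length l)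

   -- Every entry is worth at least 1, so a list longer than `Q` may lose its head and still be
   -- worth `Q`. This bounds the number of embedding rounds, hence the constants.
   shorten : ∀ (Q : ℕ) l -> Valid e l -> + Q ≤ value e l -> ∃ λ l′ -> Valid e l′ × + Q ≤ value e l′ × + length l′ ≤ + Q
   shorten Q [] v h = [] , [] , h , 0≤ℕ
   shorten Q (i ∷ l) (v ∷ vs) h with + length (i ∷ l) Z.≤? + Q
   ... | yes q = i ∷ l , v ∷ vs , h , q
   ... | no q = shorten Q l vs (by (0≤-+ (0≤-- (≰⇒≥1 q)) (0≤-- (value≥length l))) (eq (+ Q) (+ length l) (value e l)))
     where
     eq : ∀ Q l v -> v ≡ Q + (1ℤ + l - (Q + 1ℤ) + (v - l))
     eq = solve 3 (λ Q l v -> v := Q :+ (:1 :+ l :- (Q :+ :1) :+ (v :- l))) refl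

 -- Constants are kept as record fields so that they never unfold.
 record Scales (pn t k R : ℕ) : Set where
   field
     Q T H D Z Θ Β Β₁ : ℕ
     Q≡  : + Q ≡ + pn * + t + + 2
     T≥1 : 1ℤ ≤ + T
     T≥  : (+ Q + 1ℤ) * + ((4 ℕ.* k ℕ.* 2 ℕ.^ pn) ℕ.^ Q) ≤ + T
     H≡  : + H ≡ + 4 * + k
     D≡  : + D ≡ + 3 * + H * + T
     Z≡  : + Z ≡ + 3 * + H * + D
     Z≥1 : 1 ℕ.≤ Z
     k≤Z : + k ≤ + Z
     Θ≡  : + Θ ≡ + 2 * + k
     Β≡  : Β ≡ Θ ℕ.* Z ℕ.^ Q
     Β₁≥1 : 1ℤ ≤ + Β₁
     Β₁≡ : + Β₁ ≡ + Β * + T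
     R≥1 : 1ℤ ≤ + R
     R≥  : + 6 * + H * ((+ D + 1ℤ) * (+ D + 1ℤ)) * (+ T * (+ Β₁ * + Β₁ * + Β₁ * + Β₁)) ≤ + R

 module Core {n : ℕ} (adj : Fin n -> Fin n -> Bool) (adj-sym : ∀ i j -> adj i j ≡ adj j i)
             (y : Fin n -> ℤ) (y≥0 : ∀ u -> 0ℤ ≤ y u)
             (pn : ℕ) (2≤p : + 2 ≤ + pn) (p≤4 : + pn ≤ + 4) (t : ℕ) (1≤t : 1ℤ ≤ + t)
             (k : ℕ) (p≤k : + pn ≤ + k) (R : ℕ) (scales : Scales pn t k R) where
   open Dense adj adj-sym
   open Sets adj adj-sym y y≥0
   open Turan (+ pn) 2≤p p≤4
   open Scales scales
   open Clones adj adj-sym y y≥0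

   private
     p : ℤ
     p = + pn

     1≤k : 1ℤ ≤ + k
     1≤k = 1≤p ⟫ p≤k

     p≤4k : p ≤ + 4 * + k
     p≤4k = p≤k ⟫ by (0≤-* {+ 3} {+ k} 0≤ℕ 0≤ℕ) (e (+ k))
       where
       e : ∀ k -> + 4 * k ≡ k + + 3 * k
       e = solve 1 (λ k -> :4 :* k := k :+ con (+ 3) :* k) refl

     0≤4k = 0≤-* {+ 4} {+ k} 0≤ℕ 0≤ℕ

     Φ≥1 : 1 ℕ.≤ 4 ℕ.* k ℕ.* 2 ℕ.^ pn
     Φ≥1 = N.*-mono-≤ (N.*-mono-≤ {1} {4} (ℕ.s≤s ℕ.z≤n) (Z.drop‿+≤+ 1≤k)) (N.m^n>0 2 pn)

   module _ (1≤Σy : 1ℤ ≤ Σy) (crit : Critical (+ R) y)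
            (free : ∀ l -> Clique l -> length l ≡ Q -> ⊥)
            (cliques : ∀ S -> Σy ≤ + Β₁ * μ S -> (∀ l -> Clique l -> Inside S l -> length l ≡ pn -> ⊥) -> ⊥) where

     constants : Constants (+ R) (+ H) (+ T) (+ D) (+ Z) (+ Β₁)
     constants = record
       { 1≤R = R≥1 ; 1≤H = 1≤-* {+ 4} (+≤+ (ℕ.s≤s ℕ.z≤n)) 1≤k ⟫ ≤r (sym H≡) ; 1≤T = T≥1 ; 1≤Z = +≤+ Z≥1 ; 1≤Β = Β₁≥1
       ; D≡ = D≡ ; Z≥ = ≤r (sym Z≡) ; R≥ = R≥ }

     everything : Subset
     everything _ = true

     μ-everything : μ everything ≡ Σy
     μ-everything = ∑-cong V (λ u -> Z.*-identityˡ (y u))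

     open Partition (partition Z Θ Q Z≥1 free Β everything (≤r (cong₂ (λ b m -> + b * m) (sym Β≡) μ-everything)))

     α : Fin m -> ℤ
     α i = μ (part i)

     w : Fin m -> Fin m -> ℤ
     w i j = ⟪ on (part i) , on (part j) ⟫

     α≥1 : ∀ i -> 1ℤ ≤ α i
     α≥1 i with 1≤⊎≤0 (α i)
     ... | inj₁ h = h
     ... | inj₂ h = ⊥-elim (1≰0 (1≤Σy ⟫ large i ⟫ ≤-*ˡ (+ (Θ ℕ.* Z ℕ.^ Q)) 0≤ℕ h ⟫ ≤r (Z.*-zeroʳ (+ (Θ ℕ.* Z ℕ.^ Q)))))

     abstract
       fits? : ∀ a b c -> Dec (+ k * p * a ≤ (+ k * + c + p) * b)
       fits? a b c = (+ k * p * a) Z.≤? ((+ k * + c + p) * b)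

       -- The least c for which the density a/b is at most c/p + 1/k. Being least, it also bounds
       -- the density from below, and the shift 1/k makes it 0 on the diagonal, where clusters have
       -- density at most 1/Z.
       level : ℤ -> ℤ -> ℕ
       level a b = search (fits? a b) pn 0

       c : Fin m -> Fin m -> ℕ
       c i j = level (w i j) (α i * α j)

       c-sym : ∀ i j -> c i j ≡ c j i
       c-sym i j = cong₂ level (⟪⟫-sym (on (part i)) (on (part j))) (Z.*-comm (α i) (α j))

       c-fits : ∀ i j -> + k * p * w i j ≤ (+ k * + c i j + p) * (α i * α j)
       c-fits i j = search-sound (fits? (w i j) (α i * α j)) pn 0
         (≤-*ˡ (+ k * p) (0≤-* {+ k} {p} 0≤ℕ 0≤ℕ) (⟪⟫≤ (on (part i)) (on (part j)) (on≥0 (part i)) (on≥0 (part j))) ⟫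
          ≤-*ʳ (α i * α j) (0≤-* (0≤μ (part i)) (0≤μ (part j))) (by {+ k * p} {+ k * + pn + p} {p} 0≤ℕ refl))

       c≤p : ∀ i j -> + c i j ≤ p
       c≤p i j = +≤+ (search-≤ (fits? (w i j) (α i * α j)) pn 0)

       c-diag : ∀ i -> c i i ≡ 0
       c-diag i with c i i in eq
       ... | zero = refl
       ... | suc c′ = ⊥-elim (search-minimal (fits? (w i i) (α i * α i)) pn 0 0 ℕ.z≤n (subst (0 ℕ.<_) (sym eq) (ℕ.s≤s ℕ.z≤n)) base)
         where
         e₁ : ∀ k p a -> k * p * a ≡ p * (k * a)
         e₁ = solve 3 (λ k p a -> k :* p :* a := p :* (k :* a)) refl
         e₂ : ∀ k p a -> p * a ≡ (k * 0ℤ + p) * a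
         e₂ = solve 3 (λ k p a -> p :* a := (k :* :0 :+ p) :* a) refl
         base : + k * p * w i i ≤ (+ k * + 0 + p) * (α i * α i)
         base = ≤r (e₁ (+ k) p (w i i)) ⟫ ≤-*ˡ p 0≤p (≤-*ʳ (w i i) (0≤⟪⟫ (on (part i)) (on (part i)) (on≥0 (part i)) (on≥0 (part i))) k≤Z ⟫ sparse i) ⟫ ≤r (e₂ (+ k) p (α i * α i))

       c-minimal : ∀ i j c′ -> c i j ≡ suc c′ -> (+ k * + c′ + p) * (α i * α j) + 1ℤ ≤ + k * p * w i j
       c-minimal i j c′ eq = ≰⇒≥1 (search-minimal (fits? (w i j) (α i * α j)) pn 0 c′ ℕ.z≤n (subst (c′ ℕ.<_) (sym eq) N.≤-refl))

     e : Fin m -> Fin m -> ℤ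
     e i j = p - + c i j

     deficit : IsDeficit e
     deficit = record
       { e-sym = λ i j -> cong (λ z -> p - + z) (c-sym i j)
       ; e-diag = λ i -> trans (cong (λ z -> p - + z) (c-diag i)) (Z.+-identityʳ p)
       ; e≥0 = λ i j -> 0≤-- (c≤p i j)
       ; e≤p = λ i j -> by (0≤ℕ {c i j}) (e₁ p (+ c i j)) }
       where
       e₁ : ∀ p c -> p ≡ p - c + c
       e₁ = solve 2 (λ p c -> p := p :- c :+ c) refl

     scale-up : ∀ {i} {S : Subset} -> α i ≤ + T * μ S -> Σy ≤ + Β₁ * μ S
     scale-up {i} {S} h = large i ⟫ ≤r (cong (λ b -> + b * α i) (sym Β≡)) ⟫ ≤-*ˡ (+ Β) 0≤ℕ h ⟫ ≤r (trans (sym (Z.*-assoc (+ Β) (+ T) (μ S))) (cong (_* μ S) (sym Β₁≡)))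

     own : ∀ i -> α i ≤ + T * α i
     own i = ≤r (sym (Z.*-identityˡ (α i))) ⟫ ≤-*ʳ (α i) (0≤μ (part i)) T≥1

     pair : ∀ i j -> e i j + 1ℤ ≤ p -> ∀ B C -> B ⊑ part i -> C ⊑ part j -> α i ≤ + T * μ B -> α j ≤ + T * μ C ->
        (+ 2 * + k * (p - e i j - 1ℤ) + p) * (μ B * μ C) ≤ + 2 * + k * p * ⟪ on B , on C ⟫
     pair i j e<p B C B⊑ C⊑ hB hC with c i j in eq
     ... | zero = ⊥-elim (≥1⇒≰ (e<p) (≤r (sym (Z.+-identityʳ p))))
     ... | suc c′ = ≤r (cong (λ z -> (+ 2 * + k * z + p) * (μ B * μ C)) (e₁ p (+ c′))) ⟫
         pair-arith p (+ k) (+ c′) (α i * α j) (μ B) (μ C) (w i j) ⟪ on B , on C ⟫ (1≤-* (α≥1 i) (α≥1 j)) (0≤μ B) (0≤μ C) 0≤p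
           (c-minimal i j c′ eq)
           (subst (λ H -> (H * w i j - + 2 * (α i * α j)) * (μ B * μ C) ≤ H * (α i * α j) * ⟪ on B , on C ⟫) H≡
             (regular-pair constants 1≤Σy crit (part i) (part j) B C B⊑ C⊑ (sparse i) (sparse j) hB hC (scale-up {i} {part i} (own i)) (scale-up {j} {part j} (own j)) (scale-up {j} {C} hC)))
       where
       e₁ : ∀ p c -> p - (p - (1ℤ + c)) - 1ℤ ≡ c
       e₁ = solve 2 (λ p c -> p :- (p :- (:1 :+ c)) :- :1 := c) refl

     open Embed adj adj-sym y y≥0 pn 2≤p p≤4 k p≤4k using (module Clusters)
     open Clusters part e (IsDeficit.e≥0 deficit) (+ T) Q α≥1 pair (λ i S S⊑ h -> cliques S (scale-up {i} {S} h)) using (embed)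

     -- A valid list of larger value would be worth pt + 2, and embedding it would produce the
     -- forbidden clique.
     bounded : Bounded e (p * + t + 1ℤ)
     bounded l v with value e l Z.≤? p * + t + 1ℤ
     ... | yes h = h
     ... | no h with Shorten.shorten p 2≤p p≤4 e Q l v (≤r Q≡′ ⟫ ≰⇒≥1 h)
       where
       e₁ : ∀ a -> a + + 2 ≡ a + 1ℤ + 1ℤ
       e₁ = solve 1 (λ a -> a :+ :2 := a :+ :1 :+ :1) refl
       Q≡′ : + Q ≡ p * + t + 1ℤ + 1ℤ
       Q≡′ = trans Q≡ (e₁ (p * + t))
     ...   | l′ , v′ , big , short = ⊥-elim (embed l′ v′ part 1ℤ Z.≤-refl (All.universal (λ i -> (λ u q -> q) , ≤r (sym (Z.*-identityˡ (α i)))) l′) short const-ok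
           (λ r cl _ vr -> free (L.take Q r) (APₚ.take⁺ Q cl) (trans (Lₚ.length-take Q r) (N.m≤n⇒m⊓n≡m (Z.drop‿+≤+ (big ⟫ vr))))))
       where
       const-ok : (+ Q + 1ℤ) * (+ ((4 ℕ.* k ℕ.* 2 ℕ.^ pn) ℕ.^ length l′) * 1ℤ) ≤ + T
       const-ok = ≤-*ˡ (+ Q + 1ℤ) (0≤-+ (0≤ℕ {Q}) (0≤ℕ {1})) (≤r (Z.*-identityʳ _) ⟫ +≤+ (N.^-monoʳ-≤ _ {{ℕ.>-nonZero Φ≥1}} (Z.drop‿+≤+ short))) ⟫ T≥

     X q : ℤ
     X = ∑ (allFin m) α
     q = quad e α

     turan-bound : p * c1 * (X * X) ≤ q * (c1 * + t + 1ℤ)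
     turan-bound = TuranMain.weighted-turan p 2≤p p≤4 e deficit (+ t) 1≤t bounded α (λ i -> 0≤μ (part i))

     a r : Weight
     a u = ∑ (allFin m) (λ i -> on (part i) u)
     r = on rest

     y-split : ∀ u -> y u ≡ 1ℤ * a u + 1ℤ * r u
     y-split u = trans (sym (Z.*-identityˡ (y u))) (trans (cong (_* y u) (split u)) (trans (Z.*-distribʳ-+ (y u) (∑ (allFin m) (λ i -> ind (part i u))) (ind (rest u)))
        (trans (cong (_+ r u) (sym (∑-*ʳ (allFin m) (y u) (λ i -> ind (part i u))))) (e₁ (a u) (r u)))))
       where
       e₁ : ∀ a b -> a + b ≡ 1ℤ * a + 1ℤ * b
       e₁ = solve 2 (λ a b -> a :+ b := :1 :* a :+ :1 :* b) refl

     ⟪⟫-∑ˡ : ∀ {I : Set} (is : List I) (f : I -> Weight) g -> ⟪ (λ u -> ∑ is (λ i -> f i u)) , g ⟫ ≡ ∑ is (λ i -> ⟪ f i , g ⟫)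
     ⟪⟫-∑ˡ is f g = trans (∑-cong V (λ u -> sym (∑-*ʳ is _ (λ i -> f i u)))) (∑-swap V is _)

     aa≡ : ⟪ a , a ⟫ ≡ ∑ (allFin m) (λ i -> ∑ (allFin m) (w i))
     aa≡ = trans (⟪⟫-∑ˡ (allFin m) (λ i -> on (part i)) a) (∑-cong (allFin m) (λ i -> trans (⟪⟫-sym (on (part i)) a)
        (trans (⟪⟫-∑ˡ (allFin m) (λ j -> on (part j)) (on (part i))) (∑-cong (allFin m) (λ j -> ⟪⟫-sym (on (part j)) (on (part i)))))))

     0≤a : ∀ u -> 0ℤ ≤ a u
     0≤a u = ∑-nonneg (allFin m) (λ i -> on≥0 (part i) u)

     yy≤ : ⟪ y , y ⟫ ≤ ⟪ a , a ⟫ + + 2 * (μ rest * Σy)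
     yy≤ = by (0≤-+ (0≤-* {+ 2} 0≤ℕ (0≤-- (⟪⟫≤ y r y≥0 (on≥0 rest)))) (0≤⟪⟫ r r (on≥0 rest) (on≥0 rest)))
       (trans (e₁ ⟪ a , a ⟫ ⟪ a , r ⟫ ⟪ r , r ⟫ (μ rest) Σy) (cong₂ (λ x z -> x + (+ 2 * (Σy * μ rest - z) + ⟪ r , r ⟫)) (sym yy≡) (sym yr≡)))
       where
       yy≡ : ⟪ y , y ⟫ ≡ 1ℤ * 1ℤ * ⟪ a , a ⟫ + + 2 * 1ℤ * 1ℤ * ⟪ a , r ⟫ + 1ℤ * 1ℤ * ⟪ r , r ⟫
       yy≡ = trans (⟪⟫-cong y-split y-split) (⟪⟫-sq 1ℤ 1ℤ a r)
       yr≡ : ⟪ y , r ⟫ ≡ 1ℤ * ⟪ a , r ⟫ + 1ℤ * ⟪ r , r ⟫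
       yr≡ = trans (⟪⟫-cong y-split (λ u -> refl)) (⟪⟫-linˡ 1ℤ 1ℤ a r r)
       e₁ : ∀ aa ar rr m s -> aa + + 2 * (m * s) ≡ 1ℤ * 1ℤ * aa + + 2 * 1ℤ * 1ℤ * ar + 1ℤ * 1ℤ * rr + (+ 2 * (s * m - (1ℤ * ar + 1ℤ * rr)) + rr)
       e₁ = solve 5 (λ aa ar rr m s -> aa :+ :2 :* (m :* s) := :1 :* :1 :* aa :+ :2 :* :1 :* :1 :* ar :+ :1 :* :1 :* rr :+ (:2 :* (s :* m :- (:1 :* ar :+ :1 :* rr)) :+ rr)) refl

     ww≤ : + k * p * ⟪ a , a ⟫ ≤ + k * (p * (X * X) - q) + p * (X * X)
     ww≤ = ≤r (trans (cong (+ k * p *_) aa≡) (trans (sym (∑-*ˡ (allFin m) (+ k * p) _)) (∑-cong (allFin m) (λ i -> sym (∑-*ˡ (allFin m) (+ k * p) (w i))))))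
       ⟫ ∑-mono (allFin m) (λ i -> ∑-mono (allFin m) (c-fits i) ⟫ ≤r (inner i)) ⟫ ≤r outer
       where
       e₁ : ∀ k p c a b -> (k * c + p) * (a * b) ≡ (k * p + p) * a * b - k * a * ((p - c) * b)
       e₁ = solve 5 (λ k p c a b -> (k :* c :+ p) :* (a :* b) := (k :* p :+ p) :* a :* b :- k :* a :* ((p :- c) :* b)) refl
       inner : ∀ i -> ∑ (allFin m) (λ j -> (+ k * + c i j + p) * (α i * α j)) ≡ (+ k * p + p) * X * α i - + k * (α i * row e α i)
       inner i = trans (∑-cong (allFin m) (λ j -> e₁ (+ k) p (+ c i j) (α i) (α j))) (trans (∑-- (allFin m) (λ j -> (+ k * p + p) * α i * α j) (λ j -> + k * α i * (e i j * α j)))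
           (trans (cong₂ _-_ (∑-*ˡ (allFin m) ((+ k * p + p) * α i) α) (∑-*ˡ (allFin m) (+ k * α i) (λ j -> e i j * α j))) (e₂ (+ k * p + p) (α i) X (+ k) (row e α i))))
         where
         e₂ : ∀ b a X k r -> b * a * X - k * a * r ≡ b * X * a - k * (a * r)
         e₂ = solve 5 (λ b a X k r -> b :* a :* X :- k :* a :* r := b :* X :* a :- k :* (a :* r)) refl
       outer : ∑ (allFin m) (λ i -> (+ k * p + p) * X * α i - + k * (α i * row e α i)) ≡ + k * (p * (X * X) - q) + p * (X * X)
       outer = trans (∑-- (allFin m) (λ i -> (+ k * p + p) * X * α i) (λ i -> + k * (α i * row e α i)))
         (trans (cong₂ _-_ (∑-*ˡ (allFin m) ((+ k * p + p) * X) α) (∑-*ˡ (allFin m) (+ k) (λ i -> α i * row e α i))) (e₂ (+ k) p X q))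
         where
         e₂ : ∀ k p X q -> (k * p + p) * X * X - k * q ≡ k * (p * (X * X) - q) + p * (X * X)
         e₂ = solve 4 (λ k p X q -> (k :* p :+ p) :* X :* X :- k :* q := k :* (p :* (X :* X) :- q) :+ p :* (X :* X)) refl

     X≤ : X ≤ Σy
     X≤ = ≤r (sym (∑-swap V (allFin m) (λ u i -> on (part i) u))) ⟫ ∑-mono V (λ u -> by (on≥0 rest u) (trans (y-split u) (e₁ (a u) (r u))))
       where
       e₁ : ∀ a r -> 1ℤ * a + 1ℤ * r ≡ a + r
       e₁ = solve 2 (λ a r -> :1 :* a :+ :1 :* r := a :+ r) refl

     core : ∀ ρ -> ρ * (Σy * Σy) ≤ + R * ⟪ y , y ⟫ ->
       + R * (+ k * (c1 * + t + 1ℤ - c1) + + 2 * (c1 * + t + 1ℤ)) + 1ℤ ≤ ρ * ((c1 * + t + 1ℤ) * + k) -> ⊥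
     core ρ dens big = core-arith p (+ k) (c1 * + t + 1ℤ) c1 (+ R) ρ ⟪ y , y ⟫ ⟪ a , a ⟫ (μ rest) Σy X q
       1≤p 1≤k c≤h 0≤c1 0≤ℕ 1≤Σy (∑-nonneg (allFin m) (λ i -> 0≤μ (part i))) X≤ yy≤ ww≤ turan-bound
       (≤r (cong (_* μ rest) (sym Θ≡)) ⟫ small) dens big
       where
       c≤h : c1 ≤ c1 * + t + 1ℤ
       c≤h = by (0≤-+ (0≤-* 0≤c1 (0≤-- 1≤t)) (0≤ℕ {1})) (e₁ c1 (+ t))
         where
         e₁ : ∀ c t -> c * t + 1ℤ ≡ c + (c * (t - 1ℤ) + 1ℤ)
         e₁ = solve 2 (λ c t -> c :* t :+ :1 := c :+ (c :* (t :- :1) :+ :1)) refl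

 mk-scales : ∀ pn t k -> 1 ℕ.≤ k -> (Q T H D Z Θ Β Β₁ R₀ : ℕ) ->
   Q ≡ pn ℕ.* t ℕ.+ 2 -> T ≡ suc Q ℕ.* (4 ℕ.* k ℕ.* 2 ℕ.^ pn) ℕ.^ Q -> H ≡ 4 ℕ.* k -> D ≡ 3 ℕ.* H ℕ.* T -> Z ≡ 3 ℕ.* H ℕ.* D ->
   Θ ≡ 2 ℕ.* k -> Β ≡ Θ ℕ.* Z ℕ.^ Q -> Β₁ ≡ Β ℕ.* T ->
   R₀ ≡ 6 ℕ.* H ℕ.* ((D ℕ.+ 1) ℕ.* (D ℕ.+ 1)) ℕ.* (T ℕ.* (Β₁ ℕ.* Β₁ ℕ.* Β₁ ℕ.* Β₁)) ->
   ∀ R -> R₀ ℕ.≤ R -> Scales pn t k R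
 mk-scales pn t k 1≤k Q T H D Z Θ Β Β₁ R₀ Q= T= H= D= Z= Θ= Β= Β₁= R= R R₀≤R = record
   { Q = Q ; T = T ; H = H ; D = D ; Z = Z ; Θ = Θ ; Β = Β ; Β₁ = Β₁
   ; Q≡ = trans (cong +_ Q=) (cong (_+ + 2) (Z.pos-* pn t))
   ; T≥1 = +≤+ T≥1
   ; T≥ = ≤r (trans (cong (_* + (Φ ℕ.^ Q)) (Z.+-comm (+ Q) 1ℤ)) (trans (sym (Z.pos-* (suc Q) (Φ ℕ.^ Q))) (cong +_ (sym T=))))
   ; H≡ = trans (cong +_ H=) (Z.pos-* 4 k)
   ; D≡ = trans (cong +_ D=) (trans (Z.pos-* (3 ℕ.* H) T) (cong (_* + T) (Z.pos-* 3 H)))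
   ; Z≡ = trans (cong +_ Z=) (trans (Z.pos-* (3 ℕ.* H) D) (cong (_* + D) (Z.pos-* 3 H)))
   ; Z≥1 = Z≥1
   ; k≤Z = +≤+ (N.≤-trans (N.m≤n*m k 4) (N.≤-trans (N.≤-reflexive (sym H=)) (N.≤-trans (N.m≤n*m H 3) (N.≤-trans (N.m≤m*n (3 ℕ.* H) D {{ℕ.>-nonZero D≥1}}) (N.≤-reflexive (sym Z=))))))
   ; Θ≡ = trans (cong +_ Θ=) (Z.pos-* 2 k)
   ; Β≡ = Β=
   ; Β₁≥1 = +≤+ Β₁≥1
   ; Β₁≡ = trans (cong +_ Β₁=) (Z.pos-* Β T)
   ; R≥1 = +≤+ (N.≤-trans R₀≥1 R₀≤R)
   ; R≥ = ≤r (sym R-lift) ⟫ +≤+ R₀≤R }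
   where
   Φ : ℕ
   Φ = 4 ℕ.* k ℕ.* 2 ℕ.^ pn
   one : ∀ {m} -> 1 ℕ.≤ suc m
   one = ℕ.s≤s ℕ.z≤n
   mul : ∀ {a b} -> 1 ℕ.≤ a -> 1 ℕ.≤ b -> 1 ℕ.≤ a ℕ.* b
   mul h k = N.*-mono-≤ h k
   pow : ∀ {a} b -> 1 ℕ.≤ a -> 1 ℕ.≤ a ℕ.^ b
   pow {a} b h = N.m^n>0 a {{ℕ.>-nonZero h}} b
   by≡ : ∀ {a b} -> a ≡ b -> 1 ℕ.≤ b -> 1 ℕ.≤ a
   by≡ refl h = h
   H≥1 : 1 ℕ.≤ H
   H≥1 = by≡ H= (mul (one {3}) 1≤k)
   T≥1 : 1 ℕ.≤ T
   T≥1 = by≡ T= (mul (one {Q}) (pow {Φ} Q (mul {4 ℕ.* k} (mul (one {3}) 1≤k) (pow {2} pn one))))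
   D≥1 : 1 ℕ.≤ D
   D≥1 = by≡ D= (mul (mul (one {2}) H≥1) T≥1)
   Z≥1 : 1 ℕ.≤ Z
   Z≥1 = by≡ Z= (mul (mul (one {2}) H≥1) D≥1)
   Β₁≥1 : 1 ℕ.≤ Β₁
   Β₁≥1 = by≡ Β₁= (mul (by≡ Β= (mul (by≡ Θ= (mul (one {1}) 1≤k)) (pow Q Z≥1))) T≥1)
   D+1≥1 : 1 ℕ.≤ D ℕ.+ 1
   D+1≥1 = N.m≤n+m 1 D
   R₀≥1 : 1 ℕ.≤ R₀
   R₀≥1 = by≡ R= (mul (mul (mul (one {5}) H≥1) (mul D+1≥1 D+1≥1)) (mul T≥1 (mul (mul (mul Β₁≥1 Β₁≥1) Β₁≥1) Β₁≥1)))
   R-lift : + R₀ ≡ + 6 * + H * ((+ D + 1ℤ) * (+ D + 1ℤ)) * (+ T * (+ Β₁ * + Β₁ * + Β₁ * + Β₁))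
   R-lift = trans (cong +_ R=) (trans (Z.pos-* (6 ℕ.* H ℕ.* ((D ℕ.+ 1) ℕ.* (D ℕ.+ 1))) (T ℕ.* (Β₁ ℕ.* Β₁ ℕ.* Β₁ ℕ.* Β₁)))
     (cong₂ _*_ (trans (Z.pos-* (6 ℕ.* H) ((D ℕ.+ 1) ℕ.* (D ℕ.+ 1))) (cong₂ _*_ (Z.pos-* 6 H) (Z.pos-* (D ℕ.+ 1) (D ℕ.+ 1))))
       (trans (Z.pos-* T (Β₁ ℕ.* Β₁ ℕ.* Β₁ ℕ.* Β₁)) (cong (+ T *_) (trans (Z.pos-* (Β₁ ℕ.* Β₁ ℕ.* Β₁) Β₁) (cong (_* + Β₁) (trans (Z.pos-* (Β₁ ℕ.* Β₁) Β₁) (cong (_* + Β₁) (Z.pos-* Β₁ Β₁)))))))))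

 scales-exist : ∀ pn t k -> 1 ℕ.≤ k -> ∃ λ R₀ -> 1 ℕ.≤ R₀ × (∀ R -> R₀ ℕ.≤ R -> Scales pn t k R)
 scales-exist pn t k 1≤k = suc R₀ , ℕ.s≤s ℕ.z≤n , λ R h -> mk-scales pn t k 1≤k Q T H D Z Θ Β Β₁ R₀ refl refl refl refl refl refl refl refl refl R (N.≤-trans (N.n≤1+n R₀) h)
   where
   Q T H D Z Θ Β Β₁ R₀ : ℕ
   Q = pn ℕ.* t ℕ.+ 2
   T = suc Q ℕ.* (4 ℕ.* k ℕ.* 2 ℕ.^ pn) ℕ.^ Q
   H = 4 ℕ.* k
   D = 3 ℕ.* H ℕ.* T
   Z = 3 ℕ.* H ℕ.* D
   Θ = 2 ℕ.* k
   Β = Θ ℕ.* Z ℕ.^ Q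
   Β₁ = Β ℕ.* T
   R₀ = 6 ℕ.* H ℕ.* ((D ℕ.+ 1) ℕ.* (D ℕ.+ 1)) ℕ.* (T ℕ.* (Β₁ ℕ.* Β₁ ℕ.* Β₁ ℕ.* Β₁))

 -- The assumption says that the density exceeds a/h + 1/d with respect to n(n - 1). Half of the
 -- surplus is given up to pass to n², which is possible once 8d ≤ n.
 start-arith : ∀ a h d n e2 R′ -> 1ℤ ≤ h -> a ≤ h -> 1ℤ ≤ d -> 1ℤ ≤ R′ -> 0ℤ ≤ n -> + 8 * d ≤ n ->
   (a * d + h) * (n * (n - 1ℤ)) + 1ℤ ≤ e2 * (h * d) ->
   (R′ * (+ 4 * d * a + + 2 * h) + 1ℤ) * (n * n) ≤ h * (+ 4 * d) * R′ * e2
 start-arith a h d n e2 R′ 1≤h a≤h 1≤d 1≤R 0≤n hn big =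
   by (0≤-+ (0≤-+ (0≤-+ (0≤-+ (0≤-* (0≤-* {+ 4} 0≤ℕ 0≤R) (0≤-- big)) (0≤-* {+ 4} 0≤ℕ 0≤R)) (0≤-* (0≤-- (1≤-* 1≤h 1≤R)) (0≤-* 0≤n 0≤n)))
        (0≤-* (0≤-* (0≤-* 0≤R 0≤n) 0≤h) (0≤-- hn))) (0≤-* (0≤-* (0≤-* {+ 4} 0≤ℕ 0≤R) 0≤n) (0≤-+ (0≤-* (0≤-- a≤h) 0≤d) (0≤-* 0≤h (0≤-- 1≤d))))) (e a h d n e2 R′)
   where
   0≤h = 1≤⇒0≤ 1≤h
   0≤d = 1≤⇒0≤ 1≤d
   0≤R = 1≤⇒0≤ 1≤R
   e : ∀ a h d n e2 R -> h * (+ 4 * d) * R * e2 ≡ (R * (+ 4 * d * a + + 2 * h) + 1ℤ) * (n * n)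
       + (+ 4 * R * (e2 * (h * d) - ((a * d + h) * (n * (n - 1ℤ)) + 1ℤ)) + + 4 * R + (h * R - 1ℤ) * (n * n)
          + R * n * h * (n - + 8 * d) + + 4 * R * n * ((h - a) * d + h * (d - 1ℤ)))
   e = solve 6 (λ a h d n e2 R -> h :* (:4 :* d) :* R :* e2 := (R :* (:4 :* d :* a :+ :2 :* h) :+ :1) :* (n :* n) :+ (:4 :* R :* (e2 :* (h :* d) :- ((a :* d :+ h) :* (n :* (n :- :1)) :+ :1)) :+ :4 :* R :+ (h :* R :- :1) :* (n :* n) :+ R :* n :* h :* (n :- con (+ 8) :* d) :+ :4 :* R :* n :* ((h :- a) :* d :+ h :* (d :- :1)))) refl

 module UpperGraph (pn : ℕ) (2≤p : + 2 ≤ + pn) (p≤4 : + pn ≤ + 4) (t : ℕ) (1≤t : 1ℤ ≤ + t) (d : ℕ) (1≤d : 1 ℕ.≤ d) where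
   private
     c₁ h a : ℤ
     c₁ = + 2 * + pn - 1ℤ
     h = c₁ * + t + 1ℤ
     a = h - c₁

     1≤c₁ : 1ℤ ≤ c₁
     1≤c₁ = Turan.1≤c1 (+ pn) 2≤p p≤4
     0≤c₁t : 0ℤ ≤ c₁ * + t
     0≤c₁t = 0≤-* (1≤⇒0≤ 1≤c₁) 0≤ℕ
     1≤h : 1ℤ ≤ h
     1≤h = by 0≤c₁t (Z.+-comm (c₁ * + t) 1ℤ)

     k : ℕ
     k = 4 ℕ.* d

     1≤k : 1 ℕ.≤ k
     1≤k = N.≤-trans 1≤d (N.m≤n*m d 4)

     p≤k : + pn ≤ + k
     p≤k = p≤4 ⟫ +≤+ (N.*-monoʳ-≤ 4 1≤d)

     ∣h∣ : ℕ
     ∣h∣ = ∣ h ∣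

     h≡ : + ∣h∣ ≡ h
     h≡ = Z.0≤i⇒+∣i∣≡i (1≤⇒0≤ 1≤h)

     data Setup : Set where
       setup : ∀ R′ R -> 1 ℕ.≤ R′ -> + R ≡ h * (+ 4 * + d) * + R′ -> Scales pn t k R -> Setup

     scaled : Setup
     scaled with scales-exist pn t k 1≤k
     -- `R` is taken as a multiple of 4dh, so that the starting density a/h + 1/(2d) is a fraction
     -- with denominator `R`.
     ... | R₀ , R₀≥1 , mk = setup R₀ (∣h∣ ℕ.* k ℕ.* R₀) R₀≥1 (trans (Z.pos-* (∣h∣ ℕ.* k) R₀) (cong (_* + R₀) (trans (Z.pos-* ∣h∣ k) (cong₂ _*_ h≡ (Z.pos-* 4 d)))))
             (mk (∣h∣ ℕ.* k ℕ.* R₀) (N.m≤n*m R₀ (∣h∣ ℕ.* k) {{ℕ.>-nonZero (N.*-mono-≤ (Z.drop‿+≤+ (1≤h ⟫ ≤r (sym h≡))) 1≤k)}}))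

   upper-graph : ∃ λ (E : ℕ) -> 1 ℕ.≤ E × (∀ n (adj : Fin n -> Fin n -> Bool) -> (∀ i j -> adj i j ≡ adj j i) -> + 8 * + d ≤ + n ->
       (∀ l -> AllPairs (λ u v -> adj u v ≡ true) l -> length l ≡ pn ℕ.* t ℕ.+ 2 -> ⊥) ->
       (∀ (S : Fin n -> Bool) -> (∀ l -> AllPairs (λ u v -> adj u v ≡ true) l -> All (λ u -> S u ≡ true) l -> length l ≡ pn -> ⊥) ->
          + E * ∑ (allFin n) (λ u -> ind (S u)) + 1ℤ ≤ + n) ->
       ∑ (allFin n) (λ u -> ∑ (allFin n) (λ v -> ind (adj u v))) * (h * + d) ≤ (a * + d + h) * (+ n * (+ n - 1ℤ)))
   upper-graph with scaled
   ... | setup R′ R 1≤R′ R≡ sc = E , N.*-mono-≤ (Z.drop‿+≤+ Β₁≥1) (N.m^n>0 3 (suc R)) , main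
     where
     open Scales sc
     E : ℕ
     -- After all increments the maximum of `y` is at most 3^(R + 1) times its average. A set whose
     -- mass is at least Σy/Β₁ therefore has at least n/E vertices, so it contains a K_p.
     E = Β₁ ℕ.* 3 ℕ.^ suc R
     main : ∀ n (adj : Fin n -> Fin n -> Bool) -> (∀ i j -> adj i j ≡ adj j i) -> + 8 * + d ≤ + n -> _ -> _ -> _
     main n adj adj-sym hn free sparse with ∑ (allFin n) (λ u -> ∑ (allFin n) (λ v -> ind (adj u v))) * (h * + d) Z.≤? (a * + d + h) * (+ n * (+ n - 1ℤ))
     ... | yes q = q
     ... | no q = ⊥-elim (no-level (+ R) (+ (3 ℕ.^ suc R)) ρ₀ 0≤ℕ core′ (suc R) 1ℤ ρ₀ one (0≤ℕ {1}) (≤r (Z.*-identityˡ (+ (3 ℕ.^ suc R)))) Z.≤-refl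
            (≤r (Z.+-comm (+ R) 1ℤ) ⟫ by 0≤ρ₀ (Z.+-comm ρ₀ (+ suc R))) start)
       where
       open Dense adj adj-sym
       e2 ρ₀ : ℤ
       e2 = ∑ (allFin n) (λ u -> ∑ (allFin n) (λ v -> ind (adj u v)))
       ρ₀ = + R′ * (+ 4 * + d * a + + 2 * h) + 1ℤ
       a≤h : a ≤ h
       a≤h = by (1≤⇒0≤ 1≤c₁) (eq h c₁)
         where
         eq : ∀ h c -> h ≡ h - c + c
         eq = solve 2 (λ h c -> h := h :- c :+ c) refl
       0≤a : 0ℤ ≤ a
       0≤a = subst (0ℤ ≤_) (eq c₁ (+ t)) (0≤-+ (0≤-* (1≤⇒0≤ 1≤c₁) (0≤-- 1≤t)) (0≤ℕ {1}))
         where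
         eq : ∀ c t -> c * (t - 1ℤ) + 1ℤ ≡ c * t + 1ℤ - c
         eq = solve 2 (λ c t -> c :* (t :- :1) :+ :1 := c :* t :+ :1 :- c) refl
       0≤ρ₀ : 0ℤ ≤ ρ₀
       0≤ρ₀ = 0≤-+ (0≤-* (0≤ℕ {R′}) (0≤-+ (0≤-* (0≤-* {+ 4} {+ d} 0≤ℕ 0≤ℕ) 0≤a) (0≤-* {+ 2} 0≤ℕ (1≤⇒0≤ 1≤h)))) (0≤ℕ {1})
       one : Weight
       one _ = 1ℤ
       total : ∑ V one ≡ + n
       total = trans (∑-const V 1ℤ) (trans (Z.*-identityʳ _) (cong +_ (Lₚ.length-tabulate (λ (i : Fin n) -> i))))
       1≤n : 1ℤ ≤ + n
       1≤n = 1≤-* {+ 8} (+≤+ (ℕ.s≤s ℕ.z≤n)) (+≤+ 1≤d) ⟫ hn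
       start : Level (+ R) 1ℤ ρ₀ one
       start = record
         { y≥0 = λ _ -> 0≤ℕ ; mass = 1≤n ⟫ ≤r (sym total)
         ; spread = λ _ -> ≤r (trans (Z.*-identityʳ (+ n)) (trans (sym total) (sym (Z.*-identityˡ (∑ V one)))))
         ; dense = ≤r (cong (λ z -> ρ₀ * (z * z)) total) ⟫ start-arith a h (+ d) (+ n) e2 (+ R′) 1≤h a≤h (+≤+ 1≤d) (+≤+ 1≤R′) 0≤ℕ hn (≰⇒≥1 q)
                   ⟫ ≤r (cong₂ _*_ (sym R≡) (sym (∑-cong V (λ u -> trans (Z.*-identityˡ _) (∑-cong V (λ v -> Z.*-identityʳ (ind (adj u v)))))))) }
       core′ : ∀ B ρ y -> 0ℤ ≤ B -> B ≤ + (3 ℕ.^ suc R) -> ρ₀ ≤ ρ -> Level (+ R) B ρ y -> Critical (+ R) y -> ⊥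
       core′ B ρ y 0≤B B≤ ρ₀≤ρ lv crit = Core.core adj adj-sym y y≥0 pn 2≤p p≤4 t 1≤t k p≤k R sc mass crit
           (λ l cl len -> free l cl (trans len Q-nat)) cliques ρ dense big
         where
         open Level lv
         open Sets adj adj-sym y y≥0
         Q-nat : Q ≡ pn ℕ.* t ℕ.+ 2
         Q-nat = Z.+-injective (trans Q≡ (cong (_+ + 2) (sym (Z.pos-* pn t))))
         big : + R * (+ k * (h - c₁) + + 2 * h) + 1ℤ ≤ ρ * (h * + k)
         big = by (0≤-+ (0≤-* 0≤hk (0≤-- ρ₀≤ρ)) (0≤-- 1≤hk)) (trans (eq h (+ d) (+ R′) a ρ (+ k)) (cong₂ (λ r x -> r * (+ k * a + + 2 * h) + 1ℤ + (h * + k * (ρ - (+ R′ * (x * a + + 2 * h) + 1ℤ)) + (h * + k - 1ℤ))) (sym (trans R≡ (cong (λ x -> h * x * + R′) (sym (Z.pos-* 4 d))))) (Z.pos-* 4 d)))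
           where
           1≤hk : 1ℤ ≤ h * + k
           1≤hk = 1≤-* 1≤h (+≤+ 1≤k)
           0≤hk = 1≤⇒0≤ 1≤hk
           eq : ∀ h d R a ρ k -> ρ * (h * k) ≡ h * k * R * (k * a + + 2 * h) + 1ℤ + (h * k * (ρ - (R * (k * a + + 2 * h) + 1ℤ)) + (h * k - 1ℤ))
           eq = λ h _ -> eq₀ h
             where
             eq₀ : ∀ h R a ρ k -> ρ * (h * k) ≡ h * k * R * (k * a + + 2 * h) + 1ℤ + (h * k * (ρ - (R * (k * a + + 2 * h) + 1ℤ)) + (h * k - 1ℤ))
             eq₀ = solve 5 (λ h R a ρ k -> ρ :* (h :* k) := h :* k :* R :* (k :* a :+ :2 :* h) :+ :1 :+ (h :* k :* (ρ :- (R :* (k :* a :+ :2 :* h) :+ :1)) :+ (h :* k :- :1))) refl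
         cliques : ∀ S -> Σy ≤ + Β₁ * μ S -> (∀ l -> Clique l -> Inside S l -> length l ≡ pn -> ⊥) -> ⊥
         cliques S hS none = ≥1⇒≰ (sparse S none) (≤-cancelˡ Σy mass (≤r (Z.*-comm Σy (+ n)) ⟫ ≤-*ˡ (+ n) 0≤ℕ hS ⟫ ≤r (e₁ (+ n) (+ Β₁) (μ S))
              ⟫ ≤-*ˡ (+ Β₁) 0≤ℕ nμ ⟫ ≤-*ˡ (+ Β₁) 0≤ℕ (≤-*ʳ (Σy * |S|) (0≤-* (1≤⇒0≤ mass) 0≤|S|) B≤) ⟫ ≤r (trans (e₂ (+ Β₁) (+ (3 ℕ.^ suc R)) Σy |S|) (cong (λ z -> Σy * (z * |S|)) (sym (Z.pos-* Β₁ (3 ℕ.^ suc R)))))))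
           where
           |S| : ℤ
           |S| = ∑ V (λ u -> ind (S u))
           0≤|S| : 0ℤ ≤ |S|
           0≤|S| = ∑-nonneg V (λ u -> 0≤ind (S u))
           e₁ : ∀ n b m -> n * (b * m) ≡ b * (n * m)
           e₁ = solve 3 (λ n b m -> n :* (b :* m) := b :* (n :* m)) refl
           e₂ : ∀ b c s m -> b * (c * (s * m)) ≡ s * (b * c * m)
           e₂ = solve 4 (λ b c s m -> b :* (c :* (s :* m)) := s :* (b :* c :* m)) refl
           e₃ : ∀ n i y -> n * (i * y) ≡ i * (n * y)
           e₃ = solve 3 (λ n i y -> n :* (i :* y) := i :* (n :* y)) refl
           nμ : + n * μ S ≤ B * (Σy * |S|)
           nμ = ≤r (sym (∑-*ˡ V (+ n) (on S))) ⟫ ∑-mono V (λ u -> ≤r (e₃ (+ n) (ind (S u)) (y u)) ⟫ ≤-*ˡ (ind (S u)) (0≤ind (S u)) (spread u))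
              ⟫ ≤r (trans (∑-*ʳ V (B * Σy) (λ u -> ind (S u))) (e₄ |S| B Σy))
             where
             e₄ : ∀ m b s -> m * (b * s) ≡ b * (s * m)
             e₄ = solve 3 (λ m b s -> m :* (b :* s) := b :* (s :* m)) refl

 -- Poincaré inequalities on products and concentration

 sqpos : ℤ -> ℤ
 sqpos z = (z ⊔ 0ℤ) * (z ⊔ 0ℤ)

 0≤sqpos : ∀ z -> 0ℤ ≤ sqpos z
 0≤sqpos z = 0≤-sq (z ⊔ 0ℤ)

 sqpos-≤0 : ∀ {z} -> z ≤ 0ℤ -> sqpos z ≡ 0ℤ
 sqpos-≤0 h = cong (λ t -> t * t) (Z.i≤j⇒i⊔j≡j h)

 sqpos-mono : ∀ {a b} -> a ≤ b -> sqpos a ≤ sqpos b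
 sqpos-mono {a} {b} h = ≤-*² (Z.i≤j⊔i a 0ℤ) (Z.i≤j⊔i b 0ℤ) a≤ a≤
   where
   a≤ : a ⊔ 0ℤ ≤ b ⊔ 0ℤ
   a≤ = Z.⊔-mono-≤ h (Z.≤-refl {0ℤ})

 sqpos-both : ∀ z -> sqpos z + sqpos (- z) ≡ z * z
 sqpos-both (+ zero) = refl
 sqpos-both (+ suc n) = Z.+-identityʳ _
 sqpos-both (-[1+ n ]) = trans (Z.+-identityˡ _) refl

 sqpos≤ : ∀ z -> sqpos z ≤ z * z
 sqpos≤ z = by (0≤sqpos (- z)) (sym (sqpos-both z))

 variance : ∀ {A : Set} (xs : List A) (f : A -> ℤ) ->
   ∑ xs (λ x -> ∑ xs (λ y -> (f x - f y) * (f x - f y))) ≡ + 2 * (+ length xs * ∑ xs (λ x -> f x * f x) - ∑ xs f * ∑ xs f)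
 variance xs f = trans (∑-cong xs inner) (trans (∑-+ xs _ _) (trans (cong₂ _+_ (trans (∑-- xs _ _) (cong₂ _-_ (∑-*ˡ xs l (λ x -> f x * f x)) (∑-*ʳ xs S (λ x -> + 2 * f x)))) (∑-const xs Q))
     (trans (cong (λ z -> l * Q - z * S + l * Q) (∑-*ˡ xs (+ 2) f)) (eq l Q S))))
   where
   l S Q : ℤ
   l = + length xs
   S = ∑ xs f
   Q = ∑ xs (λ x -> f x * f x)
   sqe : ∀ a b -> (a - b) * (a - b) ≡ a * a - + 2 * a * b + b * b
   sqe = solve 2 (λ a b -> (a :- b) :* (a :- b) := a :* a :- :2 :* a :* b :+ b :* b) refl
   inner : ∀ x -> ∑ xs (λ y -> (f x - f y) * (f x - f y)) ≡ l * (f x * f x) - + 2 * f x * S + Q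
   inner x = trans (∑-cong xs (λ y -> sqe (f x) (f y))) (trans (∑-+ xs _ _) (cong (_+ Q) (trans (∑-- xs _ _) (cong₂ _-_ (∑-const xs (f x * f x)) (∑-*ˡ xs (+ 2 * f x) f)))))
   eq : ∀ l Q S -> l * Q - + 2 * S * S + l * Q ≡ + 2 * (l * Q - S * S)
   eq = solve 3 (λ l Q S -> l :* Q :- :2 :* S :* S :+ l :* Q := :2 :* (l :* Q :- S :* S)) refl

 pairs : ∀ {A B : Set} -> List A -> List B -> List (A × B)
 pairs = L.cartesianProduct

 ∑-pairs : ∀ {A B : Set} (xs : List A) (ys : List B) f -> ∑ (pairs xs ys) f ≡ ∑ xs (λ a -> ∑ ys (λ b -> f (a , b)))
 ∑-pairs [] ys f = refl
 ∑-pairs (x ∷ xs) ys f = trans (∑-++ (map (x ,_) ys) _ f) (cong₂ _+_ (∑-map (x ,_) ys f) (∑-pairs xs ys f))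

 length-pairs : ∀ {A B : Set} (xs : List A) (ys : List B) -> + length (pairs xs ys) ≡ + length xs * + length ys
 length-pairs xs ys = trans (sym (trans (∑-const (pairs xs ys) 1ℤ) (Z.*-identityʳ _)))
   (trans (∑-pairs xs ys (λ _ -> 1ℤ)) (trans (∑-cong xs (λ _ -> trans (∑-const ys 1ℤ) (Z.*-identityʳ _))) (∑-const xs (+ length ys))))

 -- A finite graph with a squared-distance-like function; the Poincaré inequality is one-sided, since the
 -- increase of a distance function along an edge is easier to bound than its decrease.
 record Space (κ c : ℤ) : Set₁ where
   field
     Pt       : Set
     pts      : List Pt
     nb       : Pt -> List Pt
     d²       : Pt -> Pt -> ℤ
     c′       : ℤ
     d²≥0     : ∀ x a -> 0ℤ ≤ d² x a
     d²-self  : ∀ x -> d² x x ≡ 0ℤ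
     0≤c′     : 0ℤ ≤ c′
     poincare : ∀ (f : Pt -> ℤ) -> ∑ pts (λ x -> ∑ pts (λ y -> (f x - f y) * (f x - f y)))
                  ≤ κ * + length pts * ∑ pts (λ x -> ∑ (nb x) (λ z -> sqpos (f z - f x)))
     gradient : ∀ x a -> ∑ (nb x) (λ z -> sqpos (d² z a - d² x a)) ≤ c * d² x a + c′

 module _ {κ c : ℤ} (0≤κ : 0ℤ ≤ κ) where
   open Space

   -- Products keep both κ and c; only c′ adds up. The sum of squared differences splits into a part
   -- within the fibres and a part between the fibre sums. The first is the inequality of the second
   -- factor; the second part reduces by Cauchy-Schwarz to the inequality of the first factor on
   -- each slice.
   _⊗_ : Space κ c -> Space κ c -> Space κ c
   S ⊗ T = record
     { Pt = Pt S × Pt T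
     ; pts = pairs (pts S) (pts T)
     ; nb = λ { (a , b) -> map (_, b) (nb S a) ++ map (a ,_) (nb T b) }
     ; d² = λ { (a , b) (a′ , b′) -> d² S a a′ + d² T b b′ }
     ; c′ = c′ S + c′ T
     ; d²≥0 = λ { (a , b) (a′ , b′) -> 0≤-+ (d²≥0 S a a′) (d²≥0 T b b′) }
     ; d²-self = λ { (a , b) -> cong₂ _+_ (d²-self S a) (d²-self T b) }
     ; 0≤c′ = 0≤-+ (0≤c′ S) (0≤c′ T)
     ; poincare = poin
     ; gradient = grad
     }
     where
     As = pts S
     Bs = pts T
     lA lB : ℤ
     lA = + length As
     lB = + length Bs
     grad : ∀ (x a : Pt S × Pt T) -> ∑ (map (_, proj₂ x) (nb S (proj₁ x)) ++ map (proj₁ x ,_) (nb T (proj₂ x)))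
              (λ z -> sqpos ((d² S (proj₁ z) (proj₁ a) + d² T (proj₂ z) (proj₂ a)) - (d² S (proj₁ x) (proj₁ a) + d² T (proj₂ x) (proj₂ a))))
              ≤ c * (d² S (proj₁ x) (proj₁ a) + d² T (proj₂ x) (proj₂ a)) + (c′ S + c′ T)
     grad (x , y) (a , b) = ≤r (trans (∑-++ (map (_, y) (nb S x)) _ _) (cong₂ _+_
           (trans (∑-map (_, y) (nb S x) _) (∑-cong (nb S x) (λ z -> cong sqpos (eqˡ (d² S z a) (d² T y b) (d² S x a)))))
           (trans (∑-map (x ,_) (nb T y) _) (∑-cong (nb T y) (λ z -> cong sqpos (eqʳ (d² S x a) (d² T z b) (d² T y b)))))))
        ⟫ Z.+-mono-≤ (gradient S x a) (gradient T y b) ⟫ ≤r (eq c (d² S x a) (d² T y b) (c′ S) (c′ T))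
       where
       eqˡ : ∀ z y x -> z + y - (x + y) ≡ z - x
       eqˡ = solve 3 (λ z y x -> z :+ y :- (x :+ y) := z :- x) refl
       eqʳ : ∀ x z y -> x + z - (x + y) ≡ z - y
       eqʳ = solve 3 (λ x z y -> x :+ z :- (x :+ y) := z :- y) refl
       eq : ∀ c x y u v -> c * x + u + (c * y + v) ≡ c * (x + y) + (u + v)
       eq = solve 5 (λ c x y u v -> c :* x :+ u :+ (c :* y :+ v) := c :* (x :+ y) :+ (u :+ v)) refl
     poin : ∀ f -> ∑ (pairs As Bs) (λ x -> ∑ (pairs As Bs) (λ y -> (f x - f y) * (f x - f y)))
        ≤ κ * + length (pairs As Bs) * ∑ (pairs As Bs) (λ x -> ∑ (map (_, proj₂ x) (nb S (proj₁ x)) ++ map (proj₁ x ,_) (nb T (proj₂ x))) (λ z -> sqpos (f z - f x)))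
     poin f = ≤r split ⟫ Z.+-mono-≤ part₁ part₂ ⟫ ≤r (trans (sym (Z.*-distribˡ-+ (κ * (lA * lB)) EB EA)) (cong₂ (λ l e -> κ * l * e) (sym (length-pairs As Bs)) (sym energy)))
       where
       Fa : Pt S -> ℤ
       Fa a = ∑ Bs (λ b -> f (a , b))
       DB : Pt S -> ℤ
       DB a = ∑ Bs (λ b -> ∑ Bs (λ b′ -> (f (a , b) - f (a , b′)) * (f (a , b) - f (a , b′))))
       DA : ℤ
       DA = ∑ As (λ a -> ∑ As (λ a′ -> (Fa a - Fa a′) * (Fa a - Fa a′)))
       EA EB : ℤ
       EA = ∑ Bs (λ b -> ∑ As (λ a -> ∑ (nb S a) (λ z -> sqpos (f (z , b) - f (a , b)))))
       EB = ∑ As (λ a -> ∑ Bs (λ b -> ∑ (nb T b) (λ z -> sqpos (f (a , z) - f (a , b)))))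
       Qa : Pt S -> ℤ
       Qa a = ∑ Bs (λ b -> f (a , b) * f (a , b))
       energy : ∑ (pairs As Bs) (λ x -> ∑ (map (_, proj₂ x) (nb S (proj₁ x)) ++ map (proj₁ x ,_) (nb T (proj₂ x))) (λ z -> sqpos (f z - f x))) ≡ EB + EA
       energy = trans (∑-pairs As Bs _) (trans (∑-cong As (λ a -> trans (∑-cong Bs (λ b -> trans (∑-++ (map (_, b) (nb S a)) _ _)
           (cong₂ _+_ (∑-map (_, b) (nb S a) _) (∑-map (a ,_) (nb T b) _)))) (∑-+ Bs _ _))) (trans (∑-+ As _ _) (trans (Z.+-comm _ EB) (cong (λ z -> EB + z) (∑-swap As Bs _)))))
       split : ∑ (pairs As Bs) (λ x -> ∑ (pairs As Bs) (λ y -> (f x - f y) * (f x - f y))) ≡ lA * ∑ As DB + DA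
       split = begin
         _ ≡⟨ variance (pairs As Bs) f ⟩
         + 2 * (+ length (pairs As Bs) * ∑ (pairs As Bs) (λ x -> f x * f x) - ∑ (pairs As Bs) f * ∑ (pairs As Bs) f)
           ≡⟨ cong₂ (λ u v -> + 2 * (u - v * v)) (cong₂ _*_ (length-pairs As Bs) (∑-pairs As Bs _)) (∑-pairs As Bs f) ⟩
         + 2 * (lA * lB * ∑ As Qa - ∑ As Fa * ∑ As Fa) ≡⟨ eq lA lB (∑ As Qa) (∑ As Fa) (∑ As (λ a -> Fa a * Fa a)) ⟩
         lA * (+ 2 * (lB * ∑ As Qa - ∑ As (λ a -> Fa a * Fa a))) + + 2 * (lA * ∑ As (λ a -> Fa a * Fa a) - ∑ As Fa * ∑ As Fa)
           ≡⟨ cong₂ (λ u v -> lA * u + v) (sym DBs) (sym (variance As Fa)) ⟩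
         lA * ∑ As DB + DA ∎
         where
         open ≡-Reasoning
         eq : ∀ a b q s r -> + 2 * (a * b * q - s * s) ≡ a * (+ 2 * (b * q - r)) + + 2 * (a * r - s * s)
         eq = solve 5 (λ a b q s r -> :2 :* (a :* b :* q :- s :* s) := a :* (:2 :* (b :* q :- r)) :+ :2 :* (a :* r :- s :* s)) refl
         DBs : ∑ As DB ≡ + 2 * (lB * ∑ As Qa - ∑ As (λ a -> Fa a * Fa a))
         DBs = trans (∑-cong As (λ a -> variance Bs (λ b -> f (a , b)))) (trans (∑-*ˡ As (+ 2) _) (cong (+ 2 *_) (trans (∑-- As _ _) (cong (_- ∑ As (λ a -> Fa a * Fa a)) (∑-*ˡ As lB Qa)))))
       part₁ : lA * ∑ As DB ≤ κ * (lA * lB) * EB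
       part₁ = ≤-*ˡ lA 0≤ℕ (∑-mono As (λ a -> poincare T (λ b -> f (a , b))) ⟫ ≤r (∑-*ˡ As (κ * lB) _)) ⟫ ≤r (eq lA κ lB EB)
         where
         eq : ∀ a k b e -> a * (k * b * e) ≡ k * (a * b) * e
         eq = solve 4 (λ a k b e -> a :* (k :* b :* e) := k :* (a :* b) :* e) refl
       part₂ : DA ≤ κ * (lA * lB) * EA
       part₂ = ∑-mono As (λ a -> ∑-mono As (λ a′ -> ≤r (cong (λ z -> z * z) (sym (∑-- Bs (λ b -> f (a , b)) (λ b -> f (a′ , b))))) ⟫ ∑-cauchy Bs (λ b -> f (a , b) - f (a′ , b))))
         ⟫ ≤r (trans (∑-cong As (λ a -> ∑-*ˡ As lB _)) (trans (∑-*ˡ As lB _) (cong (lB *_) (trans (∑-cong As (λ a -> ∑-swap As Bs _)) (∑-swap As Bs _)))))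
         ⟫ ≤-*ˡ lB 0≤ℕ (∑-mono Bs (λ b -> poincare S (λ a -> f (a , b))) ⟫ ≤r (∑-*ˡ Bs (κ * lA) _)) ⟫ ≤r (eq lA κ lB EA)
         where
         eq : ∀ a k b e -> b * (k * a * e) ≡ k * (a * b) * e
         eq = solve 4 (λ a k b e -> b :* (k :* a :* e) := k :* (a :* b) :* e) refl

   module Concentration (S : Space κ c) (0≤c : 0ℤ ≤ c) where

     -- The squared distance to the listed points, truncated at `T`. Truncation keeps the gradient
     -- bound of order `T`.
     gap : ℤ -> List (Pt S) -> Pt S -> ℤ
     gap T [] x = T
     gap T (a ∷ as) x = d² S x a ⊓ gap T as x

     gap≤T : ∀ T as x -> gap T as x ≤ T
     gap≤T T [] x = Z.≤-refl
     gap≤T T (a ∷ as) x = Z.i⊓j≤j (d² S x a) _ ⟫ gap≤T T as x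

     gap≤d² : ∀ T as x {a} -> a ∈ as -> gap T as x ≤ d² S x a
     gap≤d² T (a ∷ as) x (here refl) = Z.i⊓j≤i (d² S x a) _
     gap≤d² T (a ∷ as) x (there m) = Z.i⊓j≤j (d² S x a) _ ⟫ gap≤d² T as x m

     0≤gap : ∀ T as x -> 0ℤ ≤ T -> 0ℤ ≤ gap T as x
     0≤gap T [] x h = h
     0≤gap T (a ∷ as) x h = Z.⊓-glb (d²≥0 S x a) (0≤gap T as x h)

     attained : ∀ T as x -> gap T as x ≡ T ⊎ (∃ λ a -> a ∈ as × gap T as x ≡ d² S x a)
     attained T [] x = inj₁ refl
     attained T (a ∷ as) x with Z.⊓-sel (d² S x a) (gap T as x)
     ... | inj₁ h = inj₂ (a , here refl , h)
     ... | inj₂ h with attained T as x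
     ...   | inj₁ k = inj₁ (trans h k)
     ...   | inj₂ (b , m , k) = inj₂ (b , there m , trans h k)

     -- Where the minimum is attained at a, `gap` rises along an edge no more than the squared
     -- distance to that fixed a; where it equals `T` it cannot rise at all.
     local-energy : ∀ T as x -> 0ℤ ≤ T -> ∑ (nb S x) (λ z -> sqpos (gap T as z - gap T as x)) ≤ c * T + c′ S
     local-energy T as x 0≤T with attained T as x
     ... | inj₁ h = ≤r (trans (∑-cong (nb S x) (λ z -> sqpos-≤0 (Z.i≤j⇒i-j≤0 (gap≤T T as z ⟫ ≤r (sym h))))) (∑-zero (nb S x))) ⟫ 0≤-+ (0≤-* 0≤c 0≤T) (0≤c′ S)
     ... | inj₂ (a , m , h) = ∑-mono (nb S x) (λ z -> sqpos-mono (Z.+-mono-≤ (gap≤d² T as z m) (≤r (cong -_ h)))) ⟫ gradient S x a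
          ⟫ Z.+-monoˡ-≤ (c′ S) (≤-*ˡ c 0≤c (≤r (sym h) ⟫ gap≤T T as x))

     far : ℤ -> List (Pt S) -> Pt S -> Bool
     far T as x = does (T Z.≤? gap T as x)

     near-witness : ∀ T as x -> far T as x ≡ false -> ∃ λ a -> a ∈ as × d² S x a ≤ T
     near-witness T as x h with T Z.≤? gap T as x
     ... | no q with attained T as x
     ...   | inj₁ e = ⊥-elim (q (≤r (sym e)))
     ...   | inj₂ (a , m , e) = a , m , (≤r (sym e) ⟫ gap≤T T as x)

     members : (Pt S -> Bool) -> List (Pt S) -> List (Pt S)
     members A [] = []
     members A (x ∷ xs) = if A x then x ∷ members A xs else members A xs

     ∈-members : ∀ A xs {x} -> x ∈ xs -> A x ≡ true -> x ∈ members A xs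
     ∈-members A (y ∷ xs) (here refl) h rewrite h = here refl
     ∈-members A (y ∷ xs) (there m) h with A y
     ... | true = there (∈-members A xs m h)
     ... | false = ∈-members A xs m h

     members-∈ : ∀ A xs {x} -> x ∈ members A xs -> A x ≡ true
     members-∈ A (y ∷ xs) m with A y in eq
     members-∈ A (y ∷ xs) (here refl) | true = eq
     members-∈ A (y ∷ xs) (there m) | true = members-∈ A xs m
     ... | false = members-∈ A xs m

     -- The set of points far from A is small.
     concentration : ∀ T (A : Pt S -> Bool) -> 0ℤ ≤ T ->
       ∑ (pts S) (λ x -> ind (A x)) * ∑ (pts S) (λ x -> ind (far T (members A (pts S)) x)) * (T * T)
         ≤ κ * (+ length (pts S) * + length (pts S)) * (c * T + c′ S)
     concentration T A 0≤T = ≤r (trans (cong (_* (T * T)) (sym (∑-** X X (λ x -> ind (A x)) (λ y -> ind (far T as y)))))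
            (trans (sym (∑-*ʳ X (T * T) _)) (∑-cong X (λ x -> sym (∑-*ʳ X (T * T) _)))))
         ⟫ ∑-mono∈ X (λ x mx -> ∑-mono X (λ y -> pointwise x mx y)) ⟫ poincare S g
         ⟫ ≤-*ˡ (κ * + length X) (0≤-* 0≤κ 0≤ℕ) (∑-mono X (λ x -> local-energy T as x 0≤T) ⟫ ≤r (∑-const X _)) ⟫ ≤r (eq κ (+ length X) (c * T + c′ S))
       where
       X : List (Pt S)
       X = pts S
       as : List (Pt S)
       as = members A X
       g : Pt S -> ℤ
       g = gap T as
       eq : ∀ k l e -> k * l * (l * e) ≡ k * (l * l) * e
       eq = solve 3 (λ k l e -> k :* l :* (l :* e) := k :* (l :* l) :* e) refl
       -- `g` vanishes on A and equals `T` on the far set, so every such pair contributes T² to the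
       -- left side of the Poincaré inequality.
       pointwise : ∀ x -> x ∈ X -> ∀ y -> ind (A x) * ind (far T as y) * (T * T) ≤ (g x - g y) * (g x - g y)
       pointwise x mx y with A x in ax | T Z.≤? gap T as y
       ... | false | dec = ≤r (trans (cong (_* (T * T)) (Z.*-zeroˡ (ind (does dec)))) (Z.*-zeroˡ (T * T))) ⟫ 0≤-sq (g x - g y)
       ... | true | no _ = ≤r (Z.*-zeroˡ (T * T)) ⟫ 0≤-sq (g x - g y)
       ... | true | yes h = ≤r (trans (Z.*-identityˡ (T * T)) (cong₂ (λ u v -> u * v) T≡ T≡)) ⟫ ≤r (sq (g x) (g y))
         where
         gx≡0 : g x ≡ 0ℤ
         gx≡0 = Z.≤-antisym (gap≤d² T as x (∈-members A X mx ax) ⟫ ≤r (d²-self S x)) (0≤gap T as x 0≤T)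
         T≡ : T ≡ g y - g x
         T≡ = trans (Z.≤-antisym h (gap≤T T as y)) (sym (trans (cong (λ z -> g y - z) gx≡0) (Z.+-identityʳ (g y))))
         sq : ∀ a b -> (b - a) * (b - a) ≡ (a - b) * (a - b)
         sq = solve 2 (λ a b -> (b :- a) :* (b :- a) := (a :- b) :* (a :- b)) refl

 -- The path

 upTo : ℕ -> List ℕ
 upTo = L.upTo

 upTo-suc : ∀ n -> upTo (suc n) ≡ 0 ∷ map suc (upTo n)
 upTo-suc n = cong (0 ∷_) (sym (Lₚ.map-applyUpTo id suc n))

 ∑-upTo-suc : ∀ n (f : ℕ -> ℤ) -> ∑ (upTo (suc n)) f ≡ f 0 + ∑ (upTo n) (f ∘ suc)
 ∑-upTo-suc n f = trans (cong (λ l -> ∑ l f) (upTo-suc n)) (+ˡ (f 0) (∑-map suc (upTo n) f))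

 ∑-upTo-+ : ∀ a b (f : ℕ -> ℤ) -> ∑ (upTo (a ℕ.+ b)) f ≡ ∑ (upTo a) f + ∑ (upTo b) (λ i -> f (a ℕ.+ i))
 ∑-upTo-+ zero b f = sym (Z.+-identityˡ _)
 ∑-upTo-+ (suc a) b f = trans (∑-upTo-suc (a ℕ.+ b) f) (trans (+ˡ (f 0) (∑-upTo-+ a b (f ∘ suc)))
   (trans (sym (Z.+-assoc (f 0) _ _)) (cong (_+ ∑ (upTo b) (λ i -> f (suc a ℕ.+ i))) (sym (∑-upTo-suc a f)))))

 length-upTo : ∀ n -> length (upTo n) ≡ n
 length-upTo n = Lₚ.length-upTo n

 ∈-upTo : ∀ n {i} -> i ∈ upTo n -> i ℕ.< n
 ∈-upTo n m = ∈ₚ.∈-upTo⁻ m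

 upTo-∈ : ∀ {n i} -> i ℕ.< n -> i ∈ upTo n
 upTo-∈ h = ∈ₚ.∈-upTo⁺ h

 telescope : ∀ i (f : ℕ -> ℤ) -> ∑ (upTo i) (λ l -> f (suc l) - f l) ≡ f i - f 0
 telescope zero f = sym (Z.+-inverseʳ (f 0))
 telescope (suc i) f = trans (∑-upTo-suc i (λ l -> f (suc l) - f l)) (trans (+ˡ (f 1 - f 0) (telescope i (f ∘ suc))) (eq (f 1) (f 0) (f (suc i))))
   where
   eq : ∀ a b c -> a - b + (c - a) ≡ c - b
   eq = solve 3 (λ a b c -> a :- b :+ (c :- a) := c :- b) refl

 module Path (m : ℕ) where

   n : ℕ
   n = suc m

   -- At an end point the missing neighbour is replaced by the point itself, which adds nothing to
   -- the energy.
   up down : ℕ -> ℕ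
   up j = if j ℕ.<ᵇ m then suc j else j
   down zero = zero
   down (suc j) = j

   energy : (ℕ -> ℤ) -> ℤ
   energy f = ∑ (upTo n) (λ x -> ∑ (up x ∷ down x ∷ []) (λ z -> sqpos (f z - f x)))

   -- Every edge is met from both of its ends, and the positive parts of a difference and of its
   -- negative restore the full square.
   energy-lower : ∀ f -> ∑ (upTo m) (λ l -> (f (suc l) - f l) * (f (suc l) - f l)) ≤ energy f
   energy-lower f = ≤r (trans (∑-cong (upTo m) (λ l -> trans (sym (sqpos-both (f (suc l) - f l))) (cong (λ z -> sqpos (f (suc l) - f l) + sqpos z) (neg (f (suc l)) (f l)))))
       (∑-+ (upTo m) (λ l -> sqpos (f (suc l) - f l)) (λ l -> sqpos (f l - f (suc l)))))
     ⟫ Z.+-mono-≤ ups downs ⟫ ≤r (sym (trans (∑-cong (upTo n) (λ x -> +ˡ (sqpos (f (up x) - f x)) (Z.+-identityʳ (sqpos (f (down x) - f x))))) (∑-+ (upTo n) (λ x -> sqpos (f (up x) - f x)) (λ x -> sqpos (f (down x) - f x)))))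
     where
     neg : ∀ a b -> - (a - b) ≡ b - a
     neg = solve 2 (λ a b -> :- (a :- b) := b :- a) refl
     up≡ : ∀ l -> l ∈ upTo m -> up l ≡ suc l
     up≡ l h with l ℕ.<ᵇ m | N.<⇒<ᵇ (∈-upTo m h)
     ... | true | _ = refl
     ups : ∑ (upTo m) (λ l -> sqpos (f (suc l) - f l)) ≤ ∑ (upTo n) (λ x -> sqpos (f (up x) - f x))
     ups = ≤r (∑-cong∈ (upTo m) (λ l h -> cong (λ z -> sqpos (f z - f l)) (sym (up≡ l h))))
        ⟫ by (∑-nonneg (upTo 1) (λ i -> 0≤sqpos (f (up (m ℕ.+ i)) - f (m ℕ.+ i)))) (trans (cong (λ k -> ∑ (upTo k) (λ x -> sqpos (f (up x) - f x))) (N.+-comm 1 m)) (∑-upTo-+ m 1 (λ x -> sqpos (f (up x) - f x))))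
     downs : ∑ (upTo m) (λ l -> sqpos (f l - f (suc l))) ≤ ∑ (upTo n) (λ x -> sqpos (f (down x) - f x))
     downs = by (0≤sqpos (f 0 - f 0)) (trans (∑-upTo-suc m (λ x -> sqpos (f (down x) - f x))) (Z.+-comm (sqpos (f 0 - f 0)) _))

   near-start : ∀ f i -> i ∈ upTo n -> (f i - f 0) * (f i - f 0) ≤ + n * energy f
   near-start f i h = ≤r (cong (λ z -> z * z) (sym (telescope i f))) ⟫ ∑-cauchy (upTo i) (λ l -> f (suc l) - f l)
     ⟫ ≤-*² 0≤ℕ (0≤energy) (+≤+ (N.≤-trans (N.≤-reflexive (length-upTo i)) (N.<⇒≤ (∈-upTo n h)))) (sub ⟫ energy-lower f)
     where
     0≤energy : 0ℤ ≤ energy f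
     0≤energy = ∑-nonneg (upTo n) (λ x -> ∑-nonneg (up x ∷ down x ∷ []) (λ z -> 0≤sqpos (f z - f x)))
     i≤m : i ℕ.≤ m
     i≤m = ℕ.s≤s⁻¹ (∈-upTo n h)
     sq : ℕ -> ℤ
     sq l = (f (suc l) - f l) * (f (suc l) - f l)
     sub : ∑ (upTo i) sq ≤ ∑ (upTo m) sq
     sub = by (∑-nonneg (upTo (m ℕ.∸ i)) (λ j -> 0≤-sq (f (suc (i ℕ.+ j)) - f (i ℕ.+ j)))) (trans (cong (λ k -> ∑ (upTo k) sq) (sym (N.m+[n∸m]≡n i≤m))) (∑-upTo-+ i (m ℕ.∸ i) sq))

   κ : ℤ
   κ = + 4 * (+ n * + n)

   path-poincare : ∀ f -> ∑ (upTo n) (λ x -> ∑ (upTo n) (λ y -> (f x - f y) * (f x - f y))) ≤ κ * + length (upTo n) * energy f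
   path-poincare f = ∑-mono∈ (upTo n) (λ x hx -> ∑-mono∈ (upTo n) (λ y hy -> pw x y hx hy))
       ⟫ ≤r (trans (∑-cong (upTo n) (λ x -> ∑-const (upTo n) (+ 4 * (+ n * energy f)))) (trans (∑-const (upTo n) (+ length (upTo n) * (+ 4 * (+ n * energy f)))) (trans (cong (λ l -> + l * (+ l * (+ 4 * (+ n * energy f)))) (length-upTo n)) (trans (eq (+ n) (energy f)) (cong (λ l -> κ * + l * energy f) (sym (length-upTo n)))))))
     where
     eq : ∀ n e -> n * (n * (+ 4 * (n * e))) ≡ + 4 * (n * n) * n * e
     eq = solve 2 (λ n e -> n :* (n :* (:4 :* (n :* e))) := :4 :* (n :* n) :* n :* e) refl
     pw : ∀ x y -> x ∈ upTo n -> y ∈ upTo n -> (f x - f y) * (f x - f y) ≤ + 4 * (+ n * energy f)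
     pw x y hx hy = by (0≤-+ (0≤-+ (0≤-* {+ 2} 0≤ℕ (0≤-- (near-start f x hx))) (0≤-* {+ 2} 0≤ℕ (0≤-- (near-start f y hy)))) (0≤-sq (f x + f y - + 2 * f 0)))
         (id₁ (f x) (f y) (f 0) (+ n * energy f))
       where
       id₁ : ∀ x y z e -> + 4 * e ≡ (x - y) * (x - y) + (+ 2 * (e - (x - z) * (x - z)) + + 2 * (e - (y - z) * (y - z)) + (x + y - + 2 * z) * (x + y - + 2 * z))
       id₁ = solve 4 (λ x y z e -> :4 :* e := (x :- y) :* (x :- y) :+ (:2 :* (e :- (x :- z) :* (x :- z)) :+ :2 :* (e :- (y :- z) :* (y :- z)) :+ (x :+ y :- :2 :* z) :* (x :+ y :- :2 :* z))) refl

   -- The factor 4 makes `d²` the squared difference of the centred values 2j + 1 - n. Both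
   -- constants 32 come from (8u + 4)² + (4 - 8u)² = 32 · 4u² + 32.
   path : Space κ (+ 32)
   path = record
     { Pt = ℕ ; pts = upTo n ; nb = λ x -> up x ∷ down x ∷ [] ; d² = λ x a -> + 4 * ((+ x - + a) * (+ x - + a)) ; c′ = + 32
     ; d²≥0 = λ x a -> 0≤-* {+ 4} 0≤ℕ (0≤-sq (+ x - + a))
     ; d²-self = λ x -> self (+ x)
     ; 0≤c′ = 0≤ℕ ; poincare = path-poincare ; gradient = grad }
     where
     self : ∀ x -> + 4 * ((x - x) * (x - x)) ≡ 0ℤ
     self = solve 1 (λ x -> :4 :* ((x :- x) :* (x :- x)) := :0) refl
     dd : ℤ -> ℤ -> ℤ
     dd x a = + 4 * ((x - a) * (x - a))
     zero-diff : ∀ u -> sqpos (u - u) ≡ 0ℤ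
     zero-diff u = sqpos-≤0 (≤r (Z.+-inverseʳ u))
     move-up : ∀ x a -> sqpos (dd (+ up x) a - dd (+ x) a) ≤ (+ 8 * (+ x - a) + + 4) * (+ 8 * (+ x - a) + + 4)
     move-up x a with x ℕ.<ᵇ m
     ... | true = sqpos≤ (dd (+ suc x) a - dd (+ x) a) ⟫ ≤r (cong (λ z -> z * z) (eq (+ x) a))
       where
       eq : ∀ x a -> + 4 * ((1ℤ + x - a) * (1ℤ + x - a)) - + 4 * ((x - a) * (x - a)) ≡ + 8 * (x - a) + + 4
       eq = solve 2 (λ x a -> :4 :* ((:1 :+ x :- a) :* (:1 :+ x :- a)) :- :4 :* ((x :- a) :* (x :- a)) := con (+ 8) :* (x :- a) :+ :4) refl
     ... | false = ≤r (zero-diff (dd (+ x) a)) ⟫ 0≤-sq (+ 8 * (+ x - a) + + 4)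
     move-down : ∀ x a -> sqpos (dd (+ down x) a - dd (+ x) a) ≤ (+ 4 - + 8 * (+ x - a)) * (+ 4 - + 8 * (+ x - a))
     move-down zero a = ≤r (zero-diff (dd 0ℤ a)) ⟫ 0≤-sq (+ 4 - + 8 * (0ℤ - a))
     move-down (suc x) a = sqpos≤ (dd (+ x) a - dd (+ suc x) a) ⟫ ≤r (cong (λ z -> z * z) (eq (+ x) a))
       where
       eq : ∀ x a -> + 4 * ((x - a) * (x - a)) - + 4 * ((1ℤ + x - a) * (1ℤ + x - a)) ≡ + 4 - + 8 * (1ℤ + x - a)
       eq = solve 2 (λ x a -> :4 :* ((x :- a) :* (x :- a)) :- :4 :* ((:1 :+ x :- a) :* (:1 :+ x :- a)) := :4 :- con (+ 8) :* (:1 :+ x :- a)) refl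
     grad : ∀ x a -> sqpos (dd (+ up x) (+ a) - dd (+ x) (+ a)) + (sqpos (dd (+ down x) (+ a) - dd (+ x) (+ a)) + 0ℤ) ≤ + 32 * dd (+ x) (+ a) + + 32
     grad x a = Z.+-mono-≤ (move-up x (+ a)) (Z.+-monoˡ-≤ 0ℤ (move-down x (+ a))) ⟫ ≤r (eq (+ x - + a))
       where
       eq : ∀ u -> (+ 8 * u + + 4) * (+ 8 * u + + 4) + ((+ 4 - + 8 * u) * (+ 4 - + 8 * u) + 0ℤ) ≡ + 32 * (+ 4 * (u * u)) + + 32
       eq = solve 1 (λ u -> (con (+ 8) :* u :+ :4) :* (con (+ 8) :* u :+ :4) :+ ((:4 :- con (+ 8) :* u) :* (:4 :- con (+ 8) :* u) :+ :0) := con (+ 32) :* (:4 :* (u :* u)) :+ con (+ 32)) refl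

 -- Survival probabilities of a lazy walk

 ∑-upTo-snoc : ∀ n (f : ℕ -> ℤ) -> ∑ (upTo (suc n)) f ≡ ∑ (upTo n) f + f n
 ∑-upTo-snoc n f = trans (cong (λ k -> ∑ (upTo k) f) (N.+-comm 1 n)) (trans (∑-upTo-+ n 1 f)
   (+ˡ (∑ (upTo n) f) (trans (Z.+-identityʳ (f (n ℕ.+ 0))) (cong f (N.+-identityʳ n)))))

 ∑-upTo-reverse : ∀ n (f : ℕ -> ℤ) -> ∑ (upTo n) f ≡ ∑ (upTo n) (λ i -> f (n ℕ.∸ suc i))
 ∑-upTo-reverse zero f = refl
 ∑-upTo-reverse (suc n) f = trans (∑-upTo-snoc n f) (trans (Z.+-comm (∑ (upTo n) f) (f n))
   (trans (+ˡ (f n) (∑-upTo-reverse n f)) (sym (∑-upTo-suc n (λ i -> f (n ℕ.∸ i))))))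

 -- β n r counts (with weight 4 per step) the lazy walks of length n from r that stay positive.
 β : ℕ -> ℕ -> ℕ
 β n zero = 0
 β zero (suc r) = 1
 β (suc n) (suc r) = β n (suc (suc r)) ℕ.+ 2 ℕ.* β n (suc r) ℕ.+ β n r

 β-suc : ∀ n r -> + β (suc n) (suc r) ≡ + β n (suc (suc r)) + + 2 * + β n (suc r) + + β n r
 β-suc n r = cong (λ z -> + β n (suc (suc r)) + z + + β n r) (Z.pos-* 2 (β n (suc r)))

 4^ : ℕ -> ℤ
 4^ n = + (4 ℕ.^ n)

 4^-suc : ∀ n -> 4^ (suc n) ≡ + 4 * 4^ n
 4^-suc n = Z.pos-* 4 (4 ℕ.^ n)

 1≤4^ : ∀ n -> 1ℤ ≤ 4^ n
 1≤4^ n = +≤+ (N.m^n>0 4 n)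

 β≤4^ : ∀ n r -> + β n r ≤ 4^ n
 β≤4^ n zero = 0≤ℕ
 β≤4^ zero (suc r) = Z.≤-refl
 β≤4^ (suc n) (suc r) = ≤r (β-suc n r) ⟫ by (0≤-+ (0≤-+ (0≤-- (β≤4^ n (suc (suc r)))) (0≤-* {+ 2} 0≤ℕ (0≤-- (β≤4^ n (suc r))))) (0≤-- (β≤4^ n r)))
    (trans (4^-suc n) (eq (4^ n) (+ β n (suc (suc r))) (+ β n (suc r)) (+ β n r)))
   where
   eq : ∀ q a b c -> + 4 * q ≡ a + + 2 * b + c + (q - a + + 2 * (q - b) + (q - c))
   eq = solve 4 (λ q a b c -> :4 :* q := a :+ :2 :* b :+ c :+ (q :- a :+ :2 :* (q :- b) :+ (q :- c))) refl

 potential : ℤ -> ℤ -> ℤ -> ℤ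
 potential R n r = r * (n + + 2 * R * R) + + 2 * R * R * R * (r * (+ 2 * R - r))

 -- The function ρ = r(2R - r) has first differences D - 1 and D + 1 and second difference -2, so a
 -- lazy step lowers it by 1/2 on average. The condition 2ρ ≤ A + 1 is precisely what makes (C/A)(ρ
 -- - 1/2) ≤ (C/(A + 1))ρ.
 potential-step : ∀ A R C q a b c r ρ D -> 1ℤ ≤ A -> 0ℤ ≤ C -> 0ℤ ≤ q -> + 2 * ρ ≤ A + 1ℤ ->
   R * A * a ≤ q * ((r + 1ℤ) * A + C * (ρ + D - 1ℤ)) ->
   R * A * b ≤ q * (r * A + C * ρ) ->
   R * A * c ≤ q * ((r - 1ℤ) * A + C * (ρ - D - 1ℤ)) ->
   R * (A + 1ℤ) * (a + + 2 * b + c) ≤ + 4 * q * (r * (A + 1ℤ) + C * ρ)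
 potential-step A R C q a b c r ρ D 1≤A 0≤C 0≤q hρ ha hb hc = ≤-cancelˡ A 1≤A
   (by (0≤-+ (0≤-+ (0≤-+ (0≤-* 0≤A+1 (0≤-- ha)) (0≤-* (0≤-* {+ 2} 0≤ℕ 0≤A+1) (0≤-- hb))) (0≤-* 0≤A+1 (0≤-- hc))) (0≤-* (0≤-* {+ 2} 0≤ℕ (0≤-* 0≤q 0≤C)) (0≤-- hρ)))
     (eq A R C q a b c r ρ D))
   where
   0≤A+1 : 0ℤ ≤ A + 1ℤ
   0≤A+1 = 0≤-+ (1≤⇒0≤ 1≤A) (0≤ℕ {1})
   eq : ∀ A R C q a b c r ρ D -> A * (+ 4 * q * (r * (A + 1ℤ) + C * ρ)) ≡ A * (R * (A + 1ℤ) * (a + + 2 * b + c))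
     + ((A + 1ℤ) * (q * ((r + 1ℤ) * A + C * (ρ + D - 1ℤ)) - R * A * a) + + 2 * (A + 1ℤ) * (q * (r * A + C * ρ) - R * A * b)
       + (A + 1ℤ) * (q * ((r - 1ℤ) * A + C * (ρ - D - 1ℤ)) - R * A * c) + + 2 * (q * C) * (A + 1ℤ - + 2 * ρ))
   eq = solve 10 (λ A R C q a b c r ρ D -> A :* (:4 :* q :* (r :* (A :+ :1) :+ C :* ρ)) := A :* (R :* (A :+ :1) :* (a :+ :2 :* b :+ c)) :+ ((A :+ :1) :* (q :* ((r :+ :1) :* A :+ C :* (ρ :+ D :- :1)) :- R :* A :* a) :+ :2 :* (A :+ :1) :* (q :* (r :* A :+ C :* ρ) :- R :* A :* b) :+ (A :+ :1) :* (q :* ((r :- :1) :* A :+ C :* (ρ :- D :- :1)) :- R :* A :* c) :+ :2 :* (q :* C) :* (A :+ :1 :- :2 :* ρ))) refl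

 module Potential (R : ℕ) (1≤R : 1 ℕ.≤ R) where
   private
     A : ℤ -> ℤ
     A n = n + + 2 * + R * + R
     C : ℤ
     C = + 2 * + R * + R * + R

     0≤2R : 0ℤ ≤ + 2 * + R
     0≤2R = 0≤-* {+ 2} {+ R} 0≤ℕ 0≤ℕ

     0≤C : 0ℤ ≤ C
     0≤C = 0≤-* (0≤-* 0≤2R (0≤ℕ {R})) (0≤ℕ {R})

     0≤A : ∀ n -> 0ℤ ≤ A (+ n)
     0≤A n = 0≤-+ (0≤ℕ {n}) (0≤-* 0≤2R (0≤ℕ {R}))

     1≤A : ∀ n -> 1ℤ ≤ A (+ n)
     1≤A n = by (0≤-+ (0≤-+ (0≤ℕ {n}) (0≤-- (1≤-* {+ R} {+ R} (+≤+ 1≤R) (+≤+ 1≤R)))) (0≤-* (0≤ℕ {R}) (0≤ℕ {R}))) (eq (+ n) (+ R))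
       where
       eq : ∀ n R -> n + + 2 * R * R ≡ 1ℤ + (n + (R * R - 1ℤ) + R * R)
       eq = solve 2 (λ n R -> n :+ :2 :* R :* R := :1 :+ (n :+ (R :* R :- :1) :+ R :* R)) refl

   record Claim (n r : ℕ) : Set where
     constructor claim
     field
       bound : + R * A (+ n) * + β n r ≤ 4^ n * potential (+ R) (+ n) (+ r)

   private

     zero-case : ∀ n -> Claim n 0
     zero-case n = claim $ ≤r (eq (+ R * A (+ n)) (+ R) (+ n) (4^ n))
       where
       eq : ∀ x R n q -> x * 0ℤ ≡ q * (0ℤ * (n + + 2 * R * R) + + 2 * R * R * R * (0ℤ * (+ 2 * R - 0ℤ)))
       eq = solve 4 (λ x R n q -> x :* :0 := q :* (:0 :* (n :+ :2 :* R :* R) :+ :2 :* R :* R :* R :* (:0 :* (:2 :* R :- :0)))) refl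

     -- For r ≥ R the linear term r/R is already at least 1, and up to 2R the quadratic term is
     -- nonnegative.
     large-case : ∀ n r -> R ℕ.≤ r -> r ℕ.≤ 2 ℕ.* R -> Claim n r
     large-case n r R≤r r≤ = claim $ ≤-*ˡ (+ R * A (+ n)) (0≤-* (0≤ℕ {R}) (0≤A n)) (β≤4^ n r)
         ⟫ by (0≤-* (0≤ℕ {4 ℕ.^ n}) (0≤-+ (0≤-* (0≤-- (+≤+ R≤r)) (0≤A n)) (0≤-* 0≤C (0≤-* (0≤ℕ {r}) (0≤-- 2R≥))))) (eq (+ R) (A (+ n)) C (+ r) (4^ n))
       where
       2R≥ : + r ≤ + 2 * + R
       2R≥ = +≤+ r≤ ⟫ ≤r (Z.pos-* 2 R)
       eq : ∀ R A C r q -> q * (r * A + C * (r * (+ 2 * R - r))) ≡ R * A * q + q * ((r - R) * A + C * (r * (+ 2 * R - r)))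
       eq = solve 5 (λ R A C r q -> q :* (r :* A :+ C :* (r :* (:2 :* R :- r))) := R :* A :* q :+ q :* ((r :- R) :* A :+ C :* (r :* (:2 :* R :- r)))) refl

     base-case : ∀ r -> suc r ℕ.≤ R -> Claim 0 (suc r)
     base-case r r≤R = claim $ by (0≤-+ (0≤-* (0≤ℕ {suc r}) (0≤-* 0≤2R (0≤ℕ {R}))) (0≤-* 0≤C (0≤-+ (0≤-* (0≤ℕ {r}) (0≤-- (+≤+ r≤R))) (0≤-* (0≤ℕ {suc (suc r)}) (0≤-- (+≤+ 1≤R))))))
       (eq (+ R) (+ r))
       where
       eq : ∀ R r -> 1ℤ * ((1ℤ + r) * (0ℤ + + 2 * R * R) + + 2 * R * R * R * ((1ℤ + r) * (+ 2 * R - (1ℤ + r)))) ≡ R * (0ℤ + + 2 * R * R) * 1ℤ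
           + ((1ℤ + r) * (+ 2 * R * R) + + 2 * R * R * R * (r * (R - (1ℤ + r)) + (1ℤ + (1ℤ + r)) * (R - 1ℤ)))
       eq = solve 2 (λ R r -> :1 :* ((:1 :+ r) :* (:0 :+ :2 :* R :* R) :+ :2 :* R :* R :* R :* ((:1 :+ r) :* (:2 :* R :- (:1 :+ r)))) := R :* (:0 :+ :2 :* R :* R) :* :1 :+ ((:1 :+ r) :* (:2 :* R :* R) :+ :2 :* R :* R :* R :* (r :* (R :- (:1 :+ r)) :+ (:1 :+ (:1 :+ r)) :* (R :- :1)))) refl

     step-case : ∀ n r -> Claim n (suc (suc r)) -> Claim n (suc r) -> Claim n r -> Claim (suc n) (suc r)
     step-case n r (claim h₂) (claim h₁) (claim h₀) = claim $ ≤r (cong₂ (λ a b -> + R * a * b) (A-suc (+ n) (+ R)) (β-suc n r))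
       ⟫ potential-step (A (+ n)) (+ R) C (4^ n) (+ β n (suc (suc r))) (+ β n (suc r)) (+ β n r) (+ suc r) ρ D (1≤A n) 0≤C 0≤ℕ hρ
           (h₂ ⟫ ≤r (cong (4^ n *_) (e₂ (+ R) (A (+ n)) C (+ r)))) h₁ (h₀ ⟫ ≤r (cong (4^ n *_) (e₀ (+ R) (A (+ n)) C (+ r))))
       ⟫ ≤r (cong₂ (λ q a -> q * (+ suc r * a + C * ρ)) (sym (4^-suc n)) (sym (A-suc (+ n) (+ R))))
       where
       ρ D : ℤ
       ρ = + suc r * (+ 2 * + R - + suc r)
       D = + 2 * + R - + 2 * + suc r
       A-suc : ∀ n R -> 1ℤ + n + + 2 * R * R ≡ n + + 2 * R * R + 1ℤ
       A-suc = solve 2 (λ n R -> :1 :+ n :+ :2 :* R :* R := n :+ :2 :* R :* R :+ :1) refl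
       e₂ : ∀ R A C r -> (1ℤ + (1ℤ + r)) * A + C * ((1ℤ + (1ℤ + r)) * (+ 2 * R - (1ℤ + (1ℤ + r))))
         ≡ (1ℤ + r + 1ℤ) * A + C * ((1ℤ + r) * (+ 2 * R - (1ℤ + r)) + (+ 2 * R - + 2 * (1ℤ + r)) - 1ℤ)
       e₂ = solve 4 (λ R A C r -> (:1 :+ (:1 :+ r)) :* A :+ C :* ((:1 :+ (:1 :+ r)) :* (:2 :* R :- (:1 :+ (:1 :+ r)))) := (:1 :+ r :+ :1) :* A :+ C :* ((:1 :+ r) :* (:2 :* R :- (:1 :+ r)) :+ (:2 :* R :- :2 :* (:1 :+ r)) :- :1)) refl
       e₀ : ∀ R A C r -> r * A + C * (r * (+ 2 * R - r)) ≡ (1ℤ + r - 1ℤ) * A + C * ((1ℤ + r) * (+ 2 * R - (1ℤ + r)) - (+ 2 * R - + 2 * (1ℤ + r)) - 1ℤ)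
       e₀ = solve 4 (λ R A C r -> r :* A :+ C :* (r :* (:2 :* R :- r)) := (:1 :+ r :- :1) :* A :+ C :* ((:1 :+ r) :* (:2 :* R :- (:1 :+ r)) :- (:2 :* R :- :2 :* (:1 :+ r)) :- :1)) refl
       hρ : + 2 * ρ ≤ A (+ n) + 1ℤ
       hρ = by (0≤-+ (0≤-+ (0≤ℕ {n}) (0≤-* {+ 2} 0≤ℕ (0≤-sq (+ R - + suc r)))) (0≤ℕ {1})) (eq (+ n) (+ R) (+ suc r))
         where
         eq : ∀ n R r -> n + + 2 * R * R + 1ℤ ≡ + 2 * (r * (+ 2 * R - r)) + (n + + 2 * ((R - r) * (R - r)) + 1ℤ)
         eq = solve 3 (λ n R r -> n :+ :2 :* R :* R :+ :1 := :2 :* (r :* (:2 :* R :- r)) :+ (n :+ :2 :* ((R :- r) :* (R :- r)) :+ :1)) refl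

   -- The potential r / R + κ_n r (2R - r) with κ_n = 2R² / (n + 2R²) dominates the survival probability.
   β-bound : ∀ n r -> r ℕ.≤ 2 ℕ.* R -> Claim n r
   β-bound n zero r≤ = zero-case n
   β-bound n (suc r) r≤ = go n (R N.≤? suc r)
     where
     go : ∀ n -> Dec (R ℕ.≤ suc r) -> Claim n (suc r)
     go n (yes R≤r) = large-case n (suc r) R≤r r≤
     go zero (no R>r) = base-case r (N.<⇒≤ (N.≰⇒> R>r))
     go (suc n) (no R>r) = step-case n r (β-bound n (suc (suc r)) (N.≤-trans (N.≰⇒> R>r) (N.m≤n*m R 2)))
       (β-bound n (suc r) r≤) (β-bound n r (N.≤-trans (N.n≤1+n r) r≤))

 -- Small-ball estimate of Littlewood-Offord type

 inside : ℤ -> ℤ -> ℤ -> Bool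
 inside K t s = does (t Z.≤? s) ∧ does (s + 1ℤ Z.≤? t + + 2 * K)

 does-⇔ : ∀ {P Q : Set} (p : Dec P) (q : Dec Q) -> (P -> Q) -> (Q -> P) -> does p ≡ does q
 does-⇔ (yes _) (yes _) f g = refl
 does-⇔ (yes p) (no q) f g = ⊥-elim (q (f p))
 does-⇔ (no p) (yes q) f g = ⊥-elim (p (g q))
 does-⇔ (no _) (no _) f g = refl

 inside-shift : ∀ K t s c -> inside K t (c + s) ≡ inside K (t - c) s
 inside-shift K t s c = cong₂ _∧_
   (does-⇔ (t Z.≤? c + s) (t - c Z.≤? s) (λ h -> by (0≤-- h) (e₁ t c s)) (λ h -> by (0≤-- h) (e₂ t c s)))
   (does-⇔ (c + s + 1ℤ Z.≤? t + + 2 * K) (s + 1ℤ Z.≤? t - c + + 2 * K) (λ h -> by (0≤-- h) (e₃ t c s K)) (λ h -> by (0≤-- h) (e₄ t c s K)))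
   where
   e₁ : ∀ t c s -> s ≡ t - c + (c + s - t)
   e₁ = solve 3 (λ t c s -> s := t :- c :+ (c :+ s :- t)) refl
   e₂ : ∀ t c s -> c + s ≡ t + (s - (t - c))
   e₂ = solve 3 (λ t c s -> c :+ s := t :+ (s :- (t :- c))) refl
   e₃ : ∀ t c s K -> t - c + + 2 * K ≡ s + 1ℤ + (t + + 2 * K - (c + s + 1ℤ))
   e₃ = solve 4 (λ t c s K -> t :- c :+ :2 :* K := s :+ :1 :+ (t :+ :2 :* K :- (c :+ s :+ :1))) refl
   e₄ : ∀ t c s K -> t + + 2 * K ≡ c + s + 1ℤ + (t - c + + 2 * K - (s + 1ℤ))
   e₄ = solve 4 (λ t c s K -> t :+ :2 :* K := c :+ s :+ :1 :+ (t :- c :+ :2 :* K :- (s :+ :1))) refl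

 inside-lower : ∀ K t s -> inside K t s ≡ true -> t ≤ s
 inside-lower K t s h with t Z.≤? s
 ... | yes q = q

 inside-upper : ∀ K t s -> inside K t s ≡ true -> s + 1ℤ ≤ t + + 2 * K
 inside-upper K t s h with s + 1ℤ Z.≤? t + + 2 * K | ∧-trueʳ {does (t Z.≤? s)} h
 ... | yes q | _ = q

 Descending : ℤ -> List ℤ -> Set
 Descending K = AllPairs (λ t t′ -> t′ + + 2 * K ≤ t)

 cnt : ℤ -> List ℤ -> ℤ -> ℤ
 cnt K T s = ∑ T (λ t -> ind (inside K t s))

 cnt-shift : ∀ K T s c -> cnt K T (c + s) ≡ cnt K (map (_- c) T) s
 cnt-shift K T s c = trans (∑-cong T (λ t -> cong ind (inside-shift K t s c))) (sym (∑-map (_- c) T _))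

 cnt≤1 : ∀ K T s -> Descending K T -> cnt K T s ≤ 1ℤ
 cnt≤1 K [] s _ = 0≤ℕ
 cnt≤1 K (t ∷ T) s (h ∷ hs) with inside K t s in eq
 ... | false = ≤r (Z.+-identityˡ _) ⟫ cnt≤1 K T s hs
 ... | true = ≤r (cong (λ z -> 1ℤ + z) (trans (∑-cong∈ T none) (∑-zero T)))
   where
   none : ∀ t′ -> t′ ∈ T -> ind (inside K t′ s) ≡ 0ℤ
   none t′ m with inside K t′ s in eq′
   ... | false = refl
   ... | true = ⊥-elim (absurd _ 0ℤ (0≤-+ (0≤-+ (0≤-- (inside-lower K t s eq)) (0≤-- (inside-upper K t′ s eq′))) (0≤-- (All.lookup h m))) 0≤ℕ (e t t′ s K))
     where
     e : ∀ t t′ s K -> s - t + (t′ + + 2 * K - (s + 1ℤ)) + (t - (t′ + + 2 * K)) + 0ℤ ≡ -[1+ 0 ]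
     e = solve 4 (λ t t′ s K -> s :- t :+ (t′ :+ :2 :* K :- (s :+ :1)) :+ (t :- (t′ :+ :2 :* K)) :+ :0 := con -[1+ 0 ]) refl

 descending-map : ∀ K c T -> Descending K T -> Descending K (map (_- c) T)
 descending-map K c T h = APₚ.map⁺ (AllPairs.map (λ {t} {t′} q -> by (0≤-- q) (e t t′ K c)) h)
   where
   e : ∀ t t′ K c -> t - c ≡ t′ - c + + 2 * K + (t - (t′ + + 2 * K))
   e = solve 4 (λ t t′ K c -> t :- c := t′ :- c :+ :2 :* K :+ (t :- (t′ :+ :2 :* K))) refl

 module Powers {κ c : ℤ} (0≤κ : 0ℤ ≤ κ) where
   open Space

   unit : Space κ c
   unit = record
     { Pt = ⊤ ; pts = tt ∷ [] ; nb = λ _ -> [] ; d² = λ _ _ -> 0ℤ ; c′ = 0ℤ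
     ; d²≥0 = λ _ _ -> Z.≤-refl ; d²-self = λ _ -> refl ; 0≤c′ = Z.≤-refl
     ; poincare = λ f -> ≤r (eq (f tt) κ)
     ; gradient = λ _ _ -> ≤r (eq′ c) }
     where
     eq : ∀ x κ -> (x - x) * (x - x) + 0ℤ + 0ℤ ≡ κ * 1ℤ * (0ℤ + 0ℤ)
     eq = solve 2 (λ x κ -> (x :- x) :* (x :- x) :+ :0 :+ :0 := κ :* :1 :* (:0 :+ :0)) refl
     eq′ : ∀ c -> 0ℤ ≡ c * 0ℤ + 0ℤ
     eq′ = solve 1 (λ c -> :0 := c :* :0 :+ :0) refl

   pow : Space κ c -> ℕ -> Space κ c
   pow S zero = unit
   pow S (suc k) = _⊗_ 0≤κ S (pow S k)

   comp : ∀ S k -> Pt (pow S k) -> Fin k -> Pt S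
   comp S (suc k) (a , v) F.zero = a
   comp S (suc k) (a , v) (F.suc i) = comp S k v i

   d²-comp : ∀ S k x y -> d² (pow S k) x y ≡ ∑ (allFin k) (λ i -> d² S (comp S k x i) (comp S k y i))
   d²-comp S zero x y = refl
   d²-comp S (suc k) (a , v) (b , w) = trans (+ˡ (d² S a b) (d²-comp S k v w)) (sym (∑-allFin-suc k (λ i -> d² S (comp S (suc k) (a , v) i) (comp S (suc k) (b , w) i))))

   c′-pow : ∀ S k -> c′ (pow S k) ≡ + k * c′ S
   c′-pow S zero = refl
   c′-pow S (suc k) = trans (+ˡ (c′ S) (c′-pow S k)) (eq (+ k) (c′ S))
     where
     eq : ∀ k c -> c + k * c ≡ (1ℤ + k) * c
     eq = solve 2 (λ k c -> c :+ k :* c := (:1 :+ k) :* c) refl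

 module Smallball (m ℓ : ℕ) (m≡ : suc m ≡ 4 ℕ.* ℓ) where
   open Path m using (n; κ; path)

   0≤κ : 0ℤ ≤ κ
   0≤κ = 0≤-* {+ 4} 0≤ℕ (0≤-* (0≤ℕ {n}) (0≤ℕ {n}))

   open Powers {κ} {+ 32} 0≤κ

   Cell : ℕ -> Set
   Cell k = Space.Pt (pow path k)

   cells : ∀ k -> List (Cell k)
   cells k = Space.pts (pow path k)

   #cells : ℕ -> ℤ
   #cells k = + length (cells k)

   val : ℕ -> ℤ
   val j = + 2 * + j + 1ℤ - + n

   lin : ∀ k -> (Fin k -> ℤ) -> Cell k -> ℤ
   lin zero w _ = 0ℤ
   lin (suc k) w (j , v) = w F.zero * val j + lin k (w ∘ F.suc) v

   lin-∑ : ∀ k w v -> lin k w v ≡ ∑ (allFin k) (λ a -> w a * val (comp path k v a))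
   lin-∑ zero w v = refl
   lin-∑ (suc k) w (j , v) = trans (+ˡ (w F.zero * val j) (lin-∑ k (w ∘ F.suc) v)) (sym (∑-allFin-suc k (λ a -> w a * val (comp path (suc k) (j , v) a))))

   active : ℤ -> ℤ -> Bool
   active W x = does (W Z.≤? x) ∨ does (W Z.≤? - x)

   active-cases : ∀ W x -> active W x ≡ true -> W ≤ x ⊎ W ≤ - x
   active-cases W x h with W Z.≤? x | W Z.≤? - x
   ... | yes p | _ = inj₁ p
   ... | no _ | yes q = inj₂ q

   act : ∀ k -> ℤ -> (Fin k -> ℤ) -> ℕ
   act zero W w = 0
   act (suc k) W w = if active W (w F.zero) then suc (act k W (w ∘ F.suc)) else act k W (w ∘ F.suc)

   -- Each value is paired with its negative. Since n = 4ℓ there are 2ℓ pairs; by `outer`, the first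
   -- ℓ of them have absolute value at least 2ℓ, and these are the ones that move a sum by K or
   -- more.
   ∑-val : ∀ (f : ℤ -> ℤ) -> ∑ (upTo n) (f ∘ val) ≡ ∑ (upTo (ℓ ℕ.+ ℓ)) (λ i -> f (val i) + f (- val i))
   ∑-val f = trans (cong (λ k -> ∑ (upTo k) (f ∘ val)) n≡) (trans (∑-upTo-+ L L (f ∘ val)) (trans (+ˡ (∑ (upTo L) (f ∘ val)) back) (sym (∑-+ (upTo L) (f ∘ val) (λ i -> f (- val i))))))
     where
     L : ℕ
     L = ℓ ℕ.+ ℓ
     n≡ : n ≡ L ℕ.+ L
     n≡ = trans m≡ (trans (sym (N.+-assoc ℓ ℓ _)) (cong (λ z -> ℓ ℕ.+ ℓ ℕ.+ (ℓ ℕ.+ z)) (N.+-identityʳ ℓ)))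
     back : ∑ (upTo L) (λ i -> f (val (L ℕ.+ i))) ≡ ∑ (upTo L) (λ i -> f (- val i))
     back = trans (∑-upTo-reverse L (λ i -> f (val (L ℕ.+ i)))) (∑-cong∈ (upTo L) (λ i h -> cong f (opp i (∈-upTo L h))))
       where
       eq : ∀ l i r -> + 2 * (l + r) + 1ℤ - (l + (1ℤ + (i + r))) ≡ - (+ 2 * i + 1ℤ - (l + (1ℤ + (i + r))))
       eq = solve 3 (λ l i r -> :2 :* (l :+ r) :+ :1 :- (l :+ (:1 :+ (i :+ r))) := :- (:2 :* i :+ :1 :- (l :+ (:1 :+ (i :+ r))))) refl
       opp : ∀ i -> i ℕ.< L -> val (L ℕ.+ (L ℕ.∸ suc i)) ≡ - val i
       opp i h = trans (cong (λ z -> + 2 * (+ L + + r) + 1ℤ - + z) n≡′) (trans (eq (+ L) (+ i) (+ r)) (cong (λ z -> - (+ 2 * + i + 1ℤ - + z)) (sym n≡′)))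
         where
         r : ℕ
         r = L ℕ.∸ suc i
         n≡′ : n ≡ L ℕ.+ (suc i ℕ.+ r)
         n≡′ = trans n≡ (cong (L ℕ.+_) (sym (N.m+[n∸m]≡n h)))

   outer : ∀ i -> i ℕ.< ℓ -> + 2 * + ℓ ≤ - val i
   outer i h = by (0≤-+ (0≤-* {+ 2} 0≤ℕ (0≤ℕ {r})) (0≤ℕ {1})) (trans (cong (λ z -> - (+ 2 * + i + 1ℤ - + z)) m≡)
       (trans (cong (λ z -> - (+ 2 * + i + 1ℤ - z)) (Z.pos-* 4 ℓ)) (trans (cong (λ z -> - (+ 2 * + i + 1ℤ - + 4 * + z)) ℓ≡) (trans (eq (+ i) (+ r)) (cong (λ z -> + 2 * + z + (+ 2 * + r + 1ℤ)) (sym ℓ≡))))))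
     where
     r : ℕ
     r = ℓ ℕ.∸ suc i
     ℓ≡ : ℓ ≡ suc i ℕ.+ r
     ℓ≡ = sym (N.m+[n∸m]≡n h)
     eq : ∀ i r -> - (+ 2 * i + 1ℤ - + 4 * (1ℤ + (i + r))) ≡ + 2 * (1ℤ + (i + r)) + (+ 2 * r + 1ℤ)
     eq = solve 2 (λ i r -> :- (:2 :* i :+ :1 :- :4 :* (:1 :+ (i :+ r))) := :2 :* (:1 :+ (i :+ r)) :+ (:2 :* r :+ :1)) refl

   module LO (W K : ℤ) (0≤W : 0ℤ ≤ W) (0≤K : 0ℤ ≤ K) (K≤ : K ≤ W * (+ 2 * + ℓ)) where

     count : ∀ k -> (Fin k -> ℤ) -> List ℤ -> ℤ
     count k w T = ∑ (cells k) (λ v -> cnt K T (lin k w v))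

     -- The estimate is proved for unions of disjoint intervals rather than for one interval:
     -- conditioning on a coordinate changes the number of intervals as a step of the walk counted
     -- by `β` changes its position.
     record Bound (k : ℕ) (w : Fin k -> ℤ) (T : List ℤ) : Set where
       constructor bound
       field
         holds : 4^ (act k W w) * count k w T ≤ #cells k * + β (act k W w) (length T)

     count-∷ : ∀ k w t T -> count k w (t ∷ T) ≡ count k w (t ∷ []) + count k w T
     count-∷ k w t T = trans (∑-cong (cells k) (λ v -> cong (_+ cnt K T (lin k w v)) (sym (Z.+-identityʳ (ind (inside K t (lin k w v))))))) (∑-+ (cells k) _ _)

     count-suc : ∀ k (w : Fin (suc k) -> ℤ) T -> count (suc k) w T ≡ ∑ (upTo n) (λ j -> count k (w ∘ F.suc) (map (_- w F.zero * val j) T))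
     count-suc k w T = trans (∑-pairs (upTo n) (cells k) _) (∑-cong (upTo n) (λ j -> ∑-cong (cells k) (λ v -> cnt-shift K T (lin k (w ∘ F.suc) v) (w F.zero * val j))))

     base-case : ∀ w T -> Descending K T -> Bound 0 w T
     base-case w [] h = bound Z.≤-refl
     base-case w (t ∷ T) h = bound (≤r (trans (Z.*-identityˡ _) (Z.+-identityʳ (cnt K (t ∷ T) 0ℤ))) ⟫ cnt≤1 K (t ∷ T) 0ℤ h)

     -- Translating T by u and by -u and exchanging the top interval gives descending lists with one
     -- interval more and one interval less.
     exchange : ∀ k w u t T -> K ≤ u -> Descending K (t ∷ T) -> (∀ T -> Descending K T -> Bound k w T) ->
       4^ (act k W w) * (count k w (map (_- u) (t ∷ T)) + count k w (map (_- (- u)) (t ∷ T)))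
         ≤ #cells k * (+ β (act k W w) (suc (suc (length T))) + + β (act k W w) (length T))
     exchange k w u t T K≤u (h ∷ hs) ih = ≤r (trans (cong (4^ (act k W w) *_) regroup) (Z.*-distribˡ-+ (4^ (act k W w)) _ _))
         ⟫ Z.+-mono-≤ (Bound.holds (ih (t - - u ∷ map (_- u) (t ∷ T)) (top ∷ descending-map K u (t ∷ T) (h ∷ hs))) ⟫ ≤r (cong (λ l -> #cells k * + β (act k W w) (suc (suc l))) (Lₚ.length-map _ T)))
                       (Bound.holds (ih (map (_- (- u)) T) (descending-map K (- u) T hs)) ⟫ ≤r (cong (λ l -> #cells k * + β (act k W w) l) (Lₚ.length-map _ T)))
         ⟫ ≤r (sym (Z.*-distribˡ-+ (#cells k) _ _))
       where
       0≤u : 0ℤ ≤ u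
       0≤u = 0≤K ⟫ K≤u
       regroup : count k w (map (_- u) (t ∷ T)) + count k w (map (_- (- u)) (t ∷ T)) ≡ count k w (t - - u ∷ map (_- u) (t ∷ T)) + count k w (map (_- (- u)) T)
       regroup = trans (+ˡ (count k w (map (_- u) (t ∷ T))) (count-∷ k w (t - - u) (map (_- (- u)) T)))
          (trans (eq (count k w (map (_- u) (t ∷ T))) (count k w (t - - u ∷ [])) (count k w (map (_- (- u)) T)))
            (cong (_+ count k w (map (_- (- u)) T)) (sym (count-∷ k w (t - - u) (map (_- u) (t ∷ T))))))
         where
         eq : ∀ a b c -> a + (b + c) ≡ b + a + c
         eq = solve 3 (λ a b c -> a :+ (b :+ c) := b :+ a :+ c) refl
       top : All (λ t′ -> t′ + + 2 * K ≤ t - - u) (map (_- u) (t ∷ T))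
       top = by (0≤-* {+ 2} 0≤ℕ (0≤-- K≤u)) (e₁ t u K) ∷ Allₚ.map⁺ (All.map (λ {t′} q -> by (0≤-+ (0≤-- q) (0≤-+ 0≤u 0≤u)) (e₂ t t′ u K)) h)
         where
         e₁ : ∀ t u K -> t - - u ≡ t - u + + 2 * K + + 2 * (u - K)
         e₁ = solve 3 (λ t u K -> t :- :- u := t :- u :+ :2 :* K :+ :2 :* (u :- K)) refl
         e₂ : ∀ t t′ u K -> t - - u ≡ t′ - u + + 2 * K + (t - (t′ + + 2 * K) + (u + u))
         e₂ = solve 4 (λ t t′ u K -> t :- :- u := t′ :- u :+ :2 :* K :+ (t :- (t′ :+ :2 :* K) :+ (u :+ u))) refl

     bounded-term : ∀ k w u T -> Descending K T -> (∀ T -> Descending K T -> Bound k w T) ->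
       4^ (act k W w) * count k w (map (_- u) T) ≤ #cells k * + β (act k W w) (length T)
     bounded-term k w u T h ih = Bound.holds (ih (map (_- u) T) (descending-map K u T h)) ⟫ ≤r (cong (λ l -> #cells k * + β (act k W w) l) (Lₚ.length-map _ T))

     #cells-suc : ∀ k -> #cells (suc k) ≡ + n * #cells k
     #cells-suc k = trans (length-pairs (upTo n) (cells k)) (cong (λ z -> + z * #cells k) (length-upTo n))

     lazy-case : ∀ k (w : Fin (suc k) -> ℤ) T -> Descending K T -> (∀ T -> Descending K T -> Bound k (w ∘ F.suc) T) ->
       4^ (act k W (w ∘ F.suc)) * count (suc k) w T ≤ #cells (suc k) * + β (act k W (w ∘ F.suc)) (length T)
     lazy-case k w T h ih = ≤r (trans (cong (4^ (act k W (w ∘ F.suc)) *_) (count-suc k w T)) (sym (∑-*ˡ (upTo n) (4^ (act k W (w ∘ F.suc))) _)))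
       ⟫ ∑-mono (upTo n) (λ j -> bounded-term k (w ∘ F.suc) (w F.zero * val j) T h ih)
       ⟫ ≤r (trans (∑-const (upTo n) _) (trans (cong (λ l -> + l * (#cells k * + β (act k W (w ∘ F.suc)) (length T))) (length-upTo n))
           (trans (sym (Z.*-assoc (+ n) (#cells k) _)) (cong (_* + β (act k W (w ∘ F.suc)) (length T)) (sym (#cells-suc k))))))

     -- An outer pair of values turns r intervals into r + 1 and r - 1 by `exchange`; an inner pair
     -- only translates them and leaves r twice. Half of the pairs are outer, which yields the
     -- weights 1, 2, 1 of the lazy step.
     active-case : ∀ k (w : Fin (suc k) -> ℤ) T -> (W ≤ w F.zero ⊎ W ≤ - w F.zero) -> Descending K T -> (∀ T -> Descending K T -> Bound k (w ∘ F.suc) T) ->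
       4^ (suc (act k W (w ∘ F.suc))) * count (suc k) w T ≤ #cells (suc k) * + β (suc (act k W (w ∘ F.suc))) (length T)
     active-case k w [] _ h ih = ≤r (trans (cong (4^ (suc (act k W (w ∘ F.suc))) *_) (∑-zero (cells (suc k)))) (trans (Z.*-zeroʳ (4^ (suc (act k W (w ∘ F.suc))))) (sym (Z.*-zeroʳ (#cells (suc k))))))
     active-case k w (t ∷ T) ha h ih = ≤r (trans (cong (_* count (suc k) w (t ∷ T)) (4^-suc a)) (Z.*-assoc (+ 4) (4^ a) (count (suc k) w (t ∷ T)))) ⟫ ≤-*ˡ (+ 4) 0≤ℕ main
        ⟫ ≤r (trans (eq₃ (+ ℓ) C b₂ b₁ b₀) (cong₂ _*_ (trans (cong (_* C) (sym n≡)) (sym (#cells-suc k))) (sym (β-suc a (length T)))))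
       where
       w′ : Fin k -> ℤ
       w′ = w ∘ F.suc
       w₀ : ℤ
       w₀ = w F.zero
       a : ℕ
       a = act k W w′
       C b₀ b₁ b₂ : ℤ
       C = #cells k
       b₀ = + β a (length T)
       b₁ = + β a (suc (length T))
       b₂ = + β a (suc (suc (length T)))
       F : ℤ -> ℤ
       F v = count k w′ (map (_- w₀ * v) (t ∷ T))
       n≡ : + n ≡ + 4 * + ℓ
       n≡ = trans (cong +_ m≡) (Z.pos-* 4 ℓ)
       eq₃ : ∀ ℓ C x y z -> + 4 * (ℓ * (C * (x + z)) + ℓ * (C * (+ 2 * y))) ≡ + 4 * ℓ * C * (x + + 2 * y + z)
       eq₃ = solve 5 (λ ℓ C x y z -> :4 :* (ℓ :* (C :* (x :+ z)) :+ ℓ :* (C :* (:2 :* y))) := :4 :* ℓ :* C :* (x :+ :2 :* y :+ z)) refl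
       neg-mul : ∀ x v -> x * (- v) ≡ - (x * v)
       neg-mul = solve 2 (λ x v -> x :* (:- v) := :- (x :* v)) refl
       neg-mul′ : ∀ x v -> x * v ≡ - (x * (- v))
       neg-mul′ = solve 2 (λ x v -> x :* v := :- (x :* (:- v))) refl
       outer-pair : ∀ i -> i ℕ.< ℓ -> 4^ a * (F (val i) + F (- val i)) ≤ C * (b₂ + b₀)
       outer-pair i hi = go ha
         where
         go : (W ≤ w₀ ⊎ W ≤ - w₀) -> 4^ a * (F (val i) + F (- val i)) ≤ C * (b₂ + b₀)
         go (inj₁ p) = ≤r (cong (4^ a *_) (trans (Z.+-comm (F (val i)) (F (- val i))) (cong (λ z -> F (- val i) + count k w′ (map (_- z) (t ∷ T))) (neg-mul′ w₀ (val i)))))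
            ⟫ exchange k w′ (w₀ * (- val i)) t T (K≤ ⟫ ≤-*² 0≤W (0≤-* {+ 2} 0≤ℕ (0≤ℕ {ℓ}) ⟫ outer i hi) p (outer i hi)) h ih
         go (inj₂ p) = ≤r (cong (4^ a *_) (cong (λ z -> F (val i) + count k w′ (map (_- z) (t ∷ T))) (neg-mul w₀ (val i))))
            ⟫ exchange k w′ (w₀ * val i) t T (K≤ ⟫ ≤-*² 0≤W (0≤-* {+ 2} 0≤ℕ (0≤ℕ {ℓ}) ⟫ outer i hi) p (outer i hi) ⟫ ≤r (nn w₀ (val i))) h ih
           where
           nn : ∀ x v -> - x * - v ≡ x * v
           nn = solve 2 (λ x v -> :- x :* :- v := x :* v) refl
       inner-pair : ∀ i -> 4^ a * (F (val i) + F (- val i)) ≤ C * (+ 2 * b₁)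
       inner-pair i = ≤r (Z.*-distribˡ-+ (4^ a) (F (val i)) (F (- val i))) ⟫ Z.+-mono-≤ (bounded-term k w′ (w₀ * val i) (t ∷ T) h ih) (bounded-term k w′ (w₀ * (- val i)) (t ∷ T) h ih) ⟫ ≤r (eq C b₁)
         where
         eq : ∀ C b -> C * b + C * b ≡ C * (+ 2 * b)
         eq = solve 2 (λ C b -> C :* b :+ C :* b := C :* (:2 :* b)) refl
       main : 4^ a * count (suc k) w (t ∷ T) ≤ + ℓ * (C * (b₂ + b₀)) + + ℓ * (C * (+ 2 * b₁))
       main = ≤r (trans (cong (4^ a *_) (trans (count-suc k w (t ∷ T)) (∑-val F))) (trans (sym (∑-*ˡ (upTo (ℓ ℕ.+ ℓ)) (4^ a) _)) (∑-upTo-+ ℓ ℓ (λ i -> 4^ a * (F (val i) + F (- val i))))))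
         ⟫ Z.+-mono-≤ (∑-mono∈ (upTo ℓ) (λ i hi -> outer-pair i (∈-upTo ℓ hi)) ⟫ ≤r (len (C * (b₂ + b₀)))) (∑-mono (upTo ℓ) (λ i -> inner-pair (ℓ ℕ.+ i)) ⟫ ≤r (len (C * (+ 2 * b₁))))
         where
         len : ∀ x -> ∑ (upTo ℓ) (λ _ -> x) ≡ + ℓ * x
         len x = trans (∑-const (upTo ℓ) x) (cong (λ l -> + l * x) (length-upTo ℓ))

     littlewood-offord : ∀ k (w : Fin k -> ℤ) T -> Descending K T -> Bound k w T
     littlewood-offord zero w T h = base-case w T h
     littlewood-offord (suc k) w T h = go (active W (w F.zero)) refl
       where
       go : ∀ b -> active W (w F.zero) ≡ b -> Bound (suc k) w T
       go true e = bound (subst (λ a -> 4^ a * count (suc k) w T ≤ #cells (suc k) * + β a (length T)) (cong (λ b -> if b then suc (act k W (w ∘ F.suc)) else act k W (w ∘ F.suc)) (sym e))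
           (active-case k w T (active-cases W (w F.zero) e) h (littlewood-offord k (w ∘ F.suc))))
       go false e = bound (subst (λ a -> 4^ a * count (suc k) w T ≤ #cells (suc k) * + β a (length T)) (cong (λ b -> if b then suc (act k W (w ∘ F.suc)) else act k W (w ∘ F.suc)) (sym e))
           (lazy-case k w T h (littlewood-offord k (w ∘ F.suc))))

     starts : ℤ -> ℕ -> List ℤ
     starts s zero = []
     starts s (suc r) = s + + 2 * K * + r ∷ starts s r

     length-starts : ∀ s r -> length (starts s r) ≡ r
     length-starts s zero = refl
     length-starts s (suc r) = cong suc (length-starts s r)

     starts-top : ∀ s r -> All (λ t -> t + + 2 * K ≤ s + + 2 * K * + r) (starts s r)
     starts-top s zero = []
     starts-top s (suc r) = ≤r (e s K (+ r)) ∷ All.map (λ q -> q ⟫ by (0≤-* {+ 2} 0≤ℕ 0≤K) (e′ s K (+ r))) (starts-top s r)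
       where
       e : ∀ s K r -> s + + 2 * K * r + + 2 * K ≡ s + + 2 * K * (1ℤ + r)
       e = solve 3 (λ s K r -> s :+ :2 :* K :* r :+ :2 :* K := s :+ :2 :* K :* (:1 :+ r)) refl
       e′ : ∀ s K r -> s + + 2 * K * (1ℤ + r) ≡ s + + 2 * K * r + + 2 * K
       e′ = solve 3 (λ s K r -> s :+ :2 :* K :* (:1 :+ r) := s :+ :2 :* K :* r :+ :2 :* K) refl

     starts-descending : ∀ s r -> Descending K (starts s r)
     starts-descending s zero = []
     starts-descending s (suc r) = starts-top s r ∷ starts-descending s r

     starts-cover : ∀ s r x -> s ≤ x -> x + 1ℤ ≤ s + + 2 * K * + r -> 1ℤ ≤ cnt K (starts s r) x
     starts-cover s zero x h k = ⊥-elim (≥1⇒≰ k (≤r (e s K) ⟫ h))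
       where
       e : ∀ s K -> s + + 2 * K * 0ℤ ≡ s
       e = solve 2 (λ s K -> s :+ :2 :* K :* :0 := s) refl
     starts-cover s (suc r) x h k = go (s + + 2 * K * + r Z.≤? x)
       where
       rest≥0 : 0ℤ ≤ cnt K (starts s r) x
       rest≥0 = ∑-nonneg (starts s r) (λ t -> 0≤ind (inside K t x))
       go : Dec (s + + 2 * K * + r ≤ x) -> 1ℤ ≤ ind (inside K (s + + 2 * K * + r) x) + cnt K (starts s r) x
       go (no q) = by (0≤-+ (0≤-- (starts-cover s r x h (≰⇒≥1 q))) (0≤ind (inside K (s + + 2 * K * + r) x))) (e (ind (inside K (s + + 2 * K * + r) x)) (cnt K (starts s r) x))
         where
         e : ∀ a b -> a + b ≡ 1ℤ + (b - 1ℤ + a)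
         e = solve 2 (λ a b -> a :+ b := :1 :+ (b :- :1 :+ a)) refl
       go (yes q) = by rest≥0 (cong (λ b -> ind b + cnt K (starts s r) x) hit)
         where
         e : ∀ s K r -> s + + 2 * K * (1ℤ + r) ≡ s + + 2 * K * r + + 2 * K
         e = solve 3 (λ s K r -> s :+ :2 :* K :* (:1 :+ r) := s :+ :2 :* K :* r :+ :2 :* K) refl
         hit : inside K (s + + 2 * K * + r) x ≡ true
         hit = ∧-true (dec-true (s + + 2 * K * + r Z.≤? x) q) (dec-true (x + 1ℤ Z.≤? s + + 2 * K * + r + + 2 * K) (k ⟫ ≤r (e s K (+ r))))
           where
           dec-true : ∀ {P : Set} (d : Dec P) -> P -> does d ≡ true
           dec-true (yes _) _ = refl
           dec-true (no q) p = ⊥-elim (q p)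

     -- With R = 2 g r and at least 4 R⁴ active coordinates, a window covered by r intervals has probability at most 1 / g.
     small-ball : ∀ k (w : Fin k -> ℤ) (g r : ℕ) -> 1 ℕ.≤ g -> 1 ℕ.≤ r -> (s : ℤ) ->
       4 ℕ.* ((2 ℕ.* g ℕ.* r) ℕ.^ 4) ℕ.≤ act k W w ->
       + g * ∑ (cells k) (λ v -> ind (does (s Z.≤? lin k w v) ∧ does (lin k w v + 1ℤ Z.≤? s + + 2 * K * + r))) ≤ #cells k
     small-ball k w g r 1≤g 1≤r s ha = final
       where
       R : ℕ
       R = 2 ℕ.* g ℕ.* r
       1≤R : 1 ℕ.≤ R
       1≤R = N.*-mono-≤ (N.*-mono-≤ {1} {2} (ℕ.s≤s ℕ.z≤n) 1≤g) 1≤r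
       r≤2R : r ℕ.≤ 2 ℕ.* R
       r≤2R = N.≤-trans (N.m≤n*m r (2 ℕ.* g) {{ℕ.>-nonZero (N.*-mono-≤ {1} {2} (ℕ.s≤s ℕ.z≤n) 1≤g)}}) (N.m≤n*m R 2)
       R≡ : + R ≡ + 2 * + g * + r
       R≡ = trans (Z.pos-* (2 ℕ.* g) r) (cong (_* + r) (Z.pos-* 2 g))
       a : ℕ
       a = act k W w
       A C N Nc : ℤ
       A = + a + + 2 * + R * + R
       C = #cells k
       window : Cell k -> ℤ
       window v = ind (does (s Z.≤? lin k w v) ∧ does (lin k w v + 1ℤ Z.≤? s + + 2 * K * + r))
       N = ∑ (cells k) window
       Nc = count k w (starts s r)
       N≤ : N ≤ Nc
       N≤ = ∑-mono (cells k) pw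
         where
         pw : ∀ v -> window v ≤ cnt K (starts s r) (lin k w v)
         pw v = go (s Z.≤? lin k w v) (lin k w v + 1ℤ Z.≤? s + + 2 * K * + r)
           where
           c≥0 : 0ℤ ≤ cnt K (starts s r) (lin k w v)
           c≥0 = ∑-nonneg (starts s r) (λ t -> 0≤ind (inside K t (lin k w v)))
           go : (p : Dec (s ≤ lin k w v)) (q : Dec (lin k w v + 1ℤ ≤ s + + 2 * K * + r)) -> ind (does p ∧ does q) ≤ cnt K (starts s r) (lin k w v)
           go (yes p) (yes q) = starts-cover s r (lin k w v) p q
           go (yes p) (no q) = c≥0
           go (no p) q = c≥0
       lo : 4^ a * Nc ≤ C * + β a r
       lo = Bound.holds (littlewood-offord k w (starts s r) (starts-descending s r)) ⟫ ≤r (cong (λ l -> C * + β a l) (length-starts s r))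
       pot : + R * A * + β a r ≤ 4^ a * potential (+ R) (+ a) (+ r)
       pot = Potential.Claim.bound (Potential.β-bound R 1≤R a r r≤2R)
       1≤A : 1ℤ ≤ A
       1≤A = by (0≤-+ (0≤-+ (0≤ℕ {a}) (0≤-- (1≤-* {+ R} {+ R} (+≤+ 1≤R) (+≤+ 1≤R)))) (0≤-* (0≤ℕ {R}) (0≤ℕ {R}))) (eq (+ a) (+ R))
         where
         eq : ∀ n R -> n + + 2 * R * R ≡ 1ℤ + (n + (R * R - 1ℤ) + R * R)
         eq = solve 2 (λ n R -> n :+ :2 :* R :* R := :1 :+ (n :+ (R :* R :- :1) :+ R :* R)) refl
       0≤A = 1≤⇒0≤ 1≤A
       step₁ : + R * A * Nc ≤ C * potential (+ R) (+ a) (+ r)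
       step₁ = ≤-cancelˡ (4^ a) (1≤4^ a) (≤r (e₁ (4^ a) (+ R * A) Nc) ⟫ ≤-*ˡ (+ R * A) (0≤-* (0≤ℕ {R}) 0≤A) lo ⟫ ≤r (e₂ (+ R * A) C (+ β a r)) ⟫ ≤-*ˡ C 0≤ℕ pot ⟫ ≤r (e₂ C (4^ a) (potential (+ R) (+ a) (+ r)) ⟨≡⟩ e₁′ (4^ a) C (potential (+ R) (+ a) (+ r))))
         where
         _⟨≡⟩_ : ∀ {x y z : ℤ} -> x ≡ y -> y ≡ z -> x ≡ z
         _⟨≡⟩_ = trans
         e₁ : ∀ q x n -> q * (x * n) ≡ x * (q * n)
         e₁ = solve 3 (λ q x n -> q :* (x :* n) := x :* (q :* n)) refl
         e₂ : ∀ x c b -> x * (c * b) ≡ c * (x * b)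
         e₂ = solve 3 (λ x c b -> x :* (c :* b) := c :* (x :* b)) refl
         e₁′ : ∀ q c p -> q * (c * p) ≡ q * (c * p)
         e₁′ q c p = refl
       -- With A ≥ 4R⁴ the quadratic term of the potential is at most r/R, so both terms together
       -- give 2r/R = 1/g.
       big : + 4 * (+ R * + R * (+ R * + R)) ≤ A
       big = ≤r (trans (cong (+ 4 *_) (R⁴ R)) (sym (Z.pos-* 4 (R ℕ.^ 4)))) ⟫ +≤+ ha ⟫ by (0≤-* (0≤-* {+ 2} {+ R} 0≤ℕ 0≤ℕ) (0≤ℕ {R})) refl
         where
         R⁴ : ∀ R -> + R * + R * (+ R * + R) ≡ + (R ℕ.^ 4)
         R⁴ R = trans (e (+ R)) (sym (trans (pow-suc R 3) (cong (+ R *_) (trans (pow-suc R 2) (cong (+ R *_) (trans (pow-suc R 1) (cong (+ R *_) (pow-suc R 0))))))))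
           where
           e : ∀ R -> R * R * (R * R) ≡ R * (R * (R * (R * 1ℤ)))
           e = solve 1 (λ R -> R :* R :* (R :* R) := R :* (R :* (R :* (R :* :1)))) refl
       step₂ : + 2 * + g * A * Nc ≤ + 2 * A * C
       step₂ = ≤-cancelˡ (+ r) (+≤+ 1≤r) (≤r (trans (e₁ (+ g) (+ r) A Nc) (cong (λ z -> z * A * Nc) (sym R≡))) ⟫ step₁
           ⟫ by (0≤-* (0≤-* {C} {+ r} 0≤ℕ 0≤ℕ) (0≤-+ (0≤-- big) (0≤-* (0≤-* (0≤-* (0≤-* {+ 2} {+ R} 0≤ℕ 0≤ℕ) (0≤ℕ {R})) (0≤ℕ {R})) (0≤ℕ {r})))) (e₂ C (+ r) (+ a) (+ R)))
         where
         e₁ : ∀ g r A N -> r * (+ 2 * g * A * N) ≡ + 2 * g * r * A * N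
         e₁ = solve 4 (λ g r A N -> r :* (:2 :* g :* A :* N) := :2 :* g :* r :* A :* N) refl
         e₂ : ∀ C r n R -> r * (+ 2 * (n + + 2 * R * R) * C) ≡ C * (r * (n + + 2 * R * R) + + 2 * R * R * R * (r * (+ 2 * R - r)))
            + C * r * (n + + 2 * R * R - + 4 * (R * R * (R * R)) + + 2 * R * R * R * r)
         e₂ = solve 4 (λ C r n R -> r :* (:2 :* (n :+ :2 :* R :* R) :* C) := C :* (r :* (n :+ :2 :* R :* R) :+ :2 :* R :* R :* R :* (r :* (:2 :* R :- r))) :+ C :* r :* (n :+ :2 :* R :* R :- :4 :* (R :* R :* (R :* R)) :+ :2 :* R :* R :* R :* r)) refl
       final : + g * N ≤ C
       final = ≤-cancelˡ (+ 2 * A) (1≤-* {+ 2} (+≤+ (ℕ.s≤s ℕ.z≤n)) 1≤A) (≤-*ˡ (+ 2 * A) (0≤-* {+ 2} 0≤ℕ 0≤A) (≤-*ˡ (+ g) 0≤ℕ N≤) ⟫ ≤r (e₁ (+ g) A Nc) ⟫ step₂)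
         where
         e₁ : ∀ g A N -> + 2 * A * (g * N) ≡ + 2 * g * A * N
         e₁ = solve 3 (λ g A N -> :2 :* A :* (g :* N) := :2 :* g :* A :* N) refl

 -- Rotations and the geometry of the special classes

 record Cyclic (q : ℕ) : Set where
   infixl 6 _⊕_
   field
     _⊕_     : Fin (suc q) -> Fin (suc q) -> Fin (suc q)
     neg     : Fin (suc q) -> Fin (suc q)
     ⊕-zero  : ∀ r -> r ⊕ F.zero ≡ r
     ⊕-assoc : ∀ r k l -> (r ⊕ k) ⊕ l ≡ r ⊕ (k ⊕ l)
     ⊕-comm  : ∀ k l -> k ⊕ l ≡ l ⊕ k
     ⊕-neg   : ∀ k -> k ⊕ neg k ≡ F.zero

 module Vectors (q M : ℕ) (cg : Cyclic q) where
   open Cyclic cg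

   Ix : Set
   Ix = Fin (suc q)

   Vect : Set
   Vect = Ix -> Fin M -> ℤ

   0⊕ : ∀ k -> F.zero ⊕ k ≡ k
   0⊕ k = trans (⊕-comm F.zero k) (⊕-zero k)

   ⊕-cancel : ∀ k r -> (r ⊕ k) ⊕ neg k ≡ r
   ⊕-cancel k r = trans (⊕-assoc r k (neg k)) (trans (cong (r ⊕_) (⊕-neg k)) (⊕-zero r))

   ⊕-cancel′ : ∀ k r -> (r ⊕ neg k) ⊕ k ≡ r
   ⊕-cancel′ k r = trans (⊕-assoc r (neg k) k) (trans (cong (r ⊕_) (trans (⊕-comm (neg k) k) (⊕-neg k))) (⊕-zero r))

   neg≢0 : ∀ {k} -> k ≢ F.zero -> neg k ≢ F.zero
   neg≢0 {k} h e = h (trans (sym (⊕-zero k)) (trans (sym (cong (k ⊕_) e)) (⊕-neg k)))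

   ∑-bij : ∀ (f : Ix -> ℤ) (π : Ix -> Ix) (π⁻ : Ix -> Ix) -> (∀ r -> π⁻ (π r) ≡ r) -> (∀ r -> π (π⁻ r) ≡ r) ->
     ∑ (allFin (suc q)) (f ∘ π) ≡ ∑ (allFin (suc q)) f
   ∑-bij f π π⁻ h₁ h₂ = trans (∑-cong I (λ r -> sym (∑-δ f (π r)))) (trans (∑-swap I I (λ r s -> f s * δ (π r) s))
       (∑-cong I (λ s -> trans (∑-cong I (λ r -> trans (cong (f s *_) (δ-swap r s)) refl)) (∑-δ (λ _ -> f s) (π⁻ s)))))
     where
     I : List Ix
     I = allFin (suc q)
     δ-swap : ∀ r s -> δ (π r) s ≡ δ (π⁻ s) r
     δ-swap r s with π r Fₚ.≟ s | π⁻ s Fₚ.≟ r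
     ... | yes _ | yes _ = refl
     ... | yes refl | no b = ⊥-elim (b (h₁ r))
     ... | no a | yes refl = ⊥-elim (a (h₂ s))
     ... | no _ | no _ = refl

   ∑-shift : ∀ (f : Ix -> ℤ) k -> ∑ (allFin (suc q)) (λ r -> f (r ⊕ k)) ≡ ∑ (allFin (suc q)) f
   ∑-shift f k = ∑-bij f (_⊕ k) (_⊕ neg k) (⊕-cancel k) (⊕-cancel′ k)

   shift : Ix -> Vect -> Vect
   shift k u r = u (r ⊕ k)

   lc : Vect -> Vect -> Vect
   lc u v r a = u r a + v r a

   diff : Vect -> Vect -> Vect
   diff u v r a = u r a - v r a

   abstract
     ip : Vect -> Vect -> ℤ
     ip u v = ∑ (allFin (suc q)) (λ r -> ∑ (allFin M) (λ a -> u r a * v r a))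

     ip-def : ∀ u v -> ip u v ≡ ∑ (allFin (suc q)) (λ r -> ∑ (allFin M) (λ a -> u r a * v r a))
     ip-def u v = refl

     ip-cong : ∀ {u u′ v v′} -> (∀ r a -> u r a ≡ u′ r a) -> (∀ r a -> v r a ≡ v′ r a) -> ip u v ≡ ip u′ v′
     ip-cong h k = ∑-cong (allFin (suc q)) (λ r -> ∑-cong (allFin M) (λ a -> cong₂ _*_ (h r a) (k r a)))

     ip-sym : ∀ u v -> ip u v ≡ ip v u
     ip-sym u v = ∑-cong (allFin (suc q)) (λ r -> ∑-cong (allFin M) (λ a -> Z.*-comm (u r a) (v r a)))

     ip-add : ∀ u v w -> ip (lc u v) w ≡ ip u w + ip v w
     ip-add u v w = trans (∑-cong (allFin (suc q)) (λ r -> trans (∑-cong (allFin M) (λ a -> Z.*-distribʳ-+ (w r a) (u r a) (v r a))) (∑-+ (allFin M) (λ a -> u r a * w r a) (λ a -> v r a * w r a))))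
       (∑-+ (allFin (suc q)) (λ r -> ∑ (allFin M) (λ a -> u r a * w r a)) (λ r -> ∑ (allFin M) (λ a -> v r a * w r a)))

     ip-diffˡ : ∀ u v w -> ip (diff u v) w ≡ ip u w - ip v w
     ip-diffˡ u v w = trans (∑-cong (allFin (suc q)) (λ r -> trans (∑-cong (allFin M) (λ a -> e (u r a) (v r a) (w r a))) (∑-- (allFin M) (λ a -> u r a * w r a) (λ a -> v r a * w r a))))
       (∑-- (allFin (suc q)) (λ r -> ∑ (allFin M) (λ a -> u r a * w r a)) (λ r -> ∑ (allFin M) (λ a -> v r a * w r a)))
       where
       e : ∀ u v w -> (u - v) * w ≡ u * w - v * w
       e = solve 3 (λ u v w -> (u :- v) :* w := u :* w :- v :* w) refl

     ip-shift : ∀ k u v -> ip (shift k u) (shift k v) ≡ ip u v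
     ip-shift k u v = ∑-shift (λ r -> ∑ (allFin M) (λ a -> u r a * v r a)) k

     0≤ip : ∀ u -> 0ℤ ≤ ip u u
     0≤ip u = ∑-nonneg (allFin (suc q)) (λ r -> ∑-nonneg (allFin M) (λ a -> 0≤-sq (u r a)))

     ip-zero : ∀ w -> ip w (λ _ _ -> 0ℤ) ≡ 0ℤ
     ip-zero w = trans (∑-cong (allFin (suc q)) (λ r -> trans (∑-cong (allFin M) (λ a -> Z.*-zeroʳ (w r a))) (∑-zero (allFin M)))) (∑-zero (allFin (suc q)))

   nrm : Vect -> ℤ
   nrm u = ip u u

   ip-diffʳ : ∀ u v w -> ip w (diff u v) ≡ ip w u - ip w v
   ip-diffʳ u v w = trans (ip-sym w (diff u v)) (trans (ip-diffˡ u v w) (cong₂ _-_ (ip-sym u w) (ip-sym v w)))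

   ip-adjoint : ∀ k u v -> ip (shift k u) v ≡ ip u (shift (neg k) v)
   ip-adjoint k u v = trans (ip-cong {shift k u} {shift k u} (λ _ _ -> refl) (λ r a -> cong (λ s -> v s a) (sym (⊕-cancel k r)))) (ip-shift k u (shift (neg k) v))

   ip-adjoint′ : ∀ k u v -> ip u (shift k v) ≡ ip (shift (neg k) u) v
   ip-adjoint′ k u v = trans (ip-cong (λ r a -> cong (λ s -> u s a) (sym (⊕-cancel k r))) (λ _ _ -> refl)) (ip-shift k (shift (neg k) u) v)

   nrm-shift : ∀ k u -> nrm (shift k u) ≡ nrm u
   nrm-shift k u = ip-shift k u u

   shift-shift : ∀ k l u r a -> shift l (shift k u) r a ≡ shift (l ⊕ k) u r a
   shift-shift k l u r a = cong (λ s -> u s a) (⊕-assoc r l k)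

   0≤nrm : ∀ u -> 0ℤ ≤ nrm u
   0≤nrm = 0≤ip

   nrm-diff : ∀ u v -> nrm (diff u v) ≡ nrm u - + 2 * ip u v + nrm v
   nrm-diff u v = trans (ip-diffˡ u v (diff u v)) (trans (cong₂ _-_ (ip-diffʳ u v u) (trans (ip-diffʳ u v v) (cong (_- nrm v) (ip-sym v u)))) (e (nrm u) (ip u v) (nrm v)))
     where
     e : ∀ a b c -> a - b - (b - c) ≡ a - + 2 * b + c
     e = solve 3 (λ a b c -> a :- b :- (b :- c) := a :- :2 :* b :+ c) refl

   2ip≤ : ∀ u v -> + 2 * ip u v ≤ nrm u + nrm v
   2ip≤ u v = by (0≤nrm (diff u v)) (trans (e (nrm u) (ip u v) (nrm v)) (+ˡ (+ 2 * ip u v) (sym (nrm-diff u v))))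
     where
     e : ∀ a b c -> a + c ≡ + 2 * b + (a - + 2 * b + c)
     e = solve 3 (λ a b c -> a :+ c := :2 :* b :+ (a :- :2 :* b :+ c)) refl

   -2ip≤ : ∀ u v -> - (+ 2 * ip u v) ≤ nrm u + nrm v
   -2ip≤ u v = by (0≤nrm (diff u (diff u₀ v))) (trans (e (nrm u) (ip u v) (nrm v)) (+ˡ (- (+ 2 * ip u v)) (sym (trans (nrm-diff u (diff u₀ v)) (cong₂ (λ a b -> nrm u - + 2 * a + b) ipn nn)))))
     where
     u₀ : Vect
     u₀ _ _ = 0ℤ
     z : ∀ w -> ip w u₀ ≡ 0ℤ
     z = ip-zero
     ipn : ip u (diff u₀ v) ≡ 0ℤ - ip u v
     ipn = trans (ip-diffʳ u₀ v u) (cong (_- ip u v) (z u))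
     nn : nrm (diff u₀ v) ≡ nrm v
     nn = trans (nrm-diff u₀ v) (trans (cong₂ (λ a b -> a - + 2 * b + nrm v) (z u₀) (trans (ip-sym u₀ v) (z v))) (e′ (nrm v)))
       where
       e′ : ∀ a -> 0ℤ - + 2 * 0ℤ + a ≡ a
       e′ = solve 1 (λ a -> :0 :- :2 :* :0 :+ a := a) refl
     e : ∀ a b c -> a + c ≡ - (+ 2 * b) + (a - + 2 * (0ℤ - b) + c)
     e = solve 3 (λ a b c -> a :+ c := :- (:2 :* b) :+ (a :- :2 :* (:0 :- b) :+ c)) refl

   nrm-diff≤ : ∀ u v -> nrm (diff u v) ≤ + 2 * nrm u + + 2 * nrm v
   nrm-diff≤ u v = ≤r (nrm-diff u v) ⟫ by (0≤-- (-2ip≤ u v)) (e (nrm u) (ip u v) (nrm v))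
     where
     e : ∀ a b c -> + 2 * a + + 2 * c ≡ a - + 2 * b + c + (a + c - - (+ 2 * b))
     e = solve 3 (λ a b c -> :2 :* a :+ :2 :* c := a :- :2 :* b :+ c :+ (a :+ c :- :- (:2 :* b))) refl

   module Geometry (Δ : ℤ) (0≤Δ : 0ℤ ≤ Δ) where

     Close : Ix -> Vect -> Vect -> Set
     Close k x y = nrm (diff y (shift k x)) ≤ Δ

     Near : Vect -> Vect -> Set
     Near x y = ∃ λ k -> k ≢ F.zero × Close k x y

     -- Two uses of |u - v|² ≤ 2|u|² + 2|v|² turn three errors of squared norm Δ into 2(2Δ + 2Δ) +
     -- 2Δ = 10Δ.
     Generic : Vect -> Set
     Generic x = ∀ k -> k ≢ F.zero -> + 10 * Δ + 1ℤ ≤ nrm (diff x (shift k x))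

     -- The margin 2Δ is set by `orbit-pair`: two sector inequalities give 4Δ + 2 per vertex of the
     -- orbit, while the errors amount to at most 5Δ/2.
     Sector : Vect -> Vect -> Set
     Sector x y = ∀ k -> k ≢ F.zero -> + 2 * Δ + 1ℤ ≤ ip (diff x (shift k x)) y

     near-sym : ∀ {x y} -> Near x y -> Near y x
     near-sym {x} {y} (k , k≢0 , h) = neg k , neg≢0 k≢0 , (≤r (trans (sym (nrm-shift k (diff x (shift (neg k) y)))) (trans (ip-cong pt pt) (trans (nrm-diff (shift k x) y) (trans (e (nrm (shift k x)) (ip (shift k x) y) (nrm y)) (trans (cong (λ z -> nrm y - + 2 * z + nrm (shift k x)) (ip-sym (shift k x) y)) (sym (nrm-diff y (shift k x)))))))) ⟫ h)
       where
       pt : ∀ r a -> shift k (diff x (shift (neg k) y)) r a ≡ diff (shift k x) y r a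
       pt r a = cong (λ s -> x (r ⊕ k) a - y s a) (⊕-cancel k r)
       e : ∀ a b c -> a - + 2 * b + c ≡ c - + 2 * b + a
       e = solve 3 (λ a b c -> a :- :2 :* b :+ c := c :- :2 :* b :+ a) refl

     near-irrefl : ∀ {x} -> Generic x -> ¬ Near x x
     near-irrefl {x} g (k , k≢0 , h) = absurd _ (+ 9 * Δ) (0≤-+ (0≤-- h) (0≤-- (g k k≢0))) (0≤-* {+ 9} 0≤ℕ 0≤Δ) (e Δ (nrm (diff x (shift k x))))
       where
       e : ∀ d n -> d - n + (n - (+ 10 * d + 1ℤ)) + + 9 * d ≡ -[1+ 0 ]
       e = solve 2 (λ d n -> d :- n :+ (n :- (con (+ 10) :* d :+ :1)) :+ con (+ 9) :* d := con -[1+ 0 ]) refl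

     -- The adjoint of the rotation by k is the rotation by `neg k`, and the condition ranges over
     -- all k different from 0.
     sector-sym : ∀ {x y} -> Sector x y -> Sector y x
     sector-sym {x} {y} h k k≢0 = h (neg k) (neg≢0 k≢0) ⟫ ≤r (trans (ip-diffˡ x (shift (neg k) x) y) (trans (cong₂ _-_ (ip-sym x y) (trans (sym (ip-adjoint′ k x y)) (ip-sym x (shift k y)))) (sym (ip-diffˡ y (shift k y) x))))

     -- If y and z followed the same rotate of x, they would be close to each other; as z is close
     -- to a nontrivial rotate of y, so would y be, against genericity.
     label-distinct : ∀ {x y z} -> Generic y -> Near y z -> ∀ k -> Close k x y -> Close k x z -> ⊥
     label-distinct {x} {y} {z} g (l , l≢0 , h) k hy hz = absurd _ 0ℤ
        (0≤-+ (0≤-+ (0≤-- (g l l≢0)) (0≤-- (≤r (ip-cong pt pt) ⟫ nrm-diff≤ (diff e₁ e₂) e₃′))) (0≤-+ (0≤-+ (0≤-+ (0≤-* {+ 2} 0≤ℕ (0≤-- (nrm-diff≤ e₁ e₂))) (0≤-* {+ 4} 0≤ℕ (0≤-- hy))) (0≤-* {+ 4} 0≤ℕ (0≤-- hz))) (0≤-* {+ 2} 0≤ℕ (0≤-- h₃)))) 0≤ℕ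
        (e Δ (nrm (diff y (shift l y))) (nrm (diff e₁ e₂)) (nrm e₁) (nrm e₂) (nrm e₃′))
       where
       e₁ e₂ e₃′ : Vect
       e₁ = diff y (shift k x)
       e₂ = diff z (shift k x)
       e₃′ = diff (shift l y) z
       h₃ : nrm e₃′ ≤ Δ
       h₃ = ≤r (trans (nrm-diff (shift l y) z) (trans (sw (nrm (shift l y)) (ip (shift l y) z) (nrm z)) (trans (cong (λ t -> nrm z - + 2 * t + nrm (shift l y)) (ip-sym (shift l y) z)) (sym (nrm-diff z (shift l y)))))) ⟫ h
         where
         sw : ∀ a b c -> a - + 2 * b + c ≡ c - + 2 * b + a
         sw = solve 3 (λ a b c -> a :- :2 :* b :+ c := c :- :2 :* b :+ a) refl
       pt : ∀ r a -> diff y (shift l y) r a ≡ diff (diff e₁ e₂) e₃′ r a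
       pt r a = eq (y r a) (z r a) (x (r ⊕ k) a) (y (r ⊕ l) a)
         where
         eq : ∀ y z s t -> y - t ≡ y - s - (z - s) - (t - z)
         eq = solve 4 (λ y z s t -> y :- t := y :- s :- (z :- s) :- (t :- z)) refl
       e : ∀ d n m a b c -> n - (+ 10 * d + 1ℤ) + (+ 2 * m + + 2 * c - n) + (+ 2 * (+ 2 * a + + 2 * b - m) + + 4 * (d - a) + + 4 * (d - b) + + 2 * (d - c)) + 0ℤ ≡ -[1+ 0 ]
       e = solve 6 (λ d n m a b c -> n :- (con (+ 10) :* d :+ :1) :+ (:2 :* m :+ :2 :* c :- n) :+ (:2 :* (:2 :* a :+ :2 :* b :- m) :+ :4 :* (d :- a) :+ :4 :* (d :- b) :+ :2 :* (d :- c)) :+ :0 := con -[1+ 0 ]) refl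

     module Labels {s : ℕ} (x : Fin (suc s) -> Vect) (gen : ∀ i -> Generic (x i)) (nr : ∀ i j -> i ≢ j -> Near (x i) (x j)) where

       lab : Fin (suc s) -> Ix
       lab F.zero = F.zero
       lab (F.suc i) = proj₁ (nr F.zero (F.suc i) (λ ()))

       lab-close : ∀ i -> Close (lab i) (x F.zero) (x i)
       lab-close F.zero = ≤r (trans (ip-cong pt pt) (trans (nrm-diff x₀ x₀) (e (nrm x₀)))) ⟫ 0≤Δ
         where
         x₀ : Vect
         x₀ = x F.zero
         pt : ∀ r a -> diff x₀ (shift F.zero x₀) r a ≡ diff x₀ x₀ r a
         pt r a = cong (λ s -> x₀ r a - x₀ s a) (⊕-zero r)
         e : ∀ a -> a - + 2 * a + a ≡ 0ℤ
         e = solve 1 (λ a -> a :- :2 :* a :+ a := :0) refl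
       lab-close (F.suc i) = proj₂ (proj₂ (nr F.zero (F.suc i) (λ ())))

       lab-injective : ∀ {i j} -> i ≢ j -> lab i ≢ lab j
       lab-injective {i} {j} i≢j eq = label-distinct {x F.zero} {x i} {x j} (gen i) (nr i j i≢j) (lab i) (lab-close i) (subst (λ k -> Close k (x F.zero) (x j)) (sym eq) (lab-close j))

     -- Measured from the first vertex, the members of a clique in one class carry distinct
     -- rotations as labels, and there are only p rotations.
     part-clique : (x : Fin (suc (suc q)) -> Vect) -> (∀ i -> Generic (x i)) -> (∀ i j -> i ≢ j -> Near (x i) (x j)) -> ⊥
     part-clique x gen nr with Fₚ.pigeonhole (N.n<1+n (suc q)) (Labels.lab x gen nr)
     ... | i , j , i<j , eq = Labels.lab-injective x gen nr (Fₚ.<⇒≢ i<j) eq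

     -- Rotations preserve the inner product, so the main terms cancel in pairs and only the error
     -- `f`, by which z misses the rotate of y, remains.
     cross-identity : ∀ x y f z k -> (∀ r a -> z r a ≡ shift k y r a + f r a) ->
       ip (diff x (shift k x)) z + ip (diff x (shift (neg k) x)) y ≡ ip (diff x (shift k x)) f
     cross-identity x y f z k hz = trans (cong₂ _+_ (trans (ip-diffˡ x (shift k x) z) (cong₂ _-_ (split x) (trans (split (shift k x)) (cong (_+ ip (shift k x) f) (ip-shift k x y))))) (ip-diffˡ x (shift (neg k) x) y))
        (trans (cong (λ t -> t + ip x f - (ip x y + ip (shift k x) f) + (ip x y - ip (shift (neg k) x) y)) (ip-adjoint′ k x y)) (trans (e (ip (shift (neg k) x) y) (ip x f) (ip x y) (ip (shift k x) f)) (sym (ip-diffˡ x (shift k x) f))))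
       where
       split : ∀ u -> ip u z ≡ ip u (shift k y) + ip u f
       split u = trans (ip-cong (λ _ _ -> refl) hz) (trans (ip-sym u (lc (shift k y) f)) (trans (ip-add (shift k y) f u) (cong₂ _+_ (ip-sym (shift k y) u) (ip-sym f u))))
       e : ∀ a b c d -> a + b - (c + d) + (c - a) ≡ b - d
       e = solve 4 (λ a b c d -> a :+ b :- (c :+ d) :+ (c :- a) := b :- d) refl

     -- A full orbit in one part and two vertices in the other cannot form a clique.
     orbit-pair : (x : Ix -> Vect) -> (∀ i -> Generic (x i)) -> (∀ i j -> i ≢ j -> Near (x i) (x j)) ->
       ∀ y z -> Near y z -> (∀ i -> Sector (x i) y) -> (∀ i -> Sector (x i) z) -> ⊥
     orbit-pair x gen nr y z (k , k≢0 , hf) sy sz = absurd _ (+ suc q * (+ 3 * Δ + + 4) - 1ℤ)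
         (0≤-+ (0≤-* {+ 2} 0≤ℕ (0≤-- lower)) (0≤-- upper)) (0≤-- (1≤-* {+ suc q} (+≤+ (ℕ.s≤s ℕ.z≤n)) (by (0≤-+ (0≤-* {+ 3} 0≤ℕ 0≤Δ) (0≤ℕ {3})) (e₄ Δ)))) (e₅ (+ suc q) Δ total)
       where
       open Labels x gen nr
       I : List Ix
       I = allFin (suc q)
       f h : Vect
       f = diff z (shift k y)
       h = diff f (shift (neg k) f)
       total : ℤ
       total = ∑ I (λ i -> ip (x i) h)
       e₄ : ∀ d -> + 3 * d + + 4 ≡ 1ℤ + (+ 3 * d + + 3)
       e₄ = solve 1 (λ d -> con (+ 3) :* d :+ :4 := :1 :+ (con (+ 3) :* d :+ con (+ 3))) refl
       e₅ : ∀ p d t -> + 2 * (t - p * (+ 2 * (+ 2 * d + 1ℤ))) + (p * (+ 5 * d) - + 2 * t) + (p * (+ 3 * d + + 4) - 1ℤ) ≡ -[1+ 0 ]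
       e₅ = solve 3 (λ p d t -> :2 :* (t :- p :* (:2 :* (:2 :* d :+ :1))) :+ (p :* (con (+ 5) :* d) :- :2 :* t) :+ (p :* (con (+ 3) :* d :+ :4) :- :1) := con -[1+ 0 ]) refl
       term : ∀ u -> ip (diff u (shift k u)) f ≡ ip u h
       term u = trans (ip-diffˡ u (shift k u) f) (trans (cong (λ t -> ip u f - t) (ip-adjoint k u f)) (sym (ip-diffʳ f (shift (neg k) f) u)))
       len : length I ≡ suc q
       len = Lₚ.length-tabulate (λ (i : Ix) -> i)
       lower : + suc q * (+ 2 * (+ 2 * Δ + 1ℤ)) ≤ total
       lower = ≤r (trans (cong (λ l -> + l * (+ 2 * (+ 2 * Δ + 1ℤ))) (sym len)) (sym (∑-const I (+ 2 * (+ 2 * Δ + 1ℤ))))) ⟫ ∑-mono I (λ i -> ≤r (e (+ 2 * Δ + 1ℤ)) ⟫ Z.+-mono-≤ (sz i k k≢0) (sy i (neg k) (neg≢0 k≢0))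
           ⟫ ≤r (trans (cross-identity (x i) y f z k (λ r a -> e′ (z r a) (shift k y r a))) (term (x i))))
         where
         e : ∀ a -> + 2 * a ≡ a + a
         e = solve 1 (λ a -> :2 :* a := a :+ a) refl
         e′ : ∀ z s -> z ≡ s + (z - s)
         e′ = solve 2 (λ z s -> z := s :+ (z :- s)) refl
       err : Ix -> Vect
       err i = diff (x i) (shift (lab i) (x F.zero))
       surj : ∀ s -> ∃ λ i -> lab i ≡ s
       surj s with Fₚ.any? (λ i -> lab i Fₚ.≟ s)
       ... | yes w = w
       ... | no none with Fₚ.pigeonhole (N.n<1+n q) (λ i -> F.punchOut {i = s} {j = lab i} (λ e -> none (i , sym e)))
       ...   | i , j , i<j , eq = ⊥-elim (lab-injective (Fₚ.<⇒≢ i<j) (Fₚ.punchOut-injective (λ e -> none (i , sym e)) (λ e -> none (j , sym e)) eq))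
       lab⁻ : Ix -> Ix
       lab⁻ s = proj₁ (surj s)
       lab⁻-lab : ∀ i -> lab⁻ (lab i) ≡ i
       lab⁻-lab i with lab⁻ (lab i) Fₚ.≟ i
       ... | yes e = e
       ... | no ne = ⊥-elim (lab-injective ne (proj₂ (surj (lab i))))
       -- The labels run through all rotations, and the sum of a full orbit is rotation invariant.
       -- It is therefore orthogonal to `h`, the difference of `f` and one of its rotates.
       orbit : ∑ I (λ i -> ip (shift (lab i) (x F.zero)) h) ≡ 0ℤ
       orbit = trans (∑-bij (λ s -> ip (shift s (x F.zero)) h) lab lab⁻ lab⁻-lab (λ s -> proj₂ (surj s)))
         (trans (∑-cong I (λ s -> ip-diffʳ f (shift (neg k) f) (shift s (x F.zero)))) (trans (∑-- I (λ s -> ip (shift s (x F.zero)) f) (λ s -> ip (shift s (x F.zero)) (shift (neg k) f))) (trans (cong (λ t -> ∑ I (λ s -> ip (shift s (x F.zero)) f) - t) moved) (Z.+-inverseʳ (∑ I (λ s -> ip (shift s (x F.zero)) f))))))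
         where
         moved : ∑ I (λ s -> ip (shift s (x F.zero)) (shift (neg k) f)) ≡ ∑ I (λ s -> ip (shift s (x F.zero)) f)
         moved = trans (∑-cong I (λ s -> trans (sym (ip-adjoint k (shift s (x F.zero)) f)) (ip-cong (λ r a -> trans (shift-shift s k (x F.zero) r a) (cong (λ j -> shift j (x F.zero) r a) (⊕-comm k s))) (λ _ _ -> refl))))
            (∑-shift (λ s -> ip (shift s (x F.zero)) f) k)
       total≡ : total ≡ ∑ I (λ i -> ip (err i) h)
       total≡ = sym (trans (∑-cong I (λ i -> ip-diffˡ (x i) (shift (lab i) (x F.zero)) h)) (trans (∑-- I (λ i -> ip (x i) h) (λ i -> ip (shift (lab i) (x F.zero)) h)) (trans (cong (λ t -> total - t) orbit) (Z.+-identityʳ total))))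
       h≤ : nrm h ≤ + 4 * Δ
       h≤ = nrm-diff≤ f (shift (neg k) f) ⟫ by (0≤-* {+ 4} 0≤ℕ (0≤-- hf)) (trans (e Δ (nrm f)) (cong (λ t -> + 2 * nrm f + + 2 * t + + 4 * (Δ - nrm f)) (sym (nrm-shift (neg k) f))))
         where
         e : ∀ d n -> + 4 * d ≡ + 2 * n + + 2 * n + + 4 * (d - n)
         e = solve 2 (λ d n -> :4 :* d := :2 :* n :+ :2 :* n :+ :4 :* (d :- n)) refl
       upper : + 2 * total ≤ + suc q * (+ 5 * Δ)
       upper = ≤r (trans (cong (+ 2 *_) total≡) (sym (∑-*ˡ I (+ 2) (λ i -> ip (err i) h)))) ⟫ ∑-mono I (λ i -> 2ip≤ (err i) h ⟫ Z.+-mono-≤ (lab-close i) h≤ ⟫ ≤r (e Δ)) ⟫ ≤r (trans (∑-const I (+ 5 * Δ)) (cong (λ l -> + l * (+ 5 * Δ)) len))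
         where
         e : ∀ d -> d + + 4 * d ≡ + 5 * d
         e = solve 1 (λ d -> d :+ :4 :* d := con (+ 5) :* d) refl

     -- Two antipodal pairs, one in each part, cannot form a clique.
     antipodal : ∀ h -> h ⊕ h ≡ F.zero -> h ≢ F.zero -> ∀ x x′ y y′ -> Close h x x′ -> Close h y y′ ->
       Sector x y -> Sector x y′ -> Sector x′ y -> Sector x′ y′ -> ⊥
     antipodal h hh h≢0 x x′ y y′ cx cy s₁ s₂ s₃ s₄ = absurd _ (+ 11 * Δ + + 7)
        (0≤-+ (0≤-+ (0≤-* {+ 2} 0≤ℕ (0≤-+ (0≤-+ (0≤-- (s₁ h h≢0)) (0≤-- (s₂ h h≢0))) (0≤-+ (0≤-- (s₃ h h≢0)) (0≤-- (s₄ h h≢0)))))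
          (0≤-- (2ip≤ (diff e (shift h e)) f))) (0≤-+ (0≤-+ (0≤-- (nrm-diff≤ e (shift h e))) (0≤-* {+ 4} 0≤ℕ (0≤-- cx))) (0≤-- cy)))
        (0≤-+ (0≤-* {+ 11} 0≤ℕ 0≤Δ) (0≤ℕ {7}))
        (trans (cong (λ t -> + 2 * (p₁ - (+ 2 * Δ + 1ℤ) + (p₂ - (+ 2 * Δ + 1ℤ)) + (p₃ - (+ 2 * Δ + 1ℤ) + (p₄ - (+ 2 * Δ + 1ℤ)))) + (nrm (diff e (shift h e)) + nrm f - + 2 * ip (diff e (shift h e)) f)
           + (+ 2 * nrm e + + 2 * t - nrm (diff e (shift h e)) + + 4 * (Δ - nrm e) + (Δ - nrm f)) + (+ 11 * Δ + + 7)) (nrm-shift h e))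
          (trans (cong (λ t -> + 2 * (p₁ - (+ 2 * Δ + 1ℤ) + (p₂ - (+ 2 * Δ + 1ℤ)) + (p₃ - (+ 2 * Δ + 1ℤ) + (p₄ - (+ 2 * Δ + 1ℤ)))) + (nrm (diff e (shift h e)) + nrm f - + 2 * t)
           + (+ 2 * nrm e + + 2 * nrm e - nrm (diff e (shift h e)) + + 4 * (Δ - nrm e) + (Δ - nrm f)) + (+ 11 * Δ + + 7)) (sym total))
           (fin Δ p₁ p₂ p₃ p₄ (nrm e) (nrm f) (nrm (diff e (shift h e))))))
       where
       e f : Vect
       e = diff x′ (shift h x)
       f = diff y′ (shift h y)
       p₁ p₂ p₃ p₄ : ℤ
       p₁ = ip (diff x (shift h x)) y
       p₂ = ip (diff x (shift h x)) y′
       p₃ = ip (diff x′ (shift h x′)) y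
       p₄ = ip (diff x′ (shift h x′)) y′
       fin : ∀ d a b c g n m w -> + 2 * (a - (+ 2 * d + 1ℤ) + (b - (+ 2 * d + 1ℤ)) + (c - (+ 2 * d + 1ℤ) + (g - (+ 2 * d + 1ℤ)))) + (w + m - + 2 * (a + b + (c + g)))
           + (+ 2 * n + + 2 * n - w + + 4 * (d - n) + (d - m)) + (+ 11 * d + + 7) ≡ -[1+ 0 ]
       fin = solve 8 (λ d a b c g n m w -> :2 :* (a :- (:2 :* d :+ :1) :+ (b :- (:2 :* d :+ :1)) :+ (c :- (:2 :* d :+ :1) :+ (g :- (:2 :* d :+ :1)))) :+ (w :+ m :- :2 :* (a :+ b :+ (c :+ g))) :+ (:2 :* n :+ :2 :* n :- w :+ :4 :* (d :- n) :+ (d :- m)) :+ (con (+ 11) :* d :+ con (+ 7)) := con -[1+ 0 ]) refl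
       neg-h : neg h ≡ h
       neg-h = trans (sym (0⊕ (neg h))) (trans (cong (_⊕ neg h) (sym hh)) (⊕-cancel h h))
       pair : ∀ u -> ip (diff u (shift h u)) y + ip (diff u (shift h u)) y′ ≡ ip (diff u (shift h u)) f
       pair u = trans (Z.+-comm (ip (diff u (shift h u)) y) (ip (diff u (shift h u)) y′)) (trans (cong (λ t -> ip (diff u (shift h u)) y′ + ip (diff u (shift t u)) y) (sym neg-h)) (cross-identity u y f y′ h (λ r a -> e′ (y′ r a) (shift h y r a))))
         where
         e′ : ∀ z s -> z ≡ s + (z - s)
         e′ = solve 2 (λ z s -> z := s :+ (z :- s)) refl
       -- The rotation by `h` is an involution, so adding u - σu for u = x and u = x′ leaves e - σe,
       -- where e is the error of x′ against σx. Four large correlations thus collapse to an inner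
       -- product of errors.
       total : p₁ + p₂ + (p₃ + p₄) ≡ ip (diff e (shift h e)) f
       total = trans (cong₂ _+_ (pair x) (pair x′)) (trans (sym (ip-add (diff x (shift h x)) (diff x′ (shift h x′)) f)) (ip-cong pt (λ _ _ -> refl)))
         where
         pt : ∀ r a -> diff x (shift h x) r a + diff x′ (shift h x′) r a ≡ diff e (shift h e) r a
         pt r a = trans (eq (x r a) (x (r ⊕ h) a) (x′ r a) (x′ (r ⊕ h) a)) (cong (λ s -> x′ r a - x (r ⊕ h) a - (x′ (r ⊕ h) a - x s a)) (sym (trans (⊕-assoc r h h) (trans (cong (r ⊕_) hh) (⊕-zero r)))))
           where
           eq : ∀ x s x′ t -> x - s + (x′ - t) ≡ x′ - s - (t - x)
           eq = solve 4 (λ x s x′ t -> x :- s :+ (x′ :- t) := x′ :- s :- (t :- x)) refl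

     -- Otherwise x would be close to its own rotate by k + l - j, which is nontrivial, against
     -- genericity.
     label-add : ∀ {x y z} -> Generic x -> ∀ k l j -> Close k x y -> Close l y z -> Close j x z -> j ≡ k ⊕ l
     label-add {x} {y} {z} g k l j hk hl hj with j Fₚ.≟ k ⊕ l
     ... | yes e = e
     ... | no ne = ⊥-elim (absurd _ 0ℤ (0≤-+ (0≤-+ (0≤-- (g d d≢0)) (0≤-- (≤r norm≡ ⟫ nrm-diff≤ (diff ek′ ej) el′))) (0≤-+ (0≤-+ (0≤-+ (0≤-* {+ 2} 0≤ℕ (0≤-- (nrm-diff≤ ek′ ej))) (0≤-* {+ 4} 0≤ℕ (0≤-- hk′))) (0≤-* {+ 4} 0≤ℕ (0≤-- hj′))) (0≤-* {+ 2} 0≤ℕ (0≤-- hl)))) 0≤ℕ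
          (e (Δ) (nrm (diff x (shift d x))) (nrm (diff ek′ ej)) (nrm ek′) (nrm ej) (nrm el′)))
       where
       d : Ix
       d = neg j ⊕ (k ⊕ l)
       d≢0 : d ≢ F.zero
       d≢0 h = ne (sym (trans (sym (⊕-cancel′ j (k ⊕ l))) (trans (cong (_⊕ j) (trans (⊕-comm (k ⊕ l) (neg j)) h)) (0⊕ j))))
       ej ek′ el′ : Vect
       ej = diff (shift j x) z
       ek′ = shift l (diff (shift k x) y)
       el′ = diff z (shift l y)
       sw : ∀ u v -> nrm (diff u v) ≡ nrm (diff v u)
       sw u v = trans (nrm-diff u v) (trans (e₁ (nrm u) (ip u v) (nrm v)) (trans (cong (λ t -> nrm v - + 2 * t + nrm u) (ip-sym u v)) (sym (nrm-diff v u))))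
         where
         e₁ : ∀ a b c -> a - + 2 * b + c ≡ c - + 2 * b + a
         e₁ = solve 3 (λ a b c -> a :- :2 :* b :+ c := c :- :2 :* b :+ a) refl
       hk′ : nrm ek′ ≤ Δ
       hk′ = ≤r (trans (nrm-shift l (diff (shift k x) y)) (sw (shift k x) y)) ⟫ hk
       hj′ : nrm ej ≤ Δ
       hj′ = ≤r (sw (shift j x) z) ⟫ hj
       norm≡ : nrm (diff x (shift d x)) ≡ nrm (diff (diff ek′ ej) el′)
       norm≡ = trans (sym (nrm-shift j (diff x (shift d x)))) (trans (sw-shift) (ip-cong pt pt))
         where
         jd : ∀ r -> (r ⊕ j) ⊕ d ≡ (r ⊕ l) ⊕ k
         jd r = trans (sym (⊕-assoc (r ⊕ j) (neg j) (k ⊕ l))) (trans (cong (_⊕ (k ⊕ l)) (⊕-cancel j r)) (trans (cong (r ⊕_) (⊕-comm k l)) (sym (⊕-assoc r l k))))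
         sw-shift : nrm (shift j (diff x (shift d x))) ≡ nrm (diff (shift l (shift k x)) (shift j x))
         sw-shift = trans (ip-cong pt₁ pt₁) (sw (shift j x) (shift l (shift k x)))
           where
           pt₁ : ∀ r a -> shift j (diff x (shift d x)) r a ≡ diff (shift j x) (shift l (shift k x)) r a
           pt₁ r a = cong (λ s -> x (r ⊕ j) a - x s a) (jd r)
         pt : ∀ r a -> diff (shift l (shift k x)) (shift j x) r a ≡ diff (diff ek′ ej) el′ r a
         pt r a = eq (x ((r ⊕ l) ⊕ k) a) (x (r ⊕ j) a) (y (r ⊕ l) a) (z r a)
           where
           eq : ∀ u v w z -> u - v ≡ u - w - (v - z) - (z - w)
           eq = solve 4 (λ u v w z -> u :- v := u :- w :- (v :- z) :- (z :- w)) refl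
       e : ∀ d n m a b c -> n - (+ 10 * d + 1ℤ) + (+ 2 * m + + 2 * c - n) + (+ 2 * (+ 2 * a + + 2 * b - m) + + 4 * (d - a) + + 4 * (d - b) + + 2 * (d - c)) + 0ℤ ≡ -[1+ 0 ]
       e = solve 6 (λ d n m a b c -> n :- (con (+ 10) :* d :+ :1) :+ (:2 :* m :+ :2 :* c :- n) :+ (:2 :* (:2 :* a :+ :2 :* b :- m) :+ :4 :* (d :- a) :+ :4 :* (d :- b) :+ :2 :* (d :- c)) :+ :0 := con -[1+ 0 ]) refl

 -- The model space and its cyclic action

 -- Undefined exactly at the last index and number-preserving below it, so that `cyc` is r + 1
 -- modulo n + 1.
 low : ∀ {n} -> Fin (suc n) -> Maybe (Fin n)
 low {zero} F.zero = nothing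
 low {suc n} F.zero = just F.zero
 low {suc n} (F.suc r) = Maybe.map F.suc (low r)

 cyc : ∀ {n} -> Fin (suc n) -> Fin (suc n)
 cyc r = maybe′ F.suc F.zero (low r)

 cyc^ : ∀ {n} -> ℕ -> Fin (suc n) -> Fin (suc n)
 cyc^ zero r = r
 cyc^ (suc j) r = cyc (cyc^ j r)


 record StandardCyclic (q : ℕ) : Set where
   field
     cyclic : Cyclic q
     ⊕-cyc  : ∀ r k -> Cyclic._⊕_ cyclic r k ≡ cyc^ (toℕ k) r

 module Rotations {κ c : ℤ} (0≤κ : 0ℤ ≤ κ) (S : Space κ c) where
   open Powers {κ} {c} 0≤κ
   open Space

   insertLast : ∀ k -> Pt S -> Pt (pow S k) -> Pt (pow S (suc k))
   insertLast zero a v = a , v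
   insertLast (suc k) a (b , v) = b , insertLast k a v

   rotl : ∀ k -> Pt (pow S (suc k)) -> Pt (pow S (suc k))
   rotl k (a , v) = insertLast k a v

   comp-insertLast : ∀ k a v r -> comp S (suc k) (insertLast k a v) r ≡ maybe′ (comp S k v) a (low r)
   comp-insertLast zero a v F.zero = refl
   comp-insertLast (suc k) a (b , v) F.zero = refl
   comp-insertLast (suc k) a (b , v) (F.suc r) = trans (comp-insertLast k a v r) (push (low r))
     where
     push : ∀ m -> maybe′ (comp S k v) a m ≡ maybe′ (comp S (suc k) (b , v)) a (Maybe.map F.suc m)
     push nothing = refl
     push (just _) = refl

   comp-rotl : ∀ k x r -> comp S (suc k) (rotl k x) r ≡ comp S (suc k) x (cyc r)
   comp-rotl k (a , v) r = trans (comp-insertLast k a v r) (push (low r))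
     where
     push : ∀ m -> maybe′ (comp S k v) a m ≡ comp S (suc k) (a , v) (maybe′ F.suc F.zero m)
     push nothing = refl
     push (just _) = refl

   rot^ : ∀ k -> ℕ -> Pt (pow S (suc k)) -> Pt (pow S (suc k))
   rot^ k zero x = x
   rot^ k (suc j) x = rotl k (rot^ k j x)

   comp-rot^ : ∀ k j x r -> comp S (suc k) (rot^ k j x) r ≡ comp S (suc k) x (cyc^ j r)
   comp-rot^ k zero x r = refl
   comp-rot^ k (suc j) x r = trans (comp-rotl k (rot^ k j x) r) (trans (comp-rot^ k j x (cyc r)) (cong (comp S (suc k) x) (commute j r)))
     where
     commute : ∀ j r -> cyc^ j (cyc r) ≡ cyc (cyc^ j r)
     commute zero r = refl
     commute (suc j) r = cong cyc (commute j r)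

   ∑-insertLast : ∀ k (f : Pt (pow S (suc k)) -> ℤ) -> ∑ (pts S) (λ a -> ∑ (pts (pow S k)) (λ v -> f (insertLast k a v))) ≡ ∑ (pts (pow S (suc k))) f
   ∑-insertLast zero f = sym (∑-pairs (pts S) (pts (pow S 0)) f)
   ∑-insertLast (suc k) f = begin
     ∑ (pts S) (λ a -> ∑ (pts (pow S (suc k))) (λ v -> f (insertLast (suc k) a v)))
       ≡⟨ ∑-cong (pts S) (λ a -> ∑-pairs (pts S) (pts (pow S k)) _) ⟩
     ∑ (pts S) (λ a -> ∑ (pts S) (λ b -> ∑ (pts (pow S k)) (λ v -> f (b , insertLast k a v)))) ≡⟨ ∑-swap (pts S) (pts S) _ ⟩
     ∑ (pts S) (λ b -> ∑ (pts S) (λ a -> ∑ (pts (pow S k)) (λ v -> f (b , insertLast k a v)))) ≡⟨ ∑-cong (pts S) (λ b -> ∑-insertLast k (λ v -> f (b , v))) ⟩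
     ∑ (pts S) (λ b -> ∑ (pts (pow S (suc k))) (λ v -> f (b , v))) ≡⟨ sym (∑-pairs (pts S) (pts (pow S (suc k))) f) ⟩
     ∑ (pts (pow S (suc (suc k)))) f ∎
     where open ≡-Reasoning

   ∑-rotl : ∀ k (f : Pt (pow S (suc k)) -> ℤ) -> ∑ (pts (pow S (suc k))) (f ∘ rotl k) ≡ ∑ (pts (pow S (suc k))) f
   ∑-rotl k f = trans (∑-pairs (pts S) (pts (pow S k)) (f ∘ rotl k)) (∑-insertLast k f)

   ∑-rot^ : ∀ k j (f : Pt (pow S (suc k)) -> ℤ) -> ∑ (pts (pow S (suc k))) (f ∘ rot^ k j) ≡ ∑ (pts (pow S (suc k))) f
   ∑-rot^ k zero f = refl
   ∑-rot^ k (suc j) f = trans (∑-rot^ k j (f ∘ rotl k)) (∑-rotl k f)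

 module Model (q : ℕ) (sc : StandardCyclic q) (m ℓ : ℕ) (m≡ : suc m ≡ 4 ℕ.* ℓ) (M : ℕ) where
   open StandardCyclic sc
   open Vectors q M cyclic public
   open Cyclic cyclic public
   open Smallball m ℓ m≡ public
   open Path m using (n; κ; path) public
   open Powers {κ} {+ 32} 0≤κ public
   open Rotations {κ} {+ 32} 0≤κ (pow path M) public

   Cs Ωs : Space κ (+ 32)
   Cs = pow path M
   Ωs = pow Cs (suc q)

   Ω : Set
   Ω = Space.Pt Ωs

   Ωpts : List Ω
   Ωpts = Space.pts Ωs

   |Ω| : ℤ
   |Ω| = + length Ωpts

   p : ℤ
   p = + suc q

   vec : Ω -> Vect
   vec x r a = val (comp path M (comp Cs (suc q) x r) a)

   rot : Ix -> Ω -> Ω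
   rot k = rot^ q (toℕ k)

   vec-rot : ∀ k x r a -> vec (rot k x) r a ≡ shift k (vec x) r a
   vec-rot k x r a = cong (λ z -> val (comp path M z a)) (trans (comp-rot^ q (toℕ k) x r) (cong (comp Cs (suc q) x) (sym (⊕-cyc r k))))

   ∑-rot : ∀ k (f : Ω -> ℤ) -> ∑ Ωpts (f ∘ rot k) ≡ ∑ Ωpts f
   ∑-rot k f = ∑-rot^ q (toℕ k) f

   d²-nrm : ∀ x y -> Space.d² Ωs x y ≡ nrm (diff (vec x) (vec y))
   d²-nrm x y = trans (d²-comp Cs (suc q) x y) (trans (∑-cong (allFin (suc q)) (λ r -> trans (d²-comp path M (comp Cs (suc q) x r) (comp Cs (suc q) y r))
      (∑-cong (allFin M) (λ a -> e (+ comp path M (comp Cs (suc q) x r) a) (+ comp path M (comp Cs (suc q) y r) a) (+ n))))) (sym (ip-def (diff (vec x) (vec y)) (diff (vec x) (vec y)))))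
     where
     e : ∀ i j n -> + 4 * ((i - j) * (i - j)) ≡ (+ 2 * i + 1ℤ - n - (+ 2 * j + 1ℤ - n)) * (+ 2 * i + 1ℤ - n - (+ 2 * j + 1ℤ - n))
     e = solve 3 (λ i j n -> :4 :* ((i :- j) :* (i :- j)) := (:2 :* i :+ :1 :- n :- (:2 :* j :+ :1 :- n)) :* (:2 :* i :+ :1 :- n :- (:2 :* j :+ :1 :- n))) refl

   ∑-Ω : ∀ (f : Ω -> ℤ) -> ∑ Ωpts f ≡ ∑ (cells M) (λ a -> ∑ (Space.pts (pow Cs q)) (λ v -> f (a , v)))
   ∑-Ω f = ∑-pairs (cells M) (Space.pts (pow Cs q)) f

   |Ω|-split : |Ω| ≡ #cells M * + length (Space.pts (pow Cs q))
   |Ω|-split = length-pairs (cells M) (Space.pts (pow Cs q))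

   module Concentrate (T : ℤ) (0≤T : 0ℤ ≤ T) (E : ℕ)
                      (hT : + E * p * κ * (+ 32 * T + p * (+ M * + 32)) + 1ℤ ≤ T * T) (1≤Ω : 1ℤ ≤ |Ω|) where
     open Concentration {κ} {+ 32} 0≤κ Ωs 0≤ℕ

     module _ (A : Ω -> Bool) (big : |Ω| ≤ + E * ∑ Ωpts (λ x -> ind (A x))) where
       as : List Ω
       as = members A Ωpts

       b mA : ℤ
       b = ∑ Ωpts (λ x -> ind (far T as x))
       mA = ∑ Ωpts (λ x -> ind (A x))

       few-far : p * b + 1ℤ ≤ |Ω|
       few-far = go (|Ω| Z.≤? p * b)
         where
         c′≡ : Space.c′ Ωs ≡ p * (+ M * + 32)
         c′≡ = trans (c′-pow Cs (suc q)) (cong (p *_) (c′-pow path M))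
         conc : mA * b * (T * T) ≤ κ * (|Ω| * |Ω|) * (+ 32 * T + p * (+ M * + 32))
         conc = concentration T A 0≤T ⟫ ≤r (cong (λ z -> κ * (|Ω| * |Ω|) * (+ 32 * T + z)) c′≡)
         go : Dec (|Ω| ≤ p * b) -> p * b + 1ℤ ≤ |Ω|
         go (no h) = ≰⇒≥1 h
         go (yes h) = ⊥-elim (absurd _ (|Ω| * |Ω| - 1ℤ)
            (0≤-+ (0≤-+ (0≤-+ (0≤-* (0≤-* (0≤ℕ {E}) (0≤ℕ {suc q})) (0≤-- conc)) (0≤-* (0≤-* 0≤ℕ′ 0≤ℕ′) (0≤-- hT)))
              (0≤-* (0≤-sq T) (0≤-* (0≤ℕ′) (0≤-- h)))) (0≤-* (0≤-sq T) (0≤-* (0≤-* (0≤ℕ {suc q}) 0≤b) (0≤-- big))))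
            (0≤-- (1≤-* 1≤Ω 1≤Ω)) (e (+ E) p κ |Ω| mA b T (+ 32 * T + p * (+ M * + 32))))
           where
           0≤ℕ′ : 0ℤ ≤ |Ω|
           0≤ℕ′ = 0≤ℕ
           0≤b : 0ℤ ≤ b
           0≤b = ∑-nonneg Ωpts (λ x -> 0≤ind (far T as x))
           e : ∀ E p κ o m b T x -> E * p * (κ * (o * o) * x - m * b * (T * T)) + o * o * (T * T - (E * p * κ * x + 1ℤ)) + T * T * (o * (p * b - o)) + T * T * (p * b * (E * m - o)) + (o * o - 1ℤ) ≡ -[1+ 0 ]
           e = solve 8 (λ E p κ o m b T x -> E :* p :* (κ :* (o :* o) :* x :- m :* b :* (T :* T)) :+ o :* o :* (T :* T :- (E :* p :* κ :* x :+ :1)) :+ T :* T :* (o :* (p :* b :- o)) :+ T :* T :* (p :* b :* (E :* m :- o)) :+ (o :* o :- :1) := con -[1+ 0 ]) refl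

       -- For a uniformly random point each of its p rotates is uniform. By `few-far` fewer than one
       -- of them is far from A on average, so some point has none.
       centre : ∃ λ z -> ∀ k -> far T as (rot k z) ≡ false
       centre = z , all-near
         where
         total : ∑ Ωpts (λ z -> ∑ (allFin (suc q)) (λ k -> ind (far T as (rot k z)))) ≡ p * b
         total = trans (∑-swap Ωpts (allFin (suc q)) _) (trans (∑-cong (allFin (suc q)) (λ k -> ∑-rot k (λ x -> ind (far T as x))))
           (trans (∑-const (allFin (suc q)) b) (cong (λ l -> + l * b) (Lₚ.length-tabulate (λ (i : Ix) -> i)))))
         picked : ∃ λ z -> z ∈ Ωpts × ∑ (allFin (suc q)) (λ k -> ind (far T as (rot k z))) + 1ℤ ≤ 1ℤ
         picked = ∑-pick Ωpts (≤r (cong (_+ 1ℤ) total) ⟫ few-far ⟫ ≤r (sym (trans (∑-const Ωpts 1ℤ) (Z.*-identityʳ |Ω|))))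
         z : Ω
         z = proj₁ picked
         all-near : ∀ k -> far T as (rot k z) ≡ false
         all-near k = go (far T as (rot k z)) refl
           where
           go : ∀ b -> far T as (rot k z) ≡ b -> far T as (rot k z) ≡ false
           go false e = e
           go true e = ⊥-elim (≥1⇒≰ (proj₂ (proj₂ picked)) (≤r (cong ind (sym e)) ⟫ ∑-∈≤ (allFin (suc q)) (λ k -> 0≤ind (far T as (rot k z))) (∈ₚ.∈-allFin k)))

       open Geometry (+ 4 * T) (0≤-* {+ 4} 0≤ℕ 0≤T)

       -- Members of A are chosen near the p rotates of the centre. The j-th and the rotate of the
       -- i-th by j - i both lie within `T` of the same rotate of the centre, so their squared
       -- distance is at most 2T + 2T; this is the origin of Δ = 4T.
       near-clique : ∃ λ (x : Ix -> Ω) -> (∀ i -> A (x i) ≡ true) × (∀ i j -> i ≢ j -> Near (vec (x i)) (vec (x j)))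
       near-clique = x , (λ i -> members-∈ A Ωpts (proj₁ (proj₂ (wit i)))) , near
         where
         z : Ω
         z = proj₁ centre
         wit : ∀ k -> ∃ λ a -> a ∈ as × Space.d² Ωs (rot k z) a ≤ T
         wit k = near-witness T as (rot k z) (proj₂ centre k)
         x : Ix -> Ω
         x k = proj₁ (wit k)
         σz : ∀ k -> Vect
         σz k = shift k (vec z)
         close : ∀ k -> nrm (diff (σz k) (vec (x k))) ≤ T
         close k = ≤r (sym (trans (d²-nrm (rot k z) (x k)) (ip-cong pt pt))) ⟫ proj₂ (proj₂ (wit k))
           where
           pt : ∀ r a -> diff (vec (rot k z)) (vec (x k)) r a ≡ diff (σz k) (vec (x k)) r a
           pt r a = cong (_- vec (x k) r a) (vec-rot k z r a)
         near : ∀ i j -> i ≢ j -> Near (vec (x i)) (vec (x j))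
         near i j i≢j = k , k≢0 , (≤r (ip-cong pt pt) ⟫ nrm-diff≤ (shift k (diff (σz i) (vec (x i)))) (diff (σz j) (vec (x j)))
              ⟫ by (0≤-+ (0≤-* {+ 2} 0≤ℕ (0≤-- (close i))) (0≤-* {+ 2} 0≤ℕ (0≤-- (close j)))) (trans (e T (nrm (diff (σz i) (vec (x i)))) (nrm (diff (σz j) (vec (x j)))))
                  (cong (λ t -> + 2 * t + + 2 * nrm (diff (σz j) (vec (x j))) + (+ 2 * (T - nrm (diff (σz i) (vec (x i)))) + + 2 * (T - nrm (diff (σz j) (vec (x j)))))) (sym (nrm-shift k (diff (σz i) (vec (x i))))))))
           where
           k : Ix
           k = neg i ⊕ j
           ki : ∀ r -> (r ⊕ k) ⊕ i ≡ r ⊕ j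
           ki r = trans (⊕-assoc r k i) (cong (r ⊕_) (trans (⊕-comm k i) (trans (sym (⊕-assoc i (neg i) j)) (trans (cong (_⊕ j) (⊕-neg i)) (0⊕ j)))))
           k≢0 : k ≢ F.zero
           k≢0 h = i≢j (trans (sym (⊕-zero i)) (trans (cong (i ⊕_) (sym h)) (trans (sym (⊕-assoc i (neg i) j)) (trans (cong (_⊕ j) (⊕-neg i)) (0⊕ j)))))
           e : ∀ t a b -> + 4 * t ≡ + 2 * a + + 2 * b + (+ 2 * (t - a) + + 2 * (t - b))
           e = solve 3 (λ t a b -> :4 :* t := :2 :* a :+ :2 :* b :+ (:2 :* (t :- a) :+ :2 :* (t :- b))) refl
           pt : ∀ r a -> diff (vec (x j)) (shift k (vec (x i))) r a ≡ diff (shift k (diff (σz i) (vec (x i)))) (diff (σz j) (vec (x j))) r a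
           pt r a = trans (eq (vec (x j) r a) (vec (x i) (r ⊕ k) a) (vec z (r ⊕ j) a)) (cong (λ s -> vec z s a - vec (x i) (r ⊕ k) a - (vec z (r ⊕ j) a - vec (x j) r a)) (sym (ki r)))
             where
             eq : ∀ u v w -> u - v ≡ w - v - (w - u)
             eq = solve 3 (λ u v w -> u :- v := w :- v :- (w :- u)) refl

 -- Counting special points and sector pairs

 argmax : ∀ {n} (f : Fin (suc n) -> ℤ) -> ∃ λ j -> ∀ i -> f i ≤ f j
 argmax {zero} f = F.zero , λ { F.zero -> Z.≤-refl }
 argmax {suc n} f with argmax (f ∘ F.suc)
 ... | j , h with f F.zero Z.≤? f (F.suc j)
 ...   | yes q = F.suc j , λ { F.zero -> q ; (F.suc i) -> h i }
 ...   | no q = F.zero , λ { F.zero -> Z.≤-refl ; (F.suc i) -> h i ⟫ Z.<⇒≤ (Z.≰⇒> q) }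

 dec-true : ∀ {P : Set} (d : Dec P) -> P -> does d ≡ true
 dec-true (yes _) _ = refl
 dec-true (no q) p = ⊥-elim (q p)

 from-does : ∀ {P : Set} (d : Dec P) -> does d ≡ true -> P
 from-does (yes p) _ = p

 -- A coordinate is active from size `W` on, a difference is heavy with `A₀` active coordinates, and
 -- `r₀` intervals of length 2K cover the window from -2Δ to 2Δ (`covered`). `separated` makes
 -- points with heavy differences generic, `fine` and `doubled` make light differences rare, and
 -- `spread` is the hypothesis of the small-ball estimate.
 record Numbers (q m ℓ M g : ℕ) : Set where
   field
     W A₀ r₀ : ℕ
     Δ     : ℤ
     0≤Δ   : 0ℤ ≤ Δ
     1≤g   : 1 ℕ.≤ g
     1≤r₀  : 1 ℕ.≤ r₀
     1≤A₀  : 1 ℕ.≤ A₀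
     separated : + 10 * Δ + 1ℤ ≤ + A₀ * (+ W * + W)
     covered   : + 4 * Δ + 1ℤ ≤ + 2 * (+ W * (+ 2 * + ℓ)) * + r₀
     fine      : + g * (+ 2 * + W + 1ℤ) ≤ + suc m
     doubled      : + 2 * + A₀ ≤ + M
     spread    : 4 ℕ.* ((2 ℕ.* g ℕ.* r₀) ℕ.^ 4) ℕ.≤ A₀

 module Counting (q : ℕ) (sc : StandardCyclic q) (m ℓ : ℕ) (m≡ : suc m ≡ 4 ℕ.* ℓ) (M g : ℕ) (nums : Numbers q m ℓ M g) where
   open Model q sc m ℓ m≡ M public
   open Numbers nums public
   open Geometry Δ 0≤Δ public

   K : ℤ
   K = + W * (+ 2 * + ℓ)

   0≤K : 0ℤ ≤ K
   0≤K = 0≤-* {+ W} 0≤ℕ (0≤-* {+ 2} {+ ℓ} 0≤ℕ 0≤ℕ)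

   1≤M : 1ℤ ≤ + M
   1≤M = 1≤-* {+ 2} (+≤+ (ℕ.s≤s ℕ.z≤n)) (+≤+ 1≤A₀) ⟫ doubled

   idle : ℤ -> ℤ
   idle x = ind (not (active (+ W) x))

   idle-cases : ∀ x -> (idle x ≡ 1ℤ × x + 1ℤ ≤ + W × 1ℤ - + W ≤ x) ⊎ idle x ≡ 0ℤ
   idle-cases x with + W Z.≤? x | + W Z.≤? - x
   ... | yes _ | _ = inj₂ refl
   ... | no _ | yes _ = inj₂ refl
   ... | no a | no b = inj₁ (refl , ≰⇒≥1 a , by (0≤-- (≰⇒≥1 b)) (e (+ W) x))
     where
     e : ∀ W x -> x ≡ 1ℤ - W + (W - (- x + 1ℤ))
     e = solve 2 (λ W x -> x := :1 :- W :+ (W :- (:- x :+ :1))) refl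

   -- A ramp of slope one across the window, so that each idle value costs two units of its total height.
   ramp : ℤ -> ℤ
   ramp x = (x + + W ⊔ 0ℤ) ⊓ (+ 2 * + W + 1ℤ)

   0≤2W+1 : 0ℤ ≤ + 2 * + W + 1ℤ
   0≤2W+1 = 0≤-+ (0≤-* {+ 2} {+ W} 0≤ℕ 0≤ℕ) (0≤ℕ {1})

   ramp-mono : ∀ {x y} -> x ≤ y -> ramp x ≤ ramp y
   ramp-mono {x} {y} h = Z.⊓-monoˡ-≤ (+ 2 * + W + 1ℤ) {x + + W ⊔ 0ℤ} {y + + W ⊔ 0ℤ} (Z.⊔-mono-≤ (Z.+-monoˡ-≤ (+ W) h) (Z.≤-refl {0ℤ}))

   idle-ramp : ∀ x -> + 2 * idle x ≤ ramp (x + + 2) - ramp x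
   idle-ramp x = go (idle-cases x)
     where
     go : (idle x ≡ 1ℤ × x + 1ℤ ≤ + W × 1ℤ - + W ≤ x) ⊎ idle x ≡ 0ℤ -> + 2 * idle x ≤ ramp (x + + 2) - ramp x
     go (inj₂ e) = ≤r (cong (+ 2 *_) e) ⟫ 0≤-- (ramp-mono {x} {x + + 2} (by (0≤ℕ {2}) refl))
     go (inj₁ (e , hi , lo)) = ≤r (trans (cong (+ 2 *_) e) (sym (trans (cong₂ _-_ (at (x + + 2) p₁ p₂) (at x p₃ p₄)) (e₁ x (+ W)))))
       where
       at : ∀ z -> 0ℤ ≤ z + + W -> z + + W ≤ + 2 * + W + 1ℤ -> ramp z ≡ z + + W
       at z a b = trans (cong (_⊓ (+ 2 * + W + 1ℤ)) (Z.i≥j⇒i⊔j≡i a)) (Z.i≤j⇒i⊓j≡i b)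
       e₁ : ∀ x W -> x + + 2 + W - (x + W) ≡ + 2
       e₁ = solve 2 (λ x W -> x :+ :2 :+ W :- (x :+ W) := :2) refl
       p₃ : 0ℤ ≤ x + + W
       p₃ = by (0≤-+ (0≤-- lo) (0≤ℕ {1})) (e₂ x (+ W))
         where
         e₂ : ∀ x W -> x + W ≡ 0ℤ + (x - (1ℤ - W) + 1ℤ)
         e₂ = solve 2 (λ x W -> x :+ W := :0 :+ (x :- (:1 :- W) :+ :1)) refl
       p₂ : x + + 2 + + W ≤ + 2 * + W + 1ℤ
       p₂ = by (0≤-- hi) (e₂ x (+ W))
         where
         e₂ : ∀ x W -> + 2 * W + 1ℤ ≡ x + + 2 + W + (W - (x + 1ℤ))
         e₂ = solve 2 (λ x W -> :2 :* W :+ :1 := x :+ :2 :+ W :+ (W :- (x :+ :1))) refl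
       p₁ : 0ℤ ≤ x + + 2 + + W
       p₁ = p₃ ⟫ by (0≤ℕ {2}) (e₂ x (+ W))
         where
         e₂ : ∀ x W -> x + + 2 + W ≡ x + W + + 2
         e₂ = solve 2 (λ x W -> x :+ :2 :+ W := x :+ W :+ :2) refl
       p₄ : x + + W ≤ + 2 * + W + 1ℤ
       p₄ = by (0≤ℕ {2}) (e₂ x (+ W)) ⟫ p₂
         where
         e₂ : ∀ x W -> x + + 2 + W ≡ x + W + + 2
         e₂ = solve 2 (λ x W -> x :+ :2 :+ W := x :+ W :+ :2) refl

   -- The increments of the ramp telescope, because consecutive values differ by exactly 2.
   idle-line : ∀ t -> + 2 * ∑ (upTo n) (λ j -> idle (val j - t)) ≤ + 2 * + W + 1ℤ
   idle-line t = ≤r (sym (∑-*ˡ (upTo n) (+ 2) (λ j -> idle (val j - t)))) ⟫ ∑-mono (upTo n) (λ j -> idle-ramp (val j - t) ⟫ ≤r (cong (λ z -> ramp z - ramp (val j - t)) (e (+ j) (+ n) t)))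
      ⟫ ≤r (telescope n (λ j -> ramp (val j - t))) ⟫ by (0≤-+ (0≤-- (Z.i⊓j≤j (val n - t + + W ⊔ 0ℤ) (+ 2 * + W + 1ℤ))) (Z.⊓-glb (Z.i≤j⊔i (val 0 - t + + W) 0ℤ) 0≤2W+1)) (e′ (ramp (val n - t)) (ramp (val 0 - t)) (+ 2 * + W + 1ℤ))
     where
     e : ∀ j n t -> + 2 * j + 1ℤ - n - t + + 2 ≡ + 2 * (1ℤ + j) + 1ℤ - n - t
     e = solve 3 (λ j n t -> :2 :* j :+ :1 :- n :- t :+ :2 := :2 :* (:1 :+ j) :+ :1 :- n :- t) refl
     e′ : ∀ a b c -> c ≡ a - b + (c - a + b)
     e′ = solve 3 (λ a b c -> c := a :- b :+ (c :- a :+ b)) refl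

   idles : ∀ k -> (Fin k -> ℤ) -> ℤ
   idles k w = ∑ (allFin k) (λ a -> idle (w a))

   act-idles : ∀ k w -> + act k (+ W) w + idles k w ≡ + k
   act-idles zero w = refl
   act-idles (suc k) w = trans (+ˡ (+ act (suc k) (+ W) w) (∑-allFin-suc k (λ a -> idle (w a)))) (go (active (+ W) (w F.zero)))
     where
     e : ∀ a b -> a + (1ℤ + b) ≡ 1ℤ + (a + b)
     e = solve 2 (λ a b -> a :+ (:1 :+ b) := :1 :+ (a :+ b)) refl
     go : ∀ b -> + (if b then suc (act k (+ W) (w ∘ F.suc)) else act k (+ W) (w ∘ F.suc)) + (ind (not b) + idles k (w ∘ F.suc)) ≡ + suc k
     go true = trans (cong (λ z -> + suc (act k (+ W) (w ∘ F.suc)) + z) (Z.+-identityˡ (idles k (w ∘ F.suc)))) (trans (Z.+-assoc 1ℤ (+ act k (+ W) (w ∘ F.suc)) (idles k (w ∘ F.suc))) (+ˡ 1ℤ (act-idles k (w ∘ F.suc))))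
     go false = trans (e (+ act k (+ W) (w ∘ F.suc)) (idles k (w ∘ F.suc))) (+ˡ 1ℤ (act-idles k (w ∘ F.suc)))

   #cells-suc′ : ∀ k -> #cells (suc k) ≡ + n * #cells k
   #cells-suc′ k = trans (length-pairs (upTo n) (cells k)) (cong (λ z -> + z * #cells k) (length-upTo n))

   idle-cells : ∀ k (t : Fin k -> ℤ) -> + 2 * + n * ∑ (cells k) (λ v -> idles k (λ a -> val (comp path k v a) - t a)) ≤ + k * (+ 2 * + W + 1ℤ) * #cells k
   idle-cells zero t = ≤r (e (+ n) (+ 2 * + W + 1ℤ))
     where
     e : ∀ n w -> + 2 * n * (0ℤ + 0ℤ) ≡ 0ℤ * w * 1ℤ
     e = solve 2 (λ n w -> :2 :* n :* (:0 :+ :0) := :0 :* w :* :1) refl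
   idle-cells (suc k) t = ≤r (cong (+ 2 * + n *_) sum≡) ⟫ by (0≤-+ (0≤-* (0≤-* (0≤ℕ {n}) 0≤ℕ′) (0≤-- (idle-line (t F.zero)))) (0≤-* (0≤ℕ {n}) (0≤-- (idle-cells k (t ∘ F.suc)))))
       (trans (cong (+ suc k * (+ 2 * + W + 1ℤ) *_) (#cells-suc′ k)) (e (+ n) (+ k) (+ 2 * + W + 1ℤ) (#cells k) line rest))
     where
     0≤ℕ′ : 0ℤ ≤ #cells k
     0≤ℕ′ = 0≤ℕ
     line rest : ℤ
     line = ∑ (upTo n) (λ j -> idle (val j - t F.zero))
     rest = ∑ (cells k) (λ v -> idles k (λ a -> val (comp path k v a) - t (F.suc a)))
     e : ∀ n k w c l r -> (1ℤ + k) * w * (n * c) ≡ + 2 * n * (c * l + n * r) + (n * c * (w - + 2 * l) + n * (k * w * c - + 2 * n * r))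
     e = solve 6 (λ n k w c l r -> (:1 :+ k) :* w :* (n :* c) := :2 :* n :* (c :* l :+ n :* r) :+ (n :* c :* (w :- :2 :* l) :+ n :* (k :* w :* c :- :2 :* n :* r))) refl
     sum≡ : ∑ (cells (suc k)) (λ v -> idles (suc k) (λ a -> val (comp path (suc k) v a) - t a)) ≡ #cells k * line + + n * rest
     sum≡ = trans (∑-pairs (upTo n) (cells k) _) (trans (∑-cong (upTo n) (λ j -> trans (∑-cong (cells k) (λ v -> ∑-allFin-suc k (λ a -> idle (val (comp path (suc k) (j , v) a) - t a))))
        (trans (∑-+ (cells k) (λ v -> idle (val j - t F.zero)) (λ v -> idles k (λ a -> val (comp path k v a) - t (F.suc a)))) (cong (_+ rest) (∑-const (cells k) (idle (val j - t F.zero)))))))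
        (trans (∑-+ (upTo n) (λ j -> #cells k * idle (val j - t F.zero)) (λ _ -> rest)) (cong₂ _+_ (∑-*ˡ (upTo n) (#cells k) (λ j -> idle (val j - t F.zero))) (trans (∑-const (upTo n) rest) (cong (λ l -> + l * rest) (length-upTo n))))))

   lightB : (Fin M -> ℤ) -> Bool
   lightB w = does (+ act M (+ W) w + 1ℤ Z.≤? + A₀)

   light-idles : ∀ w -> + M * ind (lightB w) ≤ + 2 * idles M w
   light-idles w = go (+ act M (+ W) w + 1ℤ Z.≤? + A₀)
     where
     e : ∀ a i A M -> + 2 * i ≡ M * 1ℤ + (M - + 2 * A + + 2 * (A - (a + 1ℤ)) + + 2 + + 2 * (a + i - M))
     e = solve 4 (λ a i A M -> :2 :* i := M :* :1 :+ (M :- :2 :* A :+ :2 :* (A :- (a :+ :1)) :+ :2 :+ :2 :* (a :+ i :- M))) refl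
     go : (d : Dec (+ act M (+ W) w + 1ℤ ≤ + A₀)) -> + M * ind (does d) ≤ + 2 * idles M w
     go (no _) = ≤r (Z.*-zeroʳ (+ M)) ⟫ 0≤-* {+ 2} 0≤ℕ (∑-nonneg (allFin M) (λ a -> 0≤ind (not (active (+ W) (w a)))))
     go (yes h) = by (0≤-+ (0≤-+ (0≤-+ (0≤-- doubled) (0≤-* {+ 2} 0≤ℕ (0≤-- h))) (0≤ℕ {2})) (0≤-* {+ 2} 0≤ℕ (≤r (sym (Z.i≡j⇒i-j≡0 (act-idles M w)))))) (e (+ act M (+ W) w) (idles M w) (+ A₀) (+ M))

   -- Markov's inequality: fewer than A₀ ≤ M/2 active coordinates mean more than M/2 idle ones,
   -- while on average at most M(2W + 1)/(2n) coordinates are idle.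
   light-cells : ∀ (t : Fin M -> ℤ) -> + g * ∑ (cells M) (λ v -> ind (lightB (λ a -> val (comp path M v a) - t a))) ≤ #cells M
   light-cells t = ≤-cancelˡ (+ n) (+≤+ (ℕ.s≤s ℕ.z≤n)) (≤-cancelˡ (+ M) 1≤M
      (by (0≤-+ (0≤-+ (0≤-* (0≤-* (0≤ℕ {g}) (0≤ℕ {n})) (0≤-- summed)) (0≤-* (0≤ℕ {g}) (0≤-- (idle-cells M t)))) (0≤-* (0≤-* (0≤ℕ {M}) 0≤ℕ′) (0≤-- fine)))
         (e (+ n) (+ M) (+ g) (#cells M) (+ 2 * + W + 1ℤ) L I)))
     where
     0≤ℕ′ : 0ℤ ≤ #cells M
     0≤ℕ′ = 0≤ℕ
     L I : ℤ
     L = ∑ (cells M) (λ v -> ind (lightB (λ a -> val (comp path M v a) - t a)))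
     I = ∑ (cells M) (λ v -> idles M (λ a -> val (comp path M v a) - t a))
     summed : + M * L ≤ + 2 * I
     summed = ≤r (sym (∑-*ˡ (cells M) (+ M) _)) ⟫ ∑-mono (cells M) (λ v -> light-idles (λ a -> val (comp path M v a) - t a)) ⟫ ≤r (∑-*ˡ (cells M) (+ 2) (λ v -> idles M (λ a -> val (comp path M v a) - t a)))
     e : ∀ n M g C w L I -> M * (n * C) ≡ M * (n * (g * L)) + (g * n * (+ 2 * I - M * L) + g * (M * w * C - + 2 * n * I) + M * C * (n - g * w))
     e = solve 7 (λ n M g C w L I -> M :* (n :* C) := M :* (n :* (g :* L)) :+ (g :* n :* (:2 :* I :- M :* L) :+ g :* (M :* w :* C :- :2 :* n :* I) :+ M :* C :* (n :- g :* w))) refl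

   weight : Ix -> Ω -> Fin M -> ℤ
   weight k x a = vec x F.zero a - vec x k a

   light : Ix -> Ω -> Bool
   light k x = lightB (weight k x)

   light-count : ∀ (j : Fin q) -> + g * ∑ Ωpts (λ x -> ind (light (F.suc j) x)) ≤ |Ω|
   light-count j = ≤r (trans (cong (+ g *_) (trans (∑-Ω (λ x -> ind (light (F.suc j) x))) (∑-swap (cells M) Rs (λ a v -> ind (light (F.suc j) (a , v)))))) (sym (∑-*ˡ Rs (+ g) (λ v -> ∑ (cells M) (λ a -> ind (light (F.suc j) (a , v)))))))
       ⟫ ∑-mono Rs (λ v -> light-cells (λ b -> val (comp path M (comp Cs q v j) b))) ⟫ ≤r (trans (∑-const Rs (#cells M)) (trans (Z.*-comm (+ length Rs) (#cells M)) (sym |Ω|-split)))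
     where
     Rs : List (Space.Pt (pow Cs q))
     Rs = Space.pts (pow Cs q)

   act-sq : ∀ k w -> + act k (+ W) w * (+ W * + W) ≤ ∑ (allFin k) (λ a -> w a * w a)
   act-sq zero w = ≤r (Z.*-zeroˡ (+ W * + W))
   act-sq (suc k) w = go (active (+ W) (w F.zero)) refl ⟫ ≤r (sym (∑-allFin-suc k (λ a -> w a * w a)))
     where
     a : ℕ
     a = act k (+ W) (w ∘ F.suc)
     rest : ℤ
     rest = ∑ (allFin k) (λ a -> w (F.suc a) * w (F.suc a))
     big : + W ≤ w F.zero ⊎ + W ≤ - w F.zero -> + W * + W ≤ w F.zero * w F.zero
     big (inj₁ h) = ≤-*² {+ W} 0≤ℕ (0≤ℕ ⟫ h) h h
     big (inj₂ h) = ≤-*² {+ W} 0≤ℕ (0≤ℕ ⟫ h) h h ⟫ ≤r (e (w F.zero))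
       where
       e : ∀ w -> - w * - w ≡ w * w
       e = solve 1 (λ w -> :- w :* :- w := w :* w) refl
     go : ∀ b -> active (+ W) (w F.zero) ≡ b -> + (if b then suc a else a) * (+ W * + W) ≤ w F.zero * w F.zero + rest
     go true e = ≤r (e₁ (+ a) (+ W * + W)) ⟫ Z.+-mono-≤ (big (active-cases (+ W) (w F.zero) e)) (act-sq k (w ∘ F.suc))
       where
       e₁ : ∀ a s -> (1ℤ + a) * s ≡ s + a * s
       e₁ = solve 2 (λ a s -> (:1 :+ a) :* s := s :+ a :* s) refl
     go false e = act-sq k (w ∘ F.suc) ⟫ by (0≤-sq (w F.zero)) (Z.+-comm (w F.zero * w F.zero) rest)

   diff-zero : ∀ k x a -> diff (vec x) (shift k (vec x)) F.zero a ≡ weight k x a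
   diff-zero k x a = cong (λ s -> vec x F.zero a - vec x s a) (0⊕ k)

   heavy-act : ∀ k x -> light k x ≡ false -> A₀ ℕ.≤ act M (+ W) (weight k x)
   heavy-act k x e = go (+ act M (+ W) (weight k x) + 1ℤ Z.≤? + A₀) e
     where
     go : (d : Dec (+ act M (+ W) (weight k x) + 1ℤ ≤ + A₀)) -> does d ≡ false -> A₀ ℕ.≤ act M (+ W) (weight k x)
     go (no h) _ = Z.drop‿+≤+ (≤-cancel-suc (≰⇒≥1 h))
       where
       ≤-cancel-suc : ∀ {a b} -> a + 1ℤ ≤ b + 1ℤ -> a ≤ b
       ≤-cancel-suc {a} {b} h = by (0≤-- h) (e₁ a b)
         where
         e₁ : ∀ a b -> b ≡ a + (b + 1ℤ - (a + 1ℤ))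
         e₁ = solve 2 (λ a b -> b := a :+ (b :+ :1 :- (a :+ :1))) refl

   -- The first block of the difference alone contributes A₀W² to the squared norm.
   heavy-norm : ∀ k x -> light k x ≡ false -> + 10 * Δ + 1ℤ ≤ nrm (diff (vec x) (shift k (vec x)))
   heavy-norm k x e = separated ⟫ ≤-*ʳ (+ W * + W) (0≤-* {+ W} {+ W} 0≤ℕ 0≤ℕ) (+≤+ (heavy-act k x e)) ⟫ act-sq M (weight k x)
      ⟫ ≤r (∑-cong (allFin M) (λ a -> cong₂ _*_ (sym (diff-zero k x a)) (sym (diff-zero k x a))))
      ⟫ ∑-∈≤ (allFin (suc q)) {λ r -> ∑ (allFin M) (λ a -> diff (vec x) (shift k (vec x)) r a * diff (vec x) (shift k (vec x)) r a)} (λ r -> ∑-nonneg (allFin M) (λ a -> 0≤-sq (diff (vec x) (shift k (vec x)) r a))) (∈ₚ.∈-allFin F.zero) ⟫ ≤r (sym (ip-def (diff (vec x) (shift k (vec x))) (diff (vec x) (shift k (vec x)))))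

   generic? : ∀ x -> Dec (Generic (vec x))
   generic? x = Fₚ.all? (λ k -> ¬? (k Fₚ.≟ F.zero) →-dec (+ 10 * Δ + 1ℤ Z.≤? nrm (diff (vec x) (shift k (vec x)))))

   near? : ∀ x y -> Dec (Near (vec x) (vec y))
   near? x y = Fₚ.any? (λ k -> ¬? (k Fₚ.≟ F.zero) ×-dec (nrm (diff (vec y) (shift k (vec x))) Z.≤? Δ))

   sector? : ∀ x y -> Dec (Sector (vec x) (vec y))
   sector? x y = Fₚ.all? (λ k -> ¬? (k Fₚ.≟ F.zero) →-dec (+ 2 * Δ + 1ℤ Z.≤? ip (diff (vec x) (shift k (vec x))) (vec y)))

   special : Ω -> Bool
   special x = not (does (generic? x))

   special-light : ∀ x -> ind (special x) ≤ ∑ (allFin q) (λ j -> ind (light (F.suc j) x))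
   special-light x = go (Fₚ.any? (λ j -> light (F.suc j) x Bₚ.≟ true))
     where
     go : Dec (∃ λ j -> light (F.suc j) x ≡ true) -> ind (special x) ≤ ∑ (allFin q) (λ j -> ind (light (F.suc j) x))
     go (yes (j , e)) = ind≤1 (special x) ⟫ ≤r (cong ind (sym e)) ⟫ ∑-∈≤ (allFin q) (λ j -> 0≤ind (light (F.suc j) x)) (∈ₚ.∈-allFin j)
     go (no none) = ≤r (cong (λ b -> ind (not b)) (dec-true (generic? x) gen)) ⟫ ∑-nonneg (allFin q) (λ j -> 0≤ind (light (F.suc j) x))
       where
       gen : Generic (vec x)
       gen F.zero h = ⊥-elim (h refl)
       gen (F.suc j) _ = heavy-norm (F.suc j) x (notTrue (light (F.suc j) x) (λ e -> none (j , e)))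
         where
         notTrue : ∀ b -> b ≢ true -> b ≡ false
         notTrue true h = ⊥-elim (h refl)
         notTrue false h = refl

   special-count : + g * ∑ Ωpts (λ x -> ind (special x)) ≤ + q * |Ω|
   special-count = ≤-*ˡ (+ g) 0≤ℕ (∑-mono Ωpts special-light ⟫ ≤r (∑-swap Ωpts (allFin q) _)) ⟫ ≤r (sym (∑-*ˡ (allFin q) (+ g) _)) ⟫ ∑-mono (allFin q) light-count
      ⟫ ≤r (trans (∑-const (allFin q) |Ω|) (cong (λ l -> + l * |Ω|) (Lₚ.length-tabulate (λ (i : Fin q) -> i))))

   corr : Ix -> Ω -> Ω -> ℤ
   corr k x y = ip (diff (vec x) (shift k (vec x))) (vec y)

   window : Ix -> Ω -> Ω -> Bool
   window k x y = does (- (+ 2 * Δ) Z.≤? corr k x y) ∧ does (corr k x y Z.≤? + 2 * Δ)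

   -- With all blocks of y but the first fixed, the correlation is a constant plus a linear form in
   -- M coordinates, at least `A₀` of whose coefficients are active.
   window-heavy : ∀ k x -> light k x ≡ false -> + g * ∑ Ωpts (λ y -> ind (window k x y)) ≤ |Ω|
   window-heavy k x hx = ≤r (trans (cong (+ g *_) (trans (∑-Ω (λ y -> ind (window k x y))) (∑-swap (cells M) Rs (λ a v -> ind (window k x (a , v)))))) (sym (∑-*ˡ Rs (+ g) (λ v -> ∑ (cells M) (λ a -> ind (window k x (a , v)))))))
       ⟫ ∑-mono Rs (λ v -> ≤-*ˡ (+ g) 0≤ℕ (∑-mono (cells M) (λ a -> fits a v)) ⟫ LO.small-ball (+ W) K 0≤ℕ 0≤K Z.≤-refl M w g r₀ 1≤g 1≤r₀ (s v) (N.≤-trans spread (N.≤-trans (heavy-act k x hx) (N.≤-reflexive (cong-act M (λ a -> sym (diff-zero k x a)))))))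
       ⟫ ≤r (trans (∑-const Rs (#cells M)) (trans (Z.*-comm (+ length Rs) (#cells M)) (sym |Ω|-split)))
     where
     Rs : List (Space.Pt (pow Cs q))
     Rs = Space.pts (pow Cs q)
     D : Vect
     D = diff (vec x) (shift k (vec x))
     w : Fin M -> ℤ
     w = D F.zero
     cong-act : ∀ k {u v : Fin k -> ℤ} -> (∀ a -> u a ≡ v a) -> act k (+ W) u ≡ act k (+ W) v
     cong-act zero h = refl
     cong-act (suc k) h = cong₂ (λ b c -> if active (+ W) b then suc c else c) (h F.zero) (cong-act k (λ a -> h (F.suc a)))
     c s : Space.Pt (pow Cs q) -> ℤ
     c v = ∑ (allFin q) (λ r -> ∑ (allFin M) (λ b -> D (F.suc r) b * val (comp path M (comp Cs q v r) b)))
     s v = - (+ 2 * Δ) - c v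
     corr≡ : ∀ a v -> corr k x (a , v) ≡ lin M w a + c v
     corr≡ a v = trans (ip-def D (vec (a , v))) (trans (∑-allFin-suc q (λ r -> ∑ (allFin M) (λ b -> D r b * vec (a , v) r b))) (cong (_+ c v) (sym (lin-∑ M w a))))
     fits : ∀ a v -> ind (window k x (a , v)) ≤ ind (does (s v Z.≤? lin M w a) ∧ does (lin M w a + 1ℤ Z.≤? s v + + 2 * K * + r₀))
     fits a v = go (- (+ 2 * Δ) Z.≤? corr k x (a , v)) (corr k x (a , v) Z.≤? + 2 * Δ)
       where
       target : Bool
       target = does (s v Z.≤? lin M w a) ∧ does (lin M w a + 1ℤ Z.≤? s v + + 2 * K * + r₀)
       go : (d₁ : Dec (- (+ 2 * Δ) ≤ corr k x (a , v))) (d₂ : Dec (corr k x (a , v) ≤ + 2 * Δ)) -> ind (does d₁ ∧ does d₂) ≤ ind target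
       go (no _) _ = 0≤ind target
       go (yes _) (no _) = 0≤ind target
       go (yes h₁) (yes h₂) = ≤r (cong ind (sym (∧-true (dec-true (s v Z.≤? lin M w a) lower) (dec-true (lin M w a + 1ℤ Z.≤? s v + + 2 * K * + r₀) upper))))
         where
         lower : s v ≤ lin M w a
         lower = by (0≤-- (h₁ ⟫ ≤r (corr≡ a v))) (e Δ (c v) (lin M w a))
           where
           e : ∀ d c l -> l ≡ - (+ 2 * d) - c + (l + c - - (+ 2 * d))
           e = solve 3 (λ d c l -> l := :- (:2 :* d) :- c :+ (l :+ c :- :- (:2 :* d))) refl
         upper : lin M w a + 1ℤ ≤ s v + + 2 * K * + r₀
         upper = by (0≤-+ (0≤-- (≤r (sym (corr≡ a v)) ⟫ h₂)) (0≤-- covered)) (e Δ (c v) (lin M w a) (+ 2 * K * + r₀))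
           where
           e : ∀ d c l k -> - (+ 2 * d) - c + k ≡ l + 1ℤ + (+ 2 * d - (l + c) + (k - (+ 4 * d + 1ℤ)))
           e = solve 4 (λ d c l k -> :- (:2 :* d) :- c :+ k := l :+ :1 :+ (:2 :* d :- (l :+ c) :+ (k :- (:4 :* d :+ :1)))) refl

   window-count : ∀ (j : Fin q) -> + g * ∑ Ωpts (λ x -> ∑ Ωpts (λ y -> ind (window (F.suc j) x y))) ≤ + 2 * (|Ω| * |Ω|)
   window-count j = ≤r (sym (∑-*ˡ Ωpts (+ g) _)) ⟫ ∑-mono Ωpts each ⟫ ≤r (trans (∑-+ Ωpts _ _) (cong₂ _+_ (∑-*ˡ Ωpts (|Ω| * + g) (λ x -> ind (light (F.suc j) x))) (∑-const Ωpts |Ω|)))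
       ⟫ by (0≤-* 0≤ℕ′ (0≤-- (light-count j))) (e |Ω| (+ g) (∑ Ωpts (λ x -> ind (light (F.suc j) x))))
     where
     0≤ℕ′ : 0ℤ ≤ |Ω|
     0≤ℕ′ = 0≤ℕ
     e : ∀ o g l -> + 2 * (o * o) ≡ o * g * l + o * o + o * (o - g * l)
     e = solve 3 (λ o g l -> :2 :* (o :* o) := o :* g :* l :+ o :* o :+ o :* (o :- g :* l)) refl
     each : ∀ x -> + g * ∑ Ωpts (λ y -> ind (window (F.suc j) x y)) ≤ |Ω| * + g * ind (light (F.suc j) x) + |Ω|
     each x = go (light (F.suc j) x) refl
       where
       S : ℤ
       S = ∑ Ωpts (λ y -> ind (window (F.suc j) x y))
       go : ∀ b -> light (F.suc j) x ≡ b -> + g * S ≤ |Ω| * + g * ind b + |Ω|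
       go false e = window-heavy (F.suc j) x e ⟫ by (≤r (sym (Z.*-zeroʳ (|Ω| * + g)))) (Z.+-comm (|Ω| * + g * 0ℤ) |Ω|)
       go true e = ≤-*ˡ (+ g) 0≤ℕ (∑-mono Ωpts (λ y -> ind≤1 (window (F.suc j) x y)) ⟫ ≤r (trans (∑-const Ωpts 1ℤ) (Z.*-identityʳ |Ω|))) ⟫ by 0≤ℕ′ (e₂ (+ g) |Ω|)
         where
         e₂ : ∀ g o -> o * g * 1ℤ + o ≡ g * o + o
         e₂ = solve 2 (λ g o -> o :* g :* :1 :+ o := g :* o :+ o) refl

   sectorB : Ω -> Ω -> Bool
   sectorB x y = does (sector? x y)

   -- One of the p rotations of x maximises the correlation with y; it lies in the sector of y unless two
   -- rotations are almost tied.
   sector-cover : ∀ x y -> 1ℤ ≤ ∑ (allFin (suc q)) (λ j -> ind (sectorB (rot j x) y)) + ∑ (allFin (suc q)) (λ i -> ∑ (allFin q) (λ k -> ind (window (F.suc k) (rot i x) y)))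
   sector-cover x y = go (Fₚ.any? (λ k -> window (F.suc k) x′ y Bₚ.≟ true))
     where
     f : Ix -> ℤ
     f i = ip (shift i (vec x)) (vec y)
     j : Ix
     j = proj₁ (argmax f)
     x′ : Ω
     x′ = rot j x
     A₁ A₂ : ℤ
     A₁ = ∑ (allFin (suc q)) (λ j -> ind (sectorB (rot j x) y))
     A₂ = ∑ (allFin (suc q)) (λ i -> ∑ (allFin q) (λ k -> ind (window (F.suc k) (rot i x) y)))
     0≤A₁ : 0ℤ ≤ A₁
     0≤A₁ = ∑-nonneg (allFin (suc q)) (λ j -> 0≤ind (sectorB (rot j x) y))
     0≤inner : ∀ i -> 0ℤ ≤ ∑ (allFin q) (λ k -> ind (window (F.suc k) (rot i x) y))
     0≤inner i = ∑-nonneg (allFin q) (λ k -> 0≤ind (window (F.suc k) (rot i x) y))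
     corr-f : ∀ k -> corr k x′ y ≡ f j - f (k ⊕ j)
     corr-f k = trans (ip-diffˡ (vec x′) (shift k (vec x′)) (vec y)) (cong₂ _-_ (ip-cong (λ r a -> vec-rot j x r a) (λ _ _ -> refl))
        (ip-cong (λ r a -> trans (vec-rot j x (r ⊕ k) a) (shift-shift j k (vec x) r a)) (λ _ _ -> refl)))
     0≤corr : ∀ k -> 0ℤ ≤ corr k x′ y
     0≤corr k = 0≤-- (proj₂ (argmax f) (k ⊕ j)) ⟫ ≤r (sym (corr-f k))
     go : Dec (∃ λ k -> window (F.suc k) x′ y ≡ true) -> 1ℤ ≤ A₁ + A₂
     go (yes (k , e)) = ≤r (cong ind (sym e)) ⟫ ∑-∈≤ (allFin q) (λ k -> 0≤ind (window (F.suc k) x′ y)) (∈ₚ.∈-allFin k) ⟫ ∑-∈≤ (allFin (suc q)) 0≤inner (∈ₚ.∈-allFin j) ⟫ by 0≤A₁ (Z.+-comm A₁ A₂)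
     go (no none) = ≤r (cong ind (sym (dec-true (sector? x′ y) sec))) ⟫ ∑-∈≤ (allFin (suc q)) (λ j -> 0≤ind (sectorB (rot j x) y)) (∈ₚ.∈-allFin j) ⟫ by (∑-nonneg (allFin (suc q)) 0≤inner) refl
       where
       sec : Sector (vec x′) (vec y)
       sec F.zero h = ⊥-elim (h refl)
       sec (F.suc k) _ = decide (+ 2 * Δ + 1ℤ Z.≤? corr (F.suc k) x′ y)
         where
         decide : Dec (+ 2 * Δ + 1ℤ ≤ corr (F.suc k) x′ y) -> + 2 * Δ + 1ℤ ≤ corr (F.suc k) x′ y
         decide (yes h) = h
         decide (no h) = ⊥-elim (none (k , ∧-true (dec-true (- (+ 2 * Δ) Z.≤? corr (F.suc k) x′ y) (Z.neg-mono-≤ (0≤-* {+ 2} 0≤ℕ 0≤Δ) ⟫ 0≤corr (F.suc k)))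
               (dec-true (corr (F.suc k) x′ y Z.≤? + 2 * Δ) (by (0≤-- (≰⇒≥1 h)) (e (+ 2 * Δ) (corr (F.suc k) x′ y))))))
           where
           e : ∀ d c -> d ≡ c + (d + 1ℤ - (c + 1ℤ))
           e = solve 2 (λ d c -> d := c :+ (d :+ :1 :- (c :+ :1))) refl

   -- `sector-cover` is summed over all pairs. Rotations preserve the counting measure, so p times
   -- the number of sector pairs, plus the near-ties, is at least |Ω|²: the sector density is at
   -- least 1/p - 2q/g.
   sector-count : (+ g - + 2 * p * + q) * (|Ω| * |Ω|) ≤ + g * p * ∑ Ωpts (λ x -> ∑ Ωpts (λ y -> ind (sectorB x y)))
   sector-count = by (0≤-+ (0≤-* (0≤ℕ {g}) (0≤-- total)) (0≤-* (0≤ℕ {suc q}) (0≤-- windows))) (e (+ g) p (+ q) (|Ω| * |Ω|) S Wn)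
     where
     S Wn : ℤ
     S = ∑ Ωpts (λ x -> ∑ Ωpts (λ y -> ind (sectorB x y)))
     Wn = ∑ (allFin q) (λ k -> ∑ Ωpts (λ x -> ∑ Ωpts (λ y -> ind (window (F.suc k) x y))))
     len : + length (allFin (suc q)) ≡ p
     len = cong +_ (Lₚ.length-tabulate (λ (i : Ix) -> i))
     e : ∀ g p q o s w -> g * p * s ≡ (g - + 2 * p * q) * o + (g * (p * s + p * w - o) + p * (+ 2 * q * o - g * w))
     e = solve 6 (λ g p q o s w -> g :* p :* s := (g :- :2 :* p :* q) :* o :+ (g :* (p :* s :+ p :* w :- o) :+ p :* (:2 :* q :* o :- g :* w))) refl
     windows : + g * Wn ≤ + 2 * + q * (|Ω| * |Ω|)
     windows = ≤r (sym (∑-*ˡ (allFin q) (+ g) _)) ⟫ ∑-mono (allFin q) window-count ⟫ ≤r (trans (∑-const (allFin q) (+ 2 * (|Ω| * |Ω|))) (trans (cong (λ l -> + l * (+ 2 * (|Ω| * |Ω|))) (Lₚ.length-tabulate (λ (i : Fin q) -> i))) (e′ (+ q) (|Ω| * |Ω|))))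
       where
       e′ : ∀ q o -> q * (+ 2 * o) ≡ + 2 * q * o
       e′ = solve 2 (λ q o -> q :* (:2 :* o) := :2 :* q :* o) refl
     rotated : ∀ (h : Ω -> Ω -> ℤ) -> ∑ Ωpts (λ x -> ∑ Ωpts (λ y -> ∑ (allFin (suc q)) (λ j -> h (rot j x) y))) ≡ p * ∑ Ωpts (λ x -> ∑ Ωpts (h x))
     rotated h = trans (∑-cong Ωpts (λ x -> ∑-swap Ωpts (allFin (suc q)) (λ y j -> h (rot j x) y))) (trans (∑-swap Ωpts (allFin (suc q)) (λ x j -> ∑ Ωpts (h (rot j x))))
        (trans (∑-cong (allFin (suc q)) (λ j -> ∑-rot j (λ x -> ∑ Ωpts (h x)))) (trans (∑-const (allFin (suc q)) _) (cong (_* ∑ Ωpts (λ x -> ∑ Ωpts (h x))) len))))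
     total : |Ω| * |Ω| ≤ p * S + p * Wn
     total = ≤r (sym (trans (∑-const Ωpts |Ω|) refl)) ⟫ ∑-mono Ωpts (λ x -> ≤r (sym (trans (∑-const Ωpts 1ℤ) (Z.*-identityʳ |Ω|))) ⟫ ∑-mono Ωpts (λ y -> sector-cover x y) ⟫ ≤r (∑-+ Ωpts _ _))
        ⟫ ≤r (trans (∑-+ Ωpts _ _) (cong₂ _+_ (rotated (λ x y -> ind (sectorB x y))) (trans (rotated (λ x y -> ∑ (allFin q) (λ k -> ind (window (F.suc k) x y)))) (cong (p *_) (trans (∑-cong Ωpts (λ x -> ∑-swap Ωpts (allFin q) _)) (∑-swap Ωpts (allFin q) _))))))

 -- Choice of the parameters

 suc-of : ∀ {x} -> 1 ℕ.≤ x -> ∃ λ m -> suc m ≡ x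
 suc-of {suc m} _ = m , refl

 record Setting (q E g : ℕ) : Set where
   field
     m ℓ M   : ℕ
     m≡      : suc m ≡ 4 ℕ.* ℓ
     numbers : Numbers q m ℓ M g
     T       : ℤ
     0≤T     : 0ℤ ≤ T
     Δ≡      : Numbers.Δ numbers ≡ + 4 * T
     concentrated : + E * + suc q * Path.κ m * (+ 32 * T + + suc q * (+ M * + 32)) + 1ℤ ≤ T * T

 module _ (q E g : ℕ) (1≤E : 1 ℕ.≤ E) (1≤g : 1 ℕ.≤ g) where

   private
     p : ℕ
     p = suc q

     -- With n = 4gW and Δ = 4τn², the conditions on A₀ and r₀ read A₀ > 640τg² and r₀ > 64τg; the factor 256
     -- makes τn² the scale at which the Poincaré inequality separates a set of density 1/E from the rest.
     build : ∀ (τ r₀ A₀ M W ℓ m s : ℕ) -> τ ≡ 256 ℕ.* (p ℕ.* E) -> r₀ ≡ 64 ℕ.* (τ ℕ.* g) ℕ.+ 1 -> s ≡ (2 ℕ.* g ℕ.* r₀) ℕ.^ 4 ->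
       A₀ ≡ 4 ℕ.* s ℕ.+ 640 ℕ.* (τ ℕ.* (g ℕ.* g)) ℕ.+ 1 -> M ≡ 2 ℕ.* A₀ -> W ≡ p ℕ.* M -> ℓ ≡ g ℕ.* W -> suc m ≡ 4 ℕ.* ℓ -> Setting q E g
     build τ r₀ A₀ M W ℓ m s τ≡ r₀≡ s≡ A₀≡ M≡ W≡ ℓ≡ n≡ = record
       { m = m ; ℓ = ℓ ; M = M ; m≡ = n≡ ; T = T ; 0≤T = 0≤T ; Δ≡ = refl ; concentrated = conc
       ; numbers = record
         { W = W ; A₀ = A₀ ; r₀ = r₀ ; Δ = + 4 * T ; 0≤Δ = 0≤-* {+ 4} 0≤ℕ 0≤T ; 1≤g = 1≤g
         ; 1≤r₀ = subst (1 ℕ.≤_) (sym r₀≡) (N.m≤n+m 1 (64 ℕ.* (τ ℕ.* g)))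
         ; 1≤A₀ = 1≤A₀
         ; separated = sep ; covered = cov ; fine = fin
         ; doubled = ≤r (sym (trans (cong +_ M≡) (Z.pos-* 2 A₀)))
         ; spread = subst₂ (λ a b -> 4 ℕ.* a ℕ.≤ b) s≡ (sym A₀≡) (N.≤-trans (N.m≤m+n (4 ℕ.* s) (640 ℕ.* (τ ℕ.* (g ℕ.* g)))) (N.m≤m+n (4 ℕ.* s ℕ.+ 640 ℕ.* (τ ℕ.* (g ℕ.* g))) 1)) } }
       where
       T n : ℤ
       n = + suc m
       T = + τ * (n * n)
       0≤T : 0ℤ ≤ T
       0≤T = 0≤-* {+ τ} 0≤ℕ (0≤-sq n)
       1≤A₀ : 1 ℕ.≤ A₀
       1≤A₀ = subst (1 ℕ.≤_) (sym A₀≡) (N.m≤n+m 1 (4 ℕ.* s ℕ.+ 640 ℕ.* (τ ℕ.* (g ℕ.* g))))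
       τℤ : + τ ≡ + 256 * (+ p * + E)
       τℤ = trans (cong +_ τ≡) (trans (Z.pos-* 256 (p ℕ.* E)) (cong (+ 256 *_) (Z.pos-* p E)))
       r₀ℤ : + r₀ ≡ + 64 * (+ τ * + g) + 1ℤ
       r₀ℤ = trans (cong +_ r₀≡) (cong (_+ 1ℤ) (trans (Z.pos-* 64 (τ ℕ.* g)) (cong (+ 64 *_) (Z.pos-* τ g))))
       A₀ℤ : + A₀ ≡ + 4 * + s + + 640 * (+ τ * (+ g * + g)) + 1ℤ
       A₀ℤ = trans (cong +_ A₀≡) (cong (_+ 1ℤ) (cong₂ _+_ (Z.pos-* 4 s) (trans (Z.pos-* 640 (τ ℕ.* (g ℕ.* g))) (cong (+ 640 *_) (trans (Z.pos-* τ (g ℕ.* g)) (cong (+ τ *_) (Z.pos-* g g)))))))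
       ℓℤ : + ℓ ≡ + g * + W
       ℓℤ = trans (cong +_ ℓ≡) (Z.pos-* g W)
       nℤ : n ≡ + 4 * (+ g * + W)
       nℤ = trans (cong +_ n≡) (trans (Z.pos-* 4 ℓ) (cong (+ 4 *_) ℓℤ))
       Wℤ : + W ≡ + p * + M
       Wℤ = trans (cong +_ W≡) (Z.pos-* p M)
       1≤W : 1ℤ ≤ + W
       1≤W = 1≤-* {+ p} {+ M} (+≤+ (ℕ.s≤s ℕ.z≤n)) (1≤-* {+ 2} {+ A₀} (+≤+ (ℕ.s≤s ℕ.z≤n)) (+≤+ 1≤A₀) ⟫ ≤r (sym (trans (cong +_ M≡) (Z.pos-* 2 A₀)))) ⟫ ≤r (sym Wℤ)
       sep : + 10 * (+ 4 * T) + 1ℤ ≤ + A₀ * (+ W * + W)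
       sep = by (0≤-+ (0≤-* (0≤-* {+ 4} {+ s} 0≤ℕ 0≤ℕ) (0≤-sq (+ W))) (0≤-- (1≤-* 1≤W 1≤W)))
          (trans (cong (_* (+ W * + W)) A₀ℤ) (trans (e (+ s) (+ τ) (+ g) (+ W)) (cong (λ z -> + 10 * (+ 4 * (+ τ * (z * z))) + 1ℤ + (+ 4 * + s * (+ W * + W) + (+ W * + W - 1ℤ))) (sym nℤ))))
         where
         e : ∀ s t g w -> (+ 4 * s + + 640 * (t * (g * g)) + 1ℤ) * (w * w) ≡ + 10 * (+ 4 * (t * ((+ 4 * (g * w)) * (+ 4 * (g * w))))) + 1ℤ + (+ 4 * s * (w * w) + (w * w - 1ℤ))
         e = solve 4 (λ s t g w -> (:4 :* s :+ con (+ 640) :* (t :* (g :* g)) :+ :1) :* (w :* w) := con (+ 10) :* (:4 :* (t :* ((:4 :* (g :* w)) :* (:4 :* (g :* w))))) :+ :1 :+ (:4 :* s :* (w :* w) :+ (w :* w :- :1))) refl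
       cov : + 4 * (+ 4 * T) + 1ℤ ≤ + 2 * (+ W * (+ 2 * + ℓ)) * + r₀
       cov = by (0≤-- (1≤-* {+ 4} {+ g * (+ W * + W)} (+≤+ (ℕ.s≤s ℕ.z≤n)) (1≤-* {+ g} (+≤+ 1≤g) (1≤-* 1≤W 1≤W))))
          (trans (cong₂ (λ l r -> + 2 * (+ W * (+ 2 * l)) * r) ℓℤ r₀ℤ) (trans (e (+ τ) (+ g) (+ W)) (cong (λ z -> + 4 * (+ 4 * (+ τ * (z * z))) + 1ℤ + (+ 4 * (+ g * (+ W * + W)) - 1ℤ)) (sym nℤ))))
         where
         e : ∀ t g w -> + 2 * (w * (+ 2 * (g * w))) * (+ 64 * (t * g) + 1ℤ) ≡ + 4 * (+ 4 * (t * ((+ 4 * (g * w)) * (+ 4 * (g * w))))) + 1ℤ + (+ 4 * (g * (w * w)) - 1ℤ)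
         e = solve 3 (λ t g w -> :2 :* (w :* (:2 :* (g :* w))) :* (con (+ 64) :* (t :* g) :+ :1) := :4 :* (:4 :* (t :* ((:4 :* (g :* w)) :* (:4 :* (g :* w))))) :+ :1 :+ (:4 :* (g :* (w :* w)) :- :1)) refl
       fin : + g * (+ 2 * + W + 1ℤ) ≤ + suc m
       fin = by (0≤-* {+ g} 0≤ℕ (0≤-+ (0≤-- 1≤W) (0≤ℕ {W}))) (trans nℤ (e (+ g) (+ W)))
         where
         e : ∀ g w -> + 4 * (g * w) ≡ g * (+ 2 * w + 1ℤ) + g * (w - 1ℤ + w)
         e = solve 2 (λ g w -> :4 :* (g :* w) := g :* (:2 :* w :+ :1) :+ g :* (w :- :1 :+ w)) refl
       conc : + E * + p * (+ 4 * (n * n)) * (+ 32 * T + + p * (+ M * + 32)) + 1ℤ ≤ T * T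
       conc = by (0≤-- big) (trans (cong (λ z -> z * (n * n) * (z * (n * n))) τℤ) (trans (e (+ E) (+ p) (n * n) (+ M)) (cong₂ (λ z w -> + E * + p * (+ 4 * (n * n)) * (+ 32 * (z * (n * n)) + + p * (+ M * + 32)) + 1ℤ + (+ 128 * (+ E * + p * (n * n)) * (z * (n * n) - w) - 1ℤ)) (sym τℤ) (sym Wℤ))))
         where
         e : ∀ E p N M -> + 256 * (p * E) * N * (+ 256 * (p * E) * N) ≡ E * p * (+ 4 * N) * (+ 32 * (+ 256 * (p * E) * N) + p * (M * + 32)) + 1ℤ + (+ 128 * (E * p * N) * (+ 256 * (p * E) * N - p * M) - 1ℤ)
         e = solve 4 (λ E p N M -> con (+ 256) :* (p :* E) :* N :* (con (+ 256) :* (p :* E) :* N) := E :* p :* (:4 :* N) :* (con (+ 32) :* (con (+ 256) :* (p :* E) :* N) :+ p :* (M :* con (+ 32))) :+ :1 :+ (con (+ 128) :* (E :* p :* N) :* (con (+ 256) :* (p :* E) :* N :- p :* M) :- :1)) refl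
         1≤n : 1ℤ ≤ n
         1≤n = +≤+ (ℕ.s≤s ℕ.z≤n)
         1≤pE : 1ℤ ≤ + p * + E
         1≤pE = 1≤-* {+ p} (+≤+ (ℕ.s≤s ℕ.z≤n)) (+≤+ 1≤E)
         1≤τ : 1ℤ ≤ + τ
         1≤τ = 1≤-* {+ 256} (+≤+ (ℕ.s≤s ℕ.z≤n)) 1≤pE ⟫ ≤r (sym τℤ)
         W<n : + W + 1ℤ ≤ n
         W<n = by (0≤-+ (0≤-* {+ 4 * + W} (0≤-* {+ 4} {+ W} 0≤ℕ 0≤ℕ) (0≤-- (+≤+ 1≤g))) (0≤-+ (0≤-- 1≤W) (0≤-* {+ 2} {+ W} 0≤ℕ 0≤ℕ))) (trans nℤ (e₁ (+ g) (+ W)))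
           where
           e₁ : ∀ g w -> + 4 * (g * w) ≡ w + 1ℤ + (+ 4 * w * (g - 1ℤ) + (w - 1ℤ + + 2 * w))
           e₁ = solve 2 (λ g w -> :4 :* (g :* w) := w :+ :1 :+ (:4 :* w :* (g :- :1) :+ (w :- :1 :+ :2 :* w))) refl
         W<T : 1ℤ ≤ T - + W
         W<T = by (0≤-+ (0≤-- W<n) (0≤-+ (0≤-* (1≤⇒0≤ 1≤n) (0≤-- 1≤n)) (0≤-* (0≤-sq n) (0≤-- 1≤τ)))) (e₁ (+ τ) n (+ W))
           where
           e₁ : ∀ t n w -> t * (n * n) - w ≡ 1ℤ + (n - (w + 1ℤ) + (n * (n - 1ℤ) + n * n * (t - 1ℤ)))
           e₁ = solve 3 (λ t n w -> t :* (n :* n) :- w := :1 :+ (n :- (w :+ :1) :+ (n :* (n :- :1) :+ n :* n :* (t :- :1)))) refl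
         big : 1ℤ ≤ + 128 * (+ E * + p * (n * n)) * (T - + W)
         big = 1≤-* {+ 128 * (+ E * + p * (n * n))} (1≤-* {+ 128} (+≤+ (ℕ.s≤s ℕ.z≤n)) (1≤-* {+ E * + p} (1≤-* {+ E} {+ p} (+≤+ 1≤E) (+≤+ (ℕ.s≤s ℕ.z≤n))) (1≤-* {n} 1≤n 1≤n))) W<T

     choose : ∀ (r₀ s A₀ M W ℓ : ℕ) -> r₀ ≡ 64 ℕ.* ((256 ℕ.* (p ℕ.* E)) ℕ.* g) ℕ.+ 1 -> s ≡ (2 ℕ.* g ℕ.* r₀) ℕ.^ 4 ->
       A₀ ≡ 4 ℕ.* s ℕ.+ 640 ℕ.* ((256 ℕ.* (p ℕ.* E)) ℕ.* (g ℕ.* g)) ℕ.+ 1 -> M ≡ 2 ℕ.* A₀ -> W ≡ p ℕ.* M -> ℓ ≡ g ℕ.* W -> Setting q E g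
     choose r₀ s A₀ M W ℓ a b c d e f = build (256 ℕ.* (p ℕ.* E)) r₀ A₀ M W ℓ (proj₁ pred) s refl a b c d e f (proj₂ pred)
       where
       1≤ : ∀ {x y} -> 1 ℕ.≤ x -> 1 ℕ.≤ y -> 1 ℕ.≤ x ℕ.* y
       1≤ h k = N.*-mono-≤ h k
       pred : ∃ λ m -> suc m ≡ 4 ℕ.* ℓ
       pred = suc-of (1≤ {4} (ℕ.s≤s ℕ.z≤n) (subst (1 ℕ.≤_) (sym f) (1≤ 1≤g (subst (1 ℕ.≤_) (sym e) (1≤ {p} (ℕ.s≤s ℕ.z≤n)
          (subst (1 ℕ.≤_) (sym d) (1≤ {2} (ℕ.s≤s ℕ.z≤n) (subst (1 ℕ.≤_) (sym c) (N.m≤n+m 1 (4 ℕ.* s ℕ.+ 640 ℕ.* ((256 ℕ.* (p ℕ.* E)) ℕ.* (g ℕ.* g)))))))))))) 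

   abstract
     setting : Setting q E g
     setting = choose _ _ _ _ _ _ refl refl refl refl refl refl

 -- The cyclic groups of orders 3 and 4

 private
   _⊞_ : ∀ {q} -> Fin (suc q) -> Fin (suc q) -> Fin (suc q)
   r ⊞ k = cyc^ (toℕ k) r

   negate : ∀ {q} -> Fin (suc q) -> Fin (suc q)
   negate k = cyc (F.opposite k)

   assoc? : ∀ q -> Dec (∀ (r k l : Fin (suc q)) -> ((r ⊞ k) ⊞ l) ≡ (r ⊞ (k ⊞ l)))
   assoc? q = Fₚ.all? λ r -> Fₚ.all? λ k -> Fₚ.all? λ l -> ((r ⊞ k) ⊞ l) Fₚ.≟ (r ⊞ (k ⊞ l))

   comm? : ∀ q -> Dec (∀ (k l : Fin (suc q)) -> (k ⊞ l) ≡ (l ⊞ k))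
   comm? q = Fₚ.all? λ k -> Fₚ.all? λ l -> (k ⊞ l) Fₚ.≟ (l ⊞ k)

   neg? : ∀ q -> Dec (∀ (k : Fin (suc q)) -> (k ⊞ negate k) ≡ F.zero)
   neg? q = Fₚ.all? λ k -> (k ⊞ negate k) Fₚ.≟ F.zero

 standard : ∀ q -> {True (assoc? q)} -> {True (comm? q)} -> {True (neg? q)} -> StandardCyclic q
 standard q {a} {c} {n} = record
   { cyclic = record { _⊕_ = _⊞_ ; neg = negate ; ⊕-zero = λ r -> refl ; ⊕-assoc = toWitness a ; ⊕-comm = toWitness c ; ⊕-neg = toWitness n }
   ; ⊕-cyc = λ r k -> refl }

 -- What is used of the group of order 4: among three distinct elements, normalised to 0, a and b,
 -- two differ by the element of order two.
 record Halving {q} (cg : Cyclic q) : Set where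
   open Cyclic cg
   field
     half      : Fin (suc q)
     half+half : half ⊕ half ≡ F.zero
     half≢0    : half ≢ F.zero
     triple    : ∀ a b -> a ≢ F.zero -> b ≢ F.zero -> a ≢ b -> a ≡ half ⊎ b ≡ half ⊎ (∀ k -> b ≡ a ⊕ k -> k ≡ half)

 -- The last alternative of the split occurs only for p = 4.
 record Rotor (q : ℕ) : Set where
   field
     standardCyclic : StandardCyclic q
     1≤q   : 1 ℕ.≤ q
     split : ∀ {a b} -> a ℕ.≤ suc q -> b ℕ.≤ suc q -> suc q ℕ.+ 2 ℕ.≤ a ℕ.+ b ->
       (suc q ℕ.≤ a × 2 ℕ.≤ b) ⊎ (2 ℕ.≤ a × suc q ℕ.≤ b) ⊎ (3 ℕ.≤ a × 3 ℕ.≤ b × Halving (StandardCyclic.cyclic standardCyclic))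

 remainder : ∀ {a b c d} -> a ℕ.≤ c -> c ℕ.+ d ℕ.≤ a ℕ.+ b -> d ℕ.≤ b
 remainder {a} {b} {c} {d} h k = N.+-cancelˡ-≤ a d b (N.≤-trans (N.+-monoˡ-≤ d h) k)

 remainder′ : ∀ {a b c d} -> b ℕ.≤ c -> c ℕ.+ d ℕ.≤ a ℕ.+ b -> d ℕ.≤ a
 remainder′ {a} {b} {c} {d} h k = remainder h (N.≤-trans k (N.≤-reflexive (N.+-comm a b)))

 rotor₃ : Rotor 2
 rotor₃ = record { standardCyclic = standard 2 ; 1≤q = ℕ.s≤s ℕ.z≤n ; split = split }
   where
   split : ∀ {a b} -> a ℕ.≤ 3 -> b ℕ.≤ 3 -> 5 ℕ.≤ a ℕ.+ b -> (3 ℕ.≤ a × 2 ℕ.≤ b) ⊎ (2 ℕ.≤ a × 3 ℕ.≤ b) ⊎ _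
   split {a} ha hb h with 3 N.≤? a
   ... | yes k = inj₁ (k , remainder ha h)
   ... | no k = inj₂ (inj₁ (remainder′ hb h , remainder {c = 2} (N.≤-pred (N.≰⇒> k)) h))

 rotor₄ : Rotor 3
 rotor₄ = record { standardCyclic = standard 3 ; 1≤q = ℕ.s≤s ℕ.z≤n ; split = split }
   where
   open Cyclic (StandardCyclic.cyclic (standard 3))
   two : Fin 4
   two = F.suc (F.suc F.zero)
   triple? : Dec (∀ a b -> a ≢ F.zero -> b ≢ F.zero -> a ≢ b -> a ≡ two ⊎ b ≡ two ⊎ (∀ k -> b ≡ a ⊕ k -> k ≡ two))
   triple? = Fₚ.all? λ a -> Fₚ.all? λ b -> ¬? (a Fₚ.≟ F.zero) →-dec (¬? (b Fₚ.≟ F.zero) →-dec (¬? (a Fₚ.≟ b) →-dec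
     ((a Fₚ.≟ two) ⊎-dec ((b Fₚ.≟ two) ⊎-dec Fₚ.all? λ k -> (b Fₚ.≟ a ⊕ k) →-dec (k Fₚ.≟ two)))))
   halving : Halving (StandardCyclic.cyclic (standard 3))
   halving = record { half = two ; half+half = refl ; half≢0 = λ () ; triple = toWitness {a? = triple?} _ }
   split : ∀ {a b} -> a ℕ.≤ 4 -> b ℕ.≤ 4 -> 6 ℕ.≤ a ℕ.+ b -> (4 ℕ.≤ a × 2 ℕ.≤ b) ⊎ (2 ℕ.≤ a × 4 ℕ.≤ b) ⊎ (3 ℕ.≤ a × 3 ℕ.≤ b × Halving _)
   split {a} {b} ha hb h with 4 N.≤? a | 4 N.≤? b
   ... | yes k | _ = inj₁ (k , remainder ha h)
   ... | no _ | yes k = inj₂ (inj₁ (remainder′ hb h , k))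
   ... | no k | no l = inj₂ (inj₂ (remainder′ {c = 3} (N.≤-pred (N.≰⇒> l)) h , remainder {c = 3} (N.≤-pred (N.≰⇒> k)) h , halving))

 -- The model graph and its cliques

 all-lookup : ∀ {A : Set} {R : A -> A -> Set} -> (∀ {u v} -> R u v -> R v u) -> ∀ {l} -> AllPairs R l -> ∀ i j -> i ≢ j -> R (lookup l i) (lookup l j)
 all-lookup sy (h ∷ hs) F.zero F.zero n = ⊥-elim (n refl)
 all-lookup sy (h ∷ hs) F.zero (F.suc j) n = All.lookup h (∈ₚ.∈-lookup j)
 all-lookup sy (h ∷ hs) (F.suc i) F.zero n = sy (All.lookup h (∈ₚ.∈-lookup i))
 all-lookup sy (h ∷ hs) (F.suc i) (F.suc j) n = all-lookup sy hs i j (n ∘ cong F.suc)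

 all-distinct : ∀ {A : Set} {R : A -> A -> Set} -> (∀ {u v} -> R u v -> R v u) -> ∀ {l} -> AllPairs R l -> ∀ {u v} -> u ∈ l -> v ∈ l -> u ≢ v -> R u v
 all-distinct sy (h ∷ hs) (here refl) (here refl) n = ⊥-elim (n refl)
 all-distinct sy (h ∷ hs) (here refl) (there b) n = All.lookup h b
 all-distinct sy (h ∷ hs) (there a) (here refl) n = sy (All.lookup h a)
 all-distinct sy (h ∷ hs) (there a) (there b) n = all-distinct sy hs a b n

 does-iff : ∀ {P Q : Set} -> (P -> Q) -> (Q -> P) -> (d : Dec P) (e : Dec Q) -> does d ≡ does e
 does-iff f g (yes p) (yes q) = refl
 does-iff f g (yes p) (no n) = ⊥-elim (n (f p))
 does-iff f g (no n) (yes q) = ⊥-elim (n (g q))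
 does-iff f g (no _) (no _) = refl

 some-other : ∀ {k} -> 2 ℕ.≤ k -> (i : Fin k) -> ∃ λ j -> i ≢ j
 some-other {suc zero} (ℕ.s≤s ()) F.zero
 some-other {suc (suc k)} h F.zero = F.suc F.zero , λ ()
 some-other {suc (suc k)} h (F.suc i) = F.zero , λ ()

 ∑-replicate : ∀ {A : Set} k (x : A) f -> ∑ (L.replicate k x) f ≡ + k * f x
 ∑-replicate zero x f = sym (Z.*-zeroˡ (f x))
 ∑-replicate (suc k) x f = trans (+ˡ (f x) (∑-replicate k x f)) (e (+ k) (f x))
   where
   e : ∀ k y -> y + k * y ≡ (1ℤ + k) * y
   e = solve 2 (λ k y -> y :+ k :* y := (:1 :+ k) :* y) refl

 ∑-concatMap : ∀ {A B : Set} (h : A -> List B) xs f -> ∑ (L.concatMap h xs) f ≡ ∑ xs (λ x -> ∑ (h x) f)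
 ∑-concatMap h [] f = refl
 ∑-concatMap h (x ∷ xs) f = trans (∑-++ (h x) (L.concatMap h xs) f) (+ˡ (∑ (h x) f) (∑-concatMap h xs f))

 module ModelGraph (q : ℕ) (rotor : Rotor q) (E g : ℕ) (1≤E : 1 ℕ.≤ E) (1≤g : 1 ℕ.≤ g) (s : ℕ) where
   open Rotor rotor public
   open Setting (setting q E g 1≤E 1≤g) public
   open Counting q standardCyclic m ℓ m≡ M g numbers public

   -- Here t = s + 1: two special classes X and Y, and s = t - 1 classes Z.
   Key : Set
   Key = Fin (suc (suc s))

   pattern X = F.zero
   pattern Y = F.suc F.zero
   pattern Z i = F.suc (F.suc i)

   Vertex : Set
   Vertex = Key × Ω

   -- Points that are not generic get no neighbours in their own class. Cliques inside a class then
   -- consist of generic points, and the excluded points are few.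
   same : Ω -> Ω -> Bool
   same x y = does (generic? x) ∧ (does (generic? y) ∧ does (near? x y))

   cross : Key -> Key -> Ω -> Ω -> Bool
   cross X Y x y = sectorB x y
   cross Y X x y = sectorB y x
   cross X X x y = true
   cross Y Y x y = true
   cross X (Z _) x y = true
   cross Y (Z _) x y = true
   cross (Z _) _ x y = true

   joined : Vertex -> Vertex -> Bool
   joined (k , x) (l , y) = if does (k Fₚ.≟ l) then same x y else cross k l x y

   same-spec : ∀ {x y} -> same x y ≡ true -> Generic (vec x) × Generic (vec y) × Near (vec x) (vec y)
   same-spec {x} {y} h = from-does (generic? x) (∧-trueˡ h) , from-does (generic? y) (∧-trueˡ (∧-trueʳ {does (generic? x)} h)) , from-does (near? x y) (∧-trueʳ {does (generic? y)} (∧-trueʳ {does (generic? x)} h))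

   same-true : ∀ {x y} -> Generic (vec x) -> Generic (vec y) -> Near (vec x) (vec y) -> same x y ≡ true
   same-true {x} {y} gx gy n = ∧-true (dec-true (generic? x) gx) (∧-true (dec-true (generic? y) gy) (dec-true (near? x y) n))

   same-sym : ∀ x y -> same x y ≡ same y x
   same-sym x y = trans (swap (does (generic? x)) (does (generic? y)) (does (near? x y))) (cong (λ b -> does (generic? y) ∧ (does (generic? x) ∧ b)) (does-iff (near-sym {vec x} {vec y}) (near-sym {vec y} {vec x}) (near? x y) (near? y x)))
     where
     swap : ∀ a b c -> a ∧ (b ∧ c) ≡ b ∧ (a ∧ c)
     swap true true c = refl
     swap true false c = refl
     swap false true c = refl
     swap false false c = refl

   same-irrefl : ∀ x -> same x x ≡ false
   same-irrefl x = go (same x x) refl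
     where
     go : ∀ b -> same x x ≡ b -> same x x ≡ false
     go false e = e
     go true e = ⊥-elim (near-irrefl {vec x} (proj₁ (same-spec {x} {x} e)) (proj₂ (proj₂ (same-spec {x} {x} e))))

   joined-same : ∀ k x y -> joined (k , x) (k , y) ≡ same x y
   joined-same k x y = cong (λ b -> if b then same x y else cross k k x y) (dec-true (k Fₚ.≟ k) refl)

   joined-distinct : ∀ {k l} x y -> k ≢ l -> joined (k , x) (l , y) ≡ cross k l x y
   joined-distinct {k} {l} x y k≢l = go (k Fₚ.≟ l)
     where
     go : (d : Dec (k ≡ l)) -> (if does d then same x y else cross k l x y) ≡ cross k l x y
     go (yes e) = ⊥-elim (k≢l e)
     go (no _) = refl

   cross-sym : ∀ k l x y -> cross k l x y ≡ cross l k y x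
   cross-sym X X x y = refl
   cross-sym X Y x y = refl
   cross-sym X (Z _) x y = refl
   cross-sym Y X x y = refl
   cross-sym Y Y x y = refl
   cross-sym Y (Z _) x y = refl
   cross-sym (Z _) X x y = refl
   cross-sym (Z _) Y x y = refl
   cross-sym (Z _) (Z _) x y = refl

   joined-sym : ∀ u v -> joined u v ≡ joined v u
   joined-sym (k , x) (l , y) = go (k Fₚ.≟ l)
     where
     go : Dec (k ≡ l) -> joined (k , x) (l , y) ≡ joined (l , y) (k , x)
     go (yes refl) = trans (joined-same k x y) (trans (same-sym x y) (sym (joined-same k y x)))
     go (no n) = trans (joined-distinct x y n) (trans (cross-sym k l x y) (sym (joined-distinct y x (n ∘ sym))))

   joined-irrefl : ∀ u -> joined u u ≡ false
   joined-irrefl (k , x) = trans (joined-same k x x) (same-irrefl x)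

   Joined : Vertex -> Vertex -> Set
   Joined u v = joined u v ≡ true

   at : Key -> List Vertex -> List Ω
   at k [] = []
   at k ((l , x) ∷ vs) = if does (l Fₚ.≟ k) then x ∷ at k vs else at k vs

   at-All : ∀ {P : Vertex -> Set} k vs -> All P vs -> All (λ x -> P (k , x)) (at k vs)
   at-All k [] [] = []
   at-All {P} k ((l , x) ∷ vs) (h ∷ hs) = go (l Fₚ.≟ k)
     where
     go : (d : Dec (l ≡ k)) -> All (λ x -> P (k , x)) (if does d then x ∷ at k vs else at k vs)
     go (yes refl) = h ∷ at-All k vs hs
     go (no _) = at-All k vs hs

   Linked : Ω -> Ω -> Set
   Linked x y = same x y ≡ true

   linked-sym : ∀ {x y} -> Linked x y -> Linked y x
   linked-sym {x} {y} h = trans (same-sym y x) h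

   at-pairs : ∀ k vs -> AllPairs Joined vs -> AllPairs Linked (at k vs)
   at-pairs k [] [] = []
   at-pairs k ((l , x) ∷ vs) (h ∷ hs) = go (l Fₚ.≟ k)
     where
     go : (d : Dec (l ≡ k)) -> AllPairs Linked (if does d then x ∷ at k vs else at k vs)
     go (yes refl) = All.map (λ {y} e -> trans (sym (joined-same k x y)) e) (at-All k vs h) ∷ at-pairs k vs hs
     go (no _) = at-pairs k vs hs

   length-at : ∀ vs -> + length vs ≡ ∑ (allFin (suc (suc s))) (λ k -> + length (at k vs))
   length-at [] = sym (∑-zero (allFin (suc (suc s))))
   length-at ((l , x) ∷ vs) = trans (cong (λ z -> 1ℤ + z) (length-at vs)) (trans (cong (_+ ∑ (allFin (suc (suc s))) (λ k -> + length (at k vs))) (sym (∑-δ (λ _ -> 1ℤ) l)))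
       (trans (sym (∑-+ (allFin (suc (suc s))) (λ k -> 1ℤ * δ l k) (λ k -> + length (at k vs)))) (∑-cong (allFin (suc (suc s))) (λ k -> step k (does (l Fₚ.≟ k))))))
     where
     step : ∀ k b -> 1ℤ * (if b then 1ℤ else 0ℤ) + + length (at k vs) ≡ + length (if b then x ∷ at k vs else at k vs)
     step k true = refl
     step k false = Z.+-identityˡ (+ length (at k vs))

   Family : ℕ -> List Ω -> Set
   Family k xs = Σ (Fin k -> Ω) λ f -> (∀ i -> f i ∈ xs) × (∀ i j -> i ≢ j -> Linked (f i) (f j))

   family : ∀ {k} xs -> AllPairs Linked xs -> k ℕ.≤ length xs -> Family k xs
   family xs h le = (λ i -> lookup xs (F.inject≤ i le)) , (λ i -> ∈ₚ.∈-lookup (F.inject≤ i le))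
     , λ i j i≢j -> all-lookup (λ {x} {y} -> linked-sym {x} {y}) h (F.inject≤ i le) (F.inject≤ j le) (i≢j ∘ Fₚ.inject≤-injective le le i j)

   module _ {k} {xs} (2≤k : 2 ℕ.≤ k) (fam : Family k xs) where
     fam-generic : ∀ i -> Generic (vec (proj₁ fam i))
     fam-generic i = proj₁ (same-spec {proj₁ fam i} {proj₁ fam (proj₁ (some-other 2≤k i))} (proj₂ (proj₂ fam) i (proj₁ (some-other 2≤k i)) (proj₂ (some-other 2≤k i))))

     fam-near : ∀ i j -> i ≢ j -> Near (vec (proj₁ fam i)) (vec (proj₁ fam j))
     fam-near i j n = proj₂ (proj₂ (same-spec {proj₁ fam i} {proj₁ fam j} (proj₂ (proj₂ fam) i j n)))

   2≤p : 2 ℕ.≤ suc q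
   2≤p = ℕ.s≤s 1≤q

   part-bound : ∀ xs -> AllPairs Linked xs -> length xs ℕ.≤ suc q
   part-bound xs h = go (length xs N.≤? suc q)
     where
     go : Dec (length xs ℕ.≤ suc q) -> length xs ℕ.≤ suc q
     go (yes k) = k
     go (no k) = ⊥-elim (part-clique (λ i -> vec (proj₁ fam i)) (fam-generic (N.m≤n⇒m≤1+n 2≤p) fam) (fam-near (N.m≤n⇒m≤1+n 2≤p) fam))
       where
       fam : Family (suc (suc q)) xs
       fam = family xs h (N.≰⇒> k)

   full-pair : ∀ {xs ys} -> Family (suc q) xs -> Family 2 ys -> (∀ {x y} -> x ∈ xs -> y ∈ ys -> Sector (vec x) (vec y)) -> ⊥
   full-pair {xs} {ys} f f′ sec = orbit-pair (λ i -> vec (proj₁ f i)) (fam-generic 2≤p f) (fam-near 2≤p f)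
      (vec (proj₁ f′ F.zero)) (vec (proj₁ f′ (F.suc F.zero))) (fam-near N.≤-refl f′ F.zero (F.suc F.zero) (λ ()))
      (λ i -> sec (proj₁ (proj₂ f) i) (proj₁ (proj₂ f′) F.zero)) (λ i -> sec (proj₁ (proj₂ f) i) (proj₁ (proj₂ f′) (F.suc F.zero)))

   module _ (hv : Halving (StandardCyclic.cyclic standardCyclic)) where
     open Halving hv

     2≤3 : 2 ℕ.≤ 3
     2≤3 = ℕ.s≤s (ℕ.s≤s ℕ.z≤n)

     -- The labels of the three vertices relative to the first are 0, a and b, all distinct. If the
     -- two that differ by the half turn are a and b, `label-add` converts this into closeness of
     -- the vertices themselves.
     antipodes : ∀ {xs} -> (f : Family 3 xs) -> ∃ λ i -> ∃ λ j -> Close half (vec (proj₁ f i)) (vec (proj₁ f j))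
     antipodes {xs} f = go (triple (lab one) (lab two) (lab-injective {one} {F.zero} (λ ())) (lab-injective {two} {F.zero} (λ ())) (lab-injective {one} {two} (λ ())))
       where
       one two : Fin 3
       one = F.suc F.zero
       two = F.suc (F.suc F.zero)
       v : Fin 3 -> Vect
       v i = vec (proj₁ f i)
       open Labels v (fam-generic {3} {xs} 2≤3 f) (fam-near {3} {xs} 2≤3 f)
       go : lab one ≡ half ⊎ lab two ≡ half ⊎ (∀ k -> lab two ≡ lab one ⊕ k -> k ≡ half) -> ∃ λ i -> ∃ λ j -> Close half (v i) (v j)
       go (inj₁ e) = F.zero , one , subst (λ k -> Close k (v F.zero) (v one)) e (lab-close one)
       go (inj₂ (inj₁ e)) = F.zero , two , subst (λ k -> Close k (v F.zero) (v two)) e (lab-close two)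
       go (inj₂ (inj₂ h)) = one , two , subst (λ k -> Close k (v one) (v two)) (h k (label-add {v F.zero} {v one} {v two} (fam-generic {3} {xs} 2≤3 f F.zero) (lab one) k (lab two) (lab-close one) (proj₂ (proj₂ near)) (lab-close two))) (proj₂ (proj₂ near))
         where
         near : Near (v one) (v two)
         near = fam-near {3} {xs} 2≤3 f one two (λ ())
         k : Ix
         k = proj₁ near

     triple-pair : ∀ {xs ys} -> Family 3 xs -> Family 3 ys -> (∀ {x y} -> x ∈ xs -> y ∈ ys -> Sector (vec x) (vec y)) -> ⊥
     triple-pair {xs} {ys} f f′ sec = go (antipodes f) (antipodes f′)
       where
       go : (∃ λ i -> ∃ λ j -> Close half (vec (proj₁ f i)) (vec (proj₁ f j))) -> (∃ λ i -> ∃ λ j -> Close half (vec (proj₁ f′ i)) (vec (proj₁ f′ j))) -> ⊥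
       go (i , j , c) (i′ , j′ , c′) = antipodal half half+half half≢0 (vec (proj₁ f i)) (vec (proj₁ f j)) (vec (proj₁ f′ i′)) (vec (proj₁ f′ j′)) c c′ (st i i′) (st i j′) (st j i′) (st j j′)
         where
         st : ∀ i j -> Sector (vec (proj₁ f i)) (vec (proj₁ f′ j))
         st i j = sec (proj₁ (proj₂ f) i) (proj₁ (proj₂ f′) j)

   -- Each class contributes at most p vertices, so p + 2 vertices contain one of the configurations
   -- listed by `split`, and each of these has been excluded.
   pair-bound : ∀ xs ys -> AllPairs Linked xs -> AllPairs Linked ys -> (∀ {x y} -> x ∈ xs -> y ∈ ys -> Sector (vec x) (vec y)) -> length xs ℕ.+ length ys ℕ.≤ suc q ℕ.+ 1
   pair-bound xs ys hx hy sec = go (length xs ℕ.+ length ys N.≤? suc q ℕ.+ 1)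
     where
     go : Dec (length xs ℕ.+ length ys ℕ.≤ suc q ℕ.+ 1) -> length xs ℕ.+ length ys ℕ.≤ suc q ℕ.+ 1
     go (yes h) = h
     go (no h) = ⊥-elim (cases (split (part-bound xs hx) (part-bound ys hy) (subst (ℕ._≤ length xs ℕ.+ length ys) (sym (N.+-suc (suc q) 1)) (N.≰⇒> h))))
       where
       cases : _ -> ⊥
       cases (inj₁ (a , b)) = full-pair (family xs hx a) (family ys hy b) sec
       cases (inj₂ (inj₁ (a , b))) = full-pair (family ys hy b) (family xs hx a) (λ {y} {x} my mx -> sector-sym {vec x} {vec y} (sec mx my))
       cases (inj₂ (inj₂ (a , b , hv))) = triple-pair hv (family xs hx a) (family ys hy b) sec

   no-clique : ∀ vs -> AllPairs Joined vs -> length vs ≡ suc q ℕ.* suc s ℕ.+ 2 -> ⊥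
   no-clique vs h len = absurd _ 0ℤ (0≤-+ (0≤-- (+≤+ xy)) (0≤-- zs)) 0≤ℕ
       (trans (cong (λ z -> + suc q + 1ℤ - (x + y) + (+ s * + suc q - z) + 0ℤ) z≡) (e (+ suc q) (+ s) x y))
     where
     x y z : ℤ
     x = + length (at X vs)
     y = + length (at Y vs)
     z = ∑ (allFin s) (λ i -> + length (at (Z i) vs))
     e : ∀ p s x y -> p + 1ℤ - (x + y) + (s * p - (p * (1ℤ + s) + + 2 - x - y)) + 0ℤ ≡ -[1+ 0 ]
     e = solve 4 (λ p s x y -> p :+ :1 :- (x :+ y) :+ (s :* p :- (p :* (:1 :+ s) :+ :2 :- x :- y)) :+ :0 := con -[1+ 0 ]) refl
     z≡ : z ≡ + suc q * + suc s + + 2 - x - y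
     z≡ = trans (e′ x y z) (cong (λ t -> t - x - y) (trans (sym (trans (length-at vs) (trans (∑-allFin-suc (suc s) (λ k -> + length (at k vs))) (+ˡ x (∑-allFin-suc s (λ k -> + length (at (F.suc k) vs)))))))
         (trans (cong +_ len) (cong (_+ + 2) (Z.pos-* (suc q) (suc s))))))
       where
       e′ : ∀ x y z -> z ≡ x + (y + z) - x - y
       e′ = solve 3 (λ x y z -> z := x :+ (y :+ z) :- x :- y) refl
     zs : z ≤ + s * + suc q
     zs = ∑-mono (allFin s) (λ i -> +≤+ (part-bound (at (Z i) vs) (at-pairs (Z i) vs h))) ⟫ ≤r (trans (∑-const (allFin s) (+ suc q)) (cong (λ t -> + t * + suc q) (Lₚ.length-tabulate (λ (i : Fin s) -> i))))
     xy : length (at X vs) ℕ.+ length (at Y vs) ℕ.≤ suc q ℕ.+ 1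
     xy = pair-bound (at X vs) (at Y vs) (at-pairs X vs h) (at-pairs Y vs h) sec
       where
       member : ∀ k {x} -> x ∈ at k vs -> (k , x) ∈ vs
       member k m = All.lookup (at-All {λ v -> v ∈ vs} k vs (All.tabulate id)) m
       sec : ∀ {x y} -> x ∈ at X vs -> y ∈ at Y vs -> Sector (vec x) (vec y)
       sec {x} {y} mx my = from-does (sector? x y) (trans (sym (joined-distinct {X} {Y} x y (λ ()))) (all-distinct (λ {u} {v} e -> trans (joined-sym v u) e) h (member X mx) (member Y my) (λ ())))

 ≟-pow : ∀ {κ c} (0≤κ : 0ℤ ≤ κ) (S : Space κ c) -> DecidableEquality (Space.Pt S) -> ∀ k -> DecidableEquality (Space.Pt (Powers.pow {κ} {c} 0≤κ S k))
 ≟-pow 0≤κ S e zero = _≟⊤_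
 ≟-pow 0≤κ S e (suc k) = ×ₚ.≡-dec e (≟-pow 0≤κ S e k)

 -- Density and clique-free sets of the model graph

 module ModelDensity (q : ℕ) (rotor : Rotor q) (E g : ℕ) (1≤E : 1 ℕ.≤ E) (1≤g : 1 ℕ.≤ g) (s : ℕ) where
   open ModelGraph q rotor E g 1≤E 1≤g s public

   -- The multiplicities p, p and 2p - 1 balance the classes: in units of 1/p the missing density is
   -- p · p + (p - 1) · p as seen from X or Y, and p(2p - 1) as seen from a Z. Both are p(2p - 1).
   keys : List Key
   keys = L.replicate (suc q) X ++ (L.replicate (suc q) Y ++ L.concatMap (λ i -> L.replicate (suc q ℕ.+ q) (Z i)) (allFin s))

   verts : List Vertex
   verts = pairs keys Ωpts

   ∑-keys : ∀ f -> ∑ keys f ≡ p * f X + (p * f Y + (p + + q) * ∑ (allFin s) (λ i -> f (Z i)))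
   ∑-keys f = trans (∑-++ (L.replicate (suc q) X) _ f) (cong₂ _+_ (∑-replicate (suc q) X f) (trans (∑-++ (L.replicate (suc q) Y) _ f) (cong₂ _+_ (∑-replicate (suc q) Y f)
      (trans (∑-concatMap (λ i -> L.replicate (suc q ℕ.+ q) (Z i)) (allFin s) f) (trans (∑-cong (allFin s) (λ i -> ∑-replicate (suc q ℕ.+ q) (Z i) f)) (∑-*ˡ (allFin s) (p + + q) (λ i -> f (Z i))))))))

   c : ℤ
   c = (p + + q) * (+ s + 1ℤ) + 1ℤ

   length-allFin : ∀ k -> + length (allFin k) ≡ + k
   length-allFin k = cong +_ (Lₚ.length-tabulate (λ (i : Fin k) -> i))


   length-keys : + length keys ≡ c
   length-keys = trans (sym (trans (∑-const keys 1ℤ) (Z.*-identityʳ (+ length keys)))) (trans (∑-keys (λ _ -> 1ℤ)) (trans (cong (λ z -> p * 1ℤ + (p * 1ℤ + (p + + q) * z)) (trans (∑-const (allFin s) 1ℤ) (trans (Z.*-identityʳ (+ length (allFin s))) (length-allFin s))))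
       (e (+ q) (+ s))))
     where
     e : ∀ q s -> (1ℤ + q) * 1ℤ + ((1ℤ + q) * 1ℤ + (1ℤ + q + q) * s) ≡ (1ℤ + q + q) * (s + 1ℤ) + 1ℤ
     e = solve 2 (λ q s -> (:1 :+ q) :* :1 :+ ((:1 :+ q) :* :1 :+ (:1 :+ q :+ q) :* s) := (:1 :+ q :+ q) :* (s :+ :1) :+ :1) refl

   length-verts : + length verts ≡ c * |Ω|
   length-verts = trans (length-pairs keys Ωpts) (cong (_* |Ω|) length-keys)

   _≟ⱽ_ : DecidableEquality Vertex
   _≟ⱽ_ = ×ₚ.≡-dec {A = Key} {B = λ _ -> Ω} Fₚ._≟_ (≟-pow {κ} {+ 32} 0≤κ Cs (≟-pow {κ} {+ 32} 0≤κ path N._≟_ M) (suc q))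

   1≤pow : ∀ S -> 1ℤ ≤ + length (Space.pts S) -> ∀ k -> 1ℤ ≤ + length (Space.pts (pow S k))
   1≤pow S h zero = Z.≤-refl
   1≤pow S h (suc k) = 1≤-* h (1≤pow S h k) ⟫ ≤r (sym (length-pairs (Space.pts S) (Space.pts (pow S k))))

   1≤|Ω| : 1ℤ ≤ |Ω|
   1≤|Ω| = 1≤pow Cs (1≤pow path (subst (1ℤ ≤_) (cong +_ (sym (length-upTo n))) (+≤+ (ℕ.s≤s ℕ.z≤n))) M) (suc q)

   |Ω|≥0 : 0ℤ ≤ |Ω|
   |Ω|≥0 = 0≤ℕ

   CliqueFree : (Vertex -> Bool) -> Set
   CliqueFree A = ∀ vs -> AllPairs Joined vs -> All (λ u -> A u ≡ true) vs -> length vs ≡ suc q -> ⊥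

   module _ (A : Vertex -> Bool) (free : CliqueFree A) where

     layer : Key -> Ω -> Bool
     layer k x = A (k , x) ∧ does (generic? x)

     -- A layer of density at least 1/E contains, by concentration, p mutually near points; being
     -- generic, they form a clique inside the class.
     thin : ∀ k -> + E * ∑ Ωpts (λ x -> ind (layer k x)) ≤ |Ω|
     thin k = go (|Ω| Z.≤? + E * ∑ Ωpts (λ x -> ind (layer k x)))
       where
       go : Dec (|Ω| ≤ + E * ∑ Ωpts (λ x -> ind (layer k x))) -> + E * ∑ Ωpts (λ x -> ind (layer k x)) ≤ |Ω|
       go (no h) = Z.<⇒≤ (Z.≰⇒> h)
       go (yes h) = ⊥-elim (free (L.tabulate (λ i -> k , x i)) (APₚ.tabulate⁺ {R = Joined} {f = λ i -> k , x i} (λ {i} {j} i≢j -> trans (joined-same k (x i) (x j)) (same-true {x i} {x j} (gen i) (gen j) (nr i j i≢j))))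
           (Allₚ.tabulate⁺ {P = λ u -> A u ≡ true} {f = λ i -> k , x i} (λ i -> ∧-trueˡ (mem i))) (Lₚ.length-tabulate (λ i -> k , x i)))
         where
         found : ∃ λ (x : Ix -> Ω) -> (∀ i -> layer k (x i) ≡ true) × (∀ i j -> i ≢ j -> ∃ λ r -> r ≢ F.zero × nrm (diff (vec (x j)) (shift r (vec (x i)))) ≤ + 4 * T)
         found = Concentrate.near-clique T 0≤T E concentrated 1≤|Ω| (layer k) h
         x : Ix -> Ω
         x = proj₁ found
         mem : ∀ i -> layer k (x i) ≡ true
         mem = proj₁ (proj₂ found)
         gen : ∀ i -> Generic (vec (x i))
         gen i = from-does (generic? (x i)) (∧-trueʳ {A (k , x i)} (mem i))
         nr : ∀ i j -> i ≢ j -> Near (vec (x i)) (vec (x j))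
         nr i j i≢j = proj₁ w , proj₁ (proj₂ w) , (proj₂ (proj₂ w) ⟫ ≤r (sym Δ≡))
           where
           w : ∃ λ r -> r ≢ F.zero × nrm (diff (vec (x j)) (shift r (vec (x i)))) ≤ + 4 * T
           w = proj₂ (proj₂ found) i j i≢j

     few-key : ∀ k -> + E * + g * ∑ Ωpts (λ x -> ind (A (k , x))) ≤ (+ g + + E * + q) * |Ω|
     few-key k = by (0≤-+ (0≤-* (0≤-* (0≤ℕ {E}) (0≤ℕ {g})) (0≤-- covered-by)) (0≤-+ (0≤-* (0≤ℕ {g}) (0≤-- (thin k))) (0≤-* (0≤ℕ {E}) (0≤-- special-count))))
        (e (+ E) (+ g) (+ q) |Ω| (∑ Ωpts (λ x -> ind (A (k , x)))) (∑ Ωpts (λ x -> ind (layer k x))) (∑ Ωpts (λ x -> ind (special x))))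
       where
       e : ∀ E g q o a l s -> (g + E * q) * o ≡ E * g * a + (E * g * (l + s - a) + (g * (o - E * l) + E * (q * o - g * s)))
       e = solve 7 (λ E g q o a l s -> (g :+ E :* q) :* o := E :* g :* a :+ (E :* g :* (l :+ s :- a) :+ (g :* (o :- E :* l) :+ E :* (q :* o :- g :* s)))) refl
       split-ind : ∀ a b -> ind a ≤ ind (a ∧ b) + ind (not b)
       split-ind true true = Z.≤-refl
       split-ind true false = Z.≤-refl
       split-ind false true = Z.≤-refl
       split-ind false false = 0≤ℕ
       covered-by : ∑ Ωpts (λ x -> ind (A (k , x))) ≤ ∑ Ωpts (λ x -> ind (layer k x)) + ∑ Ωpts (λ x -> ind (special x))
       covered-by = ∑-mono Ωpts (λ x -> split-ind (A (k , x)) (does (generic? x))) ⟫ ≤r (∑-+ Ωpts (λ x -> ind (layer k x)) (λ x -> ind (special x)))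

     few : + E * + g * ∑ verts (λ u -> ind (A u)) ≤ (+ g + + E * + q) * + length verts
     few = ≤r (trans (cong (+ E * + g *_) (∑-pairs keys Ωpts (λ u -> ind (A u)))) (sym (∑-*ˡ keys (+ E * + g) (λ k -> ∑ Ωpts (λ x -> ind (A (k , x)))))))
        ⟫ ∑-mono keys few-key ⟫ ≤r (trans (∑-const keys ((+ g + + E * + q) * |Ω|)) (trans (e (+ length keys) (+ g + + E * + q) |Ω|) (cong ((+ g + + E * + q) *_) (sym (length-pairs keys Ωpts)))))
       where
       e : ∀ k a o -> k * (a * o) ≡ a * (k * o)
       e = solve 3 (λ k a o -> k :* (a :* o) := a :* (k :* o)) refl

   between : Key -> Key -> ℤ
   between k l = ∑ Ωpts (λ x -> ∑ Ωpts (λ y -> ind (joined (k , x) (l , y))))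

   0≤between : ∀ k l -> 0ℤ ≤ between k l
   0≤between k l = ∑-nonneg Ωpts (λ x -> ∑-nonneg Ωpts (λ y -> 0≤ind (joined (k , x) (l , y))))

   -- Densities between classes over the common denominator gp; `side` / `scale` is the bound 1/p -
   -- 2q/g for the pair X, Y.
   scale side : ℤ
   scale = + g * p
   side = + g - + 2 * p * + q

   weight-of : Key -> Key -> ℤ
   weight-of X X = 0ℤ
   weight-of X Y = side
   weight-of X (Z _) = scale
   weight-of Y X = side
   weight-of Y Y = 0ℤ
   weight-of Y (Z _) = scale
   weight-of (Z _) X = scale
   weight-of (Z _) Y = scale
   weight-of (Z i) (Z j) = scale - scale * δ i j

   0≤scale : 0ℤ ≤ scale
   0≤scale = 0≤-* {+ g} {p} 0≤ℕ 0≤ℕ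

   full : ∀ {k l} -> k ≢ l -> (∀ x y -> cross k l x y ≡ true) -> scale * (|Ω| * |Ω|) ≤ scale * between k l
   full {k} {l} n h = ≤r (cong (scale *_) (sym (trans (∑-cong Ωpts (λ x -> trans (∑-cong Ωpts (λ y -> cong ind (trans (joined-distinct x y n) (h x y)))) (trans (∑-const Ωpts 1ℤ) (Z.*-identityʳ |Ω|)))) (∑-const Ωpts |Ω|))))

   empty : ∀ k l -> 0ℤ * (|Ω| * |Ω|) ≤ scale * between k l
   empty k l = ≤r (Z.*-zeroˡ (|Ω| * |Ω|)) ⟫ 0≤-* 0≤scale (0≤between k l)

   between-bound : ∀ k l -> weight-of k l * (|Ω| * |Ω|) ≤ scale * between k l
   between-bound X X = empty X X
   between-bound Y Y = empty Y Y
   between-bound X Y = sector-count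
   between-bound Y X = sector-count ⟫ ≤r (cong (scale *_) (∑-swap Ωpts Ωpts (λ x y -> ind (sectorB x y))))
   between-bound X (Z i) = full {X} {Z i} (λ ()) (λ _ _ -> refl)
   between-bound Y (Z i) = full {Y} {Z i} (λ ()) (λ _ _ -> refl)
   between-bound (Z i) X = full {Z i} {X} (λ ()) (λ _ _ -> refl)
   between-bound (Z i) Y = full {Z i} {Y} (λ ()) (λ _ _ -> refl)
   between-bound (Z i) (Z j) = go (i Fₚ.≟ j)
     where
     go : (d : Dec (i ≡ j)) -> (scale - scale * (if does d then 1ℤ else 0ℤ)) * (|Ω| * |Ω|) ≤ scale * between (Z i) (Z j)
     go (yes _) = ≤r (cong (_* (|Ω| * |Ω|)) (e scale)) ⟫ empty (Z i) (Z j)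
       where
       e : ∀ a -> a - a * 1ℤ ≡ 0ℤ
       e = solve 1 (λ a -> a :- a :* :1 := :0) refl
     go (no n) = ≤r (cong (_* (|Ω| * |Ω|)) (e scale)) ⟫ full {Z i} {Z j} (λ { refl -> n refl }) (λ _ _ -> refl)
       where
       e : ∀ a -> a - a * 0ℤ ≡ a
       e = solve 1 (λ a -> a :- a :* :0 := a) refl

   edge-sum : ℤ
   edge-sum = ∑ verts (λ u -> ∑ verts (λ v -> ind (joined u v)))

   edge-sum≡ : edge-sum ≡ ∑ keys (λ k -> ∑ keys (between k))
   edge-sum≡ = trans (∑-pairs keys Ωpts (λ u -> ∑ verts (λ v -> ind (joined u v)))) (∑-cong keys (λ k -> trans (∑-cong Ωpts (λ x -> ∑-pairs keys Ωpts (λ v -> ind (joined (k , x) v))))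
      (∑-swap Ωpts keys (λ x l -> ∑ Ωpts (λ y -> ind (joined (k , x) (l , y)))))))

   weight-total : ∑ keys (λ k -> ∑ keys (weight-of k)) ≡ p * (+ g * (c * (c - (p + + q))) - + 4 * (p * (p * + q)))
   weight-total = trans (∑-keys (λ k -> ∑ keys (weight-of k))) (trans (cong₂ (λ a b -> p * a + b) rowX (cong₂ (λ a b -> p * a + (p + + q) * b) rowY rowsZ)) (e (+ g) (+ q) (+ s)))
     where
     e : ∀ g q s -> (1ℤ + q) * ((1ℤ + q) * 0ℤ + ((1ℤ + q) * (g - + 2 * (1ℤ + q) * q) + (1ℤ + q + q) * (s * (g * (1ℤ + q)))))
        + ((1ℤ + q) * ((1ℤ + q) * (g - + 2 * (1ℤ + q) * q) + ((1ℤ + q) * 0ℤ + (1ℤ + q + q) * (s * (g * (1ℤ + q)))))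
          + (1ℤ + q + q) * (s * ((1ℤ + q) * (g * (1ℤ + q)) + ((1ℤ + q) * (g * (1ℤ + q)) + (1ℤ + q + q) * (s * (g * (1ℤ + q)) - g * (1ℤ + q))))))
        ≡ (1ℤ + q) * (g * (((1ℤ + q + q) * (s + 1ℤ) + 1ℤ) * ((1ℤ + q + q) * (s + 1ℤ) + 1ℤ - (1ℤ + q + q))) - + 4 * ((1ℤ + q) * ((1ℤ + q) * q)))
     e = solve 3 (λ g q s -> (:1 :+ q) :* ((:1 :+ q) :* :0 :+ ((:1 :+ q) :* (g :- :2 :* (:1 :+ q) :* q) :+ (:1 :+ q :+ q) :* (s :* (g :* (:1 :+ q))))) :+ ((:1 :+ q) :* ((:1 :+ q) :* (g :- :2 :* (:1 :+ q) :* q) :+ ((:1 :+ q) :* :0 :+ (:1 :+ q :+ q) :* (s :* (g :* (:1 :+ q))))) :+ (:1 :+ q :+ q) :* (s :* ((:1 :+ q) :* (g :* (:1 :+ q)) :+ ((:1 :+ q) :* (g :* (:1 :+ q)) :+ (:1 :+ q :+ q) :* (s :* (g :* (:1 :+ q)) :- g :* (:1 :+ q)))))) := (:1 :+ q) :* (g :* (((:1 :+ q :+ q) :* (s :+ :1) :+ :1) :* ((:1 :+ q :+ q) :* (s :+ :1) :+ :1 :- (:1 :+ q :+ q))) :- :4 :* ((:1 :+ q) :* ((:1 :+ q) :* q)))) refl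
     constant : ∀ (a : ℤ) -> ∑ (allFin s) (λ _ -> a) ≡ + s * a
     constant a = trans (∑-const (allFin s) a) (cong (_* a) (length-allFin s))
     rowX : ∑ keys (weight-of X) ≡ p * 0ℤ + (p * side + (p + + q) * (+ s * scale))
     rowX = trans (∑-keys (weight-of X)) (cong (λ z -> p * 0ℤ + (p * side + (p + + q) * z)) (constant scale))
     rowY : ∑ keys (weight-of Y) ≡ p * side + (p * 0ℤ + (p + + q) * (+ s * scale))
     rowY = trans (∑-keys (weight-of Y)) (cong (λ z -> p * side + (p * 0ℤ + (p + + q) * z)) (constant scale))
     rowZ : ∀ i -> ∑ keys (weight-of (Z i)) ≡ p * scale + (p * scale + (p + + q) * (+ s * scale - scale))
     rowZ i = trans (∑-keys (weight-of (Z i))) (cong (λ z -> p * scale + (p * scale + (p + + q) * z)) (trans (∑-- (allFin s) (λ _ -> scale) (λ j -> scale * δ i j)) (cong₂ _-_ (constant scale) (∑-δ (λ _ -> scale) i))))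
     rowsZ : ∑ (allFin s) (λ i -> ∑ keys (weight-of (Z i))) ≡ + s * (p * scale + (p * scale + (p + + q) * (+ s * scale - scale)))
     rowsZ = trans (∑-cong (allFin s) rowZ) (constant (p * scale + (p * scale + (p + + q) * (+ s * scale - scale))))

   -- Relative to (c|Ω|)² the edge density is at least 1 - (2p - 1)/c, up to an error 4p²q/(gc²)
   -- that vanishes as g grows.
   many-edges : (+ g * (c * (c - (p + + q))) - + 4 * (p * (p * + q))) * (|Ω| * |Ω|) ≤ + g * edge-sum
   many-edges = ≤-cancelˡ p (+≤+ (ℕ.s≤s ℕ.z≤n)) (≤r (trans (sym (Z.*-assoc p (+ g * (c * (c - (p + + q))) - + 4 * (p * (p * + q))) (|Ω| * |Ω|))) (cong (_* (|Ω| * |Ω|)) (sym weight-total)))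
      ⟫ ≤r (trans (sym (∑-*ʳ keys (|Ω| * |Ω|) (λ k -> ∑ keys (weight-of k)))) (∑-cong keys (λ k -> sym (∑-*ʳ keys (|Ω| * |Ω|) (weight-of k)))))
      ⟫ ∑-mono keys (λ k -> ∑-mono keys (between-bound k)) ⟫ ≤r (trans (∑-cong keys (λ k -> ∑-*ˡ keys scale (between k))) (trans (∑-*ˡ keys scale (λ k -> ∑ keys (between k))) (trans (cong (scale *_) (sym edge-sum≡)) (e (+ g) p edge-sum)))))
     where
     e : ∀ g p x -> g * p * x ≡ p * (g * x)
     e = solve 3 (λ g p x -> g :* p :* x := p :* (g :* x)) refl

 -- Blow-ups to every number of vertices

 ∑-toℕ : ∀ n (f : ℕ -> ℤ) -> ∑ (allFin n) (f ∘ toℕ) ≡ ∑ (upTo n) f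
 ∑-toℕ zero f = refl
 ∑-toℕ (suc n) f = trans (∑-allFin-suc n (f ∘ toℕ)) (trans (+ˡ (f 0) (∑-toℕ n (f ∘ suc))) (sym (∑-upTo-suc n f)))

 module Periodic {V : Set} (v₀ : V) (rest : List V) where

   vs : List V
   vs = v₀ ∷ rest

   N : ℕ
   N = length vs

   nth : List V -> ℕ -> V
   nth [] _ = v₀
   nth (v ∷ _) zero = v
   nth (_ ∷ l) (suc i) = nth l i

   -- Reading the vertex list periodically gives a blow-up for every n, with each position used k or
   -- k + 1 times.
   around : ℕ -> V
   around i = nth vs (i % N)

   ∑-nth : ∀ l φ -> ∑ (upTo (length l)) (φ ∘ nth l) ≡ ∑ l φ
   ∑-nth [] φ = refl
   ∑-nth (v ∷ l) φ = trans (∑-upTo-suc (length l) (φ ∘ nth (v ∷ l))) (+ˡ (φ v) (∑-nth l φ))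

   ∑-period : ∀ φ -> ∑ (upTo N) (φ ∘ around) ≡ ∑ vs φ
   ∑-period φ = trans (∑-cong∈ (upTo N) (λ i mi -> cong (φ ∘ nth vs) (m<n⇒m%n≡m (∈-upTo N mi)))) (∑-nth vs φ)

   around-period : ∀ i -> around (N ℕ.+ i) ≡ around i
   around-period i = cong (nth vs) (trans (cong (_% N) (N.+-comm N i)) ([m+n]%n≡m%n i N))

   ∑-blocks : ∀ k b φ -> ∑ (upTo (k ℕ.* N ℕ.+ b)) (φ ∘ around) ≡ + k * ∑ vs φ + ∑ (upTo b) (φ ∘ around)
   ∑-blocks zero b φ = sym (trans (cong (_+ ∑ (upTo b) (φ ∘ around)) (Z.*-zeroˡ (∑ vs φ))) (Z.+-identityˡ (∑ (upTo b) (φ ∘ around))))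
   ∑-blocks (suc k) b φ = trans (cong (λ x -> ∑ (upTo x) (φ ∘ around)) (N.+-assoc N (k ℕ.* N) b)) (trans (∑-upTo-+ N (k ℕ.* N ℕ.+ b) (φ ∘ around))
      (trans (cong₂ _+_ (∑-period φ) (trans (∑-cong (upTo (k ℕ.* N ℕ.+ b)) (λ i -> cong φ (around-period i))) (∑-blocks k b φ))) (e (+ k) (∑ vs φ) (∑ (upTo b) (φ ∘ around)))))
     where
     e : ∀ k x y -> x + (k * x + y) ≡ (1ℤ + k) * x + y
     e = solve 3 (λ k x y -> x :+ (k :* x :+ y) := (:1 :+ k) :* x :+ y) refl

   module _ (n : ℕ) where

     k b : ℕ
     k = n / N
     b = n % N

     n≡ : n ≡ k ℕ.* N ℕ.+ b
     n≡ = trans (m≡m%n+[m/n]*n n N) (N.+-comm b (k ℕ.* N))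

     ∑-around : ∀ φ -> ∑ (upTo n) (φ ∘ around) ≡ + k * ∑ vs φ + ∑ (upTo b) (φ ∘ around)
     ∑-around φ = trans (cong (λ x -> ∑ (upTo x) (φ ∘ around)) n≡) (∑-blocks k b φ)

     place : Fin n -> V
     place i = around (toℕ i)

     ∑-place≥ : ∀ φ -> (∀ v -> 0ℤ ≤ φ v) -> + k * ∑ vs φ ≤ ∑ (allFin n) (φ ∘ place)
     ∑-place≥ φ h = by (∑-nonneg (upTo b) (λ i -> h (around i))) (∑-around φ) ⟫ ≤r (sym (∑-toℕ n (φ ∘ around)))

     ∑-place≤ : ∀ φ -> (∀ v -> 0ℤ ≤ φ v) -> ∑ (allFin n) (φ ∘ place) ≤ (+ k + 1ℤ) * ∑ vs φ
     ∑-place≤ φ h = ≤r (trans (∑-toℕ n (φ ∘ around)) (∑-around φ)) ⟫ by (∑-nonneg (upTo (N ℕ.∸ b)) (λ i -> h (around (b ℕ.+ i))))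
        (trans (e (+ k) (∑ vs φ) (∑ (upTo b) (φ ∘ around))) (+ˡ (+ k * ∑ vs φ + ∑ (upTo b) (φ ∘ around)) (trans (cong (_- ∑ (upTo b) (φ ∘ around)) full) (e′ (∑ (upTo b) (φ ∘ around)) (∑ (upTo (N ℕ.∸ b)) (λ i -> φ (around (b ℕ.+ i))))))))
       where
       e : ∀ k x y -> (k + 1ℤ) * x ≡ k * x + y + (x - y)
       e = solve 3 (λ k x y -> (k :+ :1) :* x := k :* x :+ y :+ (x :- y)) refl
       e′ : ∀ x y -> x + y - x ≡ y
       e′ = solve 2 (λ x y -> x :+ y :- x := y) refl
       full : ∑ vs φ ≡ ∑ (upTo b) (φ ∘ around) + ∑ (upTo (N ℕ.∸ b)) (λ i -> φ (around (b ℕ.+ i)))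
       full = trans (sym (∑-period φ)) (trans (cong (λ x -> ∑ (upTo x) (φ ∘ around)) (sym (N.m+[n∸m]≡n (N.<⇒≤ (m%n<n n N))))) (∑-upTo-+ b (N ℕ.∸ b) (φ ∘ around)))

     ∑∑-place≥ : ∀ (ψ : V -> V -> ℤ) -> (∀ u v -> 0ℤ ≤ ψ u v) -> + k * + k * ∑ vs (λ u -> ∑ vs (ψ u)) ≤ ∑ (allFin n) (λ i -> ∑ (allFin n) (λ j -> ψ (place i) (place j)))
     ∑∑-place≥ ψ h = ≤r (trans (Z.*-assoc (+ k) (+ k) (∑ vs (λ u -> ∑ vs (ψ u)))) (cong (+ k *_) (sym (∑-*ˡ vs (+ k) (λ u -> ∑ vs (ψ u))))))
        ⟫ ∑-place≥ (λ u -> + k * ∑ vs (ψ u)) (λ u -> 0≤-* {+ k} 0≤ℕ (∑-nonneg vs (h u))) ⟫ ∑-mono (allFin n) (λ i -> ∑-place≥ (ψ (place i)) (h (place i)))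

     kN≤n : + k * + N ≤ + n
     kN≤n = by (0≤ℕ {b}) (trans (cong +_ n≡) (cong (_+ + b) (Z.pos-* k N)))

     n≤kN+N : + n ≤ + k * + N + + N
     n≤kN+N = ≤r (trans (cong +_ n≡) (cong (_+ + b) (Z.pos-* k N))) ⟫ Z.+-monoʳ-≤ (+ k * + N) (+≤+ (N.<⇒≤ (m%n<n n N)))

 -- A vertex set of the blow-up projects to the set of model vertices whose fibre it meets.
 module Fibres {V : Set} (_≟_ : DecidableEquality V) {n : ℕ} (place : Fin n -> V) (S : Fin n -> Bool) where

   hit? : ∀ v -> Dec (∃ λ i -> place i ≡ v × S i ≡ true)
   hit? v = Fₚ.any? (λ i -> (place i ≟ v) ×-dec (S i Bₚ.≟ true))

   shadow : V -> Bool
   shadow v = does (hit? v)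

   shadow-place : ∀ i -> ind (S i) ≤ ind (shadow (place i))
   shadow-place i = go (S i) refl
     where
     go : ∀ b -> S i ≡ b -> ind b ≤ ind (shadow (place i))
     go true e = ≤r (cong ind (sym (dec-true (hit? (place i)) (i , refl , e))))
     go false e = 0≤ind (shadow (place i))

   lift : ∀ vs -> All (λ v -> shadow v ≡ true) vs -> ∃ λ is -> map place is ≡ vs × All (λ i -> S i ≡ true) is
   lift [] [] = [] , refl , []
   lift (v ∷ vs) (h ∷ hs) = go (from-does (hit? v) h) (lift vs hs)
     where
     go : (∃ λ i -> place i ≡ v × S i ≡ true) -> (∃ λ is -> map place is ≡ vs × All (λ i -> S i ≡ true) is) -> ∃ λ is -> map place is ≡ v ∷ vs × All (λ i -> S i ≡ true) is
     go (i , e , t) (is , es , ts) = i ∷ is , cong₂ _∷_ e es , t ∷ ts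

 -- The target density a/c - 1/d leaves room for two losses: the defect D/(gc²) of the model, at
 -- most 1/(c²d), and the incomplete last period of at most c·o vertices, negligible for large n.
 transfer : ∀ c d a g D o e k n Σ -> + 2 ≤ c -> 1ℤ ≤ a -> 1ℤ ≤ d -> 1ℤ ≤ g -> 1ℤ ≤ o -> D * d ≤ g -> 0ℤ ≤ k -> 0ℤ ≤ n ->
   (g * (c * a) - D) * (o * o) ≤ g * e -> k * k * e ≤ Σ -> n ≤ k * (c * o) + c * o -> c * o ≤ n ->
   + 2 * (c * o) * (c * a * d) ≤ n -> c * c ≤ n -> (a * d - c) * (n * (n - 1ℤ)) ≤ Σ * (c * d)
 transfer c d a g D o e k n Σ 2≤c 1≤a 1≤d 1≤g 1≤o Dd≤g 0≤k 0≤n h₁ h₂ h₃ N≤n h₄ h₅ = ≤-cancelˡ c 1≤c (stepE ⟫ stepD ⟫ stepC ⟫ ≤r (e₀ c d Σ))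
   where
   1≤c : 1ℤ ≤ c
   1≤c = +≤+ (ℕ.s≤s ℕ.z≤n) ⟫ 2≤c
   N w : ℤ
   N = c * o
   w = c * a * d - 1ℤ
   0≤N : 0ℤ ≤ N
   0≤N = 0≤-* (1≤⇒0≤ 1≤c) (1≤⇒0≤ 1≤o)
   0≤w : 0ℤ ≤ w
   0≤w = 0≤-- (1≤-* (1≤-* 1≤c 1≤a) 1≤d)
   e₀ : ∀ c d x -> c * c * d * x ≡ c * (x * (c * d))
   e₀ = solve 3 (λ c d x -> c :* c :* d :* x := c :* (x :* (c :* d))) refl
   stepB : w * (N * N) ≤ c * c * d * e
   stepB = ≤-cancelˡ g 1≤g (by (0≤-+ (0≤-* (0≤-* (1≤⇒0≤ 1≤d) (0≤-sq c)) (0≤-- h₁)) (0≤-* (0≤-sq N) (0≤-- Dd≤g))) (eq c d a g D o e))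
     where
     eq : ∀ c d a g D o e -> g * (c * c * d * e) ≡ g * ((c * a * d - 1ℤ) * (c * o * (c * o))) + (d * (c * c) * (g * e - (g * (c * a) - D) * (o * o)) + c * o * (c * o) * (g - D * d))
     eq = solve 7 (λ c d a g D o e -> g :* (c :* c :* d :* e) := g :* ((c :* a :* d :- :1) :* (c :* o :* (c :* o))) :+ (d :* (c :* c) :* (g :* e :- (g :* (c :* a) :- D) :* (o :* o)) :+ c :* o :* (c :* o) :* (g :- D :* d))) refl
   stepC : w * (k * N * (k * N)) ≤ c * c * d * Σ
   stepC = by (0≤-+ (0≤-* (0≤-sq k) (0≤-- stepB)) (0≤-* (0≤-* (0≤-sq c) (1≤⇒0≤ 1≤d)) (0≤-- h₂))) (eq w k N (c * c * d) e Σ)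
     where
     eq : ∀ w k N u e x -> u * x ≡ w * (k * N * (k * N)) + (k * k * (u * e - w * (N * N)) + u * (x - k * k * e))
     eq = solve 6 (λ w k N u e x -> u :* x := w :* (k :* N :* (k :* N)) :+ (k :* k :* (u :* e :- w :* (N :* N)) :+ u :* (x :- k :* k :* e))) refl
   stepD : w * (n * n - + 2 * (n * N)) ≤ w * (k * N * (k * N))
   stepD = ≤-*ˡ w 0≤w (by (0≤-+ (0≤-sq N) (0≤-* (0≤-- h₃) (0≤-+ (0≤-- N≤n) (0≤-* 0≤k 0≤N)))) (eq n N (k * N)))
     where
     eq : ∀ n N m -> m * m ≡ n * n - + 2 * (n * N) + (N * N + (m + N - n) * (n - N + m))
     eq = solve 3 (λ n N m -> m :* m := n :* n :- :2 :* (n :* N) :+ (N :* N :+ (m :+ N :- n) :* (n :- N :+ m))) refl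
   stepE : c * ((a * d - c) * (n * (n - 1ℤ))) ≤ w * (n * n - + 2 * (n * N))
   stepE = by (0≤-+ (0≤-* 0≤n (0≤-+ (0≤-+ (0≤-- h₄) (0≤-- h₅)) (0≤-* (0≤-+ (0≤-* (0≤-- 2≤c) (0≤-+ (1≤⇒0≤ 1≤c) (0≤ℕ {2}))) (0≤ℕ {1})) 0≤n))) (0≤-+ (0≤-* {+ 2} 0≤ℕ (0≤-* 0≤n 0≤N)) (0≤-* (0≤-* (0≤-* (1≤⇒0≤ 1≤c) (1≤⇒0≤ 1≤a)) (1≤⇒0≤ 1≤d)) 0≤n))) (eq c d a n o)
     where
     eq : ∀ c d a n o -> (c * a * d - 1ℤ) * (n * n - + 2 * (n * (c * o))) ≡ c * ((a * d - c) * (n * (n - 1ℤ))) + (n * (n - + 2 * (c * o) * (c * a * d) + (n - c * c) + ((c - + 2) * (c + + 2) + 1ℤ) * n) + (+ 2 * (n * (c * o)) + c * a * d * n))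
     eq = solve 5 (λ c d a n o -> (c :* a :* d :- :1) :* (n :* n :- :2 :* (n :* (c :* o))) := c :* ((a :* d :- c) :* (n :* (n :- :1))) :+ (n :* (n :- :2 :* (c :* o) :* (c :* a :* d) :+ (n :- c :* c) :+ ((c :- :2) :* (c :+ :2) :+ :1) :* n) :+ (:2 :* (n :* (c :* o)) :+ c :* a :* d :* n))) refl

 -- The factor 4 pays twice for a factor 2: once for the nongeneric points, by E · 4 · q ≤ g, and
 -- once because a position may occur k + 1 times instead of k.
 independence : ∀ E q g x A k n N -> 1ℤ ≤ g -> 0ℤ ≤ N -> 0ℤ ≤ k -> 0ℤ ≤ E -> E * + 4 * q ≤ g ->
   E * + 4 * g * A ≤ (g + E * + 4 * q) * N -> x ≤ (k + 1ℤ) * A -> k * N ≤ n -> N ≤ n -> E * x ≤ n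
 independence E q g x A k n N 1≤g 0≤N 0≤k 0≤E hg h₁ h₂ h₃ h₄ = ≤-cancelˡ (+ 4 * g) (1≤-* {+ 4} (+≤+ (ℕ.s≤s ℕ.z≤n)) 1≤g)
   (by (0≤-+ (0≤-+ (0≤-* (0≤-* (0≤-* {+ 4} 0≤ℕ 0≤E) (1≤⇒0≤ 1≤g)) (0≤-- h₂)) (0≤-* 0≤k+1 (0≤-- h₁))) (0≤-+ (0≤-* (0≤-* 0≤k+1 0≤N) (0≤-- hg)) (0≤-* (0≤-* {+ 2} 0≤ℕ (1≤⇒0≤ 1≤g)) (0≤-+ (0≤-- h₃) (0≤-- h₄))))) (e E q g x A k n N))
   where
   0≤k+1 : 0ℤ ≤ k + 1ℤ
   0≤k+1 = 0≤-+ 0≤k (0≤ℕ {1})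
   e : ∀ E q g x A k n N -> + 4 * g * n ≡ + 4 * g * (E * x) + (+ 4 * E * g * ((k + 1ℤ) * A - x) + (k + 1ℤ) * ((g + E * + 4 * q) * N - E * + 4 * g * A) + ((k + 1ℤ) * N * (g - E * + 4 * q) + + 2 * g * (n - k * N + (n - N))))
   e = solve 8 (λ E q g x A k n N -> :4 :* g :* n := :4 :* g :* (E :* x) :+ (:4 :* E :* g :* ((k :+ :1) :* A :- x) :+ (k :+ :1) :* ((g :+ E :* :4 :* q) :* N :- E :* :4 :* g :* A) :+ ((k :+ :1) :* N :* (g :- E :* :4 :* q) :+ :2 :* g :* (n :- k :* N :+ (n :- N))))) refl

 record LowerWitness (pn K E d : ℕ) (h a : ℤ) (n : ℕ) : Set where
   field
     adj         : Fin n -> Fin n -> Bool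
     adj-sym     : ∀ i j -> adj i j ≡ adj j i
     adj-irrefl  : ∀ i -> adj i i ≡ false
     clique-free : ∀ is -> AllPairs (λ i j -> adj i j ≡ true) is -> length is ≡ K -> ⊥
     sparse      : ∀ S -> (∀ is -> AllPairs (λ i j -> adj i j ≡ true) is -> All (λ i -> S i ≡ true) is -> length is ≡ pn -> ⊥) -> + E * ∑ (allFin n) (ind ∘ S) ≤ + n
     dense       : (a * + d - h) * (+ n * (+ n - 1ℤ)) ≤ ∑ (allFin n) (λ i -> ∑ (allFin n) (λ j -> ind (adj i j))) * (h * + d)

 record Template (pn K E d : ℕ) (h a : ℤ) : Set₁ where
   field
     V     : Set
     _≟_   : DecidableEquality V
     verts : List V
     joined : V -> V -> Bool
     joined-sym    : ∀ u v -> joined u v ≡ joined v u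
     joined-irrefl : ∀ u -> joined u u ≡ false
     no-clique     : ∀ us -> AllPairs (λ u v -> joined u v ≡ true) us -> length us ≡ K -> ⊥
     g D o q : ℤ
     1≤g  : 1ℤ ≤ g
     1≤o  : 1ℤ ≤ o
     2≤h  : + 2 ≤ h
     1≤a  : 1ℤ ≤ a
     Dd≤g : D * + d ≤ g
     Eq≤g : + E * + 4 * q ≤ g
     length-verts : + length verts ≡ h * o
     few  : ∀ A -> (∀ us -> AllPairs (λ u v -> joined u v ≡ true) us -> All (λ u -> A u ≡ true) us -> length us ≡ pn -> ⊥) ->
              + E * + 4 * g * ∑ verts (ind ∘ A) ≤ (g + + E * + 4 * q) * + length verts
     many : (g * (h * a) - D) * (o * o) ≤ g * ∑ verts (λ u -> ∑ verts (λ v -> ind (joined u v)))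

 threshold : ∀ (h a d o : ℤ) -> 1ℤ ≤ h -> 1ℤ ≤ a -> 1ℤ ≤ d -> 1ℤ ≤ o -> ∃ λ n₀ -> ∀ n -> n₀ ℕ.≤ n ->
   + 2 * (h * o) * (h * a * d) ≤ + n × h * o ≤ + n × h * h ≤ + n
 threshold h a d o 1≤h 1≤a 1≤d 1≤o = ∣ x + y + z ∣ , λ n k -> big n (≤r (sym (Z.0≤i⇒+∣i∣≡i (0≤-+ (0≤-+ 0≤x 0≤y) 0≤z))) ⟫ +≤+ k)
   where
   x y z : ℤ
   x = + 2 * (h * o) * (h * a * d)
   y = h * o
   z = h * h
   0≤y : 0ℤ ≤ y
   0≤y = 0≤-* (1≤⇒0≤ 1≤h) (1≤⇒0≤ 1≤o)
   0≤x : 0ℤ ≤ x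
   0≤x = 0≤-* (0≤-* {+ 2} 0≤ℕ 0≤y) (0≤-* (0≤-* (1≤⇒0≤ 1≤h) (1≤⇒0≤ 1≤a)) (1≤⇒0≤ 1≤d))
   0≤z : 0ℤ ≤ z
   0≤z = 0≤-sq h
   e₁ : ∀ x y z -> x + y + z ≡ x + (y + z)
   e₁ = solve 3 (λ x y z -> x :+ y :+ z := x :+ (y :+ z)) refl
   e₂ : ∀ x y z -> x + y + z ≡ y + (x + z)
   e₂ = solve 3 (λ x y z -> x :+ y :+ z := y :+ (x :+ z)) refl
   e₃ : ∀ x y z -> x + y + z ≡ z + (x + y)
   e₃ = solve 3 (λ x y z -> x :+ y :+ z := z :+ (x :+ y)) refl
   big : ∀ n -> x + y + z ≤ + n -> x ≤ + n × y ≤ + n × z ≤ + n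
   big n h = by (0≤-+ 0≤y 0≤z) (e₁ x y z) ⟫ h , by (0≤-+ 0≤x 0≤z) (e₂ x y z) ⟫ h , by (0≤-+ 0≤x 0≤y) (e₃ x y z) ⟫ h

 module _ {pn K E d : ℕ} {h a : ℤ} (1≤d : 1 ℕ.≤ d) (template : Template pn K E d h a) where
   open Template template

   1≤h : 1ℤ ≤ h
   1≤h = +≤+ (ℕ.s≤s ℕ.z≤n) ⟫ 2≤h

   blow-up : ∀ v₀ rest -> verts ≡ v₀ ∷ rest -> ∀ n -> + 2 * (h * o) * (h * a * + d) ≤ + n × h * o ≤ + n × h * h ≤ + n -> LowerWitness pn K E d h a n
   blow-up v₀ rest verts≡ n (n≥₁ , n≥₂ , n≥₃) = record
     { adj = λ i j -> joined (place n i) (place n j)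
     ; adj-sym = λ i j -> joined-sym (place n i) (place n j)
     ; adj-irrefl = λ i -> joined-irrefl (place n i)
     ; clique-free = λ is cl len -> no-clique (map (place n) is) (APₚ.map⁺ cl) (trans (Lₚ.length-map (place n) is) len)
     ; sparse = sparse
     ; dense = transfer h (+ d) a g D o (∑ verts (λ u -> ∑ verts (λ v -> ind (joined u v)))) (+ k n) (+ n) (∑ (allFin n) (λ i -> ∑ (allFin n) (λ j -> ind (joined (place n i) (place n j)))))
         2≤h 1≤a (+≤+ 1≤d) 1≤g 1≤o Dd≤g 0≤ℕ 0≤ℕ many
         (≤r (cong (λ l -> + k n * + k n * ∑ l (λ u -> ∑ l (λ v -> ind (joined u v)))) verts≡) ⟫ ∑∑-place≥ n (λ u v -> ind (joined u v)) (λ u v -> 0≤ind (joined u v)))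
         (n≤kN+N n ⟫ ≤r (cong (λ x -> + k n * x + x) Nℤ)) n≥₂ n≥₁ n≥₃ }
     where
     open Periodic v₀ rest
     Nℤ : + N ≡ h * o
     Nℤ = trans (cong (λ l -> + length l) (sym verts≡)) length-verts
     sparse : ∀ S -> (∀ is -> AllPairs (λ i j -> joined (place n i) (place n j) ≡ true) is -> All (λ i -> S i ≡ true) is -> length is ≡ pn -> ⊥) -> + E * ∑ (allFin n) (ind ∘ S) ≤ + n
     sparse S free = independence (+ E) q g (∑ (allFin n) (ind ∘ S)) (∑ vs (λ v -> ind (shadow v))) (+ k n) (+ n) (+ N) 1≤g 0≤ℕ 0≤ℕ 0≤ℕ Eq≤g
         (≤r (cong (λ l -> + E * + 4 * g * ∑ l (λ v -> ind (shadow v))) (sym verts≡)) ⟫ few shadow shadow-free ⟫ ≤r (cong (λ l -> (g + + E * + 4 * q) * + length l) verts≡))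
         (∑-mono (allFin n) shadow-place ⟫ ∑-place≤ n (λ v -> ind (shadow v)) (λ v -> 0≤ind (shadow v)))
         (kN≤n n) (≤r Nℤ ⟫ n≥₂)
       where
       open Fibres _≟_ (place n) S
       shadow-free : ∀ us -> AllPairs (λ u v -> joined u v ≡ true) us -> All (λ u -> shadow u ≡ true) us -> length us ≡ pn -> ⊥
       shadow-free us cl sh len = go (lift us sh)
         where
         go : (∃ λ is -> map (place n) is ≡ us × All (λ i -> S i ≡ true) is) -> ⊥
         go (is , e , al) = free is (APₚ.map⁻ (subst (AllPairs (λ u v -> joined u v ≡ true)) (sym e) cl)) al (trans (sym (Lₚ.length-map (place n) is)) (trans (cong length e) len))

   lower-witnesses : ∃ λ n₀ -> ∀ n -> n₀ ℕ.≤ n -> LowerWitness pn K E d h a n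
   lower-witnesses = proj₁ t , λ n k -> go verts refl n (proj₂ t n k)
     where
     t : _
     t = threshold h a (+ d) o 1≤h 1≤a (+≤+ 1≤d) 1≤o
     go : ∀ l -> verts ≡ l -> ∀ n -> + 2 * (h * o) * (h * a * + d) ≤ + n × h * o ≤ + n × h * h ≤ + n -> LowerWitness pn K E d h a n
     go [] e n hn = ⊥-elim (1≰0 (1≤-* 1≤h 1≤o ⟫ ≤r (sym length-verts) ⟫ ≤r (cong (λ l -> + length l) e)))
     go (v₀ ∷ rest) e n hn = blow-up v₀ rest e n hn

 module _ (q : ℕ) (rotor : Rotor q) (E₄ g : ℕ) (1≤E₄ : 1 ℕ.≤ E₄) (1≤g : 1 ℕ.≤ g) (s : ℕ) where
   open ModelDensity q rotor E₄ g 1≤E₄ 1≤g s hiding (1≤g)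

   length-verts′ : ∀ h -> h ≡ c -> + length verts ≡ h * |Ω|
   length-verts′ h refl = length-verts

   few′ : ∀ x -> + E₄ ≡ x -> ∀ A -> CliqueFree A -> x * + g * ∑ verts (λ u -> ind (A u)) ≤ (+ g + x * + q) * + length verts
   few′ x refl = few

   many′ : ∀ h a -> h ≡ c -> a ≡ h - (+ suc q + + q) -> (+ g * (h * a) - + 4 * (+ suc q * (+ suc q * + q))) * (|Ω| * |Ω|) ≤ + g * edge-sum
   many′ h a refl refl = many-edges

   as-template : ∀ E d h a -> h ≡ (+ suc q + + q) * (+ s + 1ℤ) + 1ℤ -> a ≡ h - (+ suc q + + q) -> + E₄ ≡ + E * + 4 -> + 2 ≤ h -> 1ℤ ≤ a ->
     + 4 * (+ suc q * (+ suc q * + q)) * + d ≤ + g -> + E * + 4 * + q ≤ + g -> Template (suc q) (suc q ℕ.* suc s ℕ.+ 2) E d h a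
   as-template E d h a h≡ a≡ E≡ 2≤h 1≤a Dd≤g Eq≤g = record
     { V = Vertex ; _≟_ = _≟ⱽ_ ; verts = verts ; joined = joined ; joined-sym = joined-sym ; joined-irrefl = joined-irrefl
     ; no-clique = no-clique ; g = + g ; D = + 4 * (+ suc q * (+ suc q * + q)) ; o = |Ω| ; q = + q
     ; 1≤g = +≤+ 1≤g ; 1≤o = 1≤|Ω| ; 2≤h = 2≤h ; 1≤a = 1≤a ; Dd≤g = Dd≤g ; Eq≤g = Eq≤g
     ; length-verts = length-verts′ h h≡ ; few = few′ (+ E * + 4) E≡ ; many = many′ h a h≡ a≡ }

 module _ (q : ℕ) (rotor : Rotor q) (E d : ℕ) (1≤E : 1 ℕ.≤ E) (1≤d : 1 ℕ.≤ d) (s : ℕ) where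
   private
     1≤*ℕ : ∀ {x y} -> 1 ℕ.≤ x -> 1 ℕ.≤ y -> 1 ℕ.≤ x ℕ.* y
     1≤*ℕ x y = N.*-mono-≤ x y

     -- `E₄` makes up for the losses in `independence`. The product `g` is large enough both for the
     -- density error 4p²q/g to be at most 1/d and for the nongeneric points to be negligible at
     -- scale 1/E₄.
     module Choice (E₄ g : ℕ) (E₄≡ : E₄ ≡ E ℕ.* 4) (g≡ : g ≡ 4 ℕ.* (suc q ℕ.* (suc q ℕ.* q)) ℕ.* (d ℕ.* E₄))
                   (h a : ℤ) (h≡ : h ≡ (+ suc q + + q) * (+ s + 1ℤ) + 1ℤ) (a≡ : a ≡ h - (+ suc q + + q)) where

       1≤E₄ : 1 ℕ.≤ E₄
       1≤E₄ = subst (1 ℕ.≤_) (sym E₄≡) (1≤*ℕ 1≤E (ℕ.s≤s ℕ.z≤n))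

       1≤g : 1 ℕ.≤ g
       1≤g = subst (1 ℕ.≤_) (sym g≡) (1≤*ℕ (1≤*ℕ {4} (ℕ.s≤s ℕ.z≤n) (1≤*ℕ {suc q} (ℕ.s≤s ℕ.z≤n) (1≤*ℕ {suc q} (ℕ.s≤s ℕ.z≤n) (Rotor.1≤q rotor)))) (1≤*ℕ 1≤d 1≤E₄))

       E₄ℤ : + E₄ ≡ + E * + 4
       E₄ℤ = trans (cong +_ E₄≡) (Z.pos-* E 4)

       gℤ : + g ≡ + 4 * (+ suc q * (+ suc q * + q)) * (+ d * + E₄)
       gℤ = trans (cong +_ g≡) (trans (Z.pos-* (4 ℕ.* (suc q ℕ.* (suc q ℕ.* q))) (d ℕ.* E₄)) (cong₂ _*_ (trans (Z.pos-* 4 (suc q ℕ.* (suc q ℕ.* q))) (cong (+ 4 *_) (trans (Z.pos-* (suc q) (suc q ℕ.* q)) (cong (+ suc q *_) (Z.pos-* (suc q) q)))))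
             (Z.pos-* d E₄)))

       scaled : ∀ p q d F E g -> 1ℤ ≤ p -> 0ℤ ≤ q -> 1ℤ ≤ d -> 1ℤ ≤ F -> F ≡ E * + 4 -> g ≡ + 4 * (p * (p * q)) * (d * F) -> + 4 * (p * (p * q)) * d ≤ g × E * + 4 * q ≤ g
       scaled p q d F E g 1≤p 0≤q 1≤d 1≤F refl refl =
           by (0≤-* (0≤-* (0≤-* {+ 4} 0≤ℕ (0≤-* (1≤⇒0≤ 1≤p) (0≤-* (1≤⇒0≤ 1≤p) 0≤q))) (1≤⇒0≤ 1≤d)) (0≤-- 1≤F)) (e₁ p q d (E * + 4))
         , by (0≤-* (0≤-* (1≤⇒0≤ 1≤F) 0≤q) (0≤-- (1≤-* (1≤-* (1≤-* {+ 4} (+≤+ (ℕ.s≤s ℕ.z≤n)) 1≤p) 1≤p) 1≤d))) (e₂ p q d (E * + 4))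
         where
         e₁ : ∀ p q d F -> + 4 * (p * (p * q)) * (d * F) ≡ + 4 * (p * (p * q)) * d + + 4 * (p * (p * q)) * d * (F - 1ℤ)
         e₁ = solve 4 (λ p q d F -> :4 :* (p :* (p :* q)) :* (d :* F) := :4 :* (p :* (p :* q)) :* d :+ :4 :* (p :* (p :* q)) :* d :* (F :- :1)) refl
         e₂ : ∀ p q d F -> + 4 * (p * (p * q)) * (d * F) ≡ F * q + F * q * (+ 4 * p * p * d - 1ℤ)
         e₂ = solve 4 (λ p q d F -> :4 :* (p :* (p :* q)) :* (d :* F) := F :* q :+ F :* q :* (:4 :* p :* p :* d :- :1)) refl

       large : + 4 * (+ suc q * (+ suc q * + q)) * + d ≤ + g × + E * + 4 * + q ≤ + g
       large = scaled (+ suc q) (+ q) (+ d) (+ E₄) (+ E) (+ g) (+≤+ (ℕ.s≤s ℕ.z≤n)) 0≤ℕ (+≤+ 1≤d) (+≤+ 1≤E₄) E₄ℤ gℤ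

       counts : ∀ u s h a -> 1ℤ ≤ u -> 0ℤ ≤ s -> h ≡ u * (s + 1ℤ) + 1ℤ -> a ≡ h - u -> + 2 ≤ h × 1ℤ ≤ a
       counts u s h a 1≤u 0≤s refl refl = by (0≤-+ (0≤-- 1≤u) (0≤-* (1≤⇒0≤ 1≤u) 0≤s)) (e₁ u s) , by (0≤-* (1≤⇒0≤ 1≤u) 0≤s) (e₂ u s)
         where
         e₁ : ∀ u s -> u * (s + 1ℤ) + 1ℤ ≡ + 2 + (u - 1ℤ + u * s)
         e₁ = solve 2 (λ u s -> u :* (s :+ :1) :+ :1 := :2 :+ (u :- :1 :+ u :* s)) refl
         e₂ : ∀ u s -> u * (s + 1ℤ) + 1ℤ - u ≡ 1ℤ + u * s
         e₂ = solve 2 (λ u s -> u :* (s :+ :1) :+ :1 :- u := :1 :+ u :* s) refl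

       sizes : + 2 ≤ h × 1ℤ ≤ a
       sizes = counts (+ suc q + + q) (+ s) h a (+≤+ (ℕ.s≤s ℕ.z≤n)) 0≤ℕ h≡ a≡

       template : Template (suc q) (suc q ℕ.* suc s ℕ.+ 2) E d h a
       template = as-template q rotor E₄ g 1≤E₄ 1≤g s E d h a h≡ a≡ E₄ℤ (proj₁ sizes) (proj₂ sizes) (proj₁ large) (proj₂ large)

   lower-graphs : ∀ h a -> h ≡ (+ suc q + + q) * (+ s + 1ℤ) + 1ℤ -> a ≡ h - (+ suc q + + q) -> ∃ λ n₀ -> ∀ n -> n₀ ℕ.≤ n -> LowerWitness (suc q) (suc q ℕ.* suc s ℕ.+ 2) E d h a n
   lower-graphs h a h≡ a≡ = lower-witnesses 1≤d (Choice.template (E ℕ.* 4) (4 ℕ.* (suc q ℕ.* (suc q ℕ.* q)) ℕ.* (d ℕ.* (E ℕ.* 4))) refl refl h a h≡ a≡)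

 -- Translation to graphs, subsets and rational numbers

 ∑-sum : ∀ {A : Set} (xs : List A) (f : A -> ℕ) -> + sum (map f xs) ≡ ∑ xs (λ x -> + f x)
 ∑-sum [] f = refl
 ∑-sum (x ∷ xs) f = cong (λ z -> + f x + z) (∑-sum xs f)

 +-if : ∀ b -> + (if b then 1 else 0) ≡ ind b
 +-if true = refl
 +-if false = refl

 choose-two : ∀ n -> + 2 * + (n Comb.C 2) ≡ + n * (+ n - 1ℤ)
 choose-two zero = refl
 choose-two (suc n) = trans (cong (λ c -> + 2 * + c) (sym (Comb.nCk+nC[k+1]≡[n+1]C[k+1] n 1))) (trans (cong (λ c -> + 2 * (+ c + + (n Comb.C 2))) (Comb.nC1≡n n))
    (trans (Z.*-distribˡ-+ (+ 2) (+ n) (+ (n Comb.C 2))) (trans (cong (λ z -> + 2 * + n + z) (choose-two n)) (e (+ n)))))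
   where
   e : ∀ n -> + 2 * n + n * (n - 1ℤ) ≡ (1ℤ + n) * (1ℤ + n - 1ℤ)
   e = solve 1 (λ n -> :2 :* n :+ n :* (n :- :1) := (:1 :+ n) :* (:1 :+ n :- :1)) refl

 module _ {n : ℕ} (G : D.Graph n) where

   Edge : Fin n -> Fin n -> Set
   Edge i j = D.adj G i j ≡ true

   edge-sym : ∀ {i j} -> Edge i j -> Edge j i
   edge-sym {i} {j} h = trans (D.sym G j i) h

   edge-total : ℤ
   edge-total = ∑ (allFin n) (λ i -> ∑ (allFin n) (λ j -> ind (D.adj G i j)))

   edges-twice : + 2 * + D.edges G ≡ edge-total
   edges-twice = trans (e (+ D.edges G)) (trans (cong₂ _+_ forward (trans forward (∑-swap (allFin n) (allFin n) up))) (trans (sym (∑-+ (allFin n) (λ i -> ∑ (allFin n) (up i)) (λ i -> ∑ (allFin n) (λ j -> up j i))))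
       (∑-cong (allFin n) (λ i -> trans (sym (∑-+ (allFin n) (up i) (λ j -> up j i))) (∑-cong (allFin n) (both i))))))
     where
     e : ∀ x -> + 2 * x ≡ x + x
     e = solve 1 (λ x -> :2 :* x := x :+ x) refl
     up : Fin n -> Fin n -> ℤ
     up i j = ind (D.adj G i j ∧ (toℕ i ℕ.<ᵇ toℕ j))
     forward : + D.edges G ≡ ∑ (allFin n) (λ i -> ∑ (allFin n) (up i))
     forward = trans (∑-sum (allFin n) _) (∑-cong (allFin n) (λ i -> trans (∑-sum (allFin n) _) (∑-cong (allFin n) (λ j -> +-if (D.adj G i j ∧ (toℕ i ℕ.<ᵇ toℕ j))))))
     order : ∀ x y -> ((x ℕ.<ᵇ y) ≡ true × (y ℕ.<ᵇ x) ≡ false) ⊎ ((x ℕ.<ᵇ y) ≡ false × (y ℕ.<ᵇ x) ≡ true) ⊎ x ≡ y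
     order zero zero = inj₂ (inj₂ refl)
     order zero (suc y) = inj₁ (refl , refl)
     order (suc x) zero = inj₂ (inj₁ (refl , refl))
     order (suc x) (suc y) = go (order x y)
       where
       go : _ -> _
       go (inj₁ h) = inj₁ h
       go (inj₂ (inj₁ h)) = inj₂ (inj₁ h)
       go (inj₂ (inj₂ h)) = inj₂ (inj₂ (cong suc h))
     both : ∀ i j -> up i j + up j i ≡ ind (D.adj G i j)
     both i j = trans (cong (λ b -> up i j + ind (b ∧ (toℕ j ℕ.<ᵇ toℕ i))) (D.sym G j i)) (go (order (toℕ i) (toℕ j)))
       where
       join : ∀ a {b c} -> b ≡ true -> c ≡ false -> ind (a ∧ b) + ind (a ∧ c) ≡ ind a
       join true refl refl = refl
       join false refl refl = refl
       go : _ -> ind (D.adj G i j ∧ (toℕ i ℕ.<ᵇ toℕ j)) + ind (D.adj G i j ∧ (toℕ j ℕ.<ᵇ toℕ i)) ≡ ind (D.adj G i j)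
       go (inj₁ (h , k)) = join (D.adj G i j) h k
       go (inj₂ (inj₁ (h , k))) = trans (Z.+-comm (ind (D.adj G i j ∧ (toℕ i ℕ.<ᵇ toℕ j))) (ind (D.adj G i j ∧ (toℕ j ℕ.<ᵇ toℕ i)))) (join (D.adj G i j) k h)
       go (inj₂ (inj₂ h)) = loop (D.adj G i j) (trans (cong (D.adj G i) (sym (Fₚ.toℕ-injective h))) (D.irrefl G i))
         where
         loop : ∀ a {b c} -> a ≡ false -> ind (a ∧ b) + ind (a ∧ c) ≡ ind a
         loop false _ = refl

   list⇒clique : ∀ {k} l -> AllPairs Edge l -> length l ≡ k -> D.HasClique G k
   list⇒clique l h refl = lookup l , λ i j -> all-lookup edge-sym h i j

   clique⇒list : ∀ {k} -> D.HasClique G k -> ∃ λ l -> AllPairs Edge l × length l ≡ k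
   clique⇒list (f , h) = L.tabulate f , APₚ.tabulate⁺ (λ {i} {j} n -> h i j n) , Lₚ.length-tabulate f

   member : Subset.Subset n -> Fin n -> Bool
   member U i = V.lookup U i

   list⇒cliqueIn : ∀ {k} U l -> AllPairs Edge l -> All (λ i -> member U i ≡ true) l -> length l ≡ k -> D.HasCliqueIn G k U
   list⇒cliqueIn U l h a refl = lookup l , (λ i -> Vₚ.lookup⇒[]= (lookup l i) U (All.lookup a (∈ₚ.∈-lookup i))) , λ i j -> all-lookup edge-sym h i j

   cliqueIn⇒list : ∀ {k} U -> D.HasCliqueIn G k U -> ∃ λ l -> AllPairs Edge l × All (λ i -> member U i ≡ true) l × length l ≡ k
   cliqueIn⇒list U (f , u , h) = L.tabulate f , APₚ.tabulate⁺ (λ {i} {j} n -> h i j n) , Allₚ.tabulate⁺ (λ i -> Vₚ.[]=⇒lookup (u i)) , Lₚ.length-tabulate f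

 card-∑ : ∀ {n} (U : Subset.Subset n) -> + Subset.∣_∣ U ≡ ∑ (allFin n) (λ i -> ind (V.lookup U i))
 card-∑ {zero} V.[] = refl
 card-∑ {suc n} (b V.∷ U) = trans (go b) (sym (∑-allFin-suc n (λ i -> ind (V.lookup (b V.∷ U) i))))
   where
   go : ∀ b -> + Subset.∣_∣ (b V.∷ U) ≡ ind b + ∑ (allFin n) (λ i -> ind (V.lookup U i))
   go true = cong (λ z -> 1ℤ + z) (card-∑ U)
   go false = trans (card-∑ U) (sym (Z.+-identityˡ (∑ (allFin n) (λ i -> ind (V.lookup U i)))))

 card-tabulate : ∀ {n} (S : Fin n -> Bool) -> + Subset.∣_∣ (V.tabulate S) ≡ ∑ (allFin n) (ind ∘ S)
 card-tabulate {n} S = trans (card-∑ (V.tabulate S)) (∑-cong (allFin n) (λ i -> cong ind (Vₚ.lookup∘tabulate S i)))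

 open ℚSolver.+-*-Solver using () renaming (solve to solveℚ; _:+_ to _⊹_; _:*_ to _⊛_; _:=_ to _≐_; _:-_ to _⊖_; :-_ to ⊝_)
 import Data.Nat.Coprimality as Coprime
 import Data.Integer.Base as ℤ

 ι : ℤ -> ℚ
 ι z = z ℚ./ 1

 ι-mk : ∀ z -> ι z ≡ mkℚ z 0 (Coprime.sym (Coprime.1-coprimeTo ∣ z ∣))
 ι-mk z = Q.↥p/↧p≡p (mkℚ z 0 (Coprime.sym (Coprime.1-coprimeTo ∣ z ∣)))

 ι-* : ∀ x y -> ι (x * y) ≡ ι x ℚ.* ι y
 ι-* x y = sym (cong₂ ℚ._*_ (ι-mk x) (ι-mk y))

 ι-+ : ∀ x y -> ι (x + y) ≡ ι x ℚ.+ ι y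
 ι-+ x y = sym (trans (cong₂ ℚ._+_ (ι-mk x) (ι-mk y)) (cong ι (cong₂ _+_ (Z.*-identityʳ x) (Z.*-identityʳ y))))

 ι-mono : ∀ {x y} -> x ≤ y -> ι x ℚ.≤ ι y
 ι-mono {x} {y} h = subst₂ ℚ._≤_ (sym (ι-mk x)) (sym (ι-mk y)) (*≤* (subst₂ _≤_ (sym (Z.*-identityʳ x)) (sym (Z.*-identityʳ y)) h))

 ι-cancel-< : ∀ {x y} -> ι x ℚ.< ι y -> x < y
 ι-cancel-< {x} {y} h = subst₂ _<_ (Z.*-identityʳ x) (Z.*-identityʳ y) (Q.drop-*<* (subst₂ ℚ._<_ (ι-mk x) (ι-mk y) h))

 ι-positive : ∀ {k} -> ℚ.Positive (ι (+ suc k))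
 ι-positive {k} = subst ℚ.Positive (sym (ι-mk (+ suc k))) _

 ι-nonneg : ∀ {k} -> ℚ.NonNegative (ι (+ k))
 ι-nonneg {k} = subst ℚ.NonNegative (sym (ι-mk (+ k))) _

 -- A normalised fraction hides its original denominator, so the identity is checked on unnormalised
 -- fractions.
 clear-denominator : ∀ z k -> (z ℚ./ suc k) ℚ.* ι (+ suc k) ≡ ι z
 clear-denominator z k = Q.toℚᵘ-injective (ℚᵘₚ.≃-trans (Q.toℚᵘ-homo-* (z ℚ./ suc k) (ι (+ suc k)))
    (ℚᵘₚ.≃-trans (ℚᵘₚ.*-cong (Q.toℚᵘ-fromℚᵘ (ℚᵘ.mkℚᵘ z k)) (Q.toℚᵘ-fromℚᵘ (ℚᵘ.mkℚᵘ (+ suc k) 0)))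
      (ℚᵘₚ.≃-trans (ℚᵘ.*≡* (e z (+ suc k))) (ℚᵘₚ.≃-sym (Q.toℚᵘ-fromℚᵘ (ℚᵘ.mkℚᵘ z 0))))))
   where
   e : ∀ z k -> z * k * 1ℤ ≡ z * (k * 1ℤ)
   e = solve 2 (λ z k -> z :* k :* :1 := z :* (k :* :1)) refl

 1≤numerator : ∀ δ -> 0ℚ ℚ.< δ -> ∃ λ k -> ι 1ℤ ℚ.≤ δ ℚ.* ι (+ suc k)
 1≤numerator δ@(mkℚ (+ suc n) k _) h = k , Q.≤-trans (ι-mono {1ℤ} {+ suc n} (+≤+ (ℕ.s≤s ℕ.z≤n))) (Q.≤-reflexive (sym (trans (cong (ℚ._* ι (+ suc k)) (sym (Q.↥p/↧p≡p δ))) (clear-denominator (+ suc n) k))))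
 1≤numerator (mkℚ (+ zero) k _) (*<* (ℤ.+<+ ()))
 1≤numerator (mkℚ -[1+ n ] k _) (*<* ())

 module _ (R δ : ℚ) (a h′ k : ℕ) (R≡ : R ℚ.* ι (+ suc h′) ≡ ι (+ a)) (1≤δ : ι 1ℤ ℚ.≤ δ ℚ.* ι (+ suc k)) where
   private
     H Dn : ℚ
     H = ι (+ suc h′)
     Dn = ι (+ suc k)

     scale : ℚ
     scale = H ℚ.* Dn

     scale-positive : ℚ.Positive scale
     scale-positive = Q.pos*pos⇒pos H {{ι-positive {h′}}} Dn {{ι-positive {k}}}

     identity : ∀ R δ C H D -> (R ℚ.+ δ) ℚ.* C ℚ.* (H ℚ.* D) ≡ R ℚ.* H ℚ.* (D ℚ.* C) ℚ.+ δ ℚ.* D ℚ.* (H ℚ.* C)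
     identity = solveℚ 5 (λ R δ C H D -> (R ⊹ δ) ⊛ C ⊛ (H ⊛ D) ≐ R ⊛ H ⊛ (D ⊛ C) ⊹ δ ⊛ D ⊛ (H ⊛ C)) refl

     identity′ : ∀ e δ C H D -> (e ℚ.+ δ ℚ.* C) ℚ.* (H ℚ.* D) ≡ e ℚ.* (H ℚ.* D) ℚ.+ δ ℚ.* D ℚ.* (H ℚ.* C)
     identity′ = solveℚ 5 (λ e δ C H D -> (e ⊹ δ ⊛ C) ⊛ (H ⊛ D) ≐ e ⊛ (H ⊛ D) ⊹ δ ⊛ D ⊛ (H ⊛ C)) refl

     identity″ : ∀ R C H D -> R ℚ.* C ℚ.* (H ℚ.* D) ≡ R ℚ.* H ℚ.* (D ℚ.* C)
     identity″ = solveℚ 4 (λ R C H D -> R ⊛ C ⊛ (H ⊛ D) ≐ R ⊛ H ⊛ (D ⊛ C)) refl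

     absorb : ∀ C -> ι (+ suc h′ * + C) ℚ.≤ δ ℚ.* Dn ℚ.* (H ℚ.* ι (+ C))
     absorb C = Q.≤-trans (Q.≤-reflexive (trans (ι-* (+ suc h′) (+ C)) (sym (trans (cong (ℚ._* (H ℚ.* ι (+ C))) (ι-mk 1ℤ)) (Q.*-identityˡ (H ℚ.* ι (+ C)))))))
       (Q.*-monoʳ-≤-nonNeg (H ℚ.* ι (+ C)) {{subst ℚ.NonNegative (trans (cong ι (Z.pos-* (suc h′) C)) (ι-* (+ suc h′) (+ C))) (ι-nonneg {suc h′ ℕ.* C})}} 1≤δ)

     product : ∀ x y z -> ι (x * (y * z)) ≡ ι x ℚ.* (ι y ℚ.* ι z)
     product x y z = trans (ι-* x (y * z)) (cong (ι x ℚ.*_) (ι-* y z))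

   -- Everything is multiplied by (h′ + 1)(k + 1). The integer error term (h′ + 1)C stands for the
   -- density 1/(k + 1), which is at most δ.
   upper-ratio : ∀ e C -> + e * (+ suc h′ * + suc k) ≤ + a * (+ suc k * + C) + + suc h′ * + C -> ι (+ e) ℚ.≤ (R ℚ.+ δ) ℚ.* ι (+ C)
   upper-ratio e C h = Q.*-cancelʳ-≤-pos scale {{scale-positive}} (Q.≤-trans (Q.≤-reflexive (sym (product (+ e) (+ suc h′) (+ suc k))))
      (Q.≤-trans (ι-mono {+ e * (+ suc h′ * + suc k)} {+ a * (+ suc k * + C) + + suc h′ * + C} h) (Q.≤-trans (Q.≤-reflexive (ι-+ (+ a * (+ suc k * + C)) (+ suc h′ * + C)))
        (Q.≤-trans (Q.+-mono-≤ (Q.≤-reflexive (trans (product (+ a) (+ suc k) (+ C)) (cong (ℚ._* (Dn ℚ.* ι (+ C))) (sym R≡)))) (absorb C)) (Q.≤-reflexive (sym (identity R δ (ι (+ C)) H Dn)))))))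

   lower-ratio : ∀ e C -> + a * (+ suc k * + C) ≤ + e * (+ suc h′ * + suc k) + + suc h′ * + C -> (R ℚ.- δ) ℚ.* ι (+ C) ℚ.≤ ι (+ e)
   lower-ratio e C h = Q.≤-trans (Q.≤-reflexive (e₁ R δ (ι (+ C)))) (Q.≤-trans (Q.+-monoˡ-≤ (ℚ.- (δ ℚ.* ι (+ C))) main) (Q.≤-reflexive (e₂ (ι (+ e)) (δ ℚ.* ι (+ C)))))
     where
     e₁ : ∀ R δ C -> (R ℚ.- δ) ℚ.* C ≡ R ℚ.* C ℚ.+ ℚ.- (δ ℚ.* C)
     e₁ = solveℚ 3 (λ R δ C -> (R ⊖ δ) ⊛ C ≐ R ⊛ C ⊹ (⊝ (δ ⊛ C))) refl
     e₂ : ∀ e x -> e ℚ.+ x ℚ.+ ℚ.- x ≡ e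
     e₂ = solveℚ 2 (λ e x -> e ⊹ x ⊹ (⊝ x) ≐ e) refl
     main : R ℚ.* ι (+ C) ℚ.≤ ι (+ e) ℚ.+ δ ℚ.* ι (+ C)
     main = Q.*-cancelʳ-≤-pos scale {{scale-positive}} (Q.≤-trans (Q.≤-reflexive (trans (identity″ R (ι (+ C)) H Dn) (trans (cong (ℚ._* (Dn ℚ.* ι (+ C))) R≡) (sym (product (+ a) (+ suc k) (+ C))))))
        (Q.≤-trans (ι-mono {+ a * (+ suc k * + C)} {+ e * (+ suc h′ * + suc k) + + suc h′ * + C} h) (Q.≤-trans (Q.≤-reflexive (ι-+ (+ e * (+ suc h′ * + suc k)) (+ suc h′ * + C)))
          (Q.≤-trans (Q.+-mono-≤ (Q.≤-reflexive (product (+ e) (+ suc h′) (+ suc k))) (absorb C)) (Q.≤-reflexive (sym (identity′ (ι (+ e)) δ (ι (+ C)) H Dn)))))))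

 strict-fraction : ∀ ε k x n -> ε ℚ.< (+ 1) ℚ./ suc k -> ι (+ x) ℚ.≤ ε ℚ.* ι (+ suc n) -> + suc k * + x + 1ℤ ≤ + suc n
 strict-fraction ε k x n ε< h = ≤r (Z.+-comm (+ suc k * + x) 1ℤ) ⟫ Z.i<j⇒suc[i]≤j (ι-cancel-< {+ suc k * + x} {+ suc n} (Q.≤-<-trans (Q.≤-reflexive (ι-* (+ suc k) (+ x)))
    (Q.≤-<-trans (Q.*-monoˡ-≤-nonNeg (ι (+ suc k)) {{ι-nonneg {suc k}}} h) (Q.<-≤-trans (Q.*-monoʳ-<-pos (ι (+ suc k)) {{ι-positive {k}}} (Q.*-monoˡ-<-pos (ι (+ suc n)) {{ι-positive {n}}} ε<))
      (Q.≤-reflexive (trans (e (ι (+ suc k)) ((+ 1) ℚ./ suc k) (ι (+ suc n))) (trans (cong (ℚ._* ι (+ suc n)) (clear-denominator (+ 1) k)) (trans (sym (ι-* 1ℤ (+ suc n))) (cong ι (Z.*-identityˡ (+ suc n)))))))))))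
   where
   e : ∀ k f n -> k ℚ.* (f ℚ.* n) ≡ f ℚ.* k ℚ.* n
   e = solveℚ 3 (λ k f n -> k ⊛ (f ⊛ n) ≐ f ⊛ k ⊛ n) refl

 weak-fraction : ∀ ε k x n -> ι 1ℤ ℚ.≤ ε ℚ.* ι (+ suc k) -> + suc k * + x ≤ + n -> ι (+ x) ℚ.≤ ε ℚ.* ι (+ n)
 weak-fraction ε k x n 1≤ε h = Q.*-cancelʳ-≤-pos (ι (+ suc k)) {{ι-positive {k}}} (Q.≤-trans (Q.≤-reflexive (trans (Q.*-comm (ι (+ x)) (ι (+ suc k))) (sym (ι-* (+ suc k) (+ x)))))
    (Q.≤-trans (ι-mono {+ suc k * + x} {+ n} h) (Q.≤-trans (Q.≤-reflexive (sym (trans (cong (ℚ._* ι (+ n)) (ι-mk 1ℤ)) (Q.*-identityˡ (ι (+ n)))))) (Q.≤-trans (Q.*-monoʳ-≤-nonNeg (ι (+ n)) {{ι-nonneg {n}}} 1≤ε) (Q.≤-reflexive (e ε (ι (+ suc k)) (ι (+ n))))))))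
   where
   e : ∀ ε k n -> ε ℚ.* k ℚ.* n ≡ ε ℚ.* n ℚ.* k
   e = solveℚ 3 (λ ε k n -> ε ⊛ k ⊛ n ≐ ε ⊛ n ⊛ k) refl

 halve-upper : ∀ hX aX h a d n c e total -> h ≡ hX -> a ≡ aX -> + 2 * e ≡ total -> + 2 * c ≡ n * (n - 1ℤ) ->
   total * (hX * d) ≤ (aX * d + hX) * (n * (n - 1ℤ)) -> e * (h * d) ≤ a * (d * c) + h * c
 halve-upper h a h a d n c e total refl refl refl c≡ le = ≤-cancelˡ (+ 2) (+≤+ (ℕ.s≤s ℕ.z≤n)) (≤r (e₁ e h d) ⟫ le ⟫ ≤r (trans (cong ((a * d + h) *_) (sym c≡)) (e₂ a d h c)))
   where
   e₁ : ∀ e h d -> + 2 * (e * (h * d)) ≡ + 2 * e * (h * d)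
   e₁ = solve 3 (λ e h d -> :2 :* (e :* (h :* d)) := :2 :* e :* (h :* d)) refl
   e₂ : ∀ a d h c -> (a * d + h) * (+ 2 * c) ≡ + 2 * (a * (d * c) + h * c)
   e₂ = solve 4 (λ a d h c -> (a :* d :+ h) :* (:2 :* c) := :2 :* (a :* (d :* c) :+ h :* c)) refl

 halve-lower : ∀ h a d n c e total -> + 2 * e ≡ total -> + 2 * c ≡ n * (n - 1ℤ) ->
   (a * d - h) * (n * (n - 1ℤ)) ≤ total * (h * d) -> a * (d * c) ≤ e * (h * d) + h * c
 halve-lower h a d n c e total refl c≡ le = ≤-cancelˡ (+ 2) (+≤+ (ℕ.s≤s ℕ.z≤n)) (by (0≤-- (≤r (cong ((a * d - h) *_) c≡) ⟫ le)) (e₁ a d h c e))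
   where
   e₁ : ∀ a d h c e -> + 2 * (e * (h * d) + h * c) ≡ + 2 * (a * (d * c)) + (+ 2 * e * (h * d) - (a * d - h) * (+ 2 * c))
   e₁ = solve 5 (λ a d h c e -> :2 :* (e :* (h :* d) :+ h :* c) := :2 :* (a :* (d :* c)) :+ (:2 :* e :* (h :* d) :- (a :* d :- h) :* (:2 :* c))) refl

 -- The double limit

 module _ (q : ℕ) (rotor : Rotor q) (2≤p : + 2 ≤ + suc q) (p≤4 : + suc q ≤ + 4) (s h′ a : ℕ)
          (h≡ : + suc h′ ≡ (+ 2 * + suc q - 1ℤ) * + suc s + 1ℤ) (a≡ : + a ≡ + suc h′ - (+ 2 * + suc q - 1ℤ)) where

   private
     p K : ℕ
     p = suc q
     K = suc q ℕ.* suc s ℕ.+ 2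

     R : ℚ
     R = (+ a) ℚ./ suc h′

     1≤suc : ∀ {k} -> 1 ℕ.≤ suc k
     1≤suc = ℕ.s≤s ℕ.z≤n

   upper-side : ∀ k -> ∃ λ κ -> ∀ ε n (G : D.Graph n) -> ε ℚ.< (+ 1) ℚ./ suc κ -> 8 ℕ.* suc k ℕ.≤ n -> D.KFree G K -> D.αLe G p (ε ℚ.* D.ℕ→ℚ n) ->
     + D.edges G * (+ suc h′ * + suc k) ≤ + a * (+ suc k * + (n Comb.C 2)) + + suc h′ * + (n Comb.C 2)
   upper-side k = go (UpperGraph.upper-graph p 2≤p p≤4 (suc s) (+≤+ 1≤suc) (suc k) 1≤suc)
     where
     go : _ -> _
     go (suc κ , _ , main) = κ , bound
       where
       bound : ∀ ε n (G : D.Graph n) -> ε ℚ.< (+ 1) ℚ./ suc κ -> 8 ℕ.* suc k ℕ.≤ n -> D.KFree G K -> D.αLe G p (ε ℚ.* D.ℕ→ℚ n) ->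
         + D.edges G * (+ suc h′ * + suc k) ≤ + a * (+ suc k * + (n Comb.C 2)) + + suc h′ * + (n Comb.C 2)
       bound ε zero G ε< () free α
       bound ε n@(suc n′) G ε< hn free α = halve-upper _ _ (+ suc h′) (+ a) (+ suc k) (+ n) (+ (n Comb.C 2)) (+ D.edges G) (edge-total G) h≡ (trans a≡ (cong (_- (+ 2 * + suc q - 1ℤ)) h≡)) (edges-twice G) (choose-two n)
           (main n (D.adj G) (D.sym G) (≤r (sym (Z.pos-* 8 (suc k))) ⟫ +≤+ hn) (λ l cl len -> free (list⇒clique G l cl len)) sparse)
         where
         sparse : ∀ S -> (∀ l -> AllPairs (Edge G) l -> All (λ u -> S u ≡ true) l -> length l ≡ p -> ⊥) -> + suc κ * ∑ (allFin n) (λ u -> ind (S u)) + 1ℤ ≤ + n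
         sparse S none = ≤r (cong (λ z -> + suc κ * z + 1ℤ) (sym (card-tabulate S))) ⟫ strict-fraction ε κ (Subset.∣_∣ (V.tabulate S)) n′ ε< (α (V.tabulate S) no-clique)
           where
           no-clique : ¬ D.HasCliqueIn G p (V.tabulate S)
           no-clique c = go′ (cliqueIn⇒list G (V.tabulate S) c)
             where
             go′ : _ -> ⊥
             go′ (l , cl , al , len) = none l cl (All.map (λ {i} e -> trans (sym (Vₚ.lookup∘tabulate S i)) e) al) len

   lower-side : ∀ k κ -> ∃ λ n₀ -> ∀ ε n -> ι 1ℤ ℚ.≤ ε ℚ.* ι (+ suc κ) -> n₀ ℕ.≤ n -> Σ (D.Graph n) λ G -> D.KFree G K × D.αLe G p (ε ℚ.* D.ℕ→ℚ n) ×
     + a * (+ suc k * + (n Comb.C 2)) ≤ + D.edges G * (+ suc h′ * + suc k) + + suc h′ * + (n Comb.C 2)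
   lower-side k κ = proj₁ found , λ ε n 1≤ε hn -> build ε n 1≤ε (proj₂ found n hn)
     where
     e₁ : ∀ q s -> (+ 2 * (1ℤ + q) - 1ℤ) * (1ℤ + s) + 1ℤ ≡ (1ℤ + q + q) * (s + 1ℤ) + 1ℤ
     e₁ = solve 2 (λ q s -> (:2 :* (:1 :+ q) :- :1) :* (:1 :+ s) :+ :1 := (:1 :+ q :+ q) :* (s :+ :1) :+ :1) refl
     e₂ : ∀ h q -> h - (+ 2 * (1ℤ + q) - 1ℤ) ≡ h - (1ℤ + q + q)
     e₂ = solve 2 (λ h q -> h :- (:2 :* (:1 :+ q) :- :1) := h :- (:1 :+ q :+ q)) refl
     found : ∃ λ n₀ -> ∀ n -> n₀ ℕ.≤ n -> LowerWitness p K (suc κ) (suc k) (+ suc h′) (+ a) n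
     found = lower-graphs q rotor (suc κ) (suc k) 1≤suc 1≤suc s (+ suc h′) (+ a) (trans h≡ (e₁ (+ q) (+ s))) (trans a≡ (e₂ (+ suc h′) (+ q)))
     build : ∀ ε n -> ι 1ℤ ℚ.≤ ε ℚ.* ι (+ suc κ) -> LowerWitness p K (suc κ) (suc k) (+ suc h′) (+ a) n -> Σ (D.Graph n) λ G -> D.KFree G K × D.αLe G p (ε ℚ.* D.ℕ→ℚ n) ×
       + a * (+ suc k * + (n Comb.C 2)) ≤ + D.edges G * (+ suc h′ * + suc k) + + suc h′ * + (n Comb.C 2)
     build ε n 1≤ε w = G , free , α , halve-lower (+ suc h′) (+ a) (+ suc k) (+ n) (+ (n Comb.C 2)) (+ D.edges G) (edge-total G) (edges-twice G) (choose-two n) dense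
       where
       open LowerWitness w
       G : D.Graph n
       G = record { adj = adj ; sym = adj-sym ; irrefl = adj-irrefl }
       free : D.KFree G K
       free c = clique-free (proj₁ (clique⇒list G c)) (proj₁ (proj₂ (clique⇒list G c))) (proj₂ (proj₂ (clique⇒list G c)))
       α : D.αLe G p (ε ℚ.* D.ℕ→ℚ n)
       α U none = weak-fraction ε κ (Subset.∣_∣ U) n 1≤ε (≤r (cong (+ suc κ *_) (card-∑ U)) ⟫ sparse (V.lookup U) (λ l cl al len -> none (list⇒cliqueIn G U l cl al len)))

   rho : D.RhoIs p K R
   -- The threshold for ε comes from the upper bound alone: the construction works for every
   -- positive ε, with the number of vertices depending on it.
   rho δ 0<δ = (+ 1) ℚ./ suc κ , positive , large
     where
     k κ : ℕ
     k = proj₁ (1≤numerator δ 0<δ)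
     κ = proj₁ (upper-side k)
     R≡ : R ℚ.* ι (+ suc h′) ≡ ι (+ a)
     R≡ = clear-denominator (+ a) h′
     positive : 0ℚ ℚ.< (+ 1) ℚ./ suc κ
     positive = Q.*-cancelʳ-<-nonNeg (ι (+ suc κ)) {{ι-nonneg {suc κ}}} (subst₂ ℚ._<_ (sym (Q.*-zeroˡ (ι (+ suc κ)))) (sym (clear-denominator (+ 1) κ)) (*<* (ℤ.+<+ (ℕ.s≤s ℕ.z≤n))))
     large : ∀ ε -> 0ℚ ℚ.< ε -> ε ℚ.< (+ 1) ℚ./ suc κ -> Σ ℕ λ N -> ∀ n -> N ℕ.≤ n ->
       (∀ (G : D.Graph n) -> D.KFree G K -> D.αLe G p (ε ℚ.* D.ℕ→ℚ n) -> D.ℕ→ℚ (D.edges G) ℚ.≤ (R ℚ.+ δ) ℚ.* D.ℕ→ℚ (n Comb.C 2))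
       × Σ (D.Graph n) λ G -> D.KFree G K × D.αLe G p (ε ℚ.* D.ℕ→ℚ n) × (R ℚ.- δ) ℚ.* D.ℕ→ℚ (n Comb.C 2) ℚ.≤ D.ℕ→ℚ (D.edges G)
     large ε 0<ε ε< = 8 ℕ.* suc k ℕ.+ proj₁ lows , λ n hn ->
         (λ G free α -> upper-ratio R δ a h′ k R≡ (proj₂ (1≤numerator δ 0<δ)) (D.edges G) (n Comb.C 2) (proj₂ (upper-side k) ε n G ε< (N.≤-trans (N.m≤m+n (8 ℕ.* suc k) (proj₁ lows)) hn) free α))
       , witness n (proj₂ lows ε n (proj₂ (1≤numerator ε 0<ε)) (N.≤-trans (N.m≤n+m (proj₁ lows) (8 ℕ.* suc k)) hn))
       where
       lows : _
       lows = lower-side k (proj₁ (1≤numerator ε 0<ε))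
       witness : ∀ n -> (Σ (D.Graph n) λ G -> D.KFree G K × D.αLe G p (ε ℚ.* D.ℕ→ℚ n) × + a * (+ suc k * + (n Comb.C 2)) ≤ + D.edges G * (+ suc h′ * + suc k) + + suc h′ * + (n Comb.C 2)) ->
         Σ (D.Graph n) λ G -> D.KFree G K × D.αLe G p (ε ℚ.* D.ℕ→ℚ n) × (R ℚ.- δ) ℚ.* D.ℕ→ℚ (n Comb.C 2) ℚ.≤ D.ℕ→ℚ (D.edges G)
       witness n (G , free , α , le) = G , free , α , lower-ratio R δ a h′ k R≡ (proj₂ (1≤numerator δ 0<δ)) (D.edges G) (n Comb.C 2) le

 rho₃ : ∀ t -> 1 ℕ.≤ t -> D.RhoIs 3 (3 ℕ.* t ℕ.+ 2) ((+ (5 ℕ.* t ℕ.∸ 4)) ℚ./ suc (5 ℕ.* t))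
 rho₃ (suc s) _ = rho 2 rotor₃ (+≤+ (ℕ.s≤s (ℕ.s≤s ℕ.z≤n))) (+≤+ (ℕ.s≤s (ℕ.s≤s (ℕ.s≤s ℕ.z≤n)))) s (5 ℕ.* suc s) (5 ℕ.* suc s ℕ.∸ 4)
    (trans (Z.+-comm 1ℤ (+ (5 ℕ.* suc s))) (cong (_+ 1ℤ) (Z.pos-* 5 (suc s)))) (trans (cong (λ x -> + (x ℕ.∸ 4)) (N.*-suc 5 s)) (cong (λ x -> + suc x - + 5) (sym (N.*-suc 5 s))))

 rho₄ : ∀ t -> 1 ℕ.≤ t -> D.RhoIs 4 (4 ℕ.* t ℕ.+ 2) ((+ (7 ℕ.* t ℕ.∸ 6)) ℚ./ suc (7 ℕ.* t))
 rho₄ (suc s) _ = rho 3 rotor₄ (+≤+ (ℕ.s≤s (ℕ.s≤s ℕ.z≤n))) (+≤+ (ℕ.s≤s (ℕ.s≤s (ℕ.s≤s (ℕ.s≤s ℕ.z≤n))))) s (7 ℕ.* suc s) (7 ℕ.* suc s ℕ.∸ 6)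
    (trans (Z.+-comm 1ℤ (+ (7 ℕ.* suc s))) (cong (_+ 1ℤ) (Z.pos-* 7 (suc s)))) (trans (cong (λ x -> + (x ℕ.∸ 6)) (N.*-suc 7 s)) (cong (λ x -> + suc x - + 7) (sym (N.*-suc 7 s))))

open import Defs
open import Data.Nat using (ℕ; suc; _+_; _*_; _∸_; _≤_)
open import Data.Integer using (+_)
open import Data.Rational using (_/_)
open import Data.Product using (_×_; _,_)

theorem1p4 : (t : ℕ) → 1 ≤ t →
    RhoIs 3 (3 * t + 2) ((+ (5 * t ∸ 4)) / suc (5 * t))
    × RhoIs 4 (4 * t + 2) ((+ (7 * t ∸ 6)) / suc (7 * t))
theorem1p4 t 1≤t = Proof.rho₃ t 1≤t , Proof.rho₄ t 1≤t
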